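{- Let $q>1$ be the discriminant of a real quadratic field $\mathbb{Q}(\sqrt q)$, let $\chi$ be the even primitive real Dirichlet character modulo $q$ attached to this field, and suppose that $\chi(2)=1$. Then $$h\left(\mathbb{Q}(\sqrt q)\right)\le \frac{\sqrt q}{2}\left(1-\frac{1}{25\log q}\right),$$ where $h(\mathbb{Q}(\sqrt q))$ is the class number of $\mathbb{Q}(\sqrt q)$.
   Context: The character attached to the real quadratic field of discriminant $q$ is the Kronecker symbol $\chi(n)=\left(\frac{q}{n}\right)$; $\log$ is the natural logarithm. -}

module Defs where

open import Algebra.Bundles using (CommutativeRing)
open import Algebra.Structures using (IsCommutativeRing)
open import Data.Bool.Base using (if_then_else_)
open import Data.Fin.Base using (Fin)
open import Data.Integer.Base as ℤ using (ℤ; +_; -[1+_]; 0ℤ; 1ℤ; -1ℤ)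
import Data.Integer.Properties as ℤₚ
import Data.Integer.DivMod as ℤ
import Data.Integer.Divisibility.Signed as ℤ∣
open import Data.List.Base using (List; []; _∷_; map; foldr; upTo)
open import Data.List.Relation.Unary.Any using (Any; any?)
open import Data.Nat.Base as ℕ using (ℕ; zero; suc; pred; z≤n; s≤s)
import Data.Nat.Properties as ℕₚ
open import Data.Nat.Primality.Factorisation using (factorise; factors)
open import Data.Product.Base using (∃; ∃₂; ∃-syntax; _×_; _,_; proj₁; proj₂)
open import Data.Rational.Base as ℚ using (ℚ; 0ℚ; 1ℚ; ½; ∣_∣)
import Data.Rational.Properties as ℚₚ
import Data.Rational.Unnormalised.Base as ℚᵘ
import Data.Rational.Unnormalised.Properties as ℚᵘₚ
open import Data.Rational.Solver using (module +-*-Solver)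
open import Data.Sum.Base using (inj₁; inj₂)
open import Function.Bundles using (Bijection; _⇔_; mk⇔; Equivalence)
open import Level using (0ℓ)
open import Relation.Binary.Bundles using (Setoid)
open import Relation.Binary.PropositionalEquality
  using (_≡_; _≢_; refl; sym; trans; cong; cong₂; subst; subst₂; isEquivalence; setoid)
open import Relation.Nullary using (¬_; yes; no; does; contradiction)

open +-*-Solver using (solve; _:=_; _:+_; _:*_; :-_; _:-_; con)

------------------------------------------------------------------------
-- Rational preliminaries

fromℤ : ℤ → ℚ
fromℤ i = i ℚ./ 1

∑ : ℕ → (ℕ → ℚ) → ℚ
∑ zero    f = 0ℚ
∑ (suc n) f = ∑ n f ℚ.+ f n

1/1+ : ℕ → ℚ
1/1+ n = + 1 ℚ./ suc n

frac-≤ : ∀ a b c d → a ℕ.* suc d ℕ.≤ c ℕ.* suc b →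
         (+ a ℚ./ suc b) ℚ.≤ (+ c ℚ./ suc d)
frac-≤ a b c d h = ℚₚ.toℚᵘ-cancel-≤
  (ℚᵘₚ.≤-respˡ-≃ (ℚᵘₚ.≃-sym (ℚₚ.toℚᵘ-fromℚᵘ (ℚᵘ.mkℚᵘ (+ a) b)))
  (ℚᵘₚ.≤-respʳ-≃ (ℚᵘₚ.≃-sym (ℚₚ.toℚᵘ-fromℚᵘ (ℚᵘ.mkℚᵘ (+ c) d)))
  (ℚᵘ.*≤* (subst₂ ℤ._≤_ (ℤₚ.pos-* a (suc d)) (ℤₚ.pos-* c (suc b)) (ℤ.+≤+ h)))))

frac-+1 : ∀ a b → (+ suc a ℚ./ suc b) ≡ (+ a ℚ./ suc b) ℚ.+ 1/1+ b
frac-+1 a b = ℚₚ.toℚᵘ-injective (ℚᵘₚ.≃-trans (ℚₚ.toℚᵘ-fromℚᵘ (ℚᵘ.mkℚᵘ (+ suc a) b))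
  (ℚᵘₚ.≃-trans (ℚᵘ.*≡* lem) (ℚᵘₚ.≃-trans
    (ℚᵘₚ.+-cong (ℚᵘₚ.≃-sym (ℚₚ.toℚᵘ-fromℚᵘ (ℚᵘ.mkℚᵘ (+ a) b)))
                (ℚᵘₚ.≃-sym (ℚₚ.toℚᵘ-fromℚᵘ (ℚᵘ.mkℚᵘ (+ 1) b))))
    (ℚᵘₚ.≃-sym (ℚₚ.toℚᵘ-homo-+ (+ a ℚ./ suc b) (1/1+ b))))))
  where
  B : ℤ
  B = + suc b
  lem : + suc a ℤ.* (+ (suc b ℕ.* suc b)) ≡ (+ a ℤ.* B ℤ.+ 1ℤ ℤ.* B) ℤ.* B
  lem = trans (cong (+ suc a ℤ.*_) (ℤₚ.pos-* (suc b) (suc b)))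
       (trans (sym (ℤₚ.*-assoc (+ suc a) B B))
              (cong (ℤ._* B) (trans (cong (λ z → + z ℤ.* B) (ℕₚ.+-comm 1 a))
                (ℤₚ.*-distribʳ-+ B (+ a) 1ℤ))))

0<1/1+ : ∀ n → 0ℚ ℚ.< 1/1+ n
0<1/1+ n = ℚₚ.positive⁻¹ (1/1+ n) {{ℚₚ.normalize-pos 1 (suc n)}}

1/1+-antitone : ∀ {m n} → m ℕ.≤ n → 1/1+ n ℚ.≤ 1/1+ m
1/1+-antitone {m} {n} h =
  frac-≤ 1 n 1 m (subst₂ ℕ._≤_ (sym (ℕₚ.*-identityˡ (suc m))) (sym (ℕₚ.*-identityˡ (suc n))) (s≤s h))

archimedean : ∀ ε → 0ℚ ℚ.< ε → ∃ λ N → 1/1+ N ℚ.≤ ε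
archimedean ε 0<ε = go ε (ℚ.positive 0<ε)
  where
  go : ∀ ε → ℚ.Positive ε → ∃ λ N → 1/1+ N ℚ.≤ ε
  go ε@(ℚ.mkℚ (+ suc n) d c) _ = d , subst (1/1+ d ℚ.≤_) (ℚₚ.↥p/↧p≡p ε)
    (frac-≤ 1 d (suc n) d (ℕₚ.*-monoˡ-≤ (suc d) (s≤s (z≤n {n}))))

p≤p+q : ∀ p {q} → 0ℚ ℚ.≤ q → p ℚ.≤ p ℚ.+ q
p≤p+q p {q} 0≤q = subst (ℚ._≤ p ℚ.+ q) (ℚₚ.+-identityʳ p) (ℚₚ.+-monoʳ-≤ p 0≤q)

0<½* : ∀ {ε} → 0ℚ ℚ.< ε → 0ℚ ℚ.< ½ ℚ.* ε
0<½* {ε} 0<ε = ℚₚ.positive⁻¹ (½ ℚ.* ε) {{ℚₚ.pos*pos⇒pos ½ ε {{ℚ.positive 0<ε}}}}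

½+½ : ∀ ε → ½ ℚ.* ε ℚ.+ ½ ℚ.* ε ≡ ε
½+½ = solve 1 (λ e → con ½ :* e :+ con ½ :* e := e) refl

½ε<ε : ∀ {ε} → 0ℚ ℚ.< ε → ½ ℚ.* ε ℚ.< ε
½ε<ε {ε} 0<ε = subst₂ ℚ._<_ (ℚₚ.+-identityʳ (½ ℚ.* ε)) (½+½ ε)
  (ℚₚ.+-monoʳ-< (½ ℚ.* ε) (0<½* 0<ε))

------------------------------------------------------------------------
-- Real numbers as Cauchy sequences of rationals

IsCauchy : (ℕ → ℚ) → Set
IsCauchy x = ∀ ε → 0ℚ ℚ.< ε →
  ∃[ N ] ∀ m n → N ℕ.≤ m → N ℕ.≤ n → ∣ x m ℚ.- x n ∣ ℚ.< ε

record ℝ : Set where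
  constructor mkℝ
  field
    seq    : ℕ → ℚ
    cauchy : IsCauchy seq

open ℝ public

infix  4 _≤ᴿ_
infixl 6 _+ᴿ_ _-ᴿ_
infixl 7 _*ᴿ_

_≤ᴿ_ : ℝ → ℝ → Set
x ≤ᴿ y = ∀ ε → 0ℚ ℚ.< ε → ∃[ N ] ∀ n → N ℕ.≤ n → seq x n ℚ.≤ seq y n ℚ.+ ε

fromℚ : ℚ → ℝ
fromℚ p = mkℝ (λ _ → p) (λ ε 0<ε → 0 , λ _ _ _ _ →
  subst (λ t → ∣ t ∣ ℚ.< ε) (sym (ℚₚ.+-inverseʳ p)) 0<ε)

fromℕ : ℕ → ℝ
fromℕ n = fromℚ (fromℤ (+ n))

+-cauchy : ∀ x y → IsCauchy x → IsCauchy y → IsCauchy (λ n → x n ℚ.+ y n)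
+-cauchy x y cx cy ε 0<ε with cx (½ ℚ.* ε) (0<½* 0<ε) | cy (½ ℚ.* ε) (0<½* 0<ε)
... | M , p | N , q = M ℕ.⊔ N , λ m n h k →
  subst₂ ℚ._<_ refl (½+½ ε) (ℚₚ.≤-<-trans
    (subst (λ t → ∣ t ∣ ℚ.≤ ∣ x m ℚ.- x n ∣ ℚ.+ ∣ y m ℚ.- y n ∣)
      (solve 4 (λ a b c d → (a :- b) :+ (c :- d) := (a :+ c) :- (b :+ d)) refl
        (x m) (x n) (y m) (y n))
      (ℚₚ.∣p+q∣≤∣p∣+∣q∣ (x m ℚ.- x n) (y m ℚ.- y n)))
    (ℚₚ.+-mono-< (p m n (ℕₚ.m⊔n≤o⇒m≤o M N h) (ℕₚ.m⊔n≤o⇒m≤o M N k))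
                 (q m n (ℕₚ.m⊔n≤o⇒n≤o M N h) (ℕₚ.m⊔n≤o⇒n≤o M N k))))

neg-cauchy : ∀ x → IsCauchy x → IsCauchy (λ n → ℚ.- x n)
neg-cauchy x cx ε 0<ε with cx ε 0<ε
... | N , p = N , λ m n h k → subst (ℚ._< ε)
  (trans (sym (ℚₚ.∣-p∣≡∣p∣ (x m ℚ.- x n)))
    (cong ∣_∣ (solve 2 (λ a b → :- (a :- b) := (:- a) :- (:- b)) refl (x m) (x n))))
  (p m n h k)

bounded : ∀ x → IsCauchy x → ∃₂ λ B N → 0ℚ ℚ.< B × (∀ n → N ℕ.≤ n → ∣ x n ∣ ℚ.≤ B)
bounded x cx with cx 1ℚ (ℚₚ.positive⁻¹ 1ℚ)
... | N , p = 1ℚ ℚ.+ ∣ x N ∣ , N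
  , ℚₚ.<-≤-trans (ℚₚ.positive⁻¹ 1ℚ)
      (p≤p+q 1ℚ (ℚₚ.0≤∣p∣ (x N)))
  , λ n h → ℚₚ.≤-trans
      (subst (λ t → ∣ t ∣ ℚ.≤ ∣ x n ℚ.- x N ∣ ℚ.+ ∣ x N ∣)
        (solve 2 (λ a b → (a :- b) :+ b := a) refl (x n) (x N))
        (ℚₚ.∣p+q∣≤∣p∣+∣q∣ (x n ℚ.- x N) (x N)))
      (ℚₚ.+-monoˡ-≤ ∣ x N ∣ (ℚₚ.<⇒≤ (p n N h ℕₚ.≤-refl)))

∣*∣<B*δ : ∀ {a b B δ} → 0ℚ ℚ.< B → ∣ a ∣ ℚ.≤ B → ∣ b ∣ ℚ.< δ → ∣ a ℚ.* b ∣ ℚ.< B ℚ.* δ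
∣*∣<B*δ {a} {b} {B} {δ} 0<B a≤B b<δ = subst (ℚ._< B ℚ.* δ) (sym (ℚₚ.∣p*q∣≡∣p∣*∣q∣ a b))
  (ℚₚ.≤-<-trans
    (ℚₚ.*-monoʳ-≤-nonNeg ∣ b ∣ {{ℚₚ.∣-∣-nonNeg b}} a≤B)
    (ℚₚ.*-monoʳ-<-pos B {{ℚ.positive 0<B}} b<δ))

divide : ∀ b c → 0ℚ ℚ.< b → 0ℚ ℚ.< c → ∃ λ δ → 0ℚ ℚ.< δ × b ℚ.* δ ≡ c
divide b c 0<b 0<c = (ℚ.1/ b) {{b≢0}} ℚ.* c
  , ℚₚ.positive⁻¹ _ {{ℚₚ.pos*pos⇒pos ((ℚ.1/ b) {{b≢0}})
      {{ℚₚ.1/pos⇒pos b {{ℚ.positive 0<b}}}} c {{ℚ.positive 0<c}}}}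
  , trans (sym (ℚₚ.*-assoc b ((ℚ.1/ b) {{b≢0}}) c))
      (trans (cong (ℚ._* c) (ℚₚ.*-inverseʳ b {{b≢0}})) (ℚₚ.*-identityˡ c))
  where
  b≢0 : ℚ.NonZero b
  b≢0 = ℚₚ.pos⇒nonZero b {{ℚ.positive 0<b}}

*-cauchy : ∀ x y → IsCauchy x → IsCauchy y → IsCauchy (λ n → x n ℚ.* y n)
*-cauchy x y cx cy ε 0<ε = go (cx δ 0<δ) (cy δ 0<δ)
  where
  B₁ B₂ : ℚ
  B₁ = proj₁ (bounded x cx)
  B₂ = proj₁ (bounded y cy)
  M₁ M₂ : ℕ
  M₁ = proj₁ (proj₂ (bounded x cx))
  M₂ = proj₁ (proj₂ (bounded y cy))
  0<B₁ : 0ℚ ℚ.< B₁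
  0<B₁ = proj₁ (proj₂ (proj₂ (bounded x cx)))
  0<B₂ : 0ℚ ℚ.< B₂
  0<B₂ = proj₁ (proj₂ (proj₂ (bounded y cy)))
  b₁ : ∀ n → M₁ ℕ.≤ n → ∣ x n ∣ ℚ.≤ B₁
  b₁ = proj₂ (proj₂ (proj₂ (bounded x cx)))
  b₂ : ∀ n → M₂ ℕ.≤ n → ∣ y n ∣ ℚ.≤ B₂
  b₂ = proj₂ (proj₂ (proj₂ (bounded y cy)))
  B : ℚ
  B = B₁ ℚ.+ B₂
  B₁≤B : B₁ ℚ.≤ B
  B₁≤B = p≤p+q B₁ (ℚₚ.<⇒≤ 0<B₂)
  B₂≤B : B₂ ℚ.≤ B
  B₂≤B = subst (B₂ ℚ.≤_) (ℚₚ.+-comm B₂ B₁) (p≤p+q B₂ (ℚₚ.<⇒≤ 0<B₁))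
  0<B : 0ℚ ℚ.< B
  0<B = ℚₚ.<-≤-trans 0<B₁ B₁≤B
  quo : ∃ λ δ → 0ℚ ℚ.< δ × B ℚ.* δ ≡ ½ ℚ.* ε
  quo = divide B (½ ℚ.* ε) 0<B (0<½* 0<ε)
  δ : ℚ
  δ = proj₁ quo
  0<δ : 0ℚ ℚ.< δ
  0<δ = proj₁ (proj₂ quo)
  Bδ : B ℚ.* δ ≡ ½ ℚ.* ε
  Bδ = proj₂ (proj₂ quo)
  go : (∃[ N ] ∀ m n → N ℕ.≤ m → N ℕ.≤ n → ∣ x m ℚ.- x n ∣ ℚ.< δ) →
       (∃[ N ] ∀ m n → N ℕ.≤ m → N ℕ.≤ n → ∣ y m ℚ.- y n ∣ ℚ.< δ) →
       ∃[ N ] ∀ m n → N ℕ.≤ m → N ℕ.≤ n → ∣ x m ℚ.* y m ℚ.- x n ℚ.* y n ∣ ℚ.< ε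
  go (N₁ , p) (N₂ , q) = (M₁ ℕ.⊔ M₂) ℕ.⊔ (N₁ ℕ.⊔ N₂) , λ m n h k →
    let hM = ℕₚ.m⊔n≤o⇒m≤o (M₁ ℕ.⊔ M₂) (N₁ ℕ.⊔ N₂) h
        kM = ℕₚ.m⊔n≤o⇒m≤o (M₁ ℕ.⊔ M₂) (N₁ ℕ.⊔ N₂) k
        hN = ℕₚ.m⊔n≤o⇒n≤o (M₁ ℕ.⊔ M₂) (N₁ ℕ.⊔ N₂) h
        kN = ℕₚ.m⊔n≤o⇒n≤o (M₁ ℕ.⊔ M₂) (N₁ ℕ.⊔ N₂) k
    in ℚₚ.≤-<-trans
      (subst (λ t → ∣ t ∣ ℚ.≤ ∣ x m ℚ.* (y m ℚ.- y n) ∣ ℚ.+ ∣ y n ℚ.* (x m ℚ.- x n) ∣)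
        (solve 4 (λ a b c d → a :* (c :- d) :+ d :* (a :- b) := a :* c :- b :* d) refl
          (x m) (x n) (y m) (y n))
        (ℚₚ.∣p+q∣≤∣p∣+∣q∣ (x m ℚ.* (y m ℚ.- y n)) (y n ℚ.* (x m ℚ.- x n))))
      (subst₂ ℚ._<_ refl (trans (cong₂ ℚ._+_ Bδ Bδ) (½+½ ε)) (ℚₚ.+-mono-<
        (∣*∣<B*δ 0<B (ℚₚ.≤-trans (b₁ m (ℕₚ.m⊔n≤o⇒m≤o M₁ M₂ hM)) B₁≤B)
          (q m n (ℕₚ.m⊔n≤o⇒n≤o N₁ N₂ hN) (ℕₚ.m⊔n≤o⇒n≤o N₁ N₂ kN)))
        (∣*∣<B*δ 0<B (ℚₚ.≤-trans (b₂ n (ℕₚ.m⊔n≤o⇒n≤o M₁ M₂ kM)) B₂≤B)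
          (p m n (ℕₚ.m⊔n≤o⇒m≤o N₁ N₂ hN) (ℕₚ.m⊔n≤o⇒m≤o N₁ N₂ kN)))))

_+ᴿ_ _-ᴿ_ _*ᴿ_ : ℝ → ℝ → ℝ
x +ᴿ y = mkℝ (λ n → seq x n ℚ.+ seq y n) (+-cauchy (seq x) (seq y) (cauchy x) (cauchy y))
x -ᴿ y = mkℝ (λ n → seq x n ℚ.- seq y n)
  (+-cauchy (seq x) (λ n → ℚ.- seq y n) (cauchy x) (neg-cauchy (seq y) (cauchy y)))
x *ᴿ y = mkℝ (λ n → seq x n ℚ.* seq y n) (*-cauchy (seq x) (seq y) (cauchy x) (cauchy y))

Positiveᴿ : ℝ → Set
Positiveᴿ x = ∃[ c ] 0ℚ ℚ.< c × (∃[ N ] ∀ n → N ℕ.≤ n → c ℚ.≤ seq x n)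

fromℕ-positive : ∀ n → Positiveᴿ (fromℕ (suc n))
fromℕ-positive n = fromℤ (+ suc n) , ℚₚ.positive⁻¹ _ {{ℚₚ.normalize-pos (suc n) 1}}
  , 0 , λ _ _ → ℚₚ.≤-refl

*-positive : ∀ x y → Positiveᴿ x → Positiveᴿ y → Positiveᴿ (x *ᴿ y)
*-positive x y (c , 0<c , M , p) (d , 0<d , N , q) =
  c ℚ.* d , ℚₚ.positive⁻¹ (c ℚ.* d) {{ℚₚ.pos*pos⇒pos c {{ℚ.positive 0<c}} d {{ℚ.positive 0<d}}}}
  , M ℕ.⊔ N , λ n h →
    let c≤x = p n (ℕₚ.m⊔n≤o⇒m≤o M N h)
    in ℚₚ.≤-trans
      (ℚₚ.*-monoˡ-≤-nonNeg c {{ℚ.nonNegative (ℚₚ.<⇒≤ 0<c)}} (q n (ℕₚ.m⊔n≤o⇒n≤o M N h)))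
      (ℚₚ.*-monoʳ-≤-nonNeg (seq y n)
        {{ℚ.nonNegative (ℚₚ.≤-trans (ℚₚ.<⇒≤ 0<d) (q n (ℕₚ.m⊔n≤o⇒n≤o M N h)))}} c≤x)

module _ (c : ℚ) (0<c : 0ℚ ℚ.< c) where
  private instance
    pc : ℚ.Positive c
    pc = ℚ.positive 0<c
    nzc : ℚ.NonZero c
    nzc = ℚₚ.pos⇒nonZero c

  ⊔-positive : ∀ p → ℚ.Positive (c ℚ.⊔ p)
  ⊔-positive p = ℚ.positive (ℚₚ.<-≤-trans 0<c (ℚₚ.p≤p⊔q c p))

  inv⊔ : ℚ → ℚ
  inv⊔ p = (ℚ.1/ (c ℚ.⊔ p)) {{ℚₚ.pos⇒nonZero (c ℚ.⊔ p) {{⊔-positive p}}}}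

  inv⊔-positive : ∀ p → ℚ.Positive (inv⊔ p)
  inv⊔-positive p = ℚₚ.1/pos⇒pos (c ℚ.⊔ p) {{⊔-positive p}}

  inv⊔-inverse : ∀ {p} → c ℚ.≤ p → p ℚ.* inv⊔ p ≡ 1ℚ
  inv⊔-inverse {p} c≤p = trans (cong (ℚ._* inv⊔ p) (sym (ℚₚ.p≤q⇒p⊔q≡q c≤p)))
    (ℚₚ.*-inverseʳ (c ℚ.⊔ p) {{ℚₚ.pos⇒nonZero (c ℚ.⊔ p) {{⊔-positive p}}}})

  c*inv⊔≤1 : ∀ {p} → c ℚ.≤ p → c ℚ.* inv⊔ p ℚ.≤ 1ℚ
  c*inv⊔≤1 {p} c≤p = subst (c ℚ.* inv⊔ p ℚ.≤_) (inv⊔-inverse c≤p)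
    (ℚₚ.*-monoʳ-≤-nonNeg (inv⊔ p) {{ℚₚ.pos⇒nonNeg (inv⊔ p) {{inv⊔-positive p}}}} c≤p)

  inv-cauchy : ∀ x → IsCauchy x → (∃[ N ] ∀ n → N ℕ.≤ n → c ℚ.≤ x n) →
               IsCauchy (λ n → inv⊔ (x n))
  inv-cauchy x cx (M , c≤x) ε 0<ε = go (cx δ 0<δ)
    where
    δ : ℚ
    δ = c ℚ.* (c ℚ.* ε)
    instance
      pε : ℚ.Positive ε
      pε = ℚ.positive 0<ε
      pcε : ℚ.Positive (c ℚ.* ε)
      pcε = ℚₚ.pos*pos⇒pos c ε
    0<δ : 0ℚ ℚ.< δ
    0<δ = ℚₚ.positive⁻¹ δ {{ℚₚ.pos*pos⇒pos c (c ℚ.* ε)}}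
    go : (∃[ N ] ∀ m n → N ℕ.≤ m → N ℕ.≤ n → ∣ x m ℚ.- x n ∣ ℚ.< δ) →
         ∃[ N ] ∀ m n → N ℕ.≤ m → N ℕ.≤ n → ∣ inv⊔ (x m) ℚ.- inv⊔ (x n) ∣ ℚ.< ε
    go (N , p) = M ℕ.⊔ N , λ m n h k →
      bound (x m) (x n) (c≤x m (ℕₚ.m⊔n≤o⇒m≤o M N h)) (c≤x n (ℕₚ.m⊔n≤o⇒m≤o M N k))
        (p n m (ℕₚ.m⊔n≤o⇒n≤o M N k) (ℕₚ.m⊔n≤o⇒n≤o M N h))
      where
      bound : ∀ a b → c ℚ.≤ a → c ℚ.≤ b → ∣ b ℚ.- a ∣ ℚ.< δ → ∣ inv⊔ a ℚ.- inv⊔ b ∣ ℚ.< ε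
      bound a b c≤a c≤b b-a<δ = begin-strict
        ∣ u ℚ.- v ∣                  ≡⟨ cong ∣_∣ factor ⟩
        ∣ (u ℚ.* v) ℚ.* (b ℚ.- a) ∣  <⟨ ∣*∣<B*δ (ℚₚ.positive⁻¹ (u ℚ.* v)) (ℚₚ.≤-reflexive (ℚₚ.0≤p⇒∣p∣≡p (ℚₚ.<⇒≤ (ℚₚ.positive⁻¹ (u ℚ.* v))))) b-a<δ ⟩
        (u ℚ.* v) ℚ.* δ              ≡⟨ solve 4 (λ u v c e → (u :* v) :* (c :* (c :* e)) := ((c :* u) :* (c :* v)) :* e) refl u v c ε ⟩
        ((c ℚ.* u) ℚ.* (c ℚ.* v)) ℚ.* ε  ≤⟨ ℚₚ.*-monoʳ-≤-nonNeg ε {{ℚₚ.pos⇒nonNeg ε}} prod≤1 ⟩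
        1ℚ ℚ.* ε                     ≡⟨ ℚₚ.*-identityˡ ε ⟩
        ε                            ∎
        where
        open ℚₚ.≤-Reasoning
        u v : ℚ
        u = inv⊔ a
        v = inv⊔ b
        instance
          pu : ℚ.Positive u
          pu = inv⊔-positive a
          pv : ℚ.Positive v
          pv = inv⊔-positive b
          puv : ℚ.Positive (u ℚ.* v)
          puv = ℚₚ.pos*pos⇒pos u v
          pcv : ℚ.Positive (c ℚ.* v)
          pcv = ℚₚ.pos*pos⇒pos c v
        factor : u ℚ.- v ≡ (u ℚ.* v) ℚ.* (b ℚ.- a)
        factor = sym (trans
          (solve 4 (λ u v a b → (u :* v) :* (b :- a) := u :* (b :* v) :- v :* (a :* u)) refl u v a b)
          (cong₂ ℚ._-_ (trans (cong (u ℚ.*_) (inv⊔-inverse c≤b)) (ℚₚ.*-identityʳ u))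
                       (trans (cong (v ℚ.*_) (inv⊔-inverse c≤a)) (ℚₚ.*-identityʳ v))))
        prod≤1 : (c ℚ.* u) ℚ.* (c ℚ.* v) ℚ.≤ 1ℚ
        prod≤1 = ℚₚ.≤-trans
          (ℚₚ.*-monoʳ-≤-nonNeg (c ℚ.* v) {{ℚₚ.pos⇒nonNeg (c ℚ.* v)}} (c*inv⊔≤1 c≤a))
          (subst (ℚ._≤ 1ℚ) (sym (ℚₚ.*-identityˡ (c ℚ.* v))) (c*inv⊔≤1 c≤b))

-- The n-th term is 1 / max(c , xₙ), which is 1 / xₙ for all large n.
inverse : (x : ℝ) → Positiveᴿ x → ℝ
inverse x (c , 0<c , N , c≤x) =
  mkℝ (λ n → inv⊔ c 0<c (seq x n)) (inv-cauchy c 0<c (seq x) (cauchy x) (N , c≤x))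

close⇒cauchy : (x : ℕ → ℚ) → (∀ m n → x m ℚ.≤ x n ℚ.+ 1/1+ n) → IsCauchy x
close⇒cauchy x close ε 0<ε with archimedean (½ ℚ.* ε) (0<½* 0<ε)
... | N , N≤ = N , go
  where
  one-sided : ∀ m n → N ℕ.≤ n → x m ℚ.- x n ℚ.< ε
  one-sided m n h = ℚₚ.≤-<-trans
    (subst (x m ℚ.- x n ℚ.≤_)
      (solve 2 (λ a b → (a :+ b) :- a := b) refl (x n) (1/1+ n))
      (ℚₚ.+-monoˡ-≤ (ℚ.- x n) (close m n)))
    (ℚₚ.≤-<-trans (1/1+-antitone h) (ℚₚ.≤-<-trans N≤ (½ε<ε 0<ε)))
  go : ∀ m n → N ℕ.≤ m → N ℕ.≤ n → ∣ x m ℚ.- x n ∣ ℚ.< ε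
  go m n h k with ℚₚ.∣p∣≡p∨∣p∣≡-p (x m ℚ.- x n)
  ... | inj₁ e = subst (ℚ._< ε) (sym e) (one-sided m n k)
  ... | inj₂ e = subst (ℚ._< ε)
    (sym (trans e (solve 2 (λ a b → :- (a :- b) := b :- a) refl (x m) (x n))))
    (one-sided n m h)

-- ⌊√ (n+1)⌋ from r = ⌊√ n⌋
isqrt-step : ℕ → ℕ → ℕ
isqrt-step n r with suc r ℕ.* suc r ℕₚ.≤? suc n
... | yes _ = suc r
... | no  _ = r

isqrt : ℕ → ℕ
isqrt zero    = 0
isqrt (suc n) = isqrt-step n (isqrt n)

isqrt-lower : ∀ n → isqrt n ℕ.* isqrt n ℕ.≤ n
isqrt-lower zero    = z≤n
isqrt-lower (suc n) with suc (isqrt n) ℕ.* suc (isqrt n) ℕₚ.≤? suc n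
... | yes p = p
... | no  _ = ℕₚ.m≤n⇒m≤1+n (isqrt-lower n)

isqrt-upper : ∀ n → n ℕ.< suc (isqrt n) ℕ.* suc (isqrt n)
isqrt-upper zero    = s≤s z≤n
isqrt-upper (suc n) with suc (isqrt n) ℕ.* suc (isqrt n) ℕₚ.≤? suc n
... | yes _ = ℕₚ.<-≤-trans (s≤s (isqrt-upper n))
  (ℕₚ.*-mono-< (ℕₚ.n<1+n (suc (isqrt n))) (ℕₚ.n<1+n (suc (isqrt n))))
... | no ¬p = ℕₚ.≰⇒> ¬p

√-seq : ℕ → ℕ → ℚ
√-seq n k = + isqrt (n ℕ.* (suc k ℕ.* suc k)) ℚ./ suc k

√-close : ∀ q m n → √-seq q m ℚ.≤ √-seq q n ℚ.+ 1/1+ n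
√-close q m n = subst (√-seq q m ℚ.≤_) (frac-+1 b n) (frac-≤ a m (suc b) n an≤bm)
  where
  M N a b : ℕ
  M = suc m
  N = suc n
  a = isqrt (q ℕ.* (M ℕ.* M))
  b = isqrt (q ℕ.* (N ℕ.* N))
  open ℕₚ.≤-Reasoning
  swap : ∀ x y → (x ℕ.* y) ℕ.* (x ℕ.* y) ≡ (x ℕ.* x) ℕ.* (y ℕ.* y)
  swap x y = ℕₚ.[m*n]*[o*p]≡[m*o]*[n*p] x y x y
  squares : (a ℕ.* N) ℕ.* (a ℕ.* N) ℕ.< (suc b ℕ.* M) ℕ.* (suc b ℕ.* M)
  squares = begin-strict
    (a ℕ.* N) ℕ.* (a ℕ.* N)            ≡⟨ swap a N ⟩
    (a ℕ.* a) ℕ.* (N ℕ.* N)            ≤⟨ ℕₚ.*-monoˡ-≤ (N ℕ.* N) (isqrt-lower (q ℕ.* (M ℕ.* M))) ⟩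
    (q ℕ.* (M ℕ.* M)) ℕ.* (N ℕ.* N)    ≡⟨ ℕₚ.*-assoc q (M ℕ.* M) (N ℕ.* N) ⟩
    q ℕ.* ((M ℕ.* M) ℕ.* (N ℕ.* N))    ≡⟨ cong (q ℕ.*_) (ℕₚ.*-comm (M ℕ.* M) (N ℕ.* N)) ⟩
    q ℕ.* ((N ℕ.* N) ℕ.* (M ℕ.* M))    ≡⟨ ℕₚ.*-assoc q (N ℕ.* N) (M ℕ.* M) ⟨
    (q ℕ.* (N ℕ.* N)) ℕ.* (M ℕ.* M)    <⟨ ℕₚ.*-monoˡ-< (M ℕ.* M) (isqrt-upper (q ℕ.* (N ℕ.* N))) ⟩
    (suc b ℕ.* suc b) ℕ.* (M ℕ.* M)    ≡⟨ swap (suc b) M ⟨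
    (suc b ℕ.* M) ℕ.* (suc b ℕ.* M)    ∎
  an≤bm : a ℕ.* N ℕ.≤ suc b ℕ.* M
  an≤bm with (a ℕ.* N) ℕₚ.≤? (suc b ℕ.* M)
  ... | yes p = p
  ... | no ¬p = contradiction squares
    (ℕₚ.≤⇒≯ (ℕₚ.*-mono-≤ (ℕₚ.≰⇒≥ ¬p) (ℕₚ.≰⇒≥ ¬p)))

-- The k-th approximation is ⌊(k+1)√n⌋ / (k+1).
√ : ℕ → ℝ
√ n = mkℝ (√-seq n) (close⇒cauchy (√-seq n) (√-close n))

log-seq : ℕ → ℕ → ℚ
log-seq n k = ∑ (pred n ℕ.* suc k) (λ i → 1/1+ (suc k ℕ.+ i))

-- 1/(a+1) + … + 1/(a+l)
H : ℕ → ℕ → ℚ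
H a l = ∑ l (λ i → 1/1+ (a ℕ.+ i))

H-split : ∀ a m n → H a (m ℕ.+ n) ≡ H a m ℚ.+ H (a ℕ.+ m) n
H-split a m zero    = trans (cong (H a) (ℕₚ.+-identityʳ m)) (sym (ℚₚ.+-identityʳ (H a m)))
H-split a m (suc n) = trans (cong (H a) (ℕₚ.+-suc m n))
  (trans (cong₂ ℚ._+_ (H-split a m n) (cong 1/1+ (sym (ℕₚ.+-assoc a m n))))
    (ℚₚ.+-assoc (H a m) (H (a ℕ.+ m) n) (1/1+ (a ℕ.+ m ℕ.+ n))))

H-shift : ∀ a l → H a (suc l) ≡ 1/1+ a ℚ.+ H (suc a) l
H-shift a l = trans (H-split a 1 l) (cong₂ ℚ._+_
  (trans (ℚₚ.+-identityˡ (1/1+ (a ℕ.+ 0))) (cong 1/1+ (ℕₚ.+-identityʳ a)))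
  (cong (λ t → H t l) (ℕₚ.+-comm a 1)))

0≤1/1+ : ∀ n → 0ℚ ℚ.≤ 1/1+ n
0≤1/1+ n = ℚₚ.<⇒≤ (0<1/1+ n)

∑-≥ : ∀ l f b → (∀ i → i ℕ.< l → 1/1+ b ℚ.≤ f i) → (+ l ℚ./ suc b) ℚ.≤ ∑ l f
∑-≥ zero    f b h = ℚₚ.≤-reflexive (ℚₚ.0/n≡0 (suc b))
∑-≥ (suc l) f b h = subst (ℚ._≤ ∑ (suc l) f) (sym (frac-+1 l b))
  (ℚₚ.+-mono-≤ (∑-≥ l f b (λ i i<l → h i (ℕₚ.m<n⇒m<1+n i<l))) (h l ℕₚ.≤-refl))

∑-≤ : ∀ l f b → (∀ i → i ℕ.< l → f i ℚ.≤ 1/1+ b) → ∑ l f ℚ.≤ (+ l ℚ./ suc b)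
∑-≤ zero    f b h = ℚₚ.≤-reflexive (sym (ℚₚ.0/n≡0 (suc b)))
∑-≤ (suc l) f b h = subst (∑ (suc l) f ℚ.≤_) (sym (frac-+1 l b))
  (ℚₚ.+-mono-≤ (∑-≤ l f b (λ i i<l → h i (ℕₚ.m<n⇒m<1+n i<l))) (h l ℕₚ.≤-refl))

block-≥ : ∀ b c → 1/1+ b ℚ.≤ H (b ℕ.* suc c) (suc c)
block-≥ b c = ℚₚ.≤-trans
  (frac-≤ 1 b (suc c) (b ℕ.* suc c ℕ.+ c) (ℕₚ.≤-reflexive
    (trans (ℕₚ.*-identityˡ (suc (b ℕ.* suc c ℕ.+ c)))
    (trans (sym (ℕₚ.+-suc (b ℕ.* suc c) c))
    (trans (ℕₚ.+-comm (b ℕ.* suc c) (suc c)) (ℕₚ.*-comm (suc b) (suc c)))))))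
  (∑-≥ (suc c) _ (b ℕ.* suc c ℕ.+ c) (λ { i (s≤s i≤c) →
    1/1+-antitone (ℕₚ.+-monoʳ-≤ (b ℕ.* suc c) i≤c) }))

block-≤ : ∀ b c → H (suc b ℕ.* suc c) (suc c) ℚ.≤ 1/1+ b
block-≤ b c = ℚₚ.≤-trans
  (∑-≤ (suc c) _ (suc b ℕ.* suc c) (λ i _ → 1/1+-antitone (ℕₚ.m≤m+n (suc b ℕ.* suc c) i)))
  (frac-≤ (suc c) (suc b ℕ.* suc c) 1 b (subst₂ ℕ._≤_
    (ℕₚ.*-comm (suc b) (suc c)) (sym (ℕₚ.*-identityˡ _)) (ℕₚ.n≤1+n (suc b ℕ.* suc c))))

H-blocks : ∀ a l c → H (a ℕ.* suc c) (suc l ℕ.* suc c) ≡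
           H (a ℕ.* suc c) (l ℕ.* suc c) ℚ.+ H ((a ℕ.+ l) ℕ.* suc c) (suc c)
H-blocks a l c = trans (cong (H (a ℕ.* suc c)) (ℕₚ.+-comm (suc c) (l ℕ.* suc c)))
  (trans (H-split (a ℕ.* suc c) (l ℕ.* suc c) (suc c))
    (cong (λ t → H (a ℕ.* suc c) (l ℕ.* suc c) ℚ.+ H t (suc c))
      (sym (ℕₚ.*-distribʳ-+ (suc c) a l))))

refine-≥ : ∀ a l c → H a l ℚ.≤ H (a ℕ.* suc c) (l ℕ.* suc c)
refine-≥ a zero    c = ℚₚ.≤-refl
refine-≥ a (suc l) c = subst (H a (suc l) ℚ.≤_) (sym (H-blocks a l c))
  (ℚₚ.+-mono-≤ (refine-≥ a l c) (block-≥ (a ℕ.+ l) c))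

refine-≤′ : ∀ a l c → H (suc a ℕ.* suc c) (l ℕ.* suc c) ℚ.≤ H a l
refine-≤′ a zero    c = ℚₚ.≤-refl
refine-≤′ a (suc l) c = subst (ℚ._≤ H a (suc l)) (sym (H-blocks (suc a) l c))
  (ℚₚ.+-mono-≤ (refine-≤′ a l c) (block-≤ (a ℕ.+ l) c))

refine-≤ : ∀ a l c → H (suc a ℕ.* suc c) (l ℕ.* suc c) ℚ.≤ H (suc a) l ℚ.+ 1/1+ a
refine-≤ a l c = ℚₚ.≤-trans (refine-≤′ a l c)
  (subst (H a l ℚ.≤_) (trans (H-shift a l) (ℚₚ.+-comm (1/1+ a) (H (suc a) l)))
    (p≤p+q (H a l) (0≤1/1+ (a ℕ.+ l))))

log-close : ∀ n j k → log-seq n j ℚ.≤ log-seq n k ℚ.+ 1/1+ k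
log-close n j k = ℚₚ.≤-trans (refine-≥ J (p ℕ.* J) k)
  (subst (ℚ._≤ H K (p ℕ.* K) ℚ.+ 1/1+ k)
    (cong₂ H (ℕₚ.*-comm K J)
      (trans (ℕₚ.*-assoc p K J) (trans (cong (p ℕ.*_) (ℕₚ.*-comm K J)) (sym (ℕₚ.*-assoc p J K)))))
    (refine-≤ k (p ℕ.* K) j))
  where
  J K p : ℕ
  J = suc j
  K = suc k
  p = pred n

-- log n = ∫₁ⁿ dt/t.  The k-th approximation is the Riemann sum with step
-- 1/(k+1) and right end points: the sum of 1/j for k+1 < j ≤ n(k+1).
-- Only n ≥ 1 is meaningful.
log : ℕ → ℝ
log n = mkℝ (log-seq n) (close⇒cauchy (log-seq n) (log-close n))

log-positive : ∀ n → 1 ℕ.< n → Positiveᴿ (log n)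
log-positive 1 (s≤s ())
log-positive (suc (suc p)) _ = 1/1+ 1 , 0<1/1+ 1 , 0 , λ k _ →
  ℚₚ.≤-trans
    (subst (1/1+ 1 ℚ.≤_) (sym (H-shift 1 p))
      (p≤p+q (1/1+ 1) (H-nonNeg 2 p)))
    (subst (λ t → H 1 (suc p) ℚ.≤ H t (suc p ℕ.* suc k)) (ℕₚ.*-identityˡ (suc k))
      (refine-≥ 1 (suc p) k))
  where
  H-nonNeg : ∀ a l → 0ℚ ℚ.≤ H a l
  H-nonNeg a zero    = ℚₚ.≤-refl
  H-nonNeg a (suc l) = ℚₚ.≤-trans (H-nonNeg a l) (p≤p+q (H a l) (0≤1/1+ (a ℕ.+ l)))

------------------------------------------------------------------------
-- The field ℚ(√d)

infix 5 _+_√d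

record ℚ√ (d : ℕ) : Set where
  constructor _+_√d
  field
    rat irr : ℚ

open ℚ√ public

module _ {d : ℕ} where

  infixl 6 _+ᴷ_
  infixl 7 _*ᴷ_
  infix  8 -ᴷ_

  _+ᴷ_ _*ᴷ_ : ℚ√ d → ℚ√ d → ℚ√ d
  (a + b √d) +ᴷ (a′ + b′ √d) = (a ℚ.+ a′) + (b ℚ.+ b′) √d
  (a + b √d) *ᴷ (a′ + b′ √d) =
    (a ℚ.* a′ ℚ.+ fromℤ (+ d) ℚ.* (b ℚ.* b′)) + (a ℚ.* b′ ℚ.+ b ℚ.* a′) √d

  -ᴷ_ : ℚ√ d → ℚ√ d
  -ᴷ (a + b √d) = (ℚ.- a) + (ℚ.- b) √d

  0ᴷ 1ᴷ : ℚ√ d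
  0ᴷ = 0ℚ + 0ℚ √d
  1ᴷ = 1ℚ + 0ℚ √d

  ι : ℤ → ℚ√ d
  ι n = fromℤ n + 0ℚ √d

  -- x + x̄
  trace : ℚ√ d → ℚ
  trace (a + b √d) = a ℚ.+ a

  isCommutativeRing : IsCommutativeRing _≡_ _+ᴷ_ _*ᴷ_ -ᴷ_ 0ᴷ 1ᴷ
  isCommutativeRing = record
    { isRing = record
      { +-isAbelianGroup = record
        { isGroup = record
          { isMonoid = record
            { isSemigroup = record
              { isMagma = record { isEquivalence = isEquivalence ; ∙-cong = cong₂ _+ᴷ_ }
              ; assoc = λ x y z → cong₂ _+_√d (ℚₚ.+-assoc (rat x) (rat y) (rat z))
                                             (ℚₚ.+-assoc (irr x) (irr y) (irr z))
              }
            ; identity = (λ x → cong₂ _+_√d (ℚₚ.+-identityˡ (rat x)) (ℚₚ.+-identityˡ (irr x)))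
                       , (λ x → cong₂ _+_√d (ℚₚ.+-identityʳ (rat x)) (ℚₚ.+-identityʳ (irr x)))
            }
          ; inverse = (λ x → cong₂ _+_√d (ℚₚ.+-inverseˡ (rat x)) (ℚₚ.+-inverseˡ (irr x)))
                    , (λ x → cong₂ _+_√d (ℚₚ.+-inverseʳ (rat x)) (ℚₚ.+-inverseʳ (irr x)))
          ; ⁻¹-cong = cong -ᴷ_
          }
        ; comm = λ x y → cong₂ _+_√d (ℚₚ.+-comm (rat x) (rat y)) (ℚₚ.+-comm (irr x) (irr y))
        }
      ; *-cong = cong₂ _*ᴷ_
      ; *-assoc = *ᴷ-assoc
      ; *-identity = *ᴷ-identityˡ , (λ x → trans (*ᴷ-comm x 1ᴷ) (*ᴷ-identityˡ x))
      ; distrib = distribˡ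
                , (λ x y z → trans (*ᴷ-comm (y +ᴷ z) x)
                    (trans (distribˡ x y z) (cong₂ _+ᴷ_ (*ᴷ-comm x y) (*ᴷ-comm x z))))
      }
    ; *-comm = *ᴷ-comm
    }
    where
    D : ℚ
    D = fromℤ (+ d)
    *ᴷ-assoc : ∀ x y z → (x *ᴷ y) *ᴷ z ≡ x *ᴷ (y *ᴷ z)
    *ᴷ-assoc (a + b √d) (a′ + b′ √d) (a″ + b″ √d) = cong₂ _+_√d
      (solve 7 (λ D a b c d e f →
        (a :* c :+ D :* (b :* d)) :* e :+ D :* ((a :* d :+ b :* c) :* f) :=
        a :* (c :* e :+ D :* (d :* f)) :+ D :* (b :* (c :* f :+ d :* e)))
        refl D a b a′ b′ a″ b″)
      (solve 7 (λ D a b c d e f →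
        (a :* c :+ D :* (b :* d)) :* f :+ (a :* d :+ b :* c) :* e :=
        a :* (c :* f :+ d :* e) :+ b :* (c :* e :+ D :* (d :* f)))
        refl D a b a′ b′ a″ b″)
    *ᴷ-comm : ∀ x y → x *ᴷ y ≡ y *ᴷ x
    *ᴷ-comm (a + b √d) (a′ + b′ √d) = cong₂ _+_√d
      (solve 5 (λ D a b c d → a :* c :+ D :* (b :* d) := c :* a :+ D :* (d :* b)) refl D a b a′ b′)
      (solve 4 (λ a b c d → a :* d :+ b :* c := c :* b :+ d :* a) refl a b a′ b′)
    *ᴷ-identityˡ : ∀ x → 1ᴷ *ᴷ x ≡ x
    *ᴷ-identityˡ (a + b √d) = cong₂ _+_√d
      (solve 3 (λ D a b → con 1ℚ :* a :+ D :* (con 0ℚ :* b) := a) refl D a b)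
      (solve 2 (λ a b → con 1ℚ :* b :+ con 0ℚ :* a := b) refl a b)
    distribˡ : ∀ x y z → x *ᴷ (y +ᴷ z) ≡ (x *ᴷ y) +ᴷ (x *ᴷ z)
    distribˡ (a + b √d) (a′ + b′ √d) (a″ + b″ √d) = cong₂ _+_√d
      (solve 7 (λ D a b c d e f → a :* (c :+ e) :+ D :* (b :* (d :+ f)) :=
        (a :* c :+ D :* (b :* d)) :+ (a :* e :+ D :* (b :* f))) refl D a b a′ b′ a″ b″)
      (solve 6 (λ a b c d e f → a :* (d :+ f) :+ b :* (c :+ e) :=
        (a :* d :+ b :* c) :+ (a :* f :+ b :* e)) refl a b a′ b′ a″ b″)

ℚ√-commutativeRing : ℕ → CommutativeRing 0ℓ 0ℓ
ℚ√-commutativeRing d = record { isCommutativeRing = isCommutativeRing {d} }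

module _ {d : ℕ} where

  -- evalMonic (c₀ ∷ … ∷ cₙ₋₁ ∷ []) x = c₀ + c₁ x + … + cₙ₋₁ xⁿ⁻¹ + xⁿ
  evalMonic : List ℤ → ℚ√ d → ℚ√ d
  evalMonic []       x = 1ᴷ
  evalMonic (c ∷ cs) x = ι c +ᴷ x *ᴷ evalMonic cs x

  IsIntegral : ℚ√ d → Set
  IsIntegral x = ∃[ cs ] evalMonic cs x ≡ 0ᴷ

  -- the 𝒪-submodule generated by a list, 𝒪 being the ring of integers
  infix 4 _∈⟨_⟩
  _∈⟨_⟩ : ℚ√ d → List (ℚ√ d) → Set
  x ∈⟨ [] ⟩     = x ≡ 0ᴷ
  x ∈⟨ g ∷ gs ⟩ = ∃₂ λ a y → IsIntegral a × y ∈⟨ gs ⟩ × x ≡ a *ᴷ g +ᴷ y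

-- A basis of the ring of integers over ℤ.
record IntegralBasis (d : ℕ) : Set where
  field
    ω₁ ω₂       : ℚ√ d
    ω₁-integral : IsIntegral ω₁
    ω₂-integral : IsIntegral ω₂
    spanning    : ∀ x → IsIntegral x → ∃₂ λ a b → x ≡ ι a *ᴷ ω₁ +ᴷ ι b *ᴷ ω₂
    independent : ∀ a b → ι a *ᴷ ω₁ +ᴷ ι b *ᴷ ω₂ ≡ 0ᴷ → a ≡ 0ℤ × b ≡ 0ℤ

  discriminant : ℚ
  discriminant = trace (ω₁ *ᴷ ω₁) ℚ.* trace (ω₂ *ᴷ ω₂) ℚ.- trace (ω₁ *ᴷ ω₂) ℚ.* trace (ω₂ *ᴷ ω₁)

-- q is not a square, so that ℚ(√q) is a real quadratic field, and its
-- discriminant is q itself.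
record IsRealQuadraticDiscriminant (q : ℕ) : Set where
  field
    nonsquare : ¬ (∃[ m ] m ℕ.* m ≡ q)
    basis     : IntegralBasis q
    disc≡q    : IntegralBasis.discriminant basis ≡ fromℤ (+ q)

-- Since the ring of integers 𝒪 is Noetherian, its fractional ideals are the
-- nonzero finitely generated 𝒪-submodules of the field.
record FractionalIdeal (d : ℕ) : Set where
  constructor mkIdeal
  field
    generators : List (ℚ√ d)
    nonzero    : Any (_≢ 0ᴷ) generators

record Unit (d : ℕ) : Set where
  field
    elt inv  : ℚ√ d
    inverseʳ : elt *ᴷ inv ≡ 1ᴷ

module _ {d : ℕ} where

  infix 4 _∈_ _∼_

  _∈_ : ℚ√ d → FractionalIdeal d → Set
  x ∈ I = x ∈⟨ FractionalIdeal.generators I ⟩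

  -- J = αI for some α in the multiplicative group of the field
  _∼_ : FractionalIdeal d → FractionalIdeal d → Set
  I ∼ J = ∃ λ (α : Unit d) → ∀ y → y ∈ J ⇔ (∃[ x ] x ∈ I × y ≡ Unit.elt α *ᴷ x)

idealClasses : ℕ → Setoid 0ℓ 0ℓ
idealClasses d = record
  { Carrier       = FractionalIdeal d
  ; _≈_           = _∼_
  ; isEquivalence = record
    { refl  = λ {I} → ∼-refl {I}
    ; sym   = λ {I} {J} → ∼-sym {I} {J}
    ; trans = λ {I} {J} {K} → ∼-trans {I} {J} {K}
    }
  }
  where
  open CommutativeRing (ℚ√-commutativeRing d) using (*-assoc; *-comm; *-identityˡ)
  open Equivalence using (to; from)

  ∼-refl : ∀ {I : FractionalIdeal d} → I ∼ I
  ∼-refl {I} = record { elt = 1ᴷ ; inv = 1ᴷ ; inverseʳ = *-identityˡ 1ᴷ } , λ y → mk⇔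
    (λ y∈I → y , y∈I , sym (*-identityˡ y))
    (λ (x , x∈I , e) → subst (_∈ I) (sym (trans e (*-identityˡ x))) x∈I)

  cancel : ∀ (a b : ℚ√ d) → b *ᴷ a ≡ 1ᴷ → ∀ x → b *ᴷ (a *ᴷ x) ≡ x
  cancel a b ba≡1 x = trans (sym (*-assoc b a x)) (trans (cong (_*ᴷ x) ba≡1) (*-identityˡ x))

  ∼-sym : ∀ {I J : FractionalIdeal d} → I ∼ J → J ∼ I
  ∼-sym {I} {J} (α , h) = record { elt = inv ; inv = elt ; inverseʳ = inverseˡ } , λ y → mk⇔
    (λ y∈I → elt *ᴷ y , from (h (elt *ᴷ y)) (y , y∈I , refl) , sym (cancel elt inv inverseˡ y))
    (λ (x , x∈J , e) → let (z , z∈I , e′) = to (h x) x∈J in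
      subst (_∈ I) (sym (trans e (trans (cong (inv *ᴷ_) e′) (cancel elt inv inverseˡ z)))) z∈I)
    where
    open Unit α
    inverseˡ : inv *ᴷ elt ≡ 1ᴷ
    inverseˡ = trans (*-comm inv elt) inverseʳ

  ∼-trans : ∀ {I J K : FractionalIdeal d} → I ∼ J → J ∼ K → I ∼ K
  ∼-trans {I} {J} {K} (α , h) (β , k) = record
    { elt      = B.elt *ᴷ A.elt
    ; inv      = A.inv *ᴷ B.inv
    ; inverseʳ = trans (*-assoc B.elt A.elt (A.inv *ᴷ B.inv))
        (trans (cong (B.elt *ᴷ_) (cancel A.inv A.elt A.inverseʳ B.inv)) B.inverseʳ)
    } , λ y → mk⇔
    (λ y∈K → let (x , x∈J , e)  = to (k y) y∈K
                 (z , z∈I , e′) = to (h x) x∈J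
             in z , z∈I , trans e (trans (cong (B.elt *ᴷ_) e′) (sym (*-assoc B.elt A.elt z))))
    (λ (z , z∈I , e) → from (k y)
      (A.elt *ᴷ z , from (h (A.elt *ᴷ z)) (z , z∈I , refl) , trans e (*-assoc B.elt A.elt z)))
    where
    module A = Unit α
    module B = Unit β

-- h is the (wide) class number of ℚ(√d).
IsClassNumber : ℕ → ℕ → Set
IsClassNumber d h = Bijection (setoid (Fin h)) (idealClasses d)

------------------------------------------------------------------------
-- Kronecker symbol

kronecker2 : ℤ → ℤ
kronecker2 a with a ℤ.%ℕ 8
... | 1 = 1ℤ
... | 7 = 1ℤ
... | 3 = -1ℤ
... | 5 = -1ℤ
... | _ = 0ℤ

-- For an odd prime p.
legendre : ℤ → ℕ → ℤ
legendre a p =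
  if does (+ p ℤ∣.∣? a) then 0ℤ
  else if does (any? (λ x → + p ℤ∣.∣? (+ x ℤ.* + x ℤ.- a)) (upTo p)) then 1ℤ
  else -1ℤ

kroneckerPrime : ℤ → ℕ → ℤ
kroneckerPrime a 2 = kronecker2 a
kroneckerPrime a p = legendre a p

kroneckerSign : ℤ → ℤ
kroneckerSign (+ _)    = 1ℤ
kroneckerSign -[1+ _ ] = -1ℤ

kroneckerℕ : ℤ → (n : ℕ) → .{{ℕ.NonZero n}} → ℤ
kroneckerℕ a n = foldr ℤ._*_ 1ℤ (map (kroneckerPrime a) (factors (factorise n)))

-- (a / n)
kronecker : ℤ → ℤ → ℤ
kronecker a (+ zero)  = if does (ℤ.∣ a ∣ ℕₚ.≟ 1) then 1ℤ else 0ℤ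
kronecker a (+ suc n) = kroneckerℕ a (suc n)
kronecker a -[1+ n ]  = kroneckerSign a ℤ.* kroneckerℕ a (suc n)

χ : ℕ → ℤ → ℤ
χ q n = kronecker (+ q) n

module Submission where

-- Every ideal class of ℚ(√q), q = 4Q + 1, is represented by a lattice L = ℤa + ℤ(c +
-- ω) with a ∣ c² + c − Q.  A point α of L gives an integral ideal αL⁻¹ of norm |N α|
-- / a, encoded by its normal form (k , a′ , c′).  Take the points z + y√q (up to a
-- factor 2) with y > 0, z ≥ 0 and z² < (q − 1) y², both of the h lattices and of
-- their multiples by √q.  A unit other than ±1 moves this sector out of itself, so
-- that these 2h families have pairwise different codes.  Hence the number of points
-- of index at most Z² is bounded by the number of ideals of norm at most Z², which
-- is at most Σ_{n ≤ Z²} Σ_{d ∣ n} χ(d).  Dividing by Z² and letting Z → ∞ gives, up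
-- to small errors, h log(4q) ≤ √q L, where L bounds L(1, χ).  By Pólya–Vinogradov
-- and partial summation 2 L can be taken as log q + 1.086; the condition χ(2) = 1
-- enters through q ≡ 1 mod 8, for which the units T + U√q have integral T and U.

open import Data.Integer.Base as ℤ using (ℤ; +_; -[1+_]; 0ℤ; 1ℤ; -1ℤ)
import Data.Integer.Divisibility.Signed as ℤ∣
import Data.Integer.Properties as ℤₚ
open import Data.Integer.Tactic.RingSolver using () renaming (solve-∀ to ℤ-ring)
open import Data.Nat.Base as ℕ using (ℕ; zero; suc; pred; z≤n; s≤s; NonZero; _∸_)
import Data.Nat.Divisibility as ℕ∣
import Data.Nat.DivMod as ℕ/
open import Data.Nat.Primality using (Prime; prime⇒nonZero; prime⇒nonTrivial; prime⇒irreducible; euclidsLemma; ¬prime[1])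
import Data.Nat.Properties as ℕₚ
open import Data.Nat.Tactic.RingSolver using () renaming (solve-∀ to ℕ-ring)
open import Data.Product.Base using (∃; ∃₂; ∃-syntax; _×_; _,_; proj₁; proj₂)
open import Data.Sum.Base using (_⊎_; inj₁; inj₂; [_,_]′)
open import Relation.Binary.PropositionalEquality hiding (J; [_])
open import Relation.Nullary using (¬_; Dec; yes; no; contradiction)

open import Algebra.Bundles using (CommutativeMonoid)
open import Algebra.Structures using (IsCommutativeMonoid)
open import Data.Fin.Base using (Fin; toℕ; fromℕ<)
open import Data.Fin.Permutation using (Permutation′; permutation; _⟨$⟩ʳ_)
import Data.Fin.Properties as Finₚ
open import Function.Base using (_∘_)
open import Level using (0ℓ)
import Algebra.Properties.CommutativeMonoid.Sum as CMSum

-- The class number formula h log ε = √q L(1, χ) / 2 explains the shape of the bound: a unit T + U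
-- √q with U ≥ 1 is at least √(q - 1) + √q, so log ε is nearly log(4q) / 2 or more. Here a one-sided
-- count takes the place of the formula. The sector stands in for a fundamental domain of the units:
-- ∫ dz / (q - z²) over 0 ≤ z ≤ √(q - 1) equals log(√q + √(q - 1)) / √q, which is what the smallest
-- conceivable unit would contribute. The bound q - 1 is tuned to U² ≥ 1, which is what pushes
-- points out of the sector. Its points have negative norm; the multiples by √q account for positive
-- norms. Half-integral units would only give log q instead of log(4q). The gain log 4 = 1.386...
-- over 1.086 leaves room for the factor 1 - 1/(25 log q). All estimates stay in ℤ and ℚ: the slopes
-- z / y are cut into steps of 1/g, logarithms are harmonic sums, and g = n + 1 is tied to the n-th
-- approximation of √q, so that each n yields one inequality between rationals.

module Fold {A : Set} (_∙_ : A → A → A) (ε : A) (isCM : IsCommutativeMonoid _≡_ _∙_ ε) where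

  open IsCommutativeMonoid isCM using (assoc; comm; identityˡ; identityʳ)

  bundle : CommutativeMonoid 0ℓ 0ℓ
  bundle = record { isCommutativeMonoid = isCM }

  open CMSum bundle using (sum; sum-permute; sum-cong-≋)

  fold : ℕ → (ℕ → A) → A
  fold zero f = ε
  fold (suc n) f = fold n f ∙ f n

  fold-cong : ∀ n {f g : ℕ → A} → (∀ i → i ℕ.< n → f i ≡ g i) → fold n f ≡ fold n g
  fold-cong zero h = refl
  fold-cong (suc n) h = cong₂ _∙_ (fold-cong n (λ i i<n → h i (ℕₚ.m<n⇒m<1+n i<n))) (h n ℕₚ.≤-refl)

  fold-ε : ∀ n → fold n (λ _ → ε) ≡ ε
  fold-ε zero = refl
  fold-ε (suc n) = trans (identityʳ _) (fold-ε n)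

  interchange : ∀ a b c d → (a ∙ b) ∙ (c ∙ d) ≡ (a ∙ c) ∙ (b ∙ d)
  interchange a b c d = trans (assoc a b (c ∙ d))
    (trans (cong (a ∙_) (trans (sym (assoc b c d)) (trans (cong (_∙ d) (comm b c)) (assoc c b d))))
      (sym (assoc a c (b ∙ d))))

  fold-∙ : ∀ n f g → fold n (λ i → f i ∙ g i) ≡ fold n f ∙ fold n g
  fold-∙ zero f g = sym (identityˡ ε)
  fold-∙ (suc n) f g = trans (cong (_∙ (f n ∙ g n)) (fold-∙ n f g)) (interchange _ _ _ _)

  fold-swap : ∀ m n (f : ℕ → ℕ → A) →
    fold m (λ i → fold n (λ j → f i j)) ≡ fold n (λ j → fold m (λ i → f i j))
  fold-swap zero n f = sym (fold-ε n)
  fold-swap (suc m) n f = trans (cong (_∙ fold n (f m)) (fold-swap m n f)) (sym (fold-∙ n _ _))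

  fold-+ : ∀ m n f → fold (m ℕ.+ n) f ≡ fold m f ∙ fold n (λ i → f (m ℕ.+ i))
  fold-+ m zero f = trans (cong (λ k → fold k f) (ℕₚ.+-identityʳ m)) (sym (identityʳ _))
  fold-+ m (suc n) f = trans (cong (λ k → fold k f) (ℕₚ.+-suc m n))
    (trans (cong (_∙ f (m ℕ.+ n)) (fold-+ m n f)) (assoc _ _ _))

  fold-first : ∀ n f → fold (suc n) f ≡ f 0 ∙ fold n (λ i → f (suc i))
  fold-first n f = trans (fold-+ 1 n f) (cong (_∙ fold n (λ i → f (suc i))) (identityˡ (f 0)))

  fold-* : ∀ m n f → fold (m ℕ.* n) f ≡ fold m (λ a → fold n (λ b → f (a ℕ.* n ℕ.+ b)))
  fold-* zero n f = refl
  fold-* (suc m) n f = trans (cong (λ k → fold k f) (ℕₚ.+-comm n (m ℕ.* n)))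
    (trans (fold-+ (m ℕ.* n) n f) (cong (_∙ fold n (λ b → f (m ℕ.* n ℕ.+ b))) (fold-* m n f)))

  private
    fold≡sum : ∀ n f → fold n f ≡ sum {n} (f ∘ toℕ)
    fold≡sum zero f = refl
    fold≡sum (suc n) f = trans (fold-first n f) (cong (f 0 ∙_) (fold≡sum n (f ∘ suc)))

  -- `π` and `π⁻¹` are constrained only below `n`; there they give a permutation of `Fin n`, to
  -- which `sum-permute` applies.
  fold-permute : ∀ n (f : ℕ → A) (π π⁻¹ : ℕ → ℕ) →
    (∀ i → i ℕ.< n → π i ℕ.< n) → (∀ i → i ℕ.< n → π⁻¹ i ℕ.< n) →
    (∀ i → i ℕ.< n → π⁻¹ (π i) ≡ i) → (∀ i → i ℕ.< n → π (π⁻¹ i) ≡ i) →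
    fold n (f ∘ π) ≡ fold n f
  fold-permute n f π π⁻¹ b b⁻¹ l r = begin
    fold n (f ∘ π) ≡⟨ fold≡sum n (f ∘ π) ⟩
    sum {n} (f ∘ π ∘ toℕ) ≡⟨ sum-cong-≋ {n} (λ i → cong f (sym (Finₚ.toℕ-fromℕ< (b (toℕ i) (Finₚ.toℕ<n i))))) ⟩
    sum {n} (λ i → f (toℕ (ρ ⟨$⟩ʳ i))) ≡⟨ sum-permute {n} {n} (f ∘ toℕ) ρ ⟨
    sum {n} (f ∘ toℕ) ≡⟨ fold≡sum n f ⟨
    fold n f ∎
    where
    open ≡-Reasoning
    to from : Fin n → Fin n
    to i = fromℕ< (b (toℕ i) (Finₚ.toℕ<n i))
    from i = fromℕ< (b⁻¹ (toℕ i) (Finₚ.toℕ<n i))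
    ρ : Permutation′ n
    ρ = permutation to from
      (λ i → Finₚ.toℕ-injective (trans (Finₚ.toℕ-fromℕ< _)
        (trans (cong π (Finₚ.toℕ-fromℕ< _)) (r (toℕ i) (Finₚ.toℕ<n i)))))
      (λ i → Finₚ.toℕ-injective (trans (Finₚ.toℕ-fromℕ< _)
        (trans (cong π⁻¹ (Finₚ.toℕ-fromℕ< _)) (l (toℕ i) (Finₚ.toℕ<n i)))))

open Fold ℤ._+_ 0ℤ ℤₚ.+-0-isCommutativeMonoid public renaming
  ( fold to ∑ℤ; fold-cong to ∑ℤ-cong; fold-ε to ∑ℤ-zero; fold-∙ to ∑ℤ-+; fold-swap to ∑ℤ-swap
  ; fold-+ to ∑ℤ-split; fold-first to ∑ℤ-first; fold-* to ∑ℤ-product; fold-permute to ∑ℤ-permute )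
  hiding (bundle; interchange)

open Fold ℤ._*_ 1ℤ ℤₚ.*-1-isCommutativeMonoid public using () renaming
  ( fold to ∏ℤ; fold-cong to ∏ℤ-cong; fold-ε to ∏ℤ-one; fold-∙ to ∏ℤ-*; fold-swap to ∏ℤ-swap; fold-permute to ∏ℤ-permute )

∑ℤ-*ˡ : ∀ n c f → c ℤ.* ∑ℤ n f ≡ ∑ℤ n (λ i → c ℤ.* f i)
∑ℤ-*ˡ zero c f = ℤₚ.*-zeroʳ c
∑ℤ-*ˡ (suc n) c f = trans (ℤₚ.*-distribˡ-+ c (∑ℤ n f) (f n)) (cong (ℤ._+ c ℤ.* f n) (∑ℤ-*ˡ n c f))

∑ℤ-*ʳ : ∀ n c f → ∑ℤ n f ℤ.* c ≡ ∑ℤ n (λ i → f i ℤ.* c)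
∑ℤ-*ʳ n c f = trans (ℤₚ.*-comm (∑ℤ n f) c)
  (trans (∑ℤ-*ˡ n c f) (∑ℤ-cong n (λ i _ → ℤₚ.*-comm c (f i))))

∑ℤ-mono : ∀ n {f g} → (∀ i → i ℕ.< n → f i ℤ.≤ g i) → ∑ℤ n f ℤ.≤ ∑ℤ n g
∑ℤ-mono zero h = ℤₚ.≤-refl
∑ℤ-mono (suc n) h = ℤₚ.+-mono-≤ (∑ℤ-mono n (λ i i<n → h i (ℕₚ.m<n⇒m<1+n i<n))) (h n ℕₚ.≤-refl)

∑ℤ-const : ∀ n c → ∑ℤ n (λ _ → c) ≡ + n ℤ.* c
∑ℤ-const zero c = sym (ℤₚ.*-zeroˡ c)
∑ℤ-const (suc n) c = trans (cong (ℤ._+ c) (∑ℤ-const n c))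
  (trans (ℤₚ.+-comm (+ n ℤ.* c) c) (sym (ℤₚ.suc-* (+ n) c)))

∑ℤ-nonneg : ∀ n {f} → (∀ i → i ℕ.< n → 0ℤ ℤ.≤ f i) → 0ℤ ℤ.≤ ∑ℤ n f
∑ℤ-nonneg n {f} h = subst (ℤ._≤ ∑ℤ n f) (∑ℤ-zero n) (∑ℤ-mono n h)

∑ℤ-vanish : ∀ n {f} → (∀ i → i ℕ.< n → f i ≡ 0ℤ) → ∑ℤ n f ≡ 0ℤ
∑ℤ-vanish n h = trans (∑ℤ-cong n h) (∑ℤ-zero n)

∑ℤ-extend : ∀ {m n} f → (∀ i → 0ℤ ℤ.≤ f i) → m ℕ.≤ n → ∑ℤ m f ℤ.≤ ∑ℤ n f
∑ℤ-extend {m} {n} f h m≤n = subst₂ ℤ._≤_ (ℤₚ.+-identityʳ (∑ℤ m f))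
  (trans (sym (∑ℤ-split m (n ℕ.∸ m) f)) (cong (λ k → ∑ℤ k f) (ℕₚ.m+[n∸m]≡n m≤n)))
  (ℤₚ.+-monoʳ-≤ (∑ℤ m f) (∑ℤ-nonneg (n ℕ.∸ m) (λ i _ → h (m ℕ.+ i))))

∑ℤ-extend-≡ : ∀ {m n} f → m ℕ.≤ n → (∀ i → m ℕ.≤ i → f i ≡ 0ℤ) → ∑ℤ n f ≡ ∑ℤ m f
∑ℤ-extend-≡ {m} {n} f m≤n h = trans (cong (λ k → ∑ℤ k f) (sym (ℕₚ.m+[n∸m]≡n m≤n)))
  (trans (∑ℤ-split m (n ℕ.∸ m) f)
  (trans (cong (ℤ._+_ (∑ℤ m f)) (∑ℤ-vanish (n ℕ.∸ m) (λ i _ → h (m ℕ.+ i) (ℕₚ.m≤m+n m i))))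
    (ℤₚ.+-identityʳ _)))

∑ℤ-single : ∀ n k f → k ℕ.< n → (∀ i → i ℕ.< n → i ≢ k → f i ≡ 0ℤ) → ∑ℤ n f ≡ f k
∑ℤ-single (suc n) k f k<1+n h with k ℕₚ.≟ n
... | yes refl = trans (cong (ℤ._+ f n) (∑ℤ-vanish n (λ i i<n → h i (ℕₚ.m<n⇒m<1+n i<n) (ℕₚ.<⇒≢ i<n))))
  (ℤₚ.+-identityˡ (f n))
... | no k≢n = trans (cong₂ ℤ._+_
    (∑ℤ-single n k f (ℕₚ.≤∧≢⇒< (ℕ.s≤s⁻¹ k<1+n) k≢n) (λ i i<n → h i (ℕₚ.m<n⇒m<1+n i<n)))
    (h n ℕₚ.≤-refl (λ e → k≢n (sym e))))
  (ℤₚ.+-identityʳ (f k))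

-- Congruences and Bézout's identity in ℤ

module Congruence where

 open import Data.Integer.Base
 open import Data.Integer.Properties
 open import Data.Integer.DivMod using (n%ℕd<d; a≡a%ℕn+[a/ℕn]*n)
 open import Data.Integer.Divisibility.Signed
 open import Data.Nat.GCD using (module Bézout; module GCD)

 -- A linear combination of hypotheses, with the identity left to the ring solver.
 linear : ∀ {a b l r : ℤ} k → l ≡ r → a - b ≡ k * (l - r) → a ≡ b
 linear {l = l} k refl e = i-j≡0⇒i≡j _ _ (trans e (trans (cong (k *_) (i≡j⇒i-j≡0 {l} refl)) (*-zeroʳ k)))

 linear₂ : ∀ {a b l r l′ r′ : ℤ} k k′ → l ≡ r → l′ ≡ r′ → a - b ≡ k * (l - r) + k′ * (l′ - r′) → a ≡ b
 linear₂ {l = l} {l′ = l′} k k′ refl refl e = i-j≡0⇒i≡j _ _ (trans e (cong₂ _+_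
   (trans (cong (k *_) (i≡j⇒i-j≡0 {l} refl)) (*-zeroʳ k))
   (trans (cong (k′ *_) (i≡j⇒i-j≡0 {l′} refl)) (*-zeroʳ k′))))

 linear₃ : ∀ {a b l r l′ r′ l″ r″ : ℤ} k k′ k″ → l ≡ r → l′ ≡ r′ → l″ ≡ r″ →
   a - b ≡ k * (l - r) + k′ * (l′ - r′) + k″ * (l″ - r″) → a ≡ b
 linear₃ {l = l} {r} {l′} {r′} {l″} k k′ k″ e e′ refl f = linear₂ k k′ e e′ (trans f (trans
   (cong (_+_ (k * (l - r) + k′ * (l′ - r′))) (trans (cong (k″ *_) (i≡j⇒i-j≡0 {l″} refl)) (*-zeroʳ k″)))
   (+-identityʳ (k * (l - r) + k′ * (l′ - r′)))))

 infix 4 _≈_[_]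
 _≈_[_] : ℤ → ℤ → ℕ → Set
 x ≈ y [ n ] = + n ∣ x - y

 ≈-reflexive : ∀ {n x y} → x ≡ y → x ≈ y [ n ]
 ≈-reflexive {n} {x} refl = divides 0ℤ (trans (i≡j⇒i-j≡0 {x} refl) (sym (*-zeroˡ (+ n))))

 ≈-refl : ∀ {n} x → x ≈ x [ n ]
 ≈-refl x = ≈-reflexive {x = x} refl

 ≈-sym : ∀ {n} x y → x ≈ y [ n ] → y ≈ x [ n ]
 ≈-sym {n} x y (divides k e) = divides (- k) (linear -1ℤ e (identity x y k (+ n)))
   where
   identity : ∀ x y k n → (y - x) - (- k) * n ≡ -1ℤ * ((x - y) - k * n)
   identity = ℤ-ring

 ≈-trans : ∀ {n} x y z → x ≈ y [ n ] → y ≈ z [ n ] → x ≈ z [ n ]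
 ≈-trans {n} x y z (divides k e) (divides l f) = divides (k + l)
   (linear₂ 1ℤ 1ℤ e f (identity x y z k l (+ n)))
   where
   identity : ∀ x y z k l n → (x - z) - (k + l) * n ≡ 1ℤ * ((x - y) - k * n) + 1ℤ * ((y - z) - l * n)
   identity = ℤ-ring

 ≈-+ : ∀ {n} x y x′ y′ → x ≈ y [ n ] → x′ ≈ y′ [ n ] → x + x′ ≈ y + y′ [ n ]
 ≈-+ {n} x y x′ y′ (divides k e) (divides l f) = divides (k + l)
   (linear₂ 1ℤ 1ℤ e f (identity x y x′ y′ k l (+ n)))
   where
   identity : ∀ x y x′ y′ k l n →
     (x + x′ - (y + y′)) - (k + l) * n ≡ 1ℤ * ((x - y) - k * n) + 1ℤ * ((x′ - y′) - l * n)
   identity = ℤ-ring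

 ≈-neg : ∀ {n} x y → x ≈ y [ n ] → - x ≈ - y [ n ]
 ≈-neg {n} x y (divides k e) = divides (- k) (linear -1ℤ e (identity x y k (+ n)))
   where
   identity : ∀ x y k n → (- x - - y) - (- k) * n ≡ -1ℤ * ((x - y) - k * n)
   identity = ℤ-ring

 ≈-* : ∀ {n} x y x′ y′ → x ≈ y [ n ] → x′ ≈ y′ [ n ] → x * x′ ≈ y * y′ [ n ]
 ≈-* {n} x y x′ y′ (divides k e) (divides l f) = divides (k * x′ + y * l)
   (linear₂ x′ y e f (identity x y x′ y′ k l (+ n)))
   where
   identity : ∀ x y x′ y′ k l n →
     (x * x′ - y * y′) - (k * x′ + y * l) * n ≡ x′ * ((x - y) - k * n) + y * ((x′ - y′) - l * n)
   identity = ℤ-ring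

 ≈-*ˡ : ∀ {n} c x y → x ≈ y [ n ] → c * x ≈ c * y [ n ]
 ≈-*ˡ c x y = ≈-* c c x y (≈-refl c)

 ∣⇒≈0 : ∀ {n} x → + n ∣ x → x ≈ 0ℤ [ n ]
 ∣⇒≈0 x (divides k e) = divides k (trans (+-identityʳ x) e)

 ≈0⇒∣ : ∀ {n} x → x ≈ 0ℤ [ n ] → + n ∣ x
 ≈0⇒∣ x (divides k e) = divides k (trans (sym (+-identityʳ x)) e)

 ≈-∣ : ∀ {n} x y → x ≈ y [ n ] → + n ∣ y → + n ∣ x
 ≈-∣ x y e d = ≈0⇒∣ x (≈-trans x y 0ℤ e (∣⇒≈0 y d))

 ≈-+* : ∀ {n} x k → x + k * + n ≈ x [ n ]
 ≈-+* {n} x k = divides k (identity x k (+ n))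
   where
   identity : ∀ x k n → (x + k * n) - x ≡ k * n
   identity = ℤ-ring

 ≈-weaken : ∀ {m n} x y → + m ∣ + n → x ≈ y [ n ] → x ≈ y [ m ]
 ≈-weaken x y = ∣-trans

 %-≈ : ∀ n .{{_ : ℕ.NonZero n}} x → x ≈ + (x %ℕ n) [ n ]
 %-≈ n x = divides (x /ℕ n) (linear 1ℤ (a≡a%ℕn+[a/ℕn]*n x n) (identity x (+ (x %ℕ n)) (x /ℕ n) (+ n)))
   where
   identity : ∀ x r t n → (x - r) - t * n ≡ 1ℤ * (x - (r + t * n))
   identity = ℤ-ring

 ∣-small : ∀ {n i} → + n ∣ i → ∣ i ∣ ℕ.< n → i ≡ 0ℤ
 ∣-small {n} {i} d i<n with ∣ i ∣ in eq
 ... | zero = ∣i∣≡0⇒i≡0 eq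
 ... | suc k = contradiction (ℕ∣.∣⇒≤ (subst (n ℕ∣.∣_) eq (∣⇒∣ᵤ d))) (ℕₚ.<⇒≱ i<n)

 ≈-< : ∀ {n a b} → a ℕ.< n → b ℕ.< n → + a ≈ + b [ n ] → a ≡ b
 ≈-< {n} {a} {b} a<n b<n d = +-injective (i-j≡0⇒i≡j (+ a) (+ b) (∣-small d
   (ℕₚ.≤-<-trans (ℕₚ.≤-reflexive (cong ∣_∣ (m-n≡m⊖n a b)))
     (ℕₚ.≤-<-trans (∣m⊝n∣≤m⊔n a b) (ℕₚ.⊔-pres-<m a<n b<n)))))

 ≈⇒%≡ : ∀ n .{{_ : ℕ.NonZero n}} x y → x ≈ y [ n ] → x %ℕ n ≡ y %ℕ n
 ≈⇒%≡ n x y e = ≈-< (n%ℕd<d x n) (n%ℕd<d y n)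
   (≈-trans (+ (x %ℕ n)) x (+ (y %ℕ n)) (≈-sym x _ (%-≈ n x)) (≈-trans x y _ e (%-≈ n y)))

 ≈-%-unique : ∀ n .{{_ : ℕ.NonZero n}} x r → r ℕ.< n → x ≈ + r [ n ] → x %ℕ n ≡ r
 ≈-%-unique n x r r<n e = ≈-< (n%ℕd<d x n) r<n
   (≈-trans (+ (x %ℕ n)) x (+ r) (≈-sym x _ (%-≈ n x)) e)

 ∣⇔%≡0 : ∀ n .{{_ : ℕ.NonZero n}} x → + n ∣ x → x %ℕ n ≡ 0
 ∣⇔%≡0 n@(suc _) x d = ≈-%-unique n x 0 ℕ.z<s (∣⇒≈0 x d)

 %≡0⇒∣ : ∀ n .{{_ : ℕ.NonZero n}} x → x %ℕ n ≡ 0 → + n ∣ x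
 %≡0⇒∣ n x e = ≈-∣ x 0ℤ (subst (λ r → x ≈ + r [ n ]) e (%-≈ n x)) (divides 0ℤ (sym (*-zeroˡ (+ n))))

 -- The cofactors `m` and `n` are kept as data because lattice bases are later rewritten with them.
 record ExtendedGCD (a b : ℤ) : Set where
   field
     g : ℕ
     u v m n : ℤ
     bézout : + g ≡ u * a + v * b
     a≡m*g : a ≡ m * + g
     b≡n*g : b ≡ n * + g

 extendedGCD : ∀ a b → ExtendedGCD a b
 extendedGCD a b with Bézout.lemma ∣ a ∣ ∣ b ∣
 ... | Bézout.result d gcd ident = record
   { g = d ; u = proj-u ident * σ a ; v = proj-v ident * σ b
   ; m = quotient d∣a ; n = quotient d∣b
   ; bézout = trans (combine ident) (cong₂ _+_
       (trans (cong (proj-u ident *_) (sym (σ-abs a))) (sym (*-assoc (proj-u ident) (σ a) a)))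
       (trans (cong (proj-v ident *_) (sym (σ-abs b))) (sym (*-assoc (proj-v ident) (σ b) b))))
   ; a≡m*g = _∣_.equality d∣a ; b≡n*g = _∣_.equality d∣b }
   where
   d∣a : + d ∣ a
   d∣a = ∣ᵤ⇒∣ (GCD.gcd∣m gcd)
   d∣b : + d ∣ b
   d∣b = ∣ᵤ⇒∣ (GCD.gcd∣n gcd)
   σ : ℤ → ℤ
   σ (+ _) = 1ℤ
   σ -[1+ _ ] = -1ℤ
   σ-abs : ∀ i → σ i * i ≡ + ∣ i ∣
   σ-abs (+ n) = *-identityˡ (+ n)
   σ-abs -[1+ n ] = -1*i≡-i -[1+ n ]
   proj-u proj-v : Bézout.Identity d ∣ a ∣ ∣ b ∣ → ℤ
   proj-u (Bézout.+- x y _) = + x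
   proj-u (Bézout.-+ x y _) = - + x
   proj-v (Bézout.+- x y _) = - + y
   proj-v (Bézout.-+ x y _) = + y
   cast : ∀ x y z t w → x ℕ.+ y ℕ.* z ≡ t ℕ.* w → + x + + y * + z ≡ + t * + w
   cast x y z t w e = trans (cong (_+_ (+ x)) (sym (pos-* y z)))
     (trans (cong +_ e) (pos-* t w))
   id₁ : ∀ d x y a b → d - (x * a + (- y) * b) ≡ 1ℤ * ((d + y * b) - x * a)
   id₁ = ℤ-ring
   id₂ : ∀ d x y a b → d - ((- x) * a + y * b) ≡ 1ℤ * ((d + x * a) - y * b)
   id₂ = ℤ-ring
   A B : ℕ
   A = ∣ a ∣
   B = ∣ b ∣
   combine : (i : Bézout.Identity d ∣ a ∣ ∣ b ∣) → + d ≡ proj-u i * + ∣ a ∣ + proj-v i * + ∣ b ∣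
   combine (Bézout.+- x y e) = linear 1ℤ (cast d y B x A e) (id₁ (+ d) (+ x) (+ y) (+ A) (+ B))
   combine (Bézout.-+ x y e) = linear 1ℤ (cast d x A y B e) (id₂ (+ d) (+ x) (+ y) (+ A) (+ B))

module IntegerCharacters where

 open import Data.Integer.Base hiding (suc; pred; NonZero)
 open import Data.Integer.Divisibility.Signed
 open import Data.Integer.DivMod using (n%ℕd<d)
 open import Data.Integer.Properties hiding (_≟_; _≤?_; _<?_)
 open import Data.List.Base using (List; []; _∷_; length; replicate)
 open import Data.List.Properties using (length-replicate)
 open import Data.List.Relation.Unary.All using (All; []; _∷_)
 open import Data.Nat.ListAction using (product)
 open import Data.Nat.Primality.Factorisation using (factorise; PrimeFactorisation)
 open import Relation.Binary.Definitions using (tri<; tri≈; tri>)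
 open Congruence

 -- Jacobi symbols

 ε : ℕ → ℤ
 ε zero = 1ℤ
 ε (suc n) = - ε n

 ε-+ : ∀ m n → ε (m ℕ.+ n) ≡ ε m * ε n
 ε-+ zero n = sym (*-identityˡ (ε n))
 ε-+ (suc m) n = trans (cong -_ (ε-+ m n)) (neg-distribˡ-* (ε m) (ε n))

 ε-square : ∀ n → ε n * ε n ≡ 1ℤ
 ε-square zero = refl
 ε-square (suc n) = trans (neg² (ε n)) (ε-square n)
   where
   neg² : ∀ a → (- a) * (- a) ≡ a * a
   neg² = ℤ-ring

 ε-double : ∀ n → ε (n ℕ.+ n) ≡ 1ℤ
 ε-double n = trans (ε-+ n n) (ε-square n)

 odd : ℕ → ℕ
 odd P = suc (P ℕ.+ P)

 ε-odd : ∀ P → ε (odd P) ≡ -1ℤ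
 ε-odd P = cong -_ (ε-double P)

 ε-odd* : ∀ P n → ε (odd P ℕ.* n) ≡ ε n
 ε-odd* P zero = cong ε (ℕₚ.*-zeroʳ (odd P))
 ε-odd* P (suc n) = trans (cong ε (ℕₚ.*-suc (odd P) n))
   (trans (ε-+ (odd P) (odd P ℕ.* n))
   (trans (cong₂ _*_ (ε-odd P) (ε-odd* P n)) (-1*i≡-i (ε n))))

 ε-∏ : ∀ n → ∏ℤ n (λ _ → -1ℤ) ≡ ε n
 ε-∏ zero = refl
 ε-∏ (suc n) = trans (cong (_* -1ℤ) (ε-∏ n)) (trans (*-comm (ε n) -1ℤ) (-1*i≡-i (ε n)))

 ∏ℤ-zero : ∀ n {f} k → k ℕ.< n → f k ≡ 0ℤ → ∏ℤ n f ≡ 0ℤ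
 ∏ℤ-zero (suc n) {f} k k<1+n e with k ℕₚ.≟ n
 ... | yes refl = trans (cong (∏ℤ n f *_) e) (*-zeroʳ (∏ℤ n f))
 ... | no k≢n = trans (cong (_* f n) (∏ℤ-zero n k (ℕₚ.≤∧≢⇒< (ℕ.s≤s⁻¹ k<1+n) k≢n) e)) (*-zeroˡ (f n))

 parity : ℕ → ℤ
 parity zero = 0ℤ
 parity (suc r) = ε (suc r)

 parity≡ε : ∀ {r} → r ≢ 0 → parity r ≡ ε r
 parity≡ε {zero} r≢0 = contradiction refl r≢0
 parity≡ε {suc r} _ = refl

 infix 4 _≈±_[_]
 _≈±_[_] : ℤ → ℤ → ℕ → Set
 x ≈± y [ n ] = x ≈ y [ n ] ⊎ x ≈ - y [ n ]

 ≈±-sym : ∀ {n} x y → x ≈± y [ n ] → y ≈± x [ n ]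
 ≈±-sym x y (inj₁ e) = inj₁ (≈-sym x y e)
 ≈±-sym {n} x y (inj₂ e) = inj₂ (≈-sym (- x) y
   (subst (- x ≈_[ n ]) (neg-involutive y) (≈-neg x (- y) e)))

 ≈±-trans : ∀ {n} x y z → x ≈± y [ n ] → y ≈± z [ n ] → x ≈± z [ n ]
 ≈±-trans x y z (inj₁ e) (inj₁ f) = inj₁ (≈-trans x y z e f)
 ≈±-trans x y z (inj₁ e) (inj₂ f) = inj₂ (≈-trans x y (- z) e f)
 ≈±-trans x y z (inj₂ e) (inj₁ f) = inj₂ (≈-trans x (- y) (- z) e (≈-neg y z f))
 ≈±-trans {n} x y z (inj₂ e) (inj₂ f) = inj₁ (≈-trans x (- y) z e
   (subst (- y ≈_[ n ]) (neg-involutive z) (≈-neg y (- z) f)))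

 ≈±-*ˡ : ∀ {n} c x y → x ≈± y [ n ] → c * x ≈± c * y [ n ]
 ≈±-*ˡ c x y (inj₁ e) = inj₁ (≈-*ˡ c x y e)
 ≈±-*ˡ {n} c x y (inj₂ e) = inj₂ (subst (c * x ≈_[ n ]) (sym (neg-distribʳ-* c y)) (≈-*ˡ c x (- y) e))

 IsUnit : ℕ → ℤ → Set
 IsUnit n b = ∃[ b′ ] b * b′ ≈ 1ℤ [ n ]

 unit-sym : ∀ {n b} ((b′ , _) : IsUnit n b) → IsUnit n b′
 unit-sym {n} {b} (b′ , e) = b , subst (_≈ 1ℤ [ n ]) (*-comm b b′) e

 unit-cancel : ∀ {n} b x → ((b′ , _) : IsUnit n b) → b′ * (b * x) ≈ x [ n ]
 unit-cancel {n} b x (b′ , e) = subst₂ (_≈_[ n ]) (assoc b b′ x) (*-identityˡ x)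
   (≈-* (b * b′) 1ℤ x x e (≈-refl x))
   where
   assoc : ∀ b b′ x → b * b′ * x ≡ b′ * (b * x)
   assoc = ℤ-ring

 unit-∣ : ∀ {n} b x → IsUnit n b → + n ∣ b * x → + n ∣ x
 unit-∣ b x u@(b′ , _) d = ≈-∣ x (b′ * (b * x)) (≈-sym _ x (unit-cancel b x u)) (∣n⇒∣m*n b′ d)

 unit-* : ∀ {n} a b → IsUnit n a → IsUnit n b → IsUnit n (a * b)
 unit-* {n} a b (a′ , e) (b′ , f) = a′ * b′ ,
   subst (_≈ 1ℤ [ n ]) (mid a a′ b b′) (≈-* (a * a′) 1ℤ (b * b′) 1ℤ e f)
   where
   mid : ∀ a a′ b b′ → (a * a′) * (b * b′) ≡ a * b * (a′ * b′)
   mid = ℤ-ring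

 unit-*⁻ : ∀ {n} a b → IsUnit n (a * b) → IsUnit n a
 unit-*⁻ {n} a b (c , e) = b * c , subst (_≈ 1ℤ [ n ]) (*-assoc a b c) e

 unit-cong : ∀ {n} a b → a ≈ b [ n ] → IsUnit n a → IsUnit n b
 unit-cong a b e (a′ , f) = a′ , ≈-trans (b * a′) (a * a′) 1ℤ (≈-* b a a′ a′ (≈-sym a b e) (≈-refl a′)) f

 module _ (P : ℕ) where

   private
     N : ℕ
     N = odd P

     P<N : P ℕ.< N
     P<N = s≤s (ℕₚ.m≤m+n P P)

   opaque
     -- An odd function on ℤ/N, that is, the choice of a half system.
     sgn : ℤ → ℤ
     sgn x = parity (x %ℕ N)

     sgn-cong : ∀ x y → x ≈ y [ N ] → sgn x ≡ sgn y
     sgn-cong x y e = cong parity (≈⇒%≡ N x y e)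

     sgn-∣ : ∀ x → + N ∣ x → sgn x ≡ 0ℤ
     sgn-∣ x d = cong parity (∣⇔%≡0 N x d)

     sgn-square : ∀ x → ¬ (+ N ∣ x) → sgn x * sgn x ≡ 1ℤ
     sgn-square x ∤ = trans (cong (λ t → t * t) (parity≡ε (λ e → ∤ (%≡0⇒∣ N x e)))) (ε-square (x %ℕ N))

     sgn-small : ∀ {r} → suc r ℕ.< N → sgn (+ suc r) ≡ ε (suc r)
     sgn-small {r} r<N = cong parity (≈-%-unique N (+ suc r) (suc r) r<N (≈-refl (+ suc r)))

     ∤-small : ∀ {r} → suc r ℕ.< N → ¬ (+ N ∣ + suc r)
     ∤-small r<N d with () ← ∣-small d r<N

     -- The modulus N is odd, so the residues r and N - r have opposite parities.
     sgn-neg : ∀ x → sgn (- x) ≡ - sgn x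
     sgn-neg x with x %ℕ N in eq
     ... | zero = sgn-∣ (- x) (∣m⇒∣-m (%≡0⇒∣ N x eq))
     ... | suc r = trans (cong parity r′) (trans (parity≡ε (ℕₚ.m>n⇒m∸n≢0 sr<N)) flip)
       where
       sr<N : suc r ℕ.< N
       sr<N = subst (ℕ._< N) eq (n%ℕd<d x N)
       sub : + (N ℕ.∸ suc r) ≡ + N - + suc r
       sub = trans (sym (⊖-≥ (ℕₚ.<⇒≤ sr<N))) (sym (m-n≡m⊖n N (suc r)))
       shift : ∀ r n → - r + 1ℤ * n ≡ n - r
       shift = ℤ-ring
       -x≈ : - x ≈ + (N ℕ.∸ suc r) [ N ]
       -x≈ = ≈-trans (- x) (- + suc r) (+ (N ℕ.∸ suc r))
         (≈-neg x (+ suc r) (subst (λ t → x ≈ + t [ N ]) eq (%-≈ N x)))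
         (≈-sym (+ (N ℕ.∸ suc r)) (- + suc r)
           (subst (_≈ - + suc r [ N ]) (trans (shift (+ suc r) (+ N)) (sym sub)) (≈-+* (- + suc r) 1ℤ)))
       r′ : (- x) %ℕ N ≡ N ℕ.∸ suc r
       r′ = ≈-%-unique N (- x) (N ℕ.∸ suc r) (ℕₚ.∸-monoʳ-< ℕ.z<s (ℕₚ.<⇒≤ sr<N)) -x≈
       flip : ε (N ℕ.∸ suc r) ≡ - ε (suc r)
       flip = begin
         ε d ≡⟨ *-identityʳ (ε d) ⟨
         ε d * 1ℤ ≡⟨ cong (ε d *_) (ε-square (suc r)) ⟨
         ε d * (e * e) ≡⟨ *-assoc (ε d) e e ⟨
         ε d * e * e ≡⟨ cong (_* e) (ε-+ d (suc r)) ⟨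
         ε (d ℕ.+ suc r) * e ≡⟨ cong (λ t → ε t * e) (ℕₚ.m∸n+n≡m (ℕₚ.<⇒≤ sr<N)) ⟩
         ε N * e ≡⟨ cong (_* e) (ε-odd P) ⟩
         -1ℤ * e ≡⟨ -1*i≡-i e ⟩
         - e ∎
         where
         open ≡-Reasoning
         d : ℕ
         d = N ℕ.∸ suc r
         e : ℤ
         e = ε (suc r)

   opaque
     absMod : ℤ → ℕ
     absMod x with x %ℕ N ℕₚ.≤? P
     ... | yes _ = x %ℕ N
     ... | no _ = N ℕ.∸ x %ℕ N

     absMod≤ : ∀ x → absMod x ℕ.≤ P
     absMod≤ x with x %ℕ N ℕₚ.≤? P
     ... | yes p = p
     ... | no ¬p = ℕₚ.≤-trans (ℕₚ.∸-monoʳ-≤ N (ℕₚ.≰⇒> ¬p)) (ℕₚ.≤-reflexive (ℕₚ.m+n∸m≡n P P))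

     absMod-≈± : ∀ x → x ≈± + absMod x [ N ]
     absMod-≈± x with x %ℕ N ℕₚ.≤? P
     ... | yes _ = inj₁ (%-≈ N x)
     ... | no _ = inj₂ (≈-trans x (+ r) (- + (N ℕ.∸ r)) (%-≈ N x)
       (subst (+ r ≈_[ N ]) (trans (flip (+ r) (+ N)) (cong -_ (sym sub))) (≈-sym (+ r + -1ℤ * + N) (+ r) (≈-+* (+ r) -1ℤ))))
       where
       r : ℕ
       r = x %ℕ N
       r≤N : r ℕ.≤ N
       r≤N = ℕₚ.<⇒≤ (n%ℕd<d x N)
       sub : + (N ℕ.∸ r) ≡ + N - + r
       sub = trans (sym (⊖-≥ r≤N)) (sym (m-n≡m⊖n N r))
       flip : ∀ r n → r + -1ℤ * n ≡ - (n - r)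
       flip = ℤ-ring

     ≈±-unique : ∀ {a b} → a ℕ.≤ P → b ℕ.≤ P → + a ≈± + b [ N ] → a ≡ b
     ≈±-unique a≤P b≤P (inj₁ e) = ≈-< (ℕₚ.≤-<-trans a≤P P<N) (ℕₚ.≤-<-trans b≤P P<N) e
     ≈±-unique {a} {b} a≤P b≤P (inj₂ e) = trans (ℕₚ.m+n≡0⇒m≡0 a a+b≡0) (sym (ℕₚ.m+n≡0⇒n≡0 a a+b≡0))
       where
       a+b≡0 : a ℕ.+ b ≡ 0
       a+b≡0 = +-injective (∣-small (subst (λ t → + N ∣ + a + t) (neg-involutive (+ b)) e)
         (s≤s (ℕₚ.+-mono-≤ a≤P b≤P)))

   -- Gauss's permutation: k ↦ |b k| maps 1, ..., P onto itself, with inverse k ↦ |b′ k|, and an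
   -- even function does not see the sign.
   half-permute : ∀ (h : ℤ → ℤ) → (∀ x y → x ≈ y [ N ] → h x ≡ h y) → (∀ x → h (- x) ≡ h x) →
     ∀ b → IsUnit N b → ∏ℤ P (λ k → h (b * + suc k)) ≡ ∏ℤ P (λ k → h (+ suc k))
   half-permute h h-cong h-even b u@(b′ , _) =
     trans (∏ℤ-cong P (λ k k<P → trans (h-± _ _ (absMod-≈± (b * + suc k))) (cong (λ t → h (+ t)) (sym (suc-π b u k k<P)))))
       (∏ℤ-permute P (λ k → h (+ suc k)) (π b) (π b′) (π< b u) (π< b′ u′) (inv b u) (inv b′ u′))
     where
     u′ : IsUnit N b′
     u′ = unit-sym {b = b} u
     h-± : ∀ x y → x ≈± y [ N ] → h x ≡ h y
     h-± x y (inj₁ e) = h-cong x y e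
     h-± x y (inj₂ e) = trans (h-cong x (- y) e) (h-even y)
     π : ℤ → ℕ → ℕ
     π b k = ℕ.pred (absMod (b * + suc k))
     nonzero : ∀ b → IsUnit N b → ∀ k → k ℕ.< P → absMod (b * + suc k) ≢ 0
     nonzero b u k k<P e = ∤-small (ℕₚ.≤-<-trans k<P P<N) (unit-∣ b (+ suc k) u
       (≈0⇒∣ (b * + suc k) (≈0 (subst (λ t → b * + suc k ≈± + t [ N ]) e (absMod-≈± (b * + suc k))))))
       where
       ≈0 : b * + suc k ≈± + 0 [ N ] → b * + suc k ≈ + 0 [ N ]
       ≈0 (inj₁ d) = d
       ≈0 (inj₂ d) = d
     suc-π : ∀ b → IsUnit N b → ∀ k → k ℕ.< P → suc (π b k) ≡ absMod (b * + suc k)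
     suc-π b u k k<P = ℕₚ.suc-pred _ {{ℕ.≢-nonZero (nonzero b u k k<P)}}
     π< : ∀ b → IsUnit N b → ∀ k → k ℕ.< P → π b k ℕ.< P
     π< b u k k<P = subst (ℕ._≤ P) (sym (suc-π b u k k<P)) (absMod≤ (b * + suc k))
     inv : ∀ b (u : IsUnit N b) k → k ℕ.< P → π (proj₁ u) (π b k) ≡ k
     inv b u@(b′ , _) k k<P = cong ℕ.pred (≈±-unique (absMod≤ y) k<P
       (≈±-trans (+ absMod y) y (+ suc k) (≈±-sym y (+ absMod y) (absMod-≈± y))
         (≈±-trans y (b′ * (b * + suc k)) (+ suc k)
           (≈±-*ˡ b′ _ _ (subst (λ t → + t ≈± b * + suc k [ N ]) (sym (suc-π b u k k<P))
             (≈±-sym (b * + suc k) _ (absMod-≈± (b * + suc k)))))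
           (inj₁ (unit-cancel b (+ suc k) u)))))
       where
       y : ℤ
       y = b′ * + suc (π b k)

   -- The Jacobi symbol (x / N) for the odd modulus N = 2P + 1, by the form of
   -- Gauss's lemma that uses the residues 0 < r < N of either parity as half systems.
   jacobi : ℤ → ℤ
   jacobi x = ∏ℤ P (λ k → sgn (x * + suc k) * sgn (+ suc k))

   jacobi-cong : ∀ x y → x ≈ y [ N ] → jacobi x ≡ jacobi y
   jacobi-cong x y e = ∏ℤ-cong P (λ k _ → cong (_* sgn (+ suc k))
     (sgn-cong (x * + suc k) (y * + suc k) (≈-* x y (+ suc k) (+ suc k) e (≈-refl (+ suc k)))))

   half<N : ∀ {k} → k ℕ.< P → suc k ℕ.< N
   half<N k<P = ℕₚ.≤-<-trans k<P P<N

   ∏-one : ∀ n {f} → (∀ i → i ℕ.< n → f i ≡ 1ℤ) → ∏ℤ n f ≡ 1ℤ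
   ∏-one n h = trans (∏ℤ-cong n h) (∏ℤ-one n)

   jacobi-1 : jacobi 1ℤ ≡ 1ℤ
   jacobi-1 = ∏-one P (λ k k<P → trans (cong (λ t → sgn t * sgn (+ suc k)) (*-identityˡ (+ suc k)))
     (sgn-square (+ suc k) (∤-small (half<N k<P))))

   -- The function h(x) = sgn(a x) sgn(x) is even, so `half-permute` moves its product from k to b
   -- k. The factor sgn(b k)² = 1 is inserted to separate the two symbols.
   jacobi-*-unit : ∀ a b → IsUnit N b → jacobi (a * b) ≡ jacobi a * jacobi b
   jacobi-*-unit a b u = begin
     ∏ℤ P (λ k → sgn (a * b * + suc k) * sgn (+ suc k))
       ≡⟨ ∏ℤ-cong P split ⟩
     ∏ℤ P (λ k → h (b * + suc k) * (sgn (b * + suc k) * sgn (+ suc k)))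
       ≡⟨ ∏ℤ-* P _ _ ⟩
     ∏ℤ P (λ k → h (b * + suc k)) * jacobi b
       ≡⟨ cong (_* jacobi b) (half-permute h h-cong h-even b u) ⟩
     jacobi a * jacobi b ∎
     where
     open ≡-Reasoning
     h : ℤ → ℤ
     h x = sgn (a * x) * sgn x
     h-cong : ∀ x y → x ≈ y [ N ] → h x ≡ h y
     h-cong x y e = cong₂ _*_ (sgn-cong (a * x) (a * y) (≈-*ˡ a x y e)) (sgn-cong x y e)
     neg² : ∀ s t → (- s) * (- t) ≡ s * t
     neg² = ℤ-ring
     h-even : ∀ x → h (- x) ≡ h x
     h-even x = trans (cong₂ _*_ (trans (cong sgn (sym (neg-distribʳ-* a x))) (sgn-neg (a * x))) (sgn-neg x))
       (neg² (sgn (a * x)) (sgn x))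
     insert : ∀ s t r → t * t ≡ 1ℤ → s * r ≡ (s * t) * (t * r)
     insert s t r e = linear (- (s * r)) e (identity s t r)
       where
       identity : ∀ s t r → s * r - (s * t) * (t * r) ≡ (- (s * r)) * (t * t - 1ℤ)
       identity = ℤ-ring
     split : ∀ k → k ℕ.< P → sgn (a * b * + suc k) * sgn (+ suc k) ≡
       h (b * + suc k) * (sgn (b * + suc k) * sgn (+ suc k))
     split k k<P = trans (cong (λ t → sgn t * sgn (+ suc k)) (*-assoc a b (+ suc k)))
       (insert (sgn (a * (b * + suc k))) (sgn (b * + suc k)) (sgn (+ suc k)) (sgn-square (b * + suc k) (λ d → ∤-small (half<N k<P) (unit-∣ b (+ suc k) u d))))

   -- If g = gcd(b, N) is at least 2, then b (N / g) is a multiple of N, and N / g ≤ P makes it one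
   -- of the factors of the Gauss product, which therefore vanishes.
   unit? : ∀ b → IsUnit N b ⊎ (∃[ k ] k ℕ.< P × + N ∣ b * + suc k)
   unit? b with extendedGCD b (+ N)
   ... | record { g = suc zero ; u = u ; v = v ; bézout = e } =
     inj₁ (u , divides (- v) (linear -1ℤ e (identity b u v (+ N))))
     where
     identity : ∀ b u v n → (b * u - 1ℤ) - (- v) * n ≡ -1ℤ * (1ℤ - (u * b + v * n))
     identity = ℤ-ring
   ... | record { g = zero ; n = n ; b≡n*g = e } = contradiction (trans e (*-zeroʳ n)) λ ()
   ... | record { g = g@(suc (suc g-2)) ; m = m ; n = n ; a≡m*g = e ; b≡n*g = f } =
     inj₂ (go n f)
     where
     identity : ∀ b m g n N → b * n - m * N ≡ n * (b - m * g) + (- m) * (N - n * g)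
     identity = ℤ-ring
     go : ∀ n → + N ≡ n * + g → ∃[ k ] k ℕ.< P × + N ∣ b * + suc k
     go (+ zero) f = contradiction f λ ()
     go (+ suc k) f = k , ℕₚ.≮⇒≥ P≮k , divides m (linear₂ (+ suc k) (- m) e f (identity b m (+ g) (+ suc k) (+ N)))
       where
       2k≤N : suc k ℕ.+ suc k ℕ.≤ N
       2k≤N = begin
         suc k ℕ.+ suc k ≡⟨ double (suc k) ⟩
         suc k ℕ.* 2 ≤⟨ ℕₚ.*-monoʳ-≤ (suc k) (s≤s (s≤s z≤n)) ⟩
         suc k ℕ.* g ≡⟨ +-injective (trans f (sym (pos-* (suc k) g))) ⟨
         N ∎
         where
         open ℕₚ.≤-Reasoning
         double : ∀ k → k ℕ.+ k ≡ k ℕ.* 2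
         double = ℕ-ring
       P≮k : ¬ (P ℕ.< suc k)
       P≮k P<k = ℕₚ.<⇒≱ (ℕₚ.n<1+n N) (ℕₚ.≤-trans (ℕₚ.≤-reflexive (cong suc (sym (ℕₚ.+-suc P P))))
         (ℕₚ.≤-trans (ℕₚ.+-mono-≤ P<k P<k) 2k≤N))
     go -[1+ k ] ()

   unit-or-zero : ∀ b → IsUnit N b ⊎ jacobi b ≡ 0ℤ
   unit-or-zero b with unit? b
   ... | inj₁ u = inj₁ u
   ... | inj₂ (k , k<P , d) = inj₂ (∏ℤ-zero P k k<P
     (trans (cong (_* sgn (+ suc k)) (sgn-∣ (b * + suc k) d)) (*-zeroˡ (sgn (+ suc k)))))

   jacobi-square : ∀ x → IsUnit N x → jacobi x * jacobi x ≡ 1ℤ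
   jacobi-square x u = trans (sym (∏ℤ-* P f f)) (∏-one P (λ k k<P → begin
     (sgn (x * + suc k) * sgn (+ suc k)) * (sgn (x * + suc k) * sgn (+ suc k))
       ≡⟨ swap (sgn (x * + suc k)) (sgn (+ suc k)) ⟩
     (sgn (x * + suc k) * sgn (x * + suc k)) * (sgn (+ suc k) * sgn (+ suc k))
       ≡⟨ cong₂ _*_ (sgn-square (x * + suc k) (λ d → ∤-small (half<N k<P) (unit-∣ x (+ suc k) u d)))
                    (sgn-square (+ suc k) (∤-small (half<N k<P))) ⟩
     1ℤ ∎))
     where
     open ≡-Reasoning
     f : ℕ → ℤ
     f k = sgn (x * + suc k) * sgn (+ suc k)
     swap : ∀ s t → (s * t) * (s * t) ≡ (s * s) * (t * t)
     swap = ℤ-ring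

   nonunit⇒0 : ∀ b → ¬ IsUnit N b → jacobi b ≡ 0ℤ
   nonunit⇒0 b ¬u with unit-or-zero b
   ... | inj₁ u = contradiction u ¬u
   ... | inj₂ e = e

   unit⇒jacobi≢0 : ∀ b → IsUnit N b → jacobi b ≢ 0ℤ
   unit⇒jacobi≢0 b u e = 1≢0 (trans (sym (jacobi-square b u)) (cong₂ _*_ e e))
     where
     1≢0 : 1ℤ ≢ 0ℤ
     1≢0 ()

   -- Only a non-unit b remains; then a b is no unit either, and both sides are zero.
   jacobi-* : ∀ a b → jacobi (a * b) ≡ jacobi a * jacobi b
   jacobi-* a b with unit-or-zero b
   ... | inj₁ u = jacobi-*-unit a b u
   ... | inj₂ e = trans (nonunit⇒0 (a * b) (λ u → unit⇒jacobi≢0 b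
       (unit-*⁻ b a (subst (IsUnit N) (*-comm a b) u)) e))
     (sym (trans (cong (jacobi a *_) e) (*-zeroʳ (jacobi a))))

   jacobi-∣ : ∀ x → + N ∣ x → P ≢ 0 → jacobi x ≡ 0ℤ
   jacobi-∣ x d P≢0 = ∏ℤ-zero P 0 (ℕₚ.n≢0⇒n>0 P≢0)
     (trans (cong (_* sgn (+ 1)) (sgn-∣ (x * + 1) (∣m⇒∣m*n (+ 1) d))) (*-zeroˡ (sgn (+ 1))))

   jacobi-neg1 : jacobi -1ℤ ≡ ε P
   jacobi-neg1 = trans (∏ℤ-cong P (λ k k<P → trans (cong (_* sgn (+ suc k)) (trans (cong sgn (-1*i≡-i (+ suc k))) (sgn-neg (+ suc k))))
     (trans (sym (neg-distribˡ-* (sgn (+ suc k)) (sgn (+ suc k)))) (cong -_ (sgn-square (+ suc k) (∤-small (half<N k<P)))))))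
     (ε-∏ P)

   -- For k ≤ P the number 2k is its own residue and is even, so only the signs of the k themselves
   -- remain.
   jacobi-2 : jacobi (+ 2) ≡ ∏ℤ P (λ k → ε (suc k))
   jacobi-2 = ∏ℤ-cong P (λ k k<P → trans
     (cong₂ _*_ (trans (sgn-small {ℕ.pred (2 ℕ.* suc k)} (s≤s (2k k<P))) (trans (cong ε (two k)) (ε-double (suc k))))
                (sgn-small (half<N k<P)))
     (*-identityˡ (ε (suc k))))
     where
     two : ∀ k → 2 ℕ.* suc k ≡ suc k ℕ.+ suc k
     two k = cong (suc k ℕ.+_) (ℕₚ.+-identityʳ (suc k))
     2k : ∀ {k} → k ℕ.< P → 2 ℕ.* suc k ℕ.≤ P ℕ.+ P
     2k {k} k<P = ℕₚ.≤-trans (ℕₚ.≤-reflexive (two k)) (ℕₚ.+-mono-≤ k<P k<P)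

 -- Quadratic reciprocity

 sign< : ℕ → ℕ → ℤ
 sign< x y with x ℕₚ.<? y
 ... | yes _ = -1ℤ
 ... | no _ = 1ℤ

 sign<-yes : ∀ {x y} → x ℕ.< y → sign< x y ≡ -1ℤ
 sign<-yes {x} {y} x<y with x ℕₚ.<? y
 ... | yes _ = refl
 ... | no ¬p = contradiction x<y ¬p

 sign<-no : ∀ {x y} → ¬ (x ℕ.< y) → sign< x y ≡ 1ℤ
 sign<-no {x} {y} ¬x<y with x ℕₚ.<? y
 ... | yes p = contradiction p ¬x<y
 ... | no _ = refl

 sign<-antisym : ∀ x y → x ≢ y → sign< x y * sign< y x ≡ -1ℤ
 sign<-antisym x y x≢y with ℕₚ.<-cmp x y
 ... | tri< a _ c = cong₂ _*_ (sign<-yes a) (sign<-no c)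
 ... | tri≈ _ e _ = contradiction e x≢y
 ... | tri> a _ c = cong₂ _*_ (sign<-no a) (sign<-yes c)

 ∏-threshold : ∀ A t → t ℕ.≤ A → (f : ℕ → ℤ) → (∀ j → j ℕ.< t → f j ≡ -1ℤ) → (∀ j → t ℕ.≤ j → f j ≡ 1ℤ) →
   ∏ℤ A f ≡ ε t
 ∏-threshold zero zero z≤n f lo hi = refl
 ∏-threshold (suc A) t t≤1+A f lo hi with ℕₚ.m≤n⇒m<n∨m≡n t≤1+A
 ... | inj₁ t<1+A = trans (cong₂ _*_ (∏-threshold A t (ℕ.s≤s⁻¹ t<1+A) f lo hi) (hi A (ℕ.s≤s⁻¹ t<1+A))) (*-identityʳ (ε t))
 ... | inj₂ refl = trans (∏ℤ-cong (suc A) lo) (ε-∏ (suc A))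

 ∣-odd-unit : ∀ {P x} k → IsUnit (odd P) x → suc k ℕ.< odd P → ¬ (+ odd P ∣ x * + suc k)
 ∣-odd-unit {P} {x} k u k<N d = ∤-small P k<N (unit-∣ x (+ suc k) u d)

 module _ (P A : ℕ) where

   private
     N a : ℕ
     N = odd P
     a = odd A

   -- Write a k = r + t N. As a and N are odd, r + t ≡ k modulo 2, so the k-th Gauss factor is
   -- (-1)^t, and t counts the multiples N j, j ≥ 1, that lie below a k.
   eisenstein : IsUnit N (+ a) →
     jacobi P (+ a) ≡ ∏ℤ P (λ k → ∏ℤ A (λ j → sign< (N ℕ.* suc j) (a ℕ.* suc k)))
   eisenstein u = ∏ℤ-cong P (λ k k<P → row k k<P (suc k ℕ.* a ℕ/.% N) refl)
     where
     row : ∀ k → k ℕ.< P → ∀ r → suc k ℕ.* a ℕ/.% N ≡ r →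
       sgn P (+ a * + suc k) * sgn P (+ suc k) ≡ ∏ℤ A (λ j → sign< (N ℕ.* suc j) (a ℕ.* suc k))
     row k k<P r r≡ = trans signs (sym (∏-threshold A t t≤A _ lo hi))
       where
       t : ℕ
       t = suc k ℕ.* a ℕ/./ N
       split : a ℕ.* suc k ≡ r ℕ.+ t ℕ.* N
       split = trans (ℕₚ.*-comm a (suc k)) (trans (ℕ/.m≡m%n+[m/n]*n (suc k ℕ.* a) N) (cong (ℕ._+ t ℕ.* N) r≡))
       r<N : r ℕ.< N
       r<N = subst (ℕ._< N) r≡ (ℕ/.m%n<n (suc k ℕ.* a) N)
       splitℤ : + a * + suc k ≡ + r + + t * + N
       splitℤ = trans (sym (pos-* a (suc k))) (trans (cong +_ split) (cong (_+_ (+ r)) (pos-* t N)))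
       r≢0 : r ≢ 0
       r≢0 e = ∣-odd-unit {P} {+ a} k u (half<N P k<P) (divides (+ t) (trans splitℤ
         (trans (cong (λ r → + r + + t * + N) e) (+-identityˡ (+ t * + N)))))
       sgn-r : ∀ s → s ≡ r → sgn P (+ s) ≡ ε s
       sgn-r zero e = contradiction (sym e) r≢0
       sgn-r (suc s) e = sgn-small P (subst (ℕ._< N) (sym e) r<N)
       parities : ε r * ε t ≡ ε (suc k)
       parities = trans (cong (ε r *_) (trans (sym (ε-odd* P t)) (cong ε (ℕₚ.*-comm N t))))
         (trans (sym (ε-+ r (t ℕ.* N))) (trans (cong ε (sym split)) (ε-odd* A (suc k))))
       signs : sgn P (+ a * + suc k) * sgn P (+ suc k) ≡ ε t
       signs = begin
         sgn P (+ a * + suc k) * sgn P (+ suc k)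
           ≡⟨ cong₂ _*_ (trans (sgn-cong P (+ a * + suc k) (+ r)
                (subst (_≈ + r [ N ]) (sym splitℤ) (≈-+* (+ r) (+ t)))) (sgn-r r refl)) (sgn-small P (half<N P k<P)) ⟩
         ε r * ε (suc k) ≡⟨ cong (ε r *_) parities ⟨
         ε r * (ε r * ε t) ≡⟨ *-assoc (ε r) (ε r) (ε t) ⟨
         ε r * ε r * ε t ≡⟨ cong (_* ε t) (ε-square r) ⟩
         1ℤ * ε t ≡⟨ *-identityˡ (ε t) ⟩
         ε t ∎
         where open ≡-Reasoning
       t≤A : t ℕ.≤ A
       t≤A = ℕₚ.≮⇒≥ λ A<t → ℕₚ.<⇒≱ (ℕₚ.<-≤-trans 2ak<aN (ℕₚ.≤-reflexive (ℕₚ.*-comm a N))) (begin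
         N ℕ.* a ≤⟨ ℕₚ.*-monoʳ-≤ N (ℕₚ.+-mono-≤ A<t (ℕₚ.<⇒≤ A<t)) ⟩
         N ℕ.* (t ℕ.+ t) ≡⟨ double N t ⟩
         t ℕ.* N ℕ.+ t ℕ.* N ≤⟨ ℕₚ.+-mono-≤ tN≤ tN≤ ⟩
         a ℕ.* suc k ℕ.+ a ℕ.* suc k ≡⟨ ℕₚ.*-distribˡ-+ a (suc k) (suc k) ⟨
         a ℕ.* (suc k ℕ.+ suc k) ∎)
         where
         open ℕₚ.≤-Reasoning
         double : ∀ N t → N ℕ.* (t ℕ.+ t) ≡ t ℕ.* N ℕ.+ t ℕ.* N
         double = ℕ-ring
         tN≤ : t ℕ.* N ℕ.≤ a ℕ.* suc k
         tN≤ = subst (t ℕ.* N ℕ.≤_) (sym split) (ℕₚ.m≤n+m (t ℕ.* N) r)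
         2ak<aN : a ℕ.* (suc k ℕ.+ suc k) ℕ.< a ℕ.* N
         2ak<aN = ℕₚ.*-monoʳ-< a (s≤s (ℕₚ.+-mono-≤ k<P k<P))
       lo : ∀ j → j ℕ.< t → sign< (N ℕ.* suc j) (a ℕ.* suc k) ≡ -1ℤ
       lo j j<t = sign<-yes (ℕₚ.≤-<-trans (ℕₚ.≤-trans (ℕₚ.*-monoʳ-≤ N j<t) (ℕₚ.≤-reflexive (ℕₚ.*-comm N t)))
         (subst (t ℕ.* N ℕ.<_) (sym split) (ℕₚ.m<n+m (t ℕ.* N) (ℕₚ.n≢0⇒n>0 r≢0))))
       hi : ∀ j → t ℕ.≤ j → sign< (N ℕ.* suc j) (a ℕ.* suc k) ≡ 1ℤ
       hi j t≤j = sign<-no (ℕₚ.≤⇒≯ (begin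
         a ℕ.* suc k ≡⟨ split ⟩
         r ℕ.+ t ℕ.* N ≤⟨ ℕₚ.+-monoˡ-≤ (t ℕ.* N) (ℕₚ.<⇒≤ r<N) ⟩
         suc t ℕ.* N ≤⟨ ℕₚ.*-monoˡ-≤ N (s≤s t≤j) ⟩
         suc j ℕ.* N ≡⟨ ℕₚ.*-comm (suc j) N ⟩
         N ℕ.* suc j ∎))
         where open ℕₚ.≤-Reasoning

 unit-swap : ∀ {m n} → IsUnit n (+ m) → IsUnit m (+ n)
 unit-swap {m} {n} (a′ , divides k e) = - k , divides (- a′) (linear 1ℤ e (identity (+ m) (+ n) a′ k))
   where
   identity : ∀ m n a k → (n * (- k) - 1ℤ) - (- a) * m ≡ 1ℤ * ((m * a - 1ℤ) - k * n)
   identity = ℤ-ring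

 -- Quadratic reciprocity: the two Eisenstein products run over the same
 -- rectangle of lattice points, on opposite sides of its diagonal.
 reciprocity : ∀ P A → IsUnit (odd P) (+ odd A) → jacobi P (+ odd A) * jacobi A (+ odd P) ≡ ε (P ℕ.* A)
 reciprocity P A u = begin
   jacobi P (+ a) * jacobi A (+ N)
     ≡⟨ cong₂ _*_ (eisenstein P A u) (trans (eisenstein A P (unit-swap u)) (∏ℤ-swap A P _)) ⟩
   ∏ℤ P (λ k → ∏ℤ A (F k)) * ∏ℤ P (λ k → ∏ℤ A (G k))
     ≡⟨ ∏ℤ-* P _ _ ⟨
   ∏ℤ P (λ k → ∏ℤ A (F k) * ∏ℤ A (G k))
     ≡⟨ ∏ℤ-cong P (λ k k<P → trans (sym (∏ℤ-* A (F k) (G k)))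
          (trans (∏ℤ-cong A (λ j _ → sign<-antisym (N ℕ.* suc j) (a ℕ.* suc k) (distinct k k<P j))) (ε-∏ A))) ⟩
   ∏ℤ P (λ _ → ε A)
     ≡⟨ power P ⟩
   ε (P ℕ.* A) ∎
   where
   open ≡-Reasoning
   N a : ℕ
   N = odd P
   a = odd A
   F G : ℕ → ℕ → ℤ
   F k j = sign< (N ℕ.* suc j) (a ℕ.* suc k)
   G k j = sign< (a ℕ.* suc k) (N ℕ.* suc j)
   distinct : ∀ k → k ℕ.< P → ∀ j → N ℕ.* suc j ≢ a ℕ.* suc k
   distinct k k<P j e = ∣-odd-unit {P} {+ a} k u (half<N P k<P) (divides (+ suc j)
     (trans (sym (pos-* a (suc k))) (trans (cong +_ (trans (sym e) (ℕₚ.*-comm N (suc j)))) (pos-* (suc j) N))))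
   power : ∀ P → ∏ℤ P (λ _ → ε A) ≡ ε (P ℕ.* A)
   power zero = refl
   power (suc P) = trans (cong (_* ε A) (power P)) (trans (sym (ε-+ (P ℕ.* A) A)) (cong ε (ℕₚ.+-comm (P ℕ.* A) A)))

 halfProduct : ℕ → ℕ → ℕ
 halfProduct P M = P ℕ.* odd M ℕ.+ M

 odd-halfProduct : ∀ P M → odd (halfProduct P M) ≡ odd P ℕ.* odd M
 odd-halfProduct = identity
   where
   identity : ∀ P M → suc (P ℕ.* suc (M ℕ.+ M) ℕ.+ M ℕ.+ (P ℕ.* suc (M ℕ.+ M) ℕ.+ M)) ≡ suc (P ℕ.+ P) ℕ.* suc (M ℕ.+ M)
   identity = ℕ-ring

 even-or-odd : ∀ n → (∃[ m ] n ≡ m ℕ.+ m) ⊎ (∃[ m ] n ≡ odd m)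
 even-or-odd zero = inj₁ (0 , refl)
 even-or-odd (suc n) with even-or-odd n
 ... | inj₁ (m , e) = inj₂ (m , cong suc e)
 ... | inj₂ (m , e) = inj₁ (suc m , trans (cong suc e) (cong suc (sym (ℕₚ.+-suc m m))))

 -- An even residue becomes odd when the odd modulus is added. Reciprocity applies only to odd
 -- representatives.
 odd-representative : ∀ T x → ∃[ A ] x ≈ + odd A [ odd T ]
 odd-representative T x with even-or-odd (x %ℕ odd T)
 ... | inj₂ (A , e) = A , subst (λ r → x ≈ + r [ odd T ]) e (%-≈ (odd T) x)
 ... | inj₁ (m , e) = m ℕ.+ T , ≈-trans x (+ (m ℕ.+ m)) (+ odd (m ℕ.+ T))
     (subst (λ r → x ≈ + r [ odd T ]) e (%-≈ (odd T) x))
     (≈-sym (+ odd (m ℕ.+ T)) (+ (m ℕ.+ m)) (divides 1ℤ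
       (trans (cong (_- + (m ℕ.+ m)) (cong +_ (shift m T))) (cancel (+ (m ℕ.+ m)) (+ odd T)))))
   where
   shift : ∀ m T → suc (m ℕ.+ T ℕ.+ (m ℕ.+ T)) ≡ m ℕ.+ m ℕ.+ suc (T ℕ.+ T)
   shift = ℕ-ring
   cancel : ∀ m n → (m + n) - m ≡ 1ℤ * n
   cancel = ℤ-ring

 unit-coarsen : ∀ {m n} x → + m ∣ + n → IsUnit n x → IsUnit m x
 unit-coarsen x d (y , e) = y , ≈-weaken (x * y) 1ℤ d e

 unit-product : ∀ m n x → IsUnit m x → IsUnit n x → IsUnit (m ℕ.* n) x
 unit-product m n x (a , divides k e) (b , divides l f) = a + b - x * a * b ,
   divides (- (k * l)) (trans (linear₂ (- (x * b - 1ℤ)) (- (k * + m)) e f (identity x a b k l (+ m) (+ n)))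
     (cong ((- (k * l)) *_) (sym (pos-* m n))))
   where
   identity : ∀ x a b k l m n → (x * (a + b - x * a * b) - 1ℤ) - (- (k * l)) * (m * n) ≡
     (- (x * b - 1ℤ)) * ((x * a - 1ℤ) - k * m) + (- (k * m)) * ((x * b - 1ℤ) - l * n)
   identity = ℤ-ring

 -- The Gauss product of a composite modulus does not split visibly. For a unit x, represented by an
 -- odd a, reciprocity exchanges modulus and argument up to a sign, and in the argument the symbol
 -- is multiplicative by `jacobi-*`.
 jacobi-modulus-* : ∀ P M x → jacobi (halfProduct P M) x ≡ jacobi P x * jacobi M x
 jacobi-modulus-* P M x with unit-or-zero (halfProduct P M) x
 ... | inj₂ e = trans e (sym zero-product)
   where
   T : ℕ
   T = halfProduct P M
   zero-product : jacobi P x * jacobi M x ≡ 0ℤ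
   zero-product with unit-or-zero P x | unit-or-zero M x
   ... | inj₂ e₁ | _ = trans (cong (_* jacobi M x) e₁) (*-zeroˡ (jacobi M x))
   ... | inj₁ _ | inj₂ e₂ = trans (cong (jacobi P x *_) e₂) (*-zeroʳ (jacobi P x))
   ... | inj₁ u₁ | inj₁ u₂ = contradiction e (unit⇒jacobi≢0 T x
     (subst (λ n → IsUnit n x) (sym (odd-halfProduct P M)) (unit-product (odd P) (odd M) x u₁ u₂)))
 ... | inj₁ u = go (odd-representative T x)
   where
   T : ℕ
   T = halfProduct P M
   P∣T : + odd P ∣ + odd T
   P∣T = divides (+ odd M) (trans (cong +_ (trans (odd-halfProduct P M) (ℕₚ.*-comm (odd P) (odd M)))) (pos-* (odd M) (odd P)))
   M∣T : + odd M ∣ + odd T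
   M∣T = divides (+ odd P) (trans (cong +_ (odd-halfProduct P M)) (pos-* (odd P) (odd M)))
   solve-for : ∀ {s t e} → s * t ≡ e → t * t ≡ 1ℤ → s ≡ e * t
   solve-for {s} {t} {e} h k = linear₂ t (- s) h k (identity s t e)
     where
     identity : ∀ s t e → s - e * t ≡ t * (s * t - e) + (- s) * (t * t - 1ℤ)
     identity = ℤ-ring
   -- T = 2 P M + P + M, so T + P + M is even and the three reciprocity signs cancel.
   evens : ∀ A → ε (T ℕ.* A) * (ε (P ℕ.* A) * ε (M ℕ.* A)) ≡ 1ℤ
   evens A = trans (cong (ε (T ℕ.* A) *_) (sym (ε-+ (P ℕ.* A) (M ℕ.* A))))
     (trans (sym (ε-+ (T ℕ.* A) (P ℕ.* A ℕ.+ M ℕ.* A)))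
     (trans (cong ε (identity P M A)) (ε-double ((P ℕ.+ M ℕ.+ P ℕ.* M) ℕ.* A))))
     where
     identity : ∀ P M A → (P ℕ.* suc (M ℕ.+ M) ℕ.+ M) ℕ.* A ℕ.+ (P ℕ.* A ℕ.+ M ℕ.* A) ≡
       (P ℕ.+ M ℕ.+ P ℕ.* M) ℕ.* A ℕ.+ (P ℕ.+ M ℕ.+ P ℕ.* M) ℕ.* A
     identity = ℕ-ring
   go : ∃[ A ] x ≈ + odd A [ odd T ] → jacobi T x ≡ jacobi P x * jacobi M x
   go (A , x≈a) = begin
     jacobi T x ≡⟨ jacobi-cong T x (+ a) x≈a ⟩
     jacobi T (+ a) ≡⟨ solve-for (reciprocity T A uT) (jacobi-square A (+ odd T) (unit-swap uT)) ⟩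
     ε (T ℕ.* A) * jacobi A (+ odd T)
       ≡⟨ cong (ε (T ℕ.* A) *_) (trans (cong (λ t → jacobi A t) (trans (cong +_ (odd-halfProduct P M)) (pos-* (odd P) (odd M))))
            (jacobi-* A (+ odd P) (+ odd M))) ⟩
     ε (T ℕ.* A) * (jacobi A (+ odd P) * jacobi A (+ odd M))
       ≡⟨ cong (ε (T ℕ.* A) *_) (cong₂ _*_ (back P uP) (back M uM)) ⟩
     ε (T ℕ.* A) * ((ε (P ℕ.* A) * jacobi P (+ a)) * (ε (M ℕ.* A) * jacobi M (+ a)))
       ≡⟨ regroup (ε (T ℕ.* A)) (ε (P ℕ.* A)) (jacobi P (+ a)) (ε (M ℕ.* A)) (jacobi M (+ a)) ⟩
     ε (T ℕ.* A) * (ε (P ℕ.* A) * ε (M ℕ.* A)) * (jacobi P (+ a) * jacobi M (+ a))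
       ≡⟨ cong (_* (jacobi P (+ a) * jacobi M (+ a))) (evens A) ⟩
     1ℤ * (jacobi P (+ a) * jacobi M (+ a))
       ≡⟨ *-identityˡ (jacobi P (+ a) * jacobi M (+ a)) ⟩
     jacobi P (+ a) * jacobi M (+ a)
       ≡⟨ cong₂ _*_ (jacobi-cong P x (+ a) (≈-weaken x (+ a) P∣T x≈a)) (jacobi-cong M x (+ a) (≈-weaken x (+ a) M∣T x≈a)) ⟨
     jacobi P x * jacobi M x ∎
     where
     open ≡-Reasoning
     a : ℕ
     a = odd A
     uT : IsUnit (odd T) (+ a)
     uT = unit-cong x (+ a) x≈a u
     uP : IsUnit (odd P) (+ a)
     uP = unit-coarsen (+ a) P∣T uT
     uM : IsUnit (odd M) (+ a)
     uM = unit-coarsen (+ a) M∣T uT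
     back : ∀ P → IsUnit (odd P) (+ a) → jacobi A (+ odd P) ≡ ε (P ℕ.* A) * jacobi P (+ a)
     back P uP = solve-for (trans (*-comm (jacobi A (+ odd P)) (jacobi P (+ a))) (reciprocity P A uP)) (jacobi-square P (+ a) uP)
     regroup : ∀ t p x m y → t * ((p * x) * (m * y)) ≡ t * (p * m) * (x * y)
     regroup = ℤ-ring

 -- Prime moduli: Euler's criterion

 ∑-affine : ∀ n .{{_ : ℕ.NonZero n}} (f : ℤ → ℤ) → (∀ x y → x ≈ y [ n ] → f x ≡ f y) →
   ∀ t c → IsUnit n t → ∑ℤ n (λ x → f (t * + x + c)) ≡ ∑ℤ n (λ x → f (+ x))
 ∑-affine n f f-cong t c (t′ , e) = trans
   (∑ℤ-cong n (λ x _ → f-cong (t * + x + c) (+ π x) (%-≈ n (t * + x + c))))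
   (∑ℤ-permute n (λ x → f (+ x)) π π⁻¹ (λ x _ → n%ℕd<d (t * + x + c) n) (λ y _ → n%ℕd<d (t′ * (+ y - c)) n)
     (λ x x<n → ≈-%-unique n (t′ * (+ π x - c)) x x<n (left x))
     (λ y y<n → ≈-%-unique n (t * + π⁻¹ y + c) y y<n (right y)))
   where
   π π⁻¹ : ℕ → ℕ
   π x = (t * + x + c) %ℕ n
   π⁻¹ y = (t′ * (+ y - c)) %ℕ n
   tt′ : ∀ z → t * t′ * z ≈ z [ n ]
   tt′ z = subst (t * t′ * z ≈_[ n ]) (*-identityˡ z) (≈-* (t * t′) 1ℤ z z e (≈-refl z))
   left : ∀ x → t′ * (+ π x - c) ≈ + x [ n ]
   left x = ≈-trans (t′ * (+ π x - c)) (t * t′ * + x) (+ x)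
     (subst (t′ * (+ π x - c) ≈_[ n ]) (identity t t′ (+ x) c)
       (≈-*ˡ t′ (+ π x - c) (t * + x + c - c)
         (≈-+ (+ π x) (t * + x + c) (- c) (- c) (≈-sym (t * + x + c) (+ π x) (%-≈ n (t * + x + c))) (≈-refl (- c)))))
     (tt′ (+ x))
     where
     identity : ∀ t t′ x c → t′ * (t * x + c - c) ≡ t * t′ * x
     identity = ℤ-ring
   right : ∀ y → t * + π⁻¹ y + c ≈ + y [ n ]
   right y = subst (t * + π⁻¹ y + c ≈_[ n ]) (cancel (+ y) c)
     (≈-+ (t * + π⁻¹ y) (+ y - c) c c
       (≈-trans (t * + π⁻¹ y) (t * (t′ * (+ y - c))) (+ y - c)
         (≈-*ˡ t (+ π⁻¹ y) (t′ * (+ y - c)) (≈-sym (t′ * (+ y - c)) (+ π⁻¹ y) (%-≈ n (t′ * (+ y - c)))))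
         (subst (_≈ + y - c [ n ]) (*-assoc t t′ (+ y - c)) (tt′ (+ y - c))))
       (≈-refl c))
     where
     cancel : ∀ y c → y - c + c ≡ y
     cancel = ℤ-ring

 prime-∣* : ∀ {p} → Prime p → ∀ a b → + p ∣ a * b → (+ p ∣ a) ⊎ (+ p ∣ b)
 prime-∣* {p} pr a b d with euclidsLemma ∣ a ∣ ∣ b ∣ pr (subst (p ℕ∣.∣_) (abs-* a b) (∣⇒∣ᵤ d))
 ... | inj₁ e = inj₁ (∣ᵤ⇒∣ e)
 ... | inj₂ e = inj₂ (∣ᵤ⇒∣ e)

 prime-∤1 : ∀ {p} → Prime p → ¬ (+ p ∣ 1ℤ)
 prime-∤1 {p} pr d = ¬prime[1] (subst Prime (ℕ∣.∣1⇒≡1 (∣⇒∣ᵤ d)) pr)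

 evalMonicℤ : List ℤ → ℤ → ℤ
 evalMonicℤ [] x = 1ℤ
 evalMonicℤ (c ∷ cs) x = c + x * evalMonicℤ cs x

 -- Horner division by x - r: the quotient is again monic, of degree one less, and its constant
 -- coefficient is the tail of the polynomial evaluated at r.
 divideLinear : ∀ c cs r → ∃[ ds ] length ds ≡ length cs ×
   (∀ x → evalMonicℤ (c ∷ cs) x - evalMonicℤ (c ∷ cs) r ≡ (x - r) * evalMonicℤ ds x)
 divideLinear c [] r = [] , refl , λ x → identity c x r
   where
   identity : ∀ c x r → (c + x * 1ℤ) - (c + r * 1ℤ) ≡ (x - r) * 1ℤ
   identity = ℤ-ring
 divideLinear c (c′ ∷ cs) r with divideLinear c′ cs r
 ... | ds , len , h = evalMonicℤ (c′ ∷ cs) r ∷ ds , cong suc len , λ x →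
   linear x (h x) (identity c x r (evalMonicℤ (c′ ∷ cs) x) (evalMonicℤ (c′ ∷ cs) r) (evalMonicℤ ds x))
   where
   identity : ∀ c x r g g₀ e →
     ((c + x * g) - (c + r * g₀)) - (x - r) * (g₀ + x * e) ≡ x * ((g - g₀) - (x - r) * e)
   identity = ℤ-ring

 -- Every root other than r 0 is incongruent to it, hence a root of the quotient by x - r 0, because
 -- p is prime; the degree drops until the constant 1 would have a root.
 lagrange : ∀ {p} → Prime p → ∀ n cs → length cs ≡ n → (r : ℕ → ℤ) →
   (∀ i → i ℕ.≤ n → + p ∣ evalMonicℤ cs (r i)) →
   ¬ (∀ i j → i ℕ.< j → j ℕ.≤ n → ¬ (+ p ∣ r j - r i))
 lagrange pr zero [] _ r roots distinct = prime-∤1 pr (roots 0 z≤n)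
 lagrange {p} pr (suc n) (c ∷ cs) len r roots distinct =
   lagrange pr n ds (trans (proj₁ (proj₂ quot)) (ℕₚ.suc-injective len)) (λ i → r (suc i)) roots′
     (λ i j i<j j≤ → distinct (suc i) (suc j) (s≤s i<j) (s≤s j≤))
   where
   quot : ∃[ ds ] length ds ≡ length cs ×
     (∀ x → evalMonicℤ (c ∷ cs) x - evalMonicℤ (c ∷ cs) (r 0) ≡ (x - r 0) * evalMonicℤ ds x)
   quot = divideLinear c cs (r 0)
   ds : List ℤ
   ds = proj₁ quot
   roots′ : ∀ i → i ℕ.≤ n → + p ∣ evalMonicℤ ds (r (suc i))
   roots′ i i≤ = [ (λ d → contradiction d (distinct 0 (suc i) (s≤s z≤n) (s≤s i≤))) , (λ d → d) ]′
     (prime-∣* pr (r (suc i) - r 0) (evalMonicℤ ds (r (suc i)))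
       (subst (+ p ∣_) (proj₂ (proj₂ quot) (r (suc i))) (∣m∣n⇒∣m-n (roots (suc i) (s≤s i≤)) (roots 0 z≤n))))

 _^ℤ_ : ℤ → ℕ → ℤ
 a ^ℤ n = ∏ℤ n (λ _ → a)

 eval-power : ∀ n x → evalMonicℤ (replicate n 0ℤ) x ≡ x ^ℤ n
 eval-power zero x = refl
 eval-power (suc n) x = trans (+-identityˡ (x * evalMonicℤ (replicate n 0ℤ) x))
   (trans (cong (x *_) (eval-power n x)) (*-comm x (x ^ℤ n)))

 ∏-≈ : ∀ {m} n f g → (∀ i → i ℕ.< n → f i ≈ g i [ m ]) → ∏ℤ n f ≈ ∏ℤ n g [ m ]
 ∏-≈ zero f g h = ≈-refl 1ℤ
 ∏-≈ (suc n) f g h = ≈-* (∏ℤ n f) (∏ℤ n g) (f n) (g n)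
   (∏-≈ n f g (λ i i<n → h i (ℕₚ.m<n⇒m<1+n i<n))) (h n ℕₚ.≤-refl)

 ∏-unit : ∀ {m} n f → (∀ i → i ℕ.< n → IsUnit m (f i)) → IsUnit m (∏ℤ n f)
 ∏-unit zero f h = 1ℤ , ≈-refl 1ℤ
 ∏-unit (suc n) f h = unit-* (∏ℤ n f) (f n) (∏-unit n f (λ i i<n → h i (ℕₚ.m<n⇒m<1+n i<n))) (h n ℕₚ.≤-refl)

 module _ (P : ℕ) (pr : Prime (odd P)) where

   private
     N : ℕ
     N = odd P

   prime-unit : ∀ b → ¬ (+ N ∣ b) → IsUnit N b
   prime-unit b ∤ with unit? P b
   ... | inj₁ u = u
   ... | inj₂ (k , k<P , d) with prime-∣* pr b (+ suc k) d
   ... | inj₁ e = contradiction e ∤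
   ... | inj₂ e = contradiction e (∤-small P (half<N P k<P))

   small-unit : ∀ {k} → suc k ℕ.< N → IsUnit N (+ suc k)
   small-unit {k} k<N = prime-unit (+ suc k) (∤-small P k<N)

   halfPrime≢0 : P ≢ 0
   halfPrime≢0 refl = ¬prime[1] pr

   -- The residue of sgn(x) x is an even function of x, so ∏ sgn(a k) a k and ∏ sgn(k) k over k ≤ P
   -- are congruent. Cancelling the unit P! leaves the Jacobi symbol times a^P.
   euler : ∀ a → IsUnit N a → jacobi P a * a ^ℤ P ≈ 1ℤ [ N ]
   euler a u = ≈-trans (j * a ^ℤ P) (w′ * (w * (j * a ^ℤ P))) 1ℤ
     (≈-sym (w′ * (w * (j * a ^ℤ P))) (j * a ^ℤ P) (unit-cancel w (j * a ^ℤ P) w-unit))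
     (≈-trans (w′ * (w * (j * a ^ℤ P))) (w′ * w) 1ℤ (≈-*ˡ w′ (w * (j * a ^ℤ P)) w main) (subst (_≈ 1ℤ [ N ]) (*-comm w w′) (proj₂ w-unit)))
     where
     j w w′ : ℤ
     j = jacobi P a
     w = ∏ℤ P (λ k → + suc k)
     w-unit : IsUnit N w
     w-unit = ∏-unit P (λ k → + suc k) (λ k k<P → small-unit (half<N P k<P))
     w′ = proj₁ w-unit
     -- Reduced modulo N, so that congruent arguments give equal values, as `half-permute` requires.
     h : ℤ → ℤ
     h x = + ((sgn P x * x) %ℕ N)
     h-≈ : ∀ x → sgn P x * x ≈ h x [ N ]
     h-≈ x = %-≈ N (sgn P x * x)
     h-cong : ∀ x y → x ≈ y [ N ] → h x ≡ h y
     h-cong x y e = cong +_ (≈⇒%≡ N (sgn P x * x) (sgn P y * y)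
       (≈-* (sgn P x) (sgn P y) x y (≈-reflexive (sgn-cong P x y e)) e))
     neg² : ∀ s t → (- s) * (- t) ≡ s * t
     neg² = ℤ-ring
     h-even : ∀ x → h (- x) ≡ h x
     h-even x = cong (λ t → + (t %ℕ N)) (trans (cong (_* (- x)) (sgn-neg P x)) (neg² (sgn P x) x))
     s₁ s₂ : ℤ
     s₁ = ∏ℤ P (λ k → sgn P (a * + suc k))
     s₂ = ∏ℤ P (λ k → sgn P (+ suc k))
     s₂² : s₂ * s₂ ≡ 1ℤ
     s₂² = trans (sym (∏ℤ-* P _ _)) (∏-one P P (λ k k<P → sgn-square P (+ suc k) (∤-small P (half<N P k<P))))
     factor₁ : ∏ℤ P (λ k → sgn P (a * + suc k) * (a * + suc k)) ≡ s₁ * (a ^ℤ P * w)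
     factor₁ = trans (∏ℤ-* P _ _) (cong (s₁ *_) (∏ℤ-* P _ _))
     permuted : s₁ * (a ^ℤ P * w) ≈ s₂ * w [ N ]
     permuted = subst₂ (_≈_[ N ]) factor₁ (∏ℤ-* P _ _)
       (≈-trans (∏ℤ P f₁) (∏ℤ P h₀) (∏ℤ P f₀)
         (subst (∏ℤ P f₁ ≈_[ N ]) (half-permute P h h-cong h-even a u)
           (∏-≈ P f₁ (λ k → h (a * + suc k)) (λ k _ → h-≈ (a * + suc k))))
         (≈-sym (∏ℤ P f₀) (∏ℤ P h₀) (∏-≈ P f₀ h₀ (λ k _ → h-≈ (+ suc k)))))
       where
       f₀ f₁ h₀ : ℕ → ℤ
       f₀ k = sgn P (+ suc k) * + suc k
       f₁ k = sgn P (a * + suc k) * (a * + suc k)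
       h₀ k = h (+ suc k)
     rearrange : ∀ s₁ s₂ b w → s₂ * (s₁ * (b * w)) ≡ w * (s₁ * s₂ * b)
     rearrange = ℤ-ring
     main : w * (j * a ^ℤ P) ≈ w [ N ]
     main = subst₂ (_≈_[ N ])
       (trans (rearrange s₁ s₂ (a ^ℤ P) w) (cong (λ t → w * (t * a ^ℤ P)) (sym (∏ℤ-* P _ _))))
       (trans (sym (*-assoc s₂ s₂ w)) (trans (cong (_* w) s₂²) (*-identityˡ w)))
       (≈-*ˡ s₂ (s₁ * (a ^ℤ P * w)) (s₂ * w) permuted)

   jacobi-±1 : ∀ a → IsUnit N a → jacobi P a ≡ 1ℤ ⊎ jacobi P a ≡ -1ℤ
   jacobi-±1 a u = [ (λ e → inj₁ (i-j≡0⇒i≡j j 1ℤ e)) , (λ e → inj₂ (i-j≡0⇒i≡j j -1ℤ e)) ]′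
     (i*j≡0⇒i≡0∨j≡0 (j - 1ℤ) (trans (identity j) (i≡j⇒i-j≡0 (jacobi-square P a u))))
     where
     j : ℤ
     j = jacobi P a
     identity : ∀ j → (j - 1ℤ) * (j - -1ℤ) ≡ j * j - 1ℤ
     identity = ℤ-ring

   -- If the symbol were 1 at 1, ..., 2P, Euler's criterion would make the P + 1 incongruent numbers
   -- 1, ..., P + 1 roots of x^P - 1.
   nonresidue : ∃[ a ] IsUnit N a × jacobi P a ≡ -1ℤ
   nonresidue = [ (λ found → found) , (λ all → contradiction (distinct all) (lagrange pr P (coeffs P) (length-coeffs P) (λ i → + suc i) (roots all))) ]′
     (search (P ℕ.+ P) ℕₚ.≤-refl)
     where
     search : ∀ n → n ℕ.≤ P ℕ.+ P → (∃[ a ] IsUnit N a × jacobi P a ≡ -1ℤ) ⊎ (∀ i → i ℕ.< n → jacobi P (+ suc i) ≡ 1ℤ)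
     search zero _ = inj₂ λ _ ()
     search (suc n) n< = [ inj₁ , (λ all → [ (λ e → inj₂ (extend all e)) , (λ e → inj₁ (+ suc n , small-unit (s≤s n<) , e)) ]′
         (jacobi-±1 (+ suc n) (small-unit (s≤s n<)))) ]′ (search n (ℕₚ.<⇒≤ n<))
       where
       extend : (∀ i → i ℕ.< n → jacobi P (+ suc i) ≡ 1ℤ) → jacobi P (+ suc n) ≡ 1ℤ →
         ∀ i → i ℕ.< suc n → jacobi P (+ suc i) ≡ 1ℤ
       extend all e i i<1+n with ℕₚ.m≤n⇒m<n∨m≡n (ℕ.s≤s⁻¹ i<1+n)
       ... | inj₁ i<n = all i i<n
       ... | inj₂ i≡n = subst (λ t → jacobi P (+ suc t) ≡ 1ℤ) (sym i≡n) e
     coeffs : ℕ → List ℤ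
     coeffs zero = []
     coeffs (suc n) = -1ℤ ∷ replicate n 0ℤ
     length-coeffs : ∀ n → length (coeffs n) ≡ n
     length-coeffs zero = refl
     length-coeffs (suc n) = cong suc (length-replicate n)
     eval-coeffs : ∀ n → n ≢ 0 → ∀ x → evalMonicℤ (coeffs n) x ≡ x ^ℤ n - 1ℤ
     eval-coeffs zero n≢0 x = contradiction refl n≢0
     eval-coeffs (suc n) _ x = trans (cong (λ t → -1ℤ + x * t) (eval-power n x)) (identity x (x ^ℤ n))
       where
       identity : ∀ x y → -1ℤ + x * y ≡ y * x - 1ℤ
       identity = ℤ-ring
     bound : ∀ {i} → i ℕ.≤ P → i ℕ.< P ℕ.+ P
     bound i≤ = ℕₚ.≤-<-trans i≤ (ℕₚ.m<m+n P (ℕₚ.n≢0⇒n>0 halfPrime≢0))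
     AllOne : Set
     AllOne = ∀ i → i ℕ.< P ℕ.+ P → jacobi P (+ suc i) ≡ 1ℤ
     roots : AllOne → ∀ i → i ℕ.≤ P → + N ∣ evalMonicℤ (coeffs P) (+ suc i)
     roots all i i≤ = subst (+ N ∣_) (sym (eval-coeffs P halfPrime≢0 (+ suc i)))
       (subst (_≈ 1ℤ [ N ]) (trans (cong (_* (+ suc i) ^ℤ P) (all i (bound i≤))) (*-identityˡ ((+ suc i) ^ℤ P)))
         (euler (+ suc i) (small-unit (s≤s (bound i≤)))))
     distinct : AllOne → ∀ i j → i ℕ.< j → j ℕ.≤ P → ¬ (+ N ∣ + suc j - + suc i)
     distinct _ i j i<j j≤ d = ℕₚ.<⇒≢ (s≤s i<j) (sym (≈-< (s≤s (bound j≤)) (s≤s (ℕₚ.<-trans i<j (bound j≤))) d))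

   -- Multiplication by a nonresidue permutes the residues and reverses the sign of the sum.
   ∑-jacobi : ∑ℤ N (λ x → jacobi P (+ x)) ≡ 0ℤ
   ∑-jacobi = go nonresidue
     where
     self-negative : ∀ s → s ≡ - s → s ≡ 0ℤ
     self-negative (+ zero) _ = refl
     go : ∃[ a ] IsUnit N a × jacobi P a ≡ -1ℤ → ∑ℤ N (λ x → jacobi P (+ x)) ≡ 0ℤ
     go (a , u , e) = self-negative _ (begin
       ∑ℤ N (λ x → jacobi P (+ x)) ≡⟨ ∑-affine N (jacobi P) (jacobi-cong P) a 0ℤ u ⟨
       ∑ℤ N (λ x → jacobi P (a * + x + 0ℤ)) ≡⟨ ∑ℤ-cong N (λ x _ → trans (cong (jacobi P) (+-identityʳ (a * + x)))
                                                   (trans (jacobi-* P a (+ x)) (cong (_* jacobi P (+ x)) e))) ⟩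
       ∑ℤ N (λ x → -1ℤ * jacobi P (+ x)) ≡⟨ ∑ℤ-*ˡ N -1ℤ (λ x → jacobi P (+ x)) ⟨
       -1ℤ * ∑ℤ N (λ x → jacobi P (+ x)) ≡⟨ -1*i≡-i _ ⟩
       - ∑ℤ N (λ x → jacobi P (+ x)) ∎)
       where open ≡-Reasoning

 -- Quadratic forms in the values of a character

 square-nonneg : ∀ i → 0ℤ ≤ i * i
 square-nonneg i@(+ n) = subst (0ℤ ≤_) (pos-* n n) (+≤+ z≤n)
 square-nonneg i@(-[1+ n ]) = +≤+ z≤n

 ∑-linear : ∀ n f g → ∑ℤ n (λ i → f i - g i) ≡ ∑ℤ n f - ∑ℤ n g
 ∑-linear n f g = trans (∑ℤ-+ n f (λ i → - g i)) (cong (_+_ (∑ℤ n f))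
   (trans (∑ℤ-cong n (λ i _ → sym (-1*i≡-i (g i)))) (trans (sym (∑ℤ-*ˡ n -1ℤ g)) (-1*i≡-i (∑ℤ n g)))))

 ∑-*-∑ : ∀ m n f g → ∑ℤ m f * ∑ℤ n g ≡ ∑ℤ m (λ i → ∑ℤ n (λ j → f i * g j))
 ∑-*-∑ m n f g = trans (∑ℤ-*ʳ m (∑ℤ n g) f) (∑ℤ-cong m (λ i _ → ∑ℤ-*ˡ n (f i) g))

 -- When n grows by one, the defect grows by the sum of the squares (f i - f n)².
 cauchy-schwarz : ∀ n f → ∑ℤ n f * ∑ℤ n f ≤ + n * ∑ℤ n (λ i → f i * f i)
 cauchy-schwarz zero f = ≤-refl
 cauchy-schwarz (suc n) f = 0≤i-j⇒j≤i (begin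
   0ℤ
     ≤⟨ +-mono-≤ (i≤j⇒0≤j-i (cauchy-schwarz n f)) (∑ℤ-nonneg n (λ i _ → square-nonneg (f i - y))) ⟩
   (+ n * ∑ℤ n (λ i → f i * f i) - s * s) + ∑ℤ n (λ i → (f i - y) * (f i - y))
     ≡⟨ cong (_+_ (+ n * ∑ℤ n (λ i → f i * f i) - s * s)) expand ⟩
   (+ n * ∑ℤ n (λ i → f i * f i) - s * s) + (∑ℤ n (λ i → f i * f i) - (y * (s + s) - + n * (y * y)))
     ≡⟨ identity (+ n) s (∑ℤ n (λ i → f i * f i)) y ⟩
   (1ℤ + + n) * (∑ℤ n (λ i → f i * f i) + y * y) - (s + y) * (s + y) ∎)
   where
   open ≤-Reasoning
   s y : ℤ
   s = ∑ℤ n f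
   y = f n
   square : ∀ a y → (a - y) * (a - y) ≡ a * a - (y * (a + a) - y * y)
   square = ℤ-ring
   expand : ∑ℤ n (λ i → (f i - y) * (f i - y)) ≡ ∑ℤ n (λ i → f i * f i) - (y * (s + s) - + n * (y * y))
   expand = trans (∑ℤ-cong n (λ i _ → square (f i) y))
     (trans (∑-linear n _ _) (cong (_-_ (∑ℤ n (λ i → f i * f i)))
       (trans (∑-linear n _ _) (cong₂ _-_
         (trans (sym (∑ℤ-*ˡ n y (λ i → f i + f i))) (cong (y *_) (∑ℤ-+ n f f)))
         (∑ℤ-const n (y * y))))))
   identity : ∀ n s t y → (n * t - s * s) + (t - (y * (s + s) - n * (y * y))) ≡ (1ℤ + n) * (t + y * y) - (s + y) * (s + y)
   identity = ℤ-ring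

 -- The Kronecker delta of x mod n and r.
 δ : (n : ℕ) .{{_ : ℕ.NonZero n}} → ℤ → ℕ → ℤ
 δ n x r with x %ℕ n ℕₚ.≟ r
 ... | yes _ = 1ℤ
 ... | no _ = 0ℤ

 δ-yes : ∀ n .{{_ : ℕ.NonZero n}} x r → x %ℕ n ≡ r → δ n x r ≡ 1ℤ
 δ-yes n x r e with x %ℕ n ℕₚ.≟ r
 ... | yes _ = refl
 ... | no ¬e = contradiction e ¬e

 δ-no : ∀ n .{{_ : ℕ.NonZero n}} x r → x %ℕ n ≢ r → δ n x r ≡ 0ℤ
 δ-no n x r ¬e with x %ℕ n ℕₚ.≟ r
 ... | yes e = contradiction e ¬e
 ... | no _ = refl

 ∑-δ : ∀ n .{{_ : ℕ.NonZero n}} x (f : ℕ → ℤ) → ∑ℤ n (λ r → δ n x r * f r) ≡ f (x %ℕ n)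
 ∑-δ n x f = trans
   (∑ℤ-single n (x %ℕ n) (λ r → δ n x r * f r) (n%ℕd<d x n)
     (λ r _ r≢ → trans (cong (_* f r) (δ-no n x r (λ e → r≢ (sym e)))) (*-zeroˡ (f r))))
   (trans (cong (_* f (x %ℕ n)) (δ-yes n x (x %ℕ n) refl)) (*-identityˡ (f (x %ℕ n))))

 -- Write x = a n + b. Then b is the residue modulo n, and for fixed b the residue of a n + b modulo
 -- m runs over everything with a, because n is a unit modulo m.
 ∑-CRT : ∀ m n .{{_ : ℕ.NonZero m}} .{{_ : ℕ.NonZero n}} → IsUnit m (+ n) → (F : ℕ → ℕ → ℤ) →
   ∑ℤ (m ℕ.* n) (λ x → F (+ x %ℕ m) (+ x %ℕ n)) ≡ ∑ℤ m (λ y → ∑ℤ n (λ z → F y z))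
 ∑-CRT m n u F = begin
   ∑ℤ (m ℕ.* n) (λ x → F (+ x %ℕ m) (+ x %ℕ n))
     ≡⟨ ∑ℤ-product m n _ ⟩
   ∑ℤ m (λ a → ∑ℤ n (λ b → F (+ (a ℕ.* n ℕ.+ b) %ℕ m) (+ (a ℕ.* n ℕ.+ b) %ℕ n)))
     ≡⟨ ∑ℤ-cong m (λ a _ → ∑ℤ-cong n (λ b b<n → cong₂ F
          (cong (_%ℕ m) (cast a b))
          (≈-%-unique n (+ (a ℕ.* n ℕ.+ b)) b b<n (subst (_≈ + b [ n ]) (sym (cast′ a b)) (≈-+* (+ b) (+ a)))))) ⟩
   ∑ℤ m (λ a → ∑ℤ n (λ b → F ((+ n * + a + + b) %ℕ m) b))
     ≡⟨ ∑ℤ-swap m n _ ⟩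
   ∑ℤ n (λ b → ∑ℤ m (λ a → F ((+ n * + a + + b) %ℕ m) b))
     ≡⟨ ∑ℤ-cong n (λ b _ → ∑-affine m (λ x → F (x %ℕ m) b) (λ x y e → cong (λ t → F t b) (≈⇒%≡ m x y e)) (+ n) (+ b) u) ⟩
   ∑ℤ n (λ b → ∑ℤ m (λ a → F (+ a %ℕ m) b))
     ≡⟨ ∑ℤ-cong n (λ b _ → ∑ℤ-cong m (λ a a<m → cong (λ t → F t b) (ℕ/.m<n⇒m%n≡m a<m))) ⟩
   ∑ℤ n (λ b → ∑ℤ m (λ a → F a b))
     ≡⟨ ∑ℤ-swap n m _ ⟩
   ∑ℤ m (λ y → ∑ℤ n (λ z → F y z)) ∎
   where
   open ≡-Reasoning
   cast : ∀ a b → + (a ℕ.* n ℕ.+ b) ≡ + n * + a + + b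
   cast a b = trans (cong (λ t → + (t ℕ.+ b)) (ℕₚ.*-comm a n)) (cong (_+ + b) (pos-* n a))
   cast′ : ∀ a b → + (a ℕ.* n ℕ.+ b) ≡ + b + + a * + n
   cast′ a b = trans (cong +_ (ℕₚ.+-comm (a ℕ.* n) b)) (cong (_+_ (+ b)) (pos-* a n))

 squareℤ : ℤ → ℤ
 squareℤ x = x * x

 -- The convolution with the Jacobi symbol has operator norm at most √(2P+1).
 NormBound : ℕ → Set
 NormBound P = ∀ n (u : ℕ → ℤ) →
   ∑ℤ (odd P) (λ x → squareℤ (∑ℤ n (λ i → u i * jacobi P (+ x - + i)))) ≤
   + odd P * ∑ℤ (odd P) (λ r → squareℤ (∑ℤ n (λ i → u i * δ (odd P) (+ i) r)))

 normBound-1 : NormBound 0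
 normBound-1 n u = ≤-reflexive (trans (+-identityˡ _) (sym (trans (*-identityˡ _) (trans (+-identityˡ _)
   (cong squareℤ (∑ℤ-cong n (λ i _ → cong (u i *_) (δ-yes 1 (+ i) 0 (ℕ/.n%1≡0 i)))))))))

 jacobi-% : ∀ P x i → jacobi P (+ (+ x %ℕ odd P) - i) ≡ jacobi P (+ x - i)
 jacobi-% P x i = jacobi-cong P (+ (+ x %ℕ odd P) - i) (+ x - i)
   (≈-+ (+ (+ x %ℕ odd P)) (+ x) (- i) (- i) (≈-sym (+ x) (+ (+ x %ℕ odd P)) (%-≈ (odd P) (+ x))) (≈-refl (- i)))

 -- The two moduli act like a tensor product of operators: after the Chinese remainder theorem the
 -- bound for M is applied in the second residue with weights u(i) ψ(y - i), then the bound for P in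
 -- the first with weights u(i) δ(i, r).
 normBound-* : ∀ P M → IsUnit (odd P) (+ odd M) → NormBound P → NormBound M → NormBound (halfProduct P M)
 normBound-* P M coprime boundP boundM n u = subst (λ t →
     ∑ℤ t (λ x → squareℤ (∑ℤ n (λ i → u i * jacobi T (+ x - + i)))) ≤ + t * ∑ℤ t (λ r → squareℤ (∑ℤ n (λ i → u i * δ (odd T) (+ i) r))))
   (sym (odd-halfProduct P M)) (begin
   ∑ℤ (p ℕ.* m) (λ x → squareℤ (∑ℤ n (λ i → u i * jacobi T (+ x - + i))))
     ≡⟨ ∑ℤ-cong (p ℕ.* m) (λ x _ → cong squareℤ (∑ℤ-cong n (λ i _ → factor x i))) ⟩
   ∑ℤ (p ℕ.* m) (λ x → G (+ x %ℕ p) (+ x %ℕ m))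
     ≡⟨ ∑-CRT p m coprime G ⟩
   ∑ℤ p (λ y → ∑ℤ m (λ z → G y z))
     ≤⟨ ∑ℤ-mono p (λ y _ → boundM n (λ i → u i * jacobi P (+ y - + i))) ⟩
   ∑ℤ p (λ y → + m * ∑ℤ m (λ r → squareℤ (∑ℤ n (λ i → u i * jacobi P (+ y - + i) * δ m (+ i) r))))
     ≡⟨ trans (sym (∑ℤ-*ˡ p (+ m) _)) (cong (+ m *_) (trans (∑ℤ-swap p m _)
          (∑ℤ-cong m (λ r _ → ∑ℤ-cong p (λ y _ → cong squareℤ (∑ℤ-cong n (λ i _ →
            swap (u i) (jacobi P (+ y - + i)) (δ m (+ i) r)))))))) ⟩
   + m * ∑ℤ m (λ r → ∑ℤ p (λ y → squareℤ (∑ℤ n (λ i → u i * δ m (+ i) r * jacobi P (+ y - + i)))))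
     ≤⟨ *-monoˡ-≤-nonNeg (+ m) (∑ℤ-mono m (λ r _ → boundP n (λ i → u i * δ m (+ i) r))) ⟩
   + m * ∑ℤ m (λ r → + p * ∑ℤ p (λ s → squareℤ (∑ℤ n (λ i → u i * δ m (+ i) r * δ p (+ i) s))))
     ≡⟨ trans (cong (+ m *_) (sym (∑ℤ-*ˡ m (+ p) _))) (trans (sym (*-assoc (+ m) (+ p) _))
          (cong₂ _*_ (trans (*-comm (+ m) (+ p)) (sym (pos-* p m))) (∑ℤ-swap m p _))) ⟩
   + (p ℕ.* m) * ∑ℤ p (λ s → ∑ℤ m (λ r → H s r))
     ≡⟨ cong (+ (p ℕ.* m) *_) (∑-CRT p m coprime H) ⟨
   + (p ℕ.* m) * ∑ℤ (p ℕ.* m) (λ x → H (+ x %ℕ p) (+ x %ℕ m))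
     ≡⟨ cong (+ (p ℕ.* m) *_) (∑ℤ-cong (p ℕ.* m) (λ x x< → cong squareℤ (∑ℤ-cong n (λ i _ →
          trans (*-assoc (u i) _ _) (cong (u i *_) (δ-factor i x x<)))))) ⟩
   + (p ℕ.* m) * ∑ℤ (p ℕ.* m) (λ r → squareℤ (∑ℤ n (λ i → u i * δ (odd T) (+ i) r))) ∎)
   where
   open ≤-Reasoning
   T p m : ℕ
   T = halfProduct P M
   p = odd P
   m = odd M
   G H : ℕ → ℕ → ℤ
   G y z = squareℤ (∑ℤ n (λ i → u i * jacobi P (+ y - + i) * jacobi M (+ z - + i)))
   H s r = squareℤ (∑ℤ n (λ i → u i * δ m (+ i) r * δ p (+ i) s))
   swap : ∀ a b c → a * b * c ≡ a * c * b
   swap = ℤ-ring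
   factor : ∀ x i → u i * jacobi T (+ x - + i) ≡ u i * jacobi P (+ (+ x %ℕ p) - + i) * jacobi M (+ (+ x %ℕ m) - + i)
   factor x i = trans (cong (u i *_) (trans (jacobi-modulus-* P M (+ x - + i))
       (cong₂ _*_ (sym (jacobi-% P x (+ i))) (sym (jacobi-% M x (+ i))))))
     (sym (*-assoc (u i) _ _))
   p∣T : + p ∣ + odd T
   p∣T = divides (+ m) (trans (cong +_ (trans (odd-halfProduct P M) (ℕₚ.*-comm p m))) (pos-* m p))
   m∣T : + m ∣ + odd T
   m∣T = divides (+ p) (trans (cong +_ (odd-halfProduct P M)) (pos-* p m))
   combine : ∀ i x → + i ≈ + x [ p ] → + i ≈ + x [ m ] → + i ≈ + x [ odd T ]
   combine i x (divides k e) (divides l f) = subst (λ t → + i ≈ + x [ t ]) (sym (odd-halfProduct P M)) (go coprime)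
     where
     identity : ∀ d k l p m b c → d - (k * b - c * l) * (p * m) ≡
       (m * b) * (d - k * p) + (- (p * c)) * (d - l * m) + (- d) * ((m * b - 1ℤ) - c * p)
     identity = ℤ-ring
     go : IsUnit p (+ m) → + i ≈ + x [ p ℕ.* m ]
     go (b , divides c g) = divides (k * b - c * l) (trans
       (linear₃ (+ m * b) (- (+ p * c)) (- (+ i - + x)) e f g (identity (+ i - + x) k l (+ p) (+ m) b c))
       (cong ((k * b - c * l) *_) (sym (pos-* p m))))
   m-fails : ∀ i x → + i %ℕ m ≢ + x %ℕ m → 0ℤ ≡ δ (odd T) (+ i) x
   m-fails i x ¬e = sym (δ-no (odd T) (+ i) x λ e → ¬e (≈⇒%≡ m (+ i) (+ x)
     (≈-weaken (+ i) (+ x) m∣T (subst (λ t → + i ≈ + t [ odd T ]) e (%-≈ (odd T) (+ i))))))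
   δ-factor : ∀ i x → x ℕ.< p ℕ.* m → δ m (+ i) (+ x %ℕ m) * δ p (+ i) (+ x %ℕ p) ≡ δ (odd T) (+ i) x
   δ-factor i x x< with + i %ℕ m ℕₚ.≟ + x %ℕ m | + i %ℕ p ℕₚ.≟ + x %ℕ p
   ... | no ¬e | yes _ = m-fails i x ¬e
   ... | no ¬e | no _ = m-fails i x ¬e
   ... | yes _ | no ¬e = trans (*-zeroʳ 1ℤ) (sym (δ-no (odd T) (+ i) x λ e → ¬e (≈⇒%≡ p (+ i) (+ x)
     (≈-weaken (+ i) (+ x) p∣T (subst (λ t → + i ≈ + t [ odd T ]) e (%-≈ (odd T) (+ i)))))))
   ... | yes e | yes f = sym (δ-yes (odd T) (+ i) x (≈-%-unique (odd T) (+ i) x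
     (subst (x ℕ.<_) (sym (odd-halfProduct P M)) x<) (combine i x (same p f) (same m e))))
     where
     same : ∀ n .{{_ : ℕ.NonZero n}} → + i %ℕ n ≡ + x %ℕ n → + i ≈ + x [ n ]
     same n e = ≈-trans (+ i) (+ (+ i %ℕ n)) (+ x) (%-≈ n (+ i))
       (subst (λ t → + t ≈ + x [ n ]) (sym e) (≈-sym (+ x) (+ (+ x %ℕ n)) (%-≈ n (+ x))))

 module _ (P : ℕ) (pr : Prime (odd P)) where

   private
     N : ℕ
     N = odd P
     ψ : ℤ → ℤ
     ψ = jacobi P

   autocorrelation : ℤ → ℤ
   autocorrelation d = ∑ℤ N (λ y → ψ (+ y) * ψ (+ y + d))

   private
     ψψ-cong : ∀ d x y → x ≈ y [ N ] → ψ x * ψ (x + d) ≡ ψ y * ψ (y + d)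
     ψψ-cong d x y e = cong₂ _*_ (jacobi-cong P x y e) (jacobi-cong P (x + d) (y + d) (≈-+ x y d d e (≈-refl d)))

   autocorrelation-0 : autocorrelation 0ℤ ≡ + (P ℕ.+ P)
   autocorrelation-0 = trans (∑ℤ-first (P ℕ.+ P) (λ y → ψ (+ y) * ψ (+ y + 0ℤ)))
     (trans (cong₂ _+_
       (trans (cong (_* ψ (0ℤ + 0ℤ)) (jacobi-∣ P 0ℤ (divides 0ℤ refl) (halfPrime≢0 P pr))) (*-zeroˡ (ψ (0ℤ + 0ℤ))))
       (trans (∑ℤ-cong (P ℕ.+ P) (λ y y< → trans (cong (λ t → ψ (+ suc y) * ψ t) (+-identityʳ (+ suc y)))
           (jacobi-square P (+ suc y) (small-unit P pr (s≤s y<)))))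
         (trans (∑ℤ-const (P ℕ.+ P) 1ℤ) (*-identityʳ (+ (P ℕ.+ P))))))
       (+-identityˡ (+ (P ℕ.+ P))))

   autocorrelation-unit : ∀ d → IsUnit N d → autocorrelation d ≡ autocorrelation 1ℤ
   autocorrelation-unit d u = trans
     (sym (∑-affine N (λ y → ψ y * ψ (y + d)) (ψψ-cong d) d 0ℤ u))
     (∑ℤ-cong N (λ y _ → begin
       ψ (d * + y + 0ℤ) * ψ (d * + y + 0ℤ + d)
         ≡⟨ cong₂ (λ s t → ψ s * ψ t) (+-identityʳ (d * + y)) (identity d (+ y)) ⟩
       ψ (d * + y) * ψ (d * (+ y + 1ℤ))
         ≡⟨ cong₂ _*_ (jacobi-* P d (+ y)) (jacobi-* P d (+ y + 1ℤ)) ⟩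
       (ψ d * ψ (+ y)) * (ψ d * ψ (+ y + 1ℤ))
         ≡⟨ regroup (ψ d) (ψ (+ y)) (ψ (+ y + 1ℤ)) ⟩
       (ψ d * ψ d) * (ψ (+ y) * ψ (+ y + 1ℤ))
         ≡⟨ trans (cong (_* (ψ (+ y) * ψ (+ y + 1ℤ))) (jacobi-square P d u)) (*-identityˡ (ψ (+ y) * ψ (+ y + 1ℤ))) ⟩
       ψ (+ y) * ψ (+ y + 1ℤ) ∎))
     where
     open ≡-Reasoning
     identity : ∀ d y → d * y + 0ℤ + d ≡ d * (y + 1ℤ)
     identity = ℤ-ring
     regroup : ∀ a b c → (a * b) * (a * c) ≡ (a * a) * (b * c)
     regroup = ℤ-ring

   ∑-autocorrelation : ∑ℤ N (λ d → autocorrelation (+ d)) ≡ 0ℤ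
   ∑-autocorrelation = trans (∑ℤ-swap N N _) (∑ℤ-vanish N (λ y _ →
     trans (sym (∑ℤ-*ˡ N (ψ (+ y)) (λ d → ψ (+ y + + d)))) (trans (cong (ψ (+ y) *_) (shift y)) (*-zeroʳ (ψ (+ y))))))
     where
     identity : ∀ y d → 1ℤ * d + y ≡ y + d
     identity = ℤ-ring
     shift : ∀ y → ∑ℤ N (λ d → ψ (+ y + + d)) ≡ 0ℤ
     shift y = trans (∑ℤ-cong N (λ d _ → cong ψ (sym (identity (+ y) (+ d)))))
       (trans (∑-affine N ψ (jacobi-cong P) 1ℤ (+ y) (1ℤ , ≈-refl 1ℤ)) (∑-jacobi P pr))

   -- All nonzero shifts have the same correlation, and the total vanishes.
   autocorrelation-1 : autocorrelation 1ℤ ≡ -1ℤ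
   autocorrelation-1 = i-j≡0⇒i≡j _ -1ℤ (*-cancelˡ-≡ (+ (P ℕ.+ P)) (autocorrelation 1ℤ - -1ℤ) 0ℤ {{nz}}
     (trans (identity (+ (P ℕ.+ P)) (autocorrelation 1ℤ)) (trans total (sym (*-zeroʳ (+ (P ℕ.+ P)))))))
     where
     nz : ℤ.NonZero (+ (P ℕ.+ P))
     nz = ≢-nonZero (λ e → halfPrime≢0 P pr (ℕₚ.m+n≡0⇒m≡0 P (+-injective e)))
     identity : ∀ n c → n * (c - -1ℤ) ≡ n + n * c
     identity = ℤ-ring
     total : + (P ℕ.+ P) + + (P ℕ.+ P) * autocorrelation 1ℤ ≡ 0ℤ
     total = begin
       + (P ℕ.+ P) + + (P ℕ.+ P) * autocorrelation 1ℤ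
         ≡⟨ cong₂ _+_ (sym autocorrelation-0) (sym (trans
              (∑ℤ-cong (P ℕ.+ P) (λ d d< → autocorrelation-unit (+ suc d) (small-unit P pr (s≤s d<))))
              (∑ℤ-const (P ℕ.+ P) (autocorrelation 1ℤ)))) ⟩
       autocorrelation 0ℤ + ∑ℤ (P ℕ.+ P) (λ d → autocorrelation (+ suc d))
         ≡⟨ ∑ℤ-first (P ℕ.+ P) (λ d → autocorrelation (+ d)) ⟨
       ∑ℤ N (λ d → autocorrelation (+ d))
         ≡⟨ ∑-autocorrelation ⟩
       0ℤ ∎
       where open ≡-Reasoning

   correlation : ∀ r s → ∑ℤ N (λ y → ψ (+ y - + r) * ψ (+ y - + s)) ≡ autocorrelation (+ r - + s)
   correlation r s = trans
     (∑ℤ-cong N (λ y _ → cong₂ (λ a b → ψ a * ψ b) (identity (+ y) (+ r)) (identity′ (+ y) (+ r) (+ s))))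
     (∑-affine N (λ y → ψ y * ψ (y + (+ r - + s))) (ψψ-cong (+ r - + s)) 1ℤ (- + r) (1ℤ , ≈-refl 1ℤ))
     where
     identity : ∀ y r → y - r ≡ 1ℤ * y + - r
     identity = ℤ-ring
     identity′ : ∀ y r s → y - s ≡ 1ℤ * y + - r + (r - s)
     identity′ = ℤ-ring

   -- So the Gram matrix of the shifted characters is N times the identity minus the all-ones
   -- matrix.
   correlation-value : ∀ r s → r ℕ.< N → s ℕ.< N →
     ∑ℤ N (λ y → ψ (+ y - + r) * ψ (+ y - + s)) ≡ + N * δ N (+ r) s - 1ℤ
   correlation-value r s r<N s<N with r ℕₚ.≟ s
   ... | yes refl = trans (correlation r r) (trans (cong autocorrelation (+-inverseʳ (+ r)))
     (trans autocorrelation-0 (sym (trans (cong (λ t → + N * t - 1ℤ) (δ-yes N (+ r) r (ℕ/.m<n⇒m%n≡m r<N)))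
       (identity (+ (P ℕ.+ P)))))))
     where
     identity : ∀ n → (1ℤ + n) * 1ℤ - 1ℤ ≡ n
     identity = ℤ-ring
   ... | no r≢s = trans (correlation r s) (trans (autocorrelation-unit (+ r - + s)
       (prime-unit P pr (+ r - + s) (λ d → r≢s (≈-< r<N s<N d))))
     (trans autocorrelation-1 (sym (trans (cong (λ t → + N * t - 1ℤ)
       (δ-no N (+ r) s (λ e → r≢s (trans (sym (ℕ/.m<n⇒m%n≡m r<N)) e)))) (cong (_- 1ℤ) (*-zeroʳ (+ N)))))))

   -- After grouping the weights by residue into U(r), `correlation-value` turns the left side into
   -- N ∑ U(r)² - (∑ U(r))², and the subtracted square is dropped.
   normBound-prime : NormBound P
   normBound-prime n u = begin
     ∑ℤ N (λ y → squareℤ (∑ℤ n (λ i → u i * ψ (+ y - + i))))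
       ≡⟨ ∑ℤ-cong N (λ y _ → cong squareℤ (group y)) ⟩
     ∑ℤ N (λ y → squareℤ (∑ℤ N (λ r → U r * ψ (+ y - + r))))
       ≡⟨ ∑ℤ-cong N (λ y _ → ∑-*-∑ N N _ _) ⟩
     ∑ℤ N (λ y → ∑ℤ N (λ r → ∑ℤ N (λ s → (U r * ψ (+ y - + r)) * (U s * ψ (+ y - + s)))))
       ≡⟨ trans (∑ℤ-swap N N _) (∑ℤ-cong N (λ r _ → ∑ℤ-swap N N _)) ⟩
     ∑ℤ N (λ r → ∑ℤ N (λ s → ∑ℤ N (λ y → (U r * ψ (+ y - + r)) * (U s * ψ (+ y - + s)))))
       ≡⟨ ∑ℤ-cong N (λ r r<N → ∑ℤ-cong N (λ s s<N → trans
            (∑ℤ-cong N (λ y _ → regroup (U r) (ψ (+ y - + r)) (U s) (ψ (+ y - + s))))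
            (trans (sym (∑ℤ-*ˡ N (U r * U s) _)) (cong (U r * U s *_) (correlation-value r s r<N s<N))))) ⟩
     ∑ℤ N (λ r → ∑ℤ N (λ s → U r * U s * (+ N * δ N (+ r) s - 1ℤ)))
       ≡⟨ ∑ℤ-cong N (λ r r<N → row r r<N) ⟩
     ∑ℤ N (λ r → + N * squareℤ (U r) - U r * ∑ℤ N U)
       ≡⟨ trans (∑-linear N _ _) (cong₂ _-_ (sym (∑ℤ-*ˡ N (+ N) (λ r → squareℤ (U r)))) (sym (∑ℤ-*ʳ N (∑ℤ N U) U))) ⟩
     + N * ∑ℤ N (λ r → squareℤ (U r)) - ∑ℤ N U * ∑ℤ N U
       ≤⟨ minus-nonneg (square-nonneg (∑ℤ N U)) ⟩
     + N * ∑ℤ N (λ r → squareℤ (U r)) ∎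
     where
     open ≤-Reasoning
     U : ℕ → ℤ
     U r = ∑ℤ n (λ i → u i * δ N (+ i) r)
     minus-nonneg : ∀ {j k} → 0ℤ ≤ k → j - k ≤ j
     minus-nonneg {j} {k} 0≤k = subst (j - k ≤_) (+-identityʳ j) (+-monoʳ-≤ j (neg-mono-≤ 0≤k))
     group : ∀ y → ∑ℤ n (λ i → u i * ψ (+ y - + i)) ≡ ∑ℤ N (λ r → U r * ψ (+ y - + r))
     group y = sym (trans
       (trans (∑ℤ-cong N (λ r _ → ∑ℤ-*ʳ n (ψ (+ y - + r)) _)) (∑ℤ-swap N n _))
       (∑ℤ-cong n (λ i _ → trans (∑ℤ-cong N (λ r _ → *-assoc (u i) _ _)) (trans (sym (∑ℤ-*ˡ N (u i) _)) (cong (u i *_)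
         (trans (∑-δ N (+ i) (λ r → ψ (+ y - + r)))
           (jacobi-cong P (+ y - + (+ i %ℕ N)) (+ y - + i)
             (≈-+ (+ y) (+ y) (- + (+ i %ℕ N)) (- + i) (≈-refl (+ y))
               (≈-neg (+ (+ i %ℕ N)) (+ i) (≈-sym (+ i) (+ (+ i %ℕ N)) (%-≈ N (+ i))))))))))))
     regroup : ∀ a b c d → (a * b) * (c * d) ≡ a * c * (b * d)
     regroup = ℤ-ring
     spread : ∀ a b n e → a * b * (n * e - 1ℤ) ≡ (n * a) * (e * b) - a * b
     spread = ℤ-ring
     row : ∀ r → r ℕ.< N → ∑ℤ N (λ s → U r * U s * (+ N * δ N (+ r) s - 1ℤ)) ≡ + N * squareℤ (U r) - U r * ∑ℤ N U
     row r r<N = trans (∑ℤ-cong N (λ s _ → spread (U r) (U s) (+ N) (δ N (+ r) s)))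
       (trans (∑-linear N _ _) (cong₂ _-_
         (trans (sym (∑ℤ-*ˡ N (+ N * U r) _)) (trans (cong (+ N * U r *_)
           (trans (∑-δ N (+ r) U) (cong U (ℕ/.m<n⇒m%n≡m r<N)))) (*-assoc (+ N) (U r) (U r))))
         (sym (∑ℤ-*ˡ N (U r) U))))

 -- The Pólya–Vinogradov inequality

 odd≢double : ∀ P m → odd P ≢ m ℕ.+ m
 odd≢double P zero ()
 odd≢double P (suc m) e with P
 ... | zero = contradiction (ℕₚ.suc-injective (ℕₚ.suc-injective (trans (cong suc e) (cong suc (cong suc (ℕₚ.+-suc m m)))))) λ ()
 ... | suc P′ = odd≢double P′ m (ℕₚ.suc-injective (ℕₚ.suc-injective
   (trans (cong suc (cong suc (sym (ℕₚ.+-suc P′ P′)))) (trans e (cong suc (ℕₚ.+-suc m m))))))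

 odd-injective : ∀ {P M} → odd P ≡ odd M → P ≡ M
 odd-injective {zero} {zero} e = refl
 odd-injective {suc P} {suc M} e = cong suc (odd-injective (ℕₚ.suc-injective (ℕₚ.suc-injective
   (trans (cong suc (cong suc (sym (ℕₚ.+-suc P P)))) (trans e (cong suc (cong suc (ℕₚ.+-suc M M))))))))

 odd-factor : ∀ {P} a b → a ℕ.* b ≡ odd P → ∃[ A ] a ≡ odd A
 odd-factor {P} a b e with even-or-odd a
 ... | inj₂ odd-a = odd-a
 ... | inj₁ (m , refl) = contradiction (trans (sym e) (ℕₚ.*-distribʳ-+ b m m)) (odd≢double P (m ℕ.* b))

 SquareFree : ℕ → Set
 SquareFree n = ∀ {p} → Prime p → ¬ (p ℕ.* p ℕ∣.∣ n)

 -- Both properties pass to products of coprime moduli, and so reach every square-free modulus by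
 -- induction over its prime factors. For the modulus 1 the sum over a period is 1, whence the
 -- condition `P ≢ 0`.
 record CharacterModulus (P : ℕ) : Set where
   field
     normBound : NormBound P
     ∑-period : P ≢ 0 → ∑ℤ (odd P) (λ x → jacobi P (+ x)) ≡ 0ℤ

 open CharacterModulus

 modulus-1 : CharacterModulus 0
 modulus-1 = record { normBound = normBound-1 ; ∑-period = λ 0≢0 → contradiction refl 0≢0 }

 modulus-* : ∀ P M → Prime (odd P) → IsUnit (odd P) (+ odd M) → CharacterModulus M → CharacterModulus (halfProduct P M)
 modulus-* P M pr u c = record
   { normBound = normBound-* P M u (normBound-prime P pr) (normBound c)
   ; ∑-period = λ _ → begin
       ∑ℤ (odd T) (λ x → jacobi T (+ x))
         ≡⟨ cong (λ t → ∑ℤ t (λ x → jacobi T (+ x))) (odd-halfProduct P M) ⟩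
       ∑ℤ (odd P ℕ.* odd M) (λ x → jacobi T (+ x))
         ≡⟨ ∑ℤ-cong (odd P ℕ.* odd M) (λ x _ → trans (jacobi-modulus-* P M (+ x)) (cong₂ _*_ (reduce P x) (reduce M x))) ⟩
       ∑ℤ (odd P ℕ.* odd M) (λ x → jacobi P (+ (+ x %ℕ odd P)) * jacobi M (+ (+ x %ℕ odd M)))
         ≡⟨ ∑-CRT (odd P) (odd M) u (λ y z → jacobi P (+ y) * jacobi M (+ z)) ⟩
       ∑ℤ (odd P) (λ y → ∑ℤ (odd M) (λ z → jacobi P (+ y) * jacobi M (+ z)))
         ≡⟨ ∑-*-∑ (odd P) (odd M) _ _ ⟨
       ∑ℤ (odd P) (λ y → jacobi P (+ y)) * ∑ℤ (odd M) (λ z → jacobi M (+ z))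
         ≡⟨ trans (cong (_* ∑ℤ (odd M) (λ z → jacobi M (+ z))) (∑-jacobi P pr)) (*-zeroˡ (∑ℤ (odd M) (λ z → jacobi M (+ z)))) ⟩
       0ℤ ∎
   }
   where
   open ≡-Reasoning
   T : ℕ
   T = halfProduct P M
   reduce : ∀ P x → jacobi P (+ x) ≡ jacobi P (+ (+ x %ℕ odd P))
   reduce P x = jacobi-cong P (+ x) (+ (+ x %ℕ odd P)) (%-≈ (odd P) (+ x))

 modulus-product : ∀ ps → All Prime ps → SquareFree (product ps) → ∀ P → product ps ≡ odd P → CharacterModulus P
 modulus-product [] [] _ P e = subst CharacterModulus (odd-injective e) modulus-1
 modulus-product (p ∷ ps) (pr ∷ prs) sf P e with odd-factor {P} p (product ps) e | odd-factor {P} (product ps) p (trans (ℕₚ.*-comm (product ps) p) e)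
 ... | A , refl | M , m≡ = subst CharacterModulus (odd-injective (trans (odd-halfProduct A M)
     (trans (cong (odd A ℕ.*_) (sym m≡)) e)))
   (modulus-* A M pr (prime-unit A pr (+ odd M) coprime)
     (modulus-product ps prs (λ pr′ d → sf pr′ (ℕ∣.∣n⇒∣m*n (odd A) d)) M m≡))
   where
   coprime : ¬ (+ odd A ∣ + odd M)
   coprime d = sf pr (ℕ∣.*-monoʳ-∣ (odd A) (subst (odd A ℕ∣.∣_) (sym m≡) (∣⇒∣ᵤ d)))

 squareFree⇒modulus : ∀ P → SquareFree (odd P) → CharacterModulus P
 squareFree⇒modulus P sf = modulus-product factors factorsPrime
   (λ pr d → sf pr (subst (_ ℕ∣.∣_) (sym isFactorisation) d)) P (sym isFactorisation)
   where open PrimeFactorisation (factorise (odd P))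

 module _ (P : ℕ) (P≢0 : P ≢ 0) (even : ε P ≡ 1ℤ) (modulus : CharacterModulus P) where

   private
     q : ℕ
     q = odd P
     ψ : ℤ → ℤ
     ψ = jacobi P

   ψ-even : ∀ x → ψ (- x) ≡ ψ x
   ψ-even x = trans (cong ψ (sym (-1*i≡-i x))) (trans (jacobi-* P -1ℤ x)
     (trans (cong (_* ψ x) (trans (jacobi-neg1 P) even)) (*-identityˡ (ψ x))))

   ψ-0 : ψ 0ℤ ≡ 0ℤ
   ψ-0 = jacobi-∣ P 0ℤ (divides 0ℤ refl) P≢0

   ∑-shift : ∀ c → ∑ℤ q (λ x → ψ (+ x + c)) ≡ 0ℤ
   ∑-shift c = trans (∑ℤ-cong q (λ x _ → cong (λ t → ψ (t + c)) (sym (*-identityˡ (+ x)))))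
     (trans (∑-affine q ψ (jacobi-cong P) 1ℤ c (1ℤ , ≈-refl 1ℤ)) (∑-period modulus P≢0))

   doubleSum : ℕ → ℤ
   doubleSum n = ∑ℤ n (λ a → ∑ℤ n (λ b → ψ (+ a - + b)))

   -- The sum ψ(1) + … + ψ(n).
   charSum : ℕ → ℤ
   charSum n = ∑ℤ n (λ i → ψ (+ suc i))

   -- Cauchy-Schwarz in a; then the outer sum is extended to a whole period and the norm bound is
   -- applied to the indicator function of 0, ..., n - 1.
   doubleSum² : ∀ n → n ℕ.≤ q → squareℤ (doubleSum n) ≤ + n * (+ q * + n)
   doubleSum² n n≤q = begin
     squareℤ (doubleSum n)
       ≤⟨ cauchy-schwarz n (λ a → ∑ℤ n (λ b → ψ (+ a - + b))) ⟩
     + n * ∑ℤ n (λ a → squareℤ (∑ℤ n (λ b → ψ (+ a - + b))))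
       ≤⟨ *-monoˡ-≤-nonNeg (+ n) (∑ℤ-extend _ (λ a → square-nonneg (∑ℤ n (λ b → ψ (+ a - + b)))) n≤q) ⟩
     + n * ∑ℤ q (λ a → squareℤ (∑ℤ n (λ b → ψ (+ a - + b))))
       ≡⟨ cong (+ n *_) (∑ℤ-cong q (λ a _ → cong squareℤ (∑ℤ-cong n (λ b _ → sym (*-identityˡ (ψ (+ a - + b))))))) ⟩
     + n * ∑ℤ q (λ a → squareℤ (∑ℤ n (λ b → 1ℤ * ψ (+ a - + b))))
       ≤⟨ *-monoˡ-≤-nonNeg (+ n) (normBound modulus n (λ _ → 1ℤ)) ⟩
     + n * (+ q * ∑ℤ q (λ r → squareℤ (∑ℤ n (λ i → 1ℤ * δ q (+ i) r))))
       ≡⟨ cong (λ t → + n * (+ q * t)) diagonal ⟩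
     + n * (+ q * + n) ∎
     where
     open ≤-Reasoning
     1·δ : ∀ i r → i ℕ.< n → i ≢ r → 1ℤ * δ q (+ i) r ≡ 0ℤ
     1·δ i r i<n i≢r = trans (*-identityˡ (δ q (+ i) r)) (δ-no q (+ i) r
       (λ e → i≢r (trans (sym (ℕ/.m<n⇒m%n≡m (ℕₚ.<-≤-trans i<n n≤q))) e)))
     inside : ∀ r → r ℕ.< n → squareℤ (∑ℤ n (λ i → 1ℤ * δ q (+ i) r)) ≡ 1ℤ
     inside r r<n = cong squareℤ (trans (∑ℤ-single n r (λ i → 1ℤ * δ q (+ i) r) r<n (λ i i<n → 1·δ i r i<n))
       (trans (*-identityˡ (δ q (+ r) r)) (δ-yes q (+ r) r (ℕ/.m<n⇒m%n≡m (ℕₚ.<-≤-trans r<n n≤q)))))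
     outside : ∀ r → n ℕ.≤ r → squareℤ (∑ℤ n (λ i → 1ℤ * δ q (+ i) r)) ≡ 0ℤ
     outside r n≤r = cong squareℤ (∑ℤ-vanish n (λ i i<n → 1·δ i r i<n (ℕₚ.<⇒≢ (ℕₚ.<-≤-trans i<n n≤r))))
     diagonal : ∑ℤ q (λ r → squareℤ (∑ℤ n (λ i → 1ℤ * δ q (+ i) r))) ≡ + n
     diagonal = trans (∑ℤ-extend-≡ _ n≤q outside)
       (trans (∑ℤ-cong n inside) (trans (∑ℤ-const n 1ℤ) (*-identityʳ (+ n))))

   -- A complete period in either variable contributes zero, so both ranges can be shortened by q,
   -- one after the other.
   doubleSum-period : ∀ n → doubleSum (q ℕ.+ n) ≡ doubleSum n
   doubleSum-period n = begin
     ∑ℤ (q ℕ.+ n) (λ a → ∑ℤ (q ℕ.+ n) (λ b → ψ (+ a - + b)))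
       ≡⟨ ∑ℤ-cong (q ℕ.+ n) (λ a _ → drop (λ b → ψ (+ a - + b)) (periodic-b a) (column a)) ⟩
     ∑ℤ (q ℕ.+ n) (λ a → ∑ℤ n (λ b → ψ (+ a - + b)))
       ≡⟨ ∑ℤ-swap (q ℕ.+ n) n _ ⟩
     ∑ℤ n (λ b → ∑ℤ (q ℕ.+ n) (λ a → ψ (+ a - + b)))
       ≡⟨ ∑ℤ-cong n (λ b _ → drop (λ a → ψ (+ a - + b)) (periodic-a b) (∑-shift (- + b))) ⟩
     ∑ℤ n (λ b → ∑ℤ n (λ a → ψ (+ a - + b)))
       ≡⟨ ∑ℤ-swap n n _ ⟩
     doubleSum n ∎
     where
     open ≡-Reasoning
     periodic-b : ∀ a b → ψ (+ a - + (q ℕ.+ b)) ≡ ψ (+ a - + b)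
     periodic-b a b = jacobi-cong P (+ a - + (q ℕ.+ b)) (+ a - + b) (divides -1ℤ (identity (+ a) (+ b) (+ q)))
       where
       identity : ∀ a b q → (a - (q + b)) - (a - b) ≡ -1ℤ * q
       identity = ℤ-ring
     periodic-a : ∀ b a → ψ (+ (q ℕ.+ a) - + b) ≡ ψ (+ a - + b)
     periodic-a b a = jacobi-cong P (+ (q ℕ.+ a) - + b) (+ a - + b) (divides 1ℤ (identity (+ a) (+ b) (+ q)))
       where
       identity : ∀ a b q → (q + a - b) - (a - b) ≡ 1ℤ * q
       identity = ℤ-ring
     column : ∀ a → ∑ℤ q (λ b → ψ (+ a - + b)) ≡ 0ℤ
     column a = trans (∑ℤ-cong q (λ b _ → trans (cong ψ (identity (+ a) (+ b))) (ψ-even (+ b + - + a)))) (∑-shift (- + a))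
       where
       identity : ∀ a b → a - b ≡ - (b + - a)
       identity = ℤ-ring
     drop : ∀ (f : ℕ → ℤ) → (∀ b → f (q ℕ.+ b) ≡ f b) → ∑ℤ q f ≡ 0ℤ → ∑ℤ (q ℕ.+ n) f ≡ ∑ℤ n f
     drop f per zero-sum = trans (∑ℤ-split q n f) (trans (cong₂ _+_ zero-sum (∑ℤ-cong n (λ b _ → per b))) (+-identityˡ (∑ℤ n f)))

   periodic-reduce : ∀ {A : Set} (f : ℕ → A) → (∀ n → f (q ℕ.+ n) ≡ f n) → ∀ n → f n ≡ f (n ℕ/.% q)
   periodic-reduce f per n = trans (cong f (trans (ℕ/.m≡m%n+[m/n]*n n q) (ℕₚ.+-comm (n ℕ/.% q) (n ℕ/./ q ℕ.* q))))
     (go (n ℕ/./ q))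
     where
     go : ∀ k → f (k ℕ.* q ℕ.+ n ℕ/.% q) ≡ f (n ℕ/.% q)
     go zero = refl
     go (suc k) = trans (cong f (ℕₚ.+-assoc q (k ℕ.* q) (n ℕ/.% q))) (trans (per (k ℕ.* q ℕ.+ n ℕ/.% q)) (go k))

   -- The bound on the square holds for n ≤ q, and periodicity reduces every n to its residue, which
   -- is no larger.
   doubleSum≤ : ∀ R → q ℕ.≤ R ℕ.* R → ∀ n → doubleSum n ≤ + (n ℕ.* R)
   doubleSum≤ R q≤R² n = subst (_≤ + (n ℕ.* R)) (sym (periodic-reduce doubleSum doubleSum-period n))
     (≤-trans (small (n ℕ/.% q) (ℕₚ.<⇒≤ (ℕ/.m%n<n n q))) (+≤+ (ℕₚ.*-monoˡ-≤ R (ℕ/.m%n≤m n q))))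
     where
     root : ∀ i k → squareℤ i ≤ + (k ℕ.* k) → i ≤ + k
     root (+ i) k h = +≤+ (ℕₚ.≮⇒≥ λ k<i → ℕₚ.<⇒≱ (ℕₚ.*-mono-< k<i k<i) (drop‿+≤+ (subst (_≤ + (k ℕ.* k)) (sym (pos-* i i)) h)))
     root -[1+ i ] k h = -≤+
     small : ∀ m → m ℕ.≤ q → doubleSum m ≤ + (m ℕ.* R)
     small m m≤q = root (doubleSum m) (m ℕ.* R) (≤-trans (doubleSum² m m≤q)
       (subst (_≤ + (m ℕ.* R ℕ.* (m ℕ.* R))) (trans (pos-* m (q ℕ.* m)) (cong (+ m *_) (pos-* q m)))
         (+≤+ (begin
           m ℕ.* (q ℕ.* m) ≤⟨ ℕₚ.*-monoʳ-≤ m (ℕₚ.*-monoˡ-≤ m q≤R²) ⟩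
           m ℕ.* (R ℕ.* R ℕ.* m) ≡⟨ identity m R ⟩
           m ℕ.* R ℕ.* (m ℕ.* R) ∎))))
       where
       open ℕₚ.≤-Reasoning
       identity : ∀ m R → m ℕ.* (R ℕ.* R ℕ.* m) ≡ m ℕ.* R ℕ.* (m ℕ.* R)
       identity = ℕ-ring

   -- The new row and the new column both sum to ψ(1) + ... + ψ(n), since ψ is even, and the corner
   -- is ψ(0) = 0.
   doubleSum-suc : ∀ n → doubleSum (suc n) ≡ doubleSum n + + 2 * charSum n
   doubleSum-suc n = begin
     ∑ℤ n (λ a → ∑ℤ n (λ b → ψ (+ a - + b)) + ψ (+ a - + n)) + (∑ℤ n (λ b → ψ (+ n - + b)) + ψ (+ n - + n))
       ≡⟨ cong₂ _+_ (trans (∑ℤ-+ n _ _) (cong (_+_ (doubleSum n)) (trans (∑ℤ-cong n mirror) (reverse n))))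
            (cong₂ _+_ (trans (∑ℤ-cong n forward) (reverse n)) (trans (cong ψ (+-inverseʳ (+ n))) ψ-0)) ⟩
     (doubleSum n + charSum n) + (charSum n + 0ℤ)
       ≡⟨ identity (doubleSum n) (charSum n) ⟩
     doubleSum n + + 2 * charSum n ∎
     where
     open ≡-Reasoning
     identity : ∀ d s → (d + s) + (s + 0ℤ) ≡ d + + 2 * s
     identity = ℤ-ring
     forward : ∀ b → b ℕ.< n → ψ (+ n - + b) ≡ ψ (+ (n ℕ.∸ b))
     forward b b<n = cong ψ (trans (m-n≡m⊖n n b) (⊖-≥ (ℕₚ.<⇒≤ b<n)))
     mirror : ∀ a → a ℕ.< n → ψ (+ a - + n) ≡ ψ (+ (n ℕ.∸ a))
     mirror a a<n = trans (sym (ψ-even (+ a - + n))) (trans (cong ψ (negate (+ a) (+ n))) (forward a a<n))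
       where
       negate : ∀ a n → - (a - n) ≡ n - a
       negate = ℤ-ring
     reverse : ∀ n → ∑ℤ n (λ b → ψ (+ (n ℕ.∸ b))) ≡ charSum n
     reverse zero = refl
     reverse (suc n) = trans (∑ℤ-first n (λ b → ψ (+ (suc n ℕ.∸ b))))
       (trans (cong (_+_ (ψ (+ suc n))) (reverse n)) (+-comm (ψ (+ suc n)) (charSum n)))

   ∑-charSum : ∀ n → + 2 * ∑ℤ n charSum ≡ doubleSum n
   ∑-charSum zero = refl
   ∑-charSum (suc n) = trans (*-distribˡ-+ (+ 2) (∑ℤ n charSum) (charSum n))
     (trans (cong (_+ + 2 * charSum n) (∑-charSum n)) (sym (doubleSum-suc n)))

   -- Hua's form of the Pólya–Vinogradov inequality.
   pólya-vinogradov : ∀ R → q ℕ.≤ R ℕ.* R → ∀ n → + 2 * ∑ℤ n charSum ≤ + (n ℕ.* R)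
   pólya-vinogradov R q≤R² n = subst (_≤ + (n ℕ.* R)) (sym (∑-charSum n)) (doubleSum≤ R q≤R² n)

   jacobi-values : ∀ x → ψ x ≡ 0ℤ ⊎ (ψ x ≡ 1ℤ ⊎ ψ x ≡ -1ℤ)
   jacobi-values x = [ (λ u → inj₂ ([ (λ e → inj₁ (i-j≡0⇒i≡j (ψ x) 1ℤ e)) , (λ e → inj₂ (i-j≡0⇒i≡j (ψ x) -1ℤ e)) ]′
       (i*j≡0⇒i≡0∨j≡0 (ψ x - 1ℤ) (trans (identity (ψ x)) (i≡j⇒i-j≡0 (jacobi-square P x u)))))) , inj₁ ]′ (unit-or-zero P x)
     where
     identity : ∀ j → (j - 1ℤ) * (j - -1ℤ) ≡ j * j - 1ℤ
     identity = ℤ-ring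

   ψ≤1 : ∀ x → ψ x ≤ 1ℤ
   ψ≤1 x = [ (λ e → subst (_≤ 1ℤ) (sym e) (+≤+ z≤n)) ,
     [ (λ e → ≤-reflexive e) , (λ e → subst (_≤ 1ℤ) (sym e) -≤+) ]′ ]′ (jacobi-values x)

   -1≤ψ : ∀ x → -1ℤ ≤ ψ x
   -1≤ψ x = [ (λ e → subst (-1ℤ ≤_) (sym e) -≤+) ,
     [ (λ e → subst (-1ℤ ≤_) (sym e) -≤+) , (λ e → ≤-reflexive (sym e)) ]′ ]′ (jacobi-values x)

   charSum≤ : ∀ n → charSum n ≤ + n
   charSum≤ n = ≤-trans (∑ℤ-mono n (λ i _ → ψ≤1 (+ suc i))) (≤-reflexive (trans (∑ℤ-const n 1ℤ) (*-identityʳ (+ n))))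

   -n≤charSum : ∀ n → - + n ≤ charSum n
   -n≤charSum n = ≤-trans (≤-reflexive (trans (sym (trans (*-comm (+ n) -1ℤ) (-1*i≡-i (+ n)))) (sym (∑ℤ-const n -1ℤ))))
     (∑ℤ-mono n (λ i _ → -1≤ψ (+ suc i)))

   charSum-period : ∀ n → charSum (q ℕ.+ n) ≡ charSum n
   charSum-period n = trans (∑ℤ-split q n _) (trans (cong₂ _+_
     (trans (∑ℤ-cong q (λ i _ → cong (λ t → ψ (+ t)) (ℕₚ.+-comm 1 i))) (∑-shift 1ℤ))
     (∑ℤ-cong n (λ i _ → jacobi-cong P (+ suc (q ℕ.+ i)) (+ suc i) (divides 1ℤ (trans (cong (λ t → + t - + suc i) (sym (ℕₚ.+-suc q i))) (identity (+ q) (+ suc i)))))))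
     (+-identityˡ (charSum n)))
     where
     identity : ∀ q i → (q + i) - i ≡ 1ℤ * q
     identity = ℤ-ring

   charSum≤q : ∀ n → charSum n ≤ + q
   charSum≤q n = subst (_≤ + q) (sym (periodic-reduce charSum charSum-period n))
     (≤-trans (charSum≤ (n ℕ/.% q)) (+≤+ (ℕₚ.<⇒≤ (ℕ/.m%n<n n q))))

   -q≤charSum : ∀ n → - + q ≤ charSum n
   -q≤charSum n = subst (- + q ≤_) (sym (periodic-reduce charSum charSum-period n))
     (≤-trans (neg-mono-≤ (+≤+ (ℕₚ.<⇒≤ (ℕ/.m%n<n n q)))) (-n≤charSum (n ℕ/.% q)))

 -- Roots of x² + x − Q modulo n

 ⟦_⟧ : ∀ {A : Set} → Dec A → ℤ
 ⟦ yes _ ⟧ = 1ℤ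
 ⟦ no _ ⟧ = 0ℤ

 ⟦⟧-nonneg : ∀ {A : Set} (d : Dec A) → 0ℤ ≤ ⟦ d ⟧
 ⟦⟧-nonneg (yes _) = +≤+ z≤n
 ⟦⟧-nonneg (no _) = ≤-refl

 ⟦⟧-yes : ∀ {A : Set} (d : Dec A) → A → ⟦ d ⟧ ≡ 1ℤ
 ⟦⟧-yes (yes _) a = refl
 ⟦⟧-yes (no ¬a) a = contradiction a ¬a

 ⟦⟧-no : ∀ {A : Set} (d : Dec A) → ¬ A → ⟦ d ⟧ ≡ 0ℤ
 ⟦⟧-no (yes a) ¬a = contradiction a ¬a
 ⟦⟧-no (no _) ¬a = refl

 ⟦⟧-⇔ : ∀ {A B : Set} (d : Dec A) (e : Dec B) → (A → B) → (B → A) → ⟦ d ⟧ ≡ ⟦ e ⟧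
 ⟦⟧-⇔ (yes a) e f g = sym (⟦⟧-yes e (f a))
 ⟦⟧-⇔ (no ¬a) e f g = sym (⟦⟧-no e (λ b → ¬a (g b)))

 module _ {A : ℕ → Set} (A? : ∀ i → Dec (A i)) where

   count-none : ∀ n → (∀ i → ¬ A i) → ∑ℤ n (λ i → ⟦ A? i ⟧) ≡ 0ℤ
   count-none n none = ∑ℤ-vanish n (λ i _ → ⟦⟧-no (A? i) (none i))

   count≤1 : ∀ n → (∀ i j → j ℕ.< n → i ℕ.< j → A i → ¬ A j) → ∑ℤ n (λ i → ⟦ A? i ⟧) ≤ 1ℤ
   count≤1 zero _ = +≤+ z≤n
   count≤1 (suc n) unique with A? n
   ... | yes a = ≤-reflexive (cong (_+ 1ℤ) (∑ℤ-vanish n (λ i i<n → ⟦⟧-no (A? i) (λ b → unique i n ℕₚ.≤-refl i<n b a))))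
   ... | no _ = ≤-trans (≤-reflexive (+-identityʳ (∑ℤ n (λ i → ⟦ A? i ⟧))))
     (count≤1 n (λ i j j<n → unique i j (ℕₚ.m<n⇒m<1+n j<n)))

   count≤2 : ∀ n → (∀ i j k → k ℕ.< n → i ℕ.< j → j ℕ.< k → A i → A j → ¬ A k) → ∑ℤ n (λ i → ⟦ A? i ⟧) ≤ + 2
   count≤2 zero _ = +≤+ z≤n
   count≤2 (suc n) unique with A? n
   ... | yes a = +-monoˡ-≤ 1ℤ (count≤1 n (λ i j j<n i<j b c → unique i j n ℕₚ.≤-refl i<j j<n b c a))
   ... | no _ = ≤-trans (≤-reflexive (+-identityʳ (∑ℤ n (λ i → ⟦ A? i ⟧))))
     (count≤2 n (λ i j k k<n → unique i j k (ℕₚ.m<n⇒m<1+n k<n)))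

 ∣-∸ : ∀ {p} i j → i ℕ.< j → j ℕ.< p → ¬ (+ p ∣ + j - + i)
 ∣-∸ {p} i j i<j j<p d = ℕₚ.<⇒≢ i<j (sym (≈-< j<p (ℕₚ.<-trans i<j j<p) d))

 -- The interface between the Jacobi symbol and the count of ideals. Primes dividing the
 -- discriminant 4Q + 1 ramify, and a root of x² + x - Q modulo an unramified p forces ψ(p) = 1;
 -- this is the direction that bounds the number of ideals from above.
 record SplittingCharacter (Q : ℕ) : Set where
   field
     ψ : ℕ → ℤ
     ψ-1 : ψ 1 ≡ 1ℤ
     ψ-* : ∀ a b → ψ (a ℕ.* b) ≡ ψ a * ψ b
     ψ-values : ∀ a → ψ a ≡ 0ℤ ⊎ (ψ a ≡ 1ℤ ⊎ ψ a ≡ -1ℤ)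
     ψ-ramified : ∀ {p} → Prime p → + p ∣ + 4 * + Q + 1ℤ → ψ p ≡ 0ℤ
     ψ-split : ∀ {p} → Prime p → ¬ (+ p ∣ + 4 * + Q + 1ℤ) → ∀ c → + p ∣ c * c + c - + Q → ψ p ≡ 1ℤ
     ψ-square : ∀ {p} → Prime p → ¬ (+ p ∣ + 4 * + Q + 1ℤ) → ψ p * ψ p ≡ 1ℤ

 SquareFree4Q+1 : ℕ → Set
 SquareFree4Q+1 Q = ∀ {p} → Prime p → ¬ (+ p * + p ∣ + 4 * + Q + 1ℤ)

 -- The norm of c + ω, where ω² = ω + Q.
 normω : ℕ → ℤ → ℤ
 normω Q c = c * c + c - + Q

 -- The number of primitive integral ideals of norm a: they are ℤ a + ℤ (c + ω), with c determined
 -- modulo a.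
 rootCount : ℕ → ℕ → ℤ
 rootCount Q a = ∑ℤ a (λ c → ⟦ + a ∣? normω Q (+ c) ⟧)

 rootCount-nonneg : ∀ Q a → 0ℤ ≤ rootCount Q a
 rootCount-nonneg Q a = ∑ℤ-nonneg a (λ c _ → ⟦⟧-nonneg (+ a ∣? normω Q (+ c)))

 module _ (Q : ℕ) (sqf : SquareFree4Q+1 Q) (χ : SplittingCharacter Q) where

   open SplittingCharacter χ

   private
     q : ℤ
     q = + 4 * + Q + 1ℤ

   private
     taylor : ∀ c a j Q → (a * j + c) * (a * j + c) + (a * j + c) - Q ≡
       (c * c + c - Q) + a * ((+ 2 * c + 1ℤ) * j + a * (j * j))
     taylor = ℤ-ring

   -- Hensel lifting. Above a root c modulo a, with N(c + ω) = f a and derivative d = 2c + 1, the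
   -- roots modulo p a are c + a j, where j is a root modulo p of `quadratic` j = f + d j + a j².
   module Lifts (p : ℕ) (pr : Prime p) (a : ℕ) (a≢0 : a ≢ 0) (c : ℕ) (f : ℤ) (F≡ : normω Q (+ c) ≡ f * + a) where

     d : ℤ
     d = + 2 * + c + 1ℤ

     quadratic : ℤ → ℤ
     quadratic j = f + (d * j + + a * (j * j))

     normω-lift : ∀ j → normω Q (+ a * + j + + c) ≡ quadratic (+ j) * + a
     normω-lift j = trans (taylor (+ c) (+ a) (+ j) (+ Q)) (linear 1ℤ F≡ (identity (normω Q (+ c)) f d (+ j) (+ a)))
       where
       identity : ∀ F f d j a → (F + a * (d * j + a * (j * j))) - (f + (d * j + a * (j * j))) * a ≡ 1ℤ * (F - f * a)
       identity = ℤ-ring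

     -- The lifted quadratic has again the discriminant `q`.
     discriminant : d * d ≡ q + + 4 * (+ a * f)
     discriminant = linear (+ 4) F≡ (identity (+ c) (+ Q) f (+ a))
       where
       identity : ∀ c Q f a → (+ 2 * c + 1ℤ) * (+ 2 * c + 1ℤ) - (+ 4 * Q + 1ℤ + + 4 * (a * f)) ≡ + 4 * ((c * c + c - Q) - f * a)
       identity = ℤ-ring

     Root : ℕ → Set
     Root j = + p ∣ quadratic (+ j)

     root? : ∀ j → Dec (Root j)
     root? j = + p ∣? quadratic (+ j)

     root-split : ∀ j → Root j → + p ∣ normω Q (+ a * + j + + c)
     root-split j r = subst (+ p ∣_) (sym (normω-lift j)) (∣m⇒∣m*n (+ a) r)

     private
       difference : ∀ i j f d a → (f + (d * j + a * (j * j))) - (f + (d * i + a * (i * i))) ≡ (j - i) * (a * (i + j) + d)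
       difference = ℤ-ring

     root-sum : ∀ i j → i ℕ.< j → j ℕ.< p → Root i → Root j → + p ∣ + a * (+ i + + j) + d
     root-sum i j i<j j<p r s = [ (λ e → contradiction e (∣-∸ i j i<j j<p)) , (λ e → e) ]′
       (prime-∣* pr (+ j - + i) (+ a * (+ i + + j) + d)
         (subst (+ p ∣_) (difference (+ i) (+ j) f d (+ a)) (∣m∣n⇒∣m-n s r)))

     -- For three roots i < j < k the relations `root-sum` of (j, k) and (i, k) differ by a (j - i),
     -- which p would have to divide.
     roots≤2 : ¬ (+ p ∣ + a) → ∑ℤ p (λ j → ⟦ root? j ⟧) ≤ + 2
     roots≤2 p∤a = count≤2 root? p λ i j k k<p i<j j<k r s t →
       [ p∤a , ∣-∸ i j i<j (ℕₚ.<-trans j<k k<p) ]′ (prime-∣* pr (+ a) (+ j - + i)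
         (subst (+ p ∣_) (identity (+ a) (+ i) (+ j) (+ k) d)
           (∣m∣n⇒∣m-n (root-sum j k j<k k<p s t) (root-sum i k (ℕₚ.<-trans i<j j<k) k<p r t))))
       where
       identity : ∀ a i j k d → (a * (j + k) + d) - (a * (i + k) + d) ≡ a * (j - i)
       identity = ℤ-ring

     p∤2 : + p ∣ q → ¬ (+ p ∣ + 2)
     p∤2 p∣q p∣2 = prime-∤1 pr (∣m+n∣m⇒∣n p∣q (∣m⇒∣m*n (+ Q) (∣m⇒∣m*n (+ 2) p∣2)))

     -- Completing the square, 4 a `quadratic` j + q = (2 a j + d)². If p ∣ q, each root satisfies 2
     -- a j + d ≡ 0, a linear congruence that determines j because p is odd and does not divide a.
     roots-ramified≤1 : + p ∣ q → ¬ (+ p ∣ + a) → ∑ℤ p (λ j → ⟦ root? j ⟧) ≤ 1ℤ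
     roots-ramified≤1 p∣q p∤a = count≤1 root? p λ i j j<p i<j r s →
       [ p∤2 p∣q , (λ e → [ p∤a , ∣-∸ i j i<j j<p ]′ (prime-∣* pr (+ a) (+ j - + i) e)) ]′
         (prime-∣* pr (+ 2) (+ a * (+ j - + i)) (subst (+ p ∣_) (identity (+ a) (+ i) (+ j) d)
           (∣m∣n⇒∣m-n (double-root j s) (double-root i r))))
       where
       identity : ∀ a i j d → (+ 2 * (a * j) + d) - (+ 2 * (a * i) + d) ≡ + 2 * (a * (j - i))
       identity = ℤ-ring
       complete-square : ∀ a j f d q → d * d ≡ q + + 4 * (a * f) →
         + 4 * a * (f + (d * j + a * (j * j))) + q ≡ (+ 2 * (a * j) + d) * (+ 2 * (a * j) + d)
       complete-square a j f d q e = linear -1ℤ e (identity′ a j f d q)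
         where
         identity′ : ∀ a j f d q → (+ 4 * a * (f + (d * j + a * (j * j))) + q) - (+ 2 * (a * j) + d) * (+ 2 * (a * j) + d) ≡
           -1ℤ * (d * d - (q + + 4 * (a * f)))
         identity′ = ℤ-ring
       double-root : ∀ j → Root j → + p ∣ + 2 * (+ a * + j) + d
       double-root j r = [ (λ e → e) , (λ e → e) ]′ (prime-∣* pr (+ 2 * (+ a * + j) + d) (+ 2 * (+ a * + j) + d)
         (subst (+ p ∣_) (complete-square (+ a) (+ j) f d q discriminant) (∣m∣n⇒∣m+n (∣n⇒∣m*n (+ 4 * + a) r) p∣q)))

     roots-inert : ¬ (+ p ∣ q) → ψ p ≢ 1ℤ → ∑ℤ p (λ j → ⟦ root? j ⟧) ≡ 0ℤ
     roots-inert p∤q ψ≢1 = count-none root? p (λ j r → ψ≢1 (ψ-split pr p∤q (+ a * + j + + c) (root-split j r)))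

     module _ (p∣a : + p ∣ + a) where

       -- Modulo p the quadratic is linear with slope d; two roots would give p ∣ d, and then p ∣ q
       -- by the discriminant.
       roots-tame≤1 : ¬ (+ p ∣ q) → ∑ℤ p (λ j → ⟦ root? j ⟧) ≤ 1ℤ
       roots-tame≤1 p∤q = count≤1 root? p λ i j j<p i<j r s → p∤q
         (∣m+n∣n⇒∣m (subst (+ p ∣_) discriminant (∣m⇒∣m*n d (∣m+n∣m⇒∣n (root-sum i j i<j j<p r s) (∣m⇒∣m*n (+ i + + j) p∣a))))
           (∣n⇒∣m*n (+ 4) (∣m⇒∣m*n f p∣a)))

       -- Square-freeness enters here: p divides d, a root makes p divide f, and then p² divides d²
       -- - 4 a f = q.
       roots-wild : + p ∣ q → ∑ℤ p (λ j → ⟦ root? j ⟧) ≡ 0ℤ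
       roots-wild p∣q = count-none root? p λ j r →
         sqf pr (subst (+ p * + p ∣_) (sym q≡) (∣m∣n⇒∣m-n (*-pres-∣ p∣d p∣d) (∣n⇒∣m*n (+ 4) (*-pres-∣ p∣a (p∣f j r)))))
         where
         *-pres-∣ : ∀ {m n} → + p ∣ m → + p ∣ n → + p * + p ∣ m * n
         *-pres-∣ {m} {n} (divides k e) (divides l g) = divides (k * l) (trans (cong₂ _*_ e g) (identity k l (+ p)))
           where
           identity : ∀ k l p → (k * p) * (l * p) ≡ k * l * (p * p)
           identity = ℤ-ring
         p∣d : + p ∣ d
         p∣d = [ (λ e → e) , (λ e → e) ]′ (prime-∣* pr d d (subst (+ p ∣_) (sym discriminant)
           (∣m∣n⇒∣m+n p∣q (∣n⇒∣m*n (+ 4) (∣m⇒∣m*n f p∣a)))))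
         p∣f : ∀ j → Root j → + p ∣ f
         p∣f j r = ∣m+n∣n⇒∣m r (∣m∣n⇒∣m+n (∣m⇒∣m*n (+ j) p∣d) (∣m⇒∣m*n (+ j * + j) p∣a))
         q≡ : q ≡ d * d - + 4 * (+ a * f)
         q≡ = linear -1ℤ discriminant (identity q d (+ 4 * (+ a * f)))
           where
           identity : ∀ q d t → q - (d * d - t) ≡ -1ℤ * (d * d - (q + t))
           identity = ℤ-ring

   -- Residues modulo p a are written j a + c with c < a. Only roots c modulo a have roots above
   -- them, each at most k.
   rootCount-lift : ∀ p a → a ≢ 0 → ∀ k → 0ℤ ≤ k →
     (∀ c f (F≡ : normω Q (+ c) ≡ f * + a) → ∑ℤ p (λ j → ⟦ + p ∣? (f + ((+ 2 * + c + 1ℤ) * + j + + a * (+ j * + j))) ⟧) ≤ k) →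
     rootCount Q (p ℕ.* a) ≤ k * rootCount Q a
   rootCount-lift p a a≢0 k 0≤k bound = begin
     rootCount Q (p ℕ.* a)
       ≡⟨ ∑ℤ-product p a _ ⟩
     ∑ℤ p (λ j → ∑ℤ a (λ c → ⟦ + (p ℕ.* a) ∣? normω Q (+ (j ℕ.* a ℕ.+ c)) ⟧))
       ≡⟨ ∑ℤ-swap p a _ ⟩
     ∑ℤ a (λ c → ∑ℤ p (λ j → ⟦ + (p ℕ.* a) ∣? normω Q (+ (j ℕ.* a ℕ.+ c)) ⟧))
       ≤⟨ ∑ℤ-mono a (λ c _ → fibre c (+ a ∣? normω Q (+ c))) ⟩
     ∑ℤ a (λ c → k * ⟦ + a ∣? normω Q (+ c) ⟧)
       ≡⟨ ∑ℤ-*ˡ a k _ ⟨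
     k * rootCount Q a ∎
     where
     open ≤-Reasoning
     cast : ∀ j c → + (j ℕ.* a ℕ.+ c) ≡ + a * + j + + c
     cast j c = cong (_+ + c) (trans (cong +_ (ℕₚ.*-comm j a)) (pos-* a j))
     fibre : ∀ c → (dec : Dec (+ a ∣ normω Q (+ c))) → ∑ℤ p (λ j → ⟦ + (p ℕ.* a) ∣? normω Q (+ (j ℕ.* a ℕ.+ c)) ⟧) ≤ k * ⟦ dec ⟧
     fibre c (no ∤) = ≤-reflexive (trans (∑ℤ-vanish p (λ j _ → ⟦⟧-no (+ (p ℕ.* a) ∣? normω Q (+ (j ℕ.* a ℕ.+ c)))
         (λ d → ∤ (∣m+n∣n⇒∣m (subst (+ a ∣_) (trans (cong (normω Q) (cast j c)) (taylor (+ c) (+ a) (+ j) (+ Q)))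
           (∣-trans (divides (+ p) (pos-* p a)) d)) (∣m⇒∣m*n _ ∣-refl))))) (sym (*-zeroʳ k)))
     fibre c (yes (divides f F≡)) = ≤-trans
       (≤-reflexive (∑ℤ-cong p (λ j _ → ⟦⟧-⇔ (+ (p ℕ.* a) ∣? normω Q (+ (j ℕ.* a ℕ.+ c))) (+ p ∣? quadratic (+ j)) (to j) (from j))))
       (≤-trans (bound c f F≡) (≤-reflexive (sym (*-identityʳ k))))
       where
       quadratic : ℤ → ℤ
       quadratic j = f + ((+ 2 * + c + 1ℤ) * j + + a * (j * j))
       lifted : ∀ j → normω Q (+ (j ℕ.* a ℕ.+ c)) ≡ quadratic (+ j) * + a
       lifted j = trans (cong (normω Q) (cast j c)) (trans (taylor (+ c) (+ a) (+ j) (+ Q))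
         (linear 1ℤ F≡ (identity (normω Q (+ c)) f (+ 2 * + c + 1ℤ) (+ j) (+ a))))
         where
         identity : ∀ F f d j a → (F + a * (d * j + a * (j * j))) - (f + (d * j + a * (j * j))) * a ≡ 1ℤ * (F - f * a)
         identity = ℤ-ring
       instance
         a-nonZero : ℤ.NonZero (+ a)
         a-nonZero = ≢-nonZero (λ e → a≢0 (+-injective e))
       to : ∀ j → + (p ℕ.* a) ∣ normω Q (+ (j ℕ.* a ℕ.+ c)) → + p ∣ quadratic (+ j)
       to j e = *-cancelʳ-∣ (+ a) (subst₂ _∣_ (pos-* p a) (lifted j) e)
       from : ∀ j → + p ∣ quadratic (+ j) → + (p ℕ.* a) ∣ normω Q (+ (j ℕ.* a ℕ.+ c))
       from j e = subst₂ _∣_ (sym (pos-* p a)) (sym (lifted j)) (*-monoˡ-∣ (+ a) e)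

   ψ≥-1 : ∀ a → 0ℤ ≤ 1ℤ + ψ a
   ψ≥-1 a = [ (λ e → subst (λ t → 0ℤ ≤ 1ℤ + t) (sym e) (+≤+ z≤n)) ,
     [ (λ e → subst (λ t → 0ℤ ≤ 1ℤ + t) (sym e) (+≤+ z≤n)) , (λ e → subst (λ t → 0ℤ ≤ 1ℤ + t) (sym e) ≤-refl) ]′ ]′ (ψ-values a)

   -- The first power of p multiplies the number of roots by at most 1 + ψ(p), that is by 2, 1 or 0
   -- in the split, ramified and inert cases. Each further power contributes at most ψ(p)², as
   -- `rootCount-∣` shows.
   rootCount-∤ : ∀ {p} → Prime p → ∀ a → a ≢ 0 → ¬ (+ p ∣ + a) → rootCount Q (p ℕ.* a) ≤ (1ℤ + ψ p) * rootCount Q a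
   rootCount-∤ {p} pr a a≢0 p∤a = rootCount-lift p a a≢0 (1ℤ + ψ p) (ψ≥-1 p) bound
     where
     module L = Lifts p pr a a≢0
     bound : ∀ c f (F≡ : normω Q (+ c) ≡ f * + a) → ∑ℤ p (λ j → ⟦ L.root? c f F≡ j ⟧) ≤ 1ℤ + ψ p
     bound c f F≡ with + p ∣? q
     ... | yes p∣q = ≤-trans (L.roots-ramified≤1 c f F≡ p∣q p∤a) (≤-reflexive (cong (_+_ 1ℤ) (sym (ψ-ramified pr p∣q))))
     ... | no p∤q with ψ p ℤₚ.≟ 1ℤ
     ... | yes e = ≤-trans (L.roots≤2 c f F≡ p∤a) (≤-reflexive (cong (_+_ 1ℤ) (sym e)))
     ... | no ψ≢1 = ≤-trans (≤-reflexive (L.roots-inert c f F≡ p∤q ψ≢1)) (ψ≥-1 p)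

   rootCount-∣ : ∀ {p} → Prime p → ∀ a → a ≢ 0 → + p ∣ + a → rootCount Q (p ℕ.* a) ≤ (ψ p * ψ p) * rootCount Q a
   rootCount-∣ {p} pr a a≢0 p∣a = rootCount-lift p a a≢0 (ψ p * ψ p) ψ²≥0 bound
     where
     module L = Lifts p pr a a≢0
     ψ²≥0 : 0ℤ ≤ ψ p * ψ p
     ψ²≥0 = [ (λ e → ≤-reflexive (sym (cong₂ _*_ e e))) ,
       [ (λ e → subst (0ℤ ≤_) (sym (cong₂ _*_ e e)) (+≤+ z≤n)) , (λ e → subst (0ℤ ≤_) (sym (cong₂ _*_ e e)) (+≤+ z≤n)) ]′ ]′ (ψ-values p)
     bound : ∀ c f (F≡ : normω Q (+ c) ≡ f * + a) → ∑ℤ p (λ j → ⟦ L.root? c f F≡ j ⟧) ≤ ψ p * ψ p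
     bound c f F≡ with + p ∣? q
     ... | yes p∣q = ≤-trans (≤-reflexive (L.roots-wild c f F≡ p∣a p∣q)) ψ²≥0
     ... | no p∤q = ≤-trans (L.roots-tame≤1 c f F≡ p∣a p∤q) (≤-reflexive (sym (ψ-square pr p∤q)))

 -- The character of ℚ(√q)

 even-prime : ∀ m → Prime (m ℕ.+ m) → m ℕ.+ m ≡ 2
 even-prime m pr = [ (λ ()) , sym ]′ (prime⇒irreducible pr (ℕ∣.divides m (trans (cong (m ℕ.+_) (sym (ℕₚ.+-identityʳ m))) (ℕₚ.*-comm 2 m))))

 -- Four consecutive signs multiply to 1. By `jacobi-2` this is the supplementary law (2 / q) = 1
 -- for q ≡ 1 modulo 8.
 ∏-ε-blocks : ∀ n → ∏ℤ (n ℕ.* 4) (λ k → ε (suc k)) ≡ 1ℤ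
 ∏-ε-blocks zero = refl
 ∏-ε-blocks (suc n) = trans (cong (λ t → t * - e * - - e * - - - e * - - - - e) (∏-ε-blocks n)) (trans (fourth e) (cong₂ _*_ (ε-square (n ℕ.* 4)) (ε-square (n ℕ.* 4))))
   where
   e : ℤ
   e = ε (n ℕ.* 4)
   fourth : ∀ e → 1ℤ * - e * - - e * - - - e * - - - - e ≡ e * e * (e * e)
   fourth = ℤ-ring

 module _ (R : ℕ) (R≢0 : R ≢ 0) where

   -- The discriminant is q = 8 R + 1 = 4 Q + 1 = `odd P`.
   Q P : ℕ
   Q = R ℕ.+ R
   P = Q ℕ.+ Q

   private
     P≢0 : P ≢ 0
     P≢0 e = R≢0 (ℕₚ.m+n≡0⇒m≡0 R (ℕₚ.m+n≡0⇒m≡0 Q e))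

     4Q+1 : + 4 * + Q + 1ℤ ≡ + odd P
     4Q+1 = trans (cong (_+ 1ℤ) (sym (pos-* 4 Q))) (trans (sym (pos-+ (4 ℕ.* Q) 1)) (cong +_ (identity Q)))
       where
       identity : ∀ Q → 4 ℕ.* Q ℕ.+ 1 ≡ suc ((Q ℕ.+ Q) ℕ.+ (Q ℕ.+ Q))
       identity = ℕ-ring

   ε-P* : ∀ A → ε (P ℕ.* A) ≡ 1ℤ
   ε-P* A = trans (cong ε (ℕₚ.*-distribʳ-+ A Q Q)) (ε-double (Q ℕ.* A))

   module _ (sqf : SquareFree (odd P)) where

     squareFreeℤ : SquareFree4Q+1 Q
     squareFreeℤ {p} pr d = sqf pr (subst₂ ℕ∣._∣_ (abs-* (+ p) (+ p)) (cong ∣_∣ 4Q+1) (∣⇒∣ᵤ d))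

     modulus : CharacterModulus P
     modulus = squareFree⇒modulus P sqf

     private
       ∤q : ∀ {p} → ¬ (+ p ∣ + 4 * + Q + 1ℤ) → ¬ (+ p ∣ + odd P)
       ∤q {p} h d = h (subst (+ p ∣_) (sym 4Q+1) d)

       odd-unit : ∀ {A} → Prime (odd A) → ¬ (+ odd A ∣ + odd P) → IsUnit (odd P) (+ odd A)
       odd-unit {A} pr h = unit-swap (prime-unit A pr (+ odd P) h)

       two-unit : IsUnit (odd P) (+ 2)
       two-unit = unit-swap (1ℤ , divides (+ P) (trans (cong (λ t → t * 1ℤ - 1ℤ) (trans (cong +_ (ℕₚ.+-comm 1 (P ℕ.+ P))) (trans (pos-+ (P ℕ.+ P) 1) (cong (_+ 1ℤ) (pos-+ P P))))) (identity (+ P))))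
         where
         identity : ∀ P → (P + P + 1ℤ) * 1ℤ - 1ℤ ≡ P * + 2
         identity = ℤ-ring

       -- As P is even, reciprocity carries no sign, and modulo the prime the number q = 4Q + 1 is
       -- congruent to the square (2c + 1)².
       split-odd : ∀ {A} → Prime (odd A) → ¬ (+ odd A ∣ + odd P) → ∀ c → + odd A ∣ normω Q c → jacobi P (+ odd A) ≡ 1ℤ
       split-odd {A} pr h c d = trans (sym (*-identityʳ (jacobi P (+ odd A)))) (trans (cong (jacobi P (+ odd A) *_) (sym residue))
         (trans (reciprocity P A (odd-unit {A} pr h)) (ε-P* A)))
         where
         x : ℤ
         x = + 2 * c + 1ℤ
         congruent : + odd P ≈ x * x [ odd A ]
         congruent = subst (+ odd A ∣_) (trans (identity c (+ Q)) (cong (_- x * x) 4Q+1)) (∣n⇒∣m*n (- + 4) d)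
           where
           identity : ∀ c Q → - + 4 * (c * c + c - Q) ≡ + 4 * Q + 1ℤ - (+ 2 * c + 1ℤ) * (+ 2 * c + 1ℤ)
           identity = ℤ-ring
         x-unit : IsUnit (odd A) x
         x-unit = unit-*⁻ x x (unit-cong (+ odd P) (x * x) congruent (prime-unit A pr (+ odd P) h))
         residue : jacobi A (+ odd P) ≡ 1ℤ
         residue = trans (jacobi-cong A (+ odd P) (x * x) congruent) (trans (jacobi-* A x x) (jacobi-square A x x-unit))

       split-2 : jacobi P (+ 2) ≡ 1ℤ
       split-2 = trans (jacobi-2 P) (trans (cong (λ n → ∏ℤ n (λ k → ε (suc k))) (identity R)) (∏-ε-blocks R))
         where
         identity : ∀ R → (R ℕ.+ R) ℕ.+ (R ℕ.+ R) ≡ R ℕ.* 4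
         identity = ℕ-ring

       by-parity : ∀ {p} → Prime p → {B : ℕ → Set} → B 2 → (∀ A → Prime (odd A) → B (odd A)) → B p
       by-parity {p} pr {B} two odds = [ (λ { (m , refl) → subst B (sym (even-prime m pr)) two }) , (λ { (A , refl) → odds A pr }) ]′ (even-or-odd p)

     splittingCharacter : SplittingCharacter Q
     splittingCharacter = record
       { ψ = λ n → jacobi P (+ n)
       ; ψ-1 = jacobi-1 P
       ; ψ-* = λ a b → trans (cong (jacobi P) (pos-* a b)) (jacobi-* P (+ a) (+ b))
       ; ψ-values = λ a → jacobi-values P P≢0 (ε-double Q) modulus (+ a)
       ; ψ-ramified = λ {p} pr d → nonunit⇒0 P (+ p) (λ u → prime-∤1 pr (unit-∣ (+ p) 1ℤ (unit-coarsen (+ p) (subst (+ p ∣_) 4Q+1 d) u) (divides 1ℤ (*-comm (+ p) 1ℤ))))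
       ; ψ-split = λ {p} pr h c d → by-parity pr {λ p → ¬ (+ p ∣ + 4 * + Q + 1ℤ) → + p ∣ normω Q c → jacobi P (+ p) ≡ 1ℤ} (λ _ _ → split-2) (λ A pr h d → split-odd {A} pr (∤q {odd A} h) c d) h d
       ; ψ-square = λ {p} pr h → jacobi-square P (+ p) (by-parity pr {λ p → ¬ (+ p ∣ + 4 * + Q + 1ℤ) → IsUnit (odd P) (+ p)} (λ _ → two-unit) (λ A pr h → odd-unit {A} pr (∤q {odd A} h)) h)
       }

 -- Units and the sector of negative norms

 -- The half-plane points z + y √q (up to sign) with z y ≥ 0 and norm less than −y².
 record InSector (q : ℕ.ℕ) (z y : ℤ) : Set where
   constructor inSector
   field
     0≤zy : 0ℤ ≤ z * y
     z²< : z * z < (+ q - 1ℤ) * (y * y)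

 private
   0≤+ : ∀ {i j} → 0ℤ ≤ i → 0ℤ ≤ j → 0ℤ ≤ i + j
   0≤+ = +-mono-≤

   0≤* : ∀ {i j} → 0ℤ ≤ i → 0ℤ ≤ j → 0ℤ ≤ i * j
   0≤* {i} {j} 0≤i 0≤j = subst (_≤ i * j) (*-zeroʳ i) (*-monoˡ-≤-nonNeg i {{nonNegative 0≤i}} 0≤j)

   0<square : ∀ {i} → i ≢ 0ℤ → 0ℤ < i * i
   0<square {i} i≢0 = ≤∧≢⇒< (square-nonneg i) (λ e → [ i≢0 , i≢0 ]′ (i*j≡0⇒i≡0∨j≡0 i (sym e)))

   ≢0⇒1≤square : ∀ {i} → i ≢ 0ℤ → 0ℤ ≤ i * i - 1ℤ
   ≢0⇒1≤square {i} i≢0 = i≤j⇒0≤j-i {1ℤ} (i<j⇒suc[i]≤j (0<square i≢0))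

   gap : ∀ q z y → InSector q z y → 0ℤ < (+ q - 1ℤ) * (y * y) - z * z
   gap q z y (inSector _ h) = subst (_< (+ q - 1ℤ) * (y * y) - z * z) (+-inverseʳ (z * z)) (+-monoˡ-< (- (z * z)) h)

   contradictory : ∀ {x y} → 0ℤ < x → x ≡ - y → 0ℤ ≤ y → ∀ {A : Set} → A
   contradictory 0<x refl 0≤y = contradiction (<-≤-trans 0<x (neg-mono-≤ 0≤y)) (<-irrefl refl)

 square≡1⇒±1 : ∀ s → s * s ≡ 1ℤ → s ≡ 1ℤ ⊎ s ≡ -1ℤ
 square≡1⇒±1 s e = [ (λ h → inj₁ (i-j≡0⇒i≡j s 1ℤ h)) , (λ h → inj₂ (i-j≡0⇒i≡j s -1ℤ h)) ]′
   (i*j≡0⇒i≡0∨j≡0 (s - 1ℤ) (trans (factor s) (i≡j⇒i-j≡0 {s * s} e)))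
   where
   factor : ∀ s → (s - 1ℤ) * (s - -1ℤ) ≡ s * s - 1ℤ
   factor = ℤ-ring

 scale-sector : ∀ q p {z y} → p ≢ 0ℤ → InSector q z y → InSector q (p * z) (p * y)
 scale-sector q p {z} {y} p≢0 (inSector h k) = inSector
   (subst (0ℤ ≤_) (lhs p z y) (0≤* (square-nonneg p) h))
   (subst₂ _<_ (left p z) (right p (+ q) y) (*-monoˡ-<-pos (p * p) {{positive (0<square p≢0)}} k))
   where
   lhs : ∀ p z y → p * p * (z * y) ≡ p * z * (p * y)
   lhs = ℤ-ring
   left : ∀ p z → p * p * (z * z) ≡ p * z * (p * z)
   left = ℤ-ring
   right : ∀ p q y → p * p * ((q - 1ℤ) * (y * y)) ≡ (q - 1ℤ) * (p * y * (p * y))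
   right = ℤ-ring

 module _ (q : ℕ.ℕ) where

   private
     D : ℤ
     D = + q

     0≤D : 0ℤ ≤ D
     0≤D = +≤+ ℕ.z≤n

   private
     simplify : ∀ T → T * T - D * (0ℤ * 0ℤ) ≡ T * T
     simplify T = trans (cong (λ t → T * T - t) (*-zeroʳ D)) (+-identityʳ (T * T))

     double : ∀ {i} → 0ℤ ≤ i → 0ℤ ≤ + 2 * i
     double = 0≤* {+ 2} (+≤+ ℕ.z≤n)

     -- The gap (D - 1) y² - z² of the image is minus a sum of nonnegative terms. The term D (U² -
     -- 1) B² shows how U² ≥ 1 meets the bound z² < (q - 1) y² of the sector.
     same-expands : ∀ {T U A B C E} → U ≢ 0ℤ → 0ℤ ≤ T * U → T * T - D * (U * U) ≡ 1ℤ → InSector q A B → InSector q C E →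
       T * A + D * (U * B) ≡ C → T * B + U * A ≡ E → ∀ {X : Set} → X
     same-expands {T} {U} {A} {B} U≢0 TU N≡ (inSector AB _) h refl refl = contradictory (gap q _ _ h)
       (linear {l = T * T - D * (U * U)} (D * (B * B) - A * A - B * B) N≡ (identity T U A B D))
       (0≤+ (0≤+ (0≤+ (0≤+ (square-nonneg A) (square-nonneg B)) (0≤* (0≤* 0≤D (≢0⇒1≤square U≢0)) (square-nonneg B)))
         (double (0≤* TU AB))) (0≤* (square-nonneg U) (square-nonneg A)))
       where
       identity : ∀ T U A B D → (D - 1ℤ) * ((T * B + U * A) * (T * B + U * A)) - (T * A + D * (U * B)) * (T * A + D * (U * B)) -
         (- (A * A + B * B + D * (U * U - 1ℤ) * (B * B) + + 2 * (T * U * (A * B)) + U * U * (A * A))) ≡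
         (D * (B * B) - A * A - B * B) * ((T * T - D * (U * U)) - 1ℤ)
       identity = ℤ-ring

     -- The relation is (T + U √q)(A + B √q) = √q (C + E √q), so D E rather than E is given by the
     -- unit. The gap of (C, E) is multiplied by D² to clear this factor, and then it is minus a sum
     -- of nonnegative terms.
     cross-expands : ∀ {T U A B C E} → U ≢ 0ℤ → 0ℤ ≤ T * U → T * T - D * (U * U) ≡ -1ℤ → InSector q A B → InSector q C E → 0ℤ < D →
       T * A + D * (U * B) ≡ D * E → T * B + U * A ≡ C → ∀ {X : Set} → X
     cross-expands {T} {U} {A} {B} {_} {E} U≢0 TU N≡ (inSector AB _) h 0<D e refl =
       contradictory (subst (_< D * D * ((D - 1ℤ) * (E * E) - (T * B + U * A) * (T * B + U * A))) (*-zeroʳ (D * D)) (*-monoˡ-<-pos (D * D) {{positive (0<square (λ D≡0 → <-irrefl (sym D≡0) 0<D))}} (gap q _ _ h)))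
         (linear₂ {l = T * T - D * (U * U)} {l′ = T * A + D * (U * B)} (D * (A * A - D * (B * B))) (- ((D - 1ℤ) * (T * A + D * (U * B) + D * E))) N≡ e (identity T U A B D E))
         (0≤+ (0≤+ (0≤+ (0≤* (0≤* (square-nonneg D) (≢0⇒1≤square U≢0)) (square-nonneg B)) (0≤* 0≤D (square-nonneg A)))
           (0≤* (square-nonneg T) (square-nonneg A))) (double (0≤* 0≤D (0≤* TU AB))))
       where
       identity : ∀ T U A B D E → D * D * ((D - 1ℤ) * (E * E) - (T * B + U * A) * (T * B + U * A)) -
         (- (D * D * (U * U - 1ℤ) * (B * B) + D * (A * A) + T * T * (A * A) + + 2 * (D * (T * U * (A * B))))) ≡
         D * (A * A - D * (B * B)) * ((T * T - D * (U * U)) - -1ℤ) + - ((D - 1ℤ) * (T * A + D * (U * B) + D * E)) * (T * A + D * (U * B) - D * E)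
       identity = ℤ-ring

     -- For T U ≤ 0 the same relation is solved for (A, B), and it is the gap of (A, B) that cannot
     -- be positive.
     cross-contracts : ∀ {T U A B C E} → U ≢ 0ℤ → 0ℤ ≤ - T * U → T * T - D * (U * U) ≡ -1ℤ → InSector q A B → InSector q C E →
       A ≡ D * (U * C - T * E) → B ≡ D * (U * E) - T * C → ∀ {X : Set} → X
     cross-contracts {T} {U} {_} {_} {C} {E} U≢0 TU N≡ h (inSector CE _) refl refl = contradictory (gap q _ _ h)
       (linear {l = T * T - D * (U * U)} (- (D * (D * (E * E) - C * C))) N≡ (identity T U C E D))
       (0≤+ (0≤+ (0≤+ (0≤* (0≤* (square-nonneg D) (≢0⇒1≤square U≢0)) (square-nonneg E)) (0≤* 0≤D (square-nonneg C)))
         (0≤* (square-nonneg T) (square-nonneg C))) (double (0≤* 0≤D (0≤* TU CE))))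
       where
       identity : ∀ T U C E D → (D - 1ℤ) * ((D * (U * E) - T * C) * (D * (U * E) - T * C)) - D * (U * C - T * E) * (D * (U * C - T * E)) -
         (- (D * D * (U * U - 1ℤ) * (E * E) + D * (C * C) + T * T * (C * C) + + 2 * (D * (- T * U * (C * E))))) ≡
         - (D * (D * (E * E) - C * C)) * ((T * T - D * (U * U)) - -1ℤ)
       identity = ℤ-ring

     -- A unit of norm -1 would turn the negative norm of a point of the sector into a positive one.
     same-sign : ∀ T U A B → T * T - D * (U * U) ≡ -1ℤ → InSector q A B → InSector q (T * A + D * (U * B)) (T * B + U * A) → ∀ {X : Set} → X
     same-sign T U A B N≡ h k = contradictory (gap q _ _ k)
       (linear {l = T * T - D * (U * U)} (D * (B * B) - A * A) N≡ (identity T U A B D))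
       (0≤+ (0≤+ (<⇒≤ (gap q _ _ h)) (square-nonneg B)) (square-nonneg (T * B + U * A)))
       where
       identity : ∀ T U A B D → (D - 1ℤ) * ((T * B + U * A) * (T * B + U * A)) - (T * A + D * (U * B)) * (T * A + D * (U * B)) -
         (- ((D - 1ℤ) * (B * B) - A * A + B * B + (T * B + U * A) * (T * B + U * A))) ≡ (D * (B * B) - A * A) * ((T * T - D * (U * U)) - -1ℤ)
       identity = ℤ-ring

     -- Multiplication by √q reverses the sign of the norm, whereas a unit of norm 1 preserves it.
     cross-sign : ∀ T U A B E → 0ℤ < D → T * T - D * (U * U) ≡ 1ℤ → InSector q A B → InSector q (T * B + U * A) E →
       T * A + D * (U * B) ≡ D * E → ∀ {X : Set} → X
     cross-sign T U A B E 0<D N≡ h k e = contradictory (subst (_< D * ((D - 1ℤ) * (E * E) - (T * B + U * A) * (T * B + U * A))) (*-zeroʳ D) (*-monoˡ-<-pos D {{positive 0<D}} (gap q _ _ k)))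
       (linear₂ {l = T * T - D * (U * U)} {l′ = T * A + D * (U * B)} (A * A - D * (B * B)) (- (T * A + D * (U * B) + D * E)) N≡ e (identity T U A B D E))
       (0≤+ (0≤+ (<⇒≤ (gap q _ _ h)) (square-nonneg B)) (0≤* 0≤D (square-nonneg E)))
       where
       identity : ∀ T U A B D E → D * ((D - 1ℤ) * (E * E) - (T * B + U * A) * (T * B + U * A)) -
         (- ((D - 1ℤ) * (B * B) - A * A + B * B + D * (E * E))) ≡
         (A * A - D * (B * B)) * ((T * T - D * (U * U)) - 1ℤ) + - (T * A + D * (U * B) + D * E) * (T * A + D * (U * B) - D * E)
       identity = ℤ-ring

     negated : ∀ i → i ≤ 0ℤ → 0ℤ ≤ - i
     negated i = neg-mono-≤

   -- A unit T + U √q ≠ ±1 moves the whole sector out of itself.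
   same-sector : ∀ {T U s A B C E} → s * s ≡ 1ℤ → T * T - D * (U * U) ≡ s → InSector q A B → InSector q C E →
     T * A + D * (U * B) ≡ C → T * B + U * A ≡ E → U ≡ 0ℤ × T * T ≡ 1ℤ
   same-sector {T} {U} {s} {A} {B} {C} {E} s² N≡ h k e f with U ℤₚ.≟ 0ℤ
   ... | yes refl = refl , [ (λ { refl → trans (sym (simplify T)) N≡ }) , (λ { refl → same-sign T U A B N≡ h (subst₂ (InSector q) (sym e) (sym f) k) }) ]′ (square≡1⇒±1 s s²)
   ... | no U≢0 = [ (λ { refl → [ (λ TU → same-expands {T} {U} U≢0 TU N≡ h k e f) , (λ TU → same-expands {T} { - U} (λ z → U≢0 (neg-injective z)) (subst (0ℤ ≤_) (neg-distribʳ-* T U) (negated (T * U) TU))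
       (trans (squares T U D) N≡) k h
       (linear₃ {l = T * T - D * (U * U)} {l′ = T * A + D * (U * B)} {l″ = T * B + U * A} A (- T) (D * U) N≡ e f (inverse₁ T U A B C E D))
       (linear₃ {l = T * T - D * (U * U)} {l′ = T * A + D * (U * B)} {l″ = T * B + U * A} B U (- T) N≡ e f (inverse₂ T U A B C E D))) ]′ (≤-total 0ℤ (T * U)) })
     , (λ { refl → same-sign T U A B N≡ h (subst₂ (InSector q) (sym e) (sym f) k) }) ]′ (square≡1⇒±1 s s²)
     where
     squares : ∀ T U D → T * T - D * (- U * - U) ≡ T * T - D * (U * U)
     squares = ℤ-ring
     inverse₁ : ∀ T U A B C E D → T * C + D * (- U * E) - A ≡
       A * (T * T - D * (U * U) - 1ℤ) + - T * (T * A + D * (U * B) - C) + D * U * (T * B + U * A - E)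
     inverse₁ = ℤ-ring
     inverse₂ : ∀ T U A B C E D → T * E + - U * C - B ≡
       B * (T * T - D * (U * U) - 1ℤ) + U * (T * A + D * (U * B) - C) + - T * (T * B + U * A - E)
     inverse₂ = ℤ-ring

   -- This separates the lattices from their multiples by √q. Signs of norms exclude units of norm
   -- 1; a unit of norm -1 has U ≠ 0 and carries one of the two points out of the sector, which one
   -- depending on the sign of T U.
   cross-sector : ∀ {T U s A B C E} → 0ℤ < D → s * s ≡ 1ℤ → T * T - D * (U * U) ≡ s → InSector q A B → InSector q C E →
     T * A + D * (U * B) ≡ D * E → T * B + U * A ≡ C → ∀ {X : Set} → X
   cross-sector {T} {U} {s} {A} {B} {C} {E} 0<D s² N≡ h k e f =
     [ (λ { refl → cross-sign T U A B E 0<D N≡ h (subst (λ C → InSector q C E) (sym f) k) e })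
     , (λ { refl → [ (λ TU → cross-expands {T} {U} (U≢0 N≡) TU N≡ h k 0<D e f) , (λ TU → cross-contracts {T} {U} (U≢0 N≡) (subst (0ℤ ≤_) (neg-distribˡ-* T U) (negated (T * U) TU)) N≡ h k
       (linear₃ {l = T * T - D * (U * U)} {l′ = T * A + D * (U * B)} {l″ = T * B + U * A} A (- T) (D * U) N≡ e f (inverse₁ T U A B C E D))
       (linear₃ {l = T * T - D * (U * U)} {l′ = T * A + D * (U * B)} {l″ = T * B + U * A} B U (- T) N≡ e f (inverse₂ T U A B C E D))) ]′ (≤-total 0ℤ (T * U)) }) ]′ (square≡1⇒±1 s s²)
     where
     U≢0 : T * T - D * (U * U) ≡ -1ℤ → U ≢ 0ℤ
     U≢0 N refl = contradiction (subst (0ℤ ≤_) (trans (sym (simplify T)) N) (square-nonneg T)) λ ()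
     inverse₁ : ∀ T U A B C E D → A - D * (U * C - T * E) ≡
       A * (T * T - D * (U * U) - -1ℤ) + - T * (T * A + D * (U * B) - D * E) + D * U * (T * B + U * A - C)
     inverse₁ = ℤ-ring
     inverse₂ : ∀ T U A B C E D → B - (D * (U * E) - T * C) ≡
       B * (T * T - D * (U * U) - -1ℤ) + U * (T * A + D * (U * B) - D * E) + - T * (T * B + U * A - C)
     inverse₂ = ℤ-ring

 difference-of-squares : ∀ {W j} → j ℕ.≤ W → + ((W ∸ j) ℕ.* (W ℕ.+ j)) ≡ + W * + W - + j * + j
 difference-of-squares {W} {j} j≤W = trans (pos-* (W ∸ j) (W ℕ.+ j)) (trans (cong₂ _*_ (sym (trans (m-n≡m⊖n W j) (⊖-≥ j≤W))) (pos-+ W j)) (identity (+ W) (+ j)))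
   where
   identity : ∀ W j → (W - j) * (W + j) ≡ W * W - j * j
   identity = ℤ-ring

 private
   square-mono : ∀ {m n} → m ℕ.≤ n → + m * + m ≤ + n * + n
   square-mono {m} {n} h = subst₂ _≤_ (pos-* m m) (pos-* n n) (ℤ.+≤+ (ℕₚ.*-mono-≤ h h))

   square-mono-< : ∀ {m n} → m ℕ.< n → + m * + m < + n * + n
   square-mono-< {m} {n} h = subst₂ _<_ (pos-* m m) (pos-* n n) (ℤ.+<+ (ℕₚ.*-mono-< h h))

 -- The j-th wedge consists of the points whose slope z / y lies between j / g and (j + 1) / g. The
 -- integer w = g z avoids fractions.
 module WedgePoint (q g W J j y w : ℕ) (z : ℤ) {{_ : NonZero g}} (gz≡w : + g * z ≡ + w)
   (jy≤w : j ℕ.* y ℕ.≤ w) (w<[1+j]y : w ℕ.< suc j ℕ.* y) where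

   private
     instance
       gg : ℤ.Positive (+ g * + g)
       gg = ℤ.positive (subst (0ℤ <_) (pos-* g g) (ℤ.+<+ (ℕ.>-nonZero⁻¹ (g ℕ.* g) {{ℕₚ.m*n≢0 g g}})))
       g>0 : ℤ.Positive (+ g)
       g>0 = ℤ.positive (ℤ.+<+ (ℕ.>-nonZero⁻¹ g))

     square-trace : + g * + g * (z * z) ≡ + w * + w
     square-trace = trans (identity (+ g) z) (cong₂ _*_ gz≡w gz≡w)
       where
       identity : ∀ g z → g * g * (z * z) ≡ g * z * (g * z)
       identity = ℤ-ring

   wedge-sector : suc j ℕ.≤ J → J ℕ.* J ℕ.+ g ℕ.* g ℕ.≤ q ℕ.* (g ℕ.* g) → InSector q z (+ y)
   wedge-sector j<J J² = inSector
     (*-cancelˡ-≤-pos 0ℤ (z * + y) (+ g) (subst₂ _≤_ (sym (*-zeroʳ (+ g))) (trans (pos-* w y) (trans (cong (_* + y) (sym gz≡w)) (*-assoc (+ g) z (+ y)))) (ℤ.+≤+ z≤n)))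
     (*-cancelˡ-<-nonNeg (+ g * + g) {{ℤ.nonNegative (<⇒≤ (positive⁻¹ (+ g * + g)))}} (begin-strict
       + g * + g * (z * z) ≡⟨ square-trace ⟩
       + w * + w <⟨ square-mono-< (ℕₚ.<-≤-trans w<[1+j]y (ℕₚ.*-monoˡ-≤ y j<J)) ⟩
       + (J ℕ.* y) * + (J ℕ.* y) ≡⟨ trans (cong (λ t → t * t) (pos-* J y)) (commute (+ J) (+ y)) ⟩
       + J * + J * (+ y * + y) ≤⟨ *-monoʳ-≤-nonNeg (+ y * + y) {{ℤ.nonNegative (square-nonneg (+ y))}} J²ℤ ⟩
       (+ q - 1ℤ) * (+ g * + g) * (+ y * + y) ≡⟨ regroup (+ q) (+ g) (+ y) ⟩
       + g * + g * ((+ q - 1ℤ) * (+ y * + y)) ∎))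
     where
     open ≤-Reasoning
     commute : ∀ J y → J * y * (J * y) ≡ J * J * (y * y)
     commute = ℤ-ring
     regroup : ∀ q g y → (q - 1ℤ) * (g * g) * (y * y) ≡ g * g * ((q - 1ℤ) * (y * y))
     regroup = ℤ-ring
     J²ℤ : + J * + J ≤ (+ q - 1ℤ) * (+ g * + g)
     J²ℤ = subst₂ _≤_ (cancel (+ J * + J) (+ g * + g)) (factor (+ q) (+ g * + g)) (+-monoˡ-≤ (- (+ g * + g))
       (subst₂ _≤_ (trans (pos-+ (J ℕ.* J) (g ℕ.* g)) (cong₂ _+_ (pos-* J J) (pos-* g g))) (trans (pos-* q (g ℕ.* g)) (cong (+ q *_) (pos-* g g))) (ℤ.+≤+ J²)))
       where
       cancel : ∀ x y → x + y - y ≡ x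
       cancel = ℤ-ring
       factor : ∀ q x → q * x - x ≡ (q - 1ℤ) * x
       factor = ℤ-ring

   -- The negative of four times the norm is at most D y² / g² in the j-th wedge, D = W² − j².
   wedge-norm : ∀ {M aZ² N} → q ℕ.* (g ℕ.* g) ℕ.≤ W ℕ.* W → j ℕ.≤ W → y ℕ.≤ M → (W ∸ j) ℕ.* (W ℕ.+ j) ℕ.* (M ℕ.* M) ℕ.≤ 4 ℕ.* (g ℕ.* g) ℕ.* aZ² →
     + 4 * N ≡ z * z - + q * (+ y * + y) → - N ≤ + aZ²
   wedge-norm {M} {aZ²} {N} gq≤W² j≤W y≤M DM² 4N≡ = *-cancelˡ-≤-pos (- N) (+ aZ²) (+ 4) (*-cancelˡ-≤-pos (+ 4 * - N) (+ 4 * + aZ²) (+ g * + g) (begin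
     + g * + g * (+ 4 * - N) ≡⟨ linear₂ {l = + 4 * N} {l′ = + g * + g * (z * z)} (- (+ g * + g)) -1ℤ 4N≡ square-trace (identity (+ g) N z (+ q) (+ y) (+ w)) ⟩
     + q * (+ g * + g) * (+ y * + y) - + w * + w ≤⟨ +-mono-≤ (*-monoʳ-≤-nonNeg (+ y * + y) {{ℤ.nonNegative (square-nonneg (+ y))}} gqℤ) (neg-mono-≤ (square-mono jy≤w)) ⟩
     + W * + W * (+ y * + y) - + (j ℕ.* y) * + (j ℕ.* y) ≡⟨ trans (cong (λ t → + W * + W * (+ y * + y) - t * t) (pos-* j y)) (factor (+ W) (+ j) (+ y)) ⟩
     (+ W * + W - + j * + j) * (+ y * + y) ≡⟨ cong₂ _*_ (sym (difference-of-squares j≤W)) refl ⟩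
     + D * (+ y * + y) ≤⟨ *-monoˡ-≤-nonNeg (+ D) (square-mono y≤M) ⟩
     + D * (+ M * + M) ≡⟨ trans (cong (+ D *_) (sym (pos-* M M))) (sym (pos-* D (M ℕ.* M))) ⟩
     + (D ℕ.* (M ℕ.* M)) ≤⟨ ℤ.+≤+ DM² ⟩
     + (4 ℕ.* (g ℕ.* g) ℕ.* aZ²) ≡⟨ trans (pos-* (4 ℕ.* (g ℕ.* g)) aZ²) (trans (cong (_* + aZ²) (trans (pos-* 4 (g ℕ.* g)) (cong (+ 4 *_) (pos-* g g)))) (commute (+ g) (+ aZ²))) ⟩
     + g * + g * (+ 4 * + aZ²) ∎))
     where
     open ≤-Reasoning
     D : ℕ
     D = (W ∸ j) ℕ.* (W ℕ.+ j)
     gqℤ : + q * (+ g * + g) ≤ + W * + W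
     gqℤ = subst₂ _≤_ (trans (pos-* q (g ℕ.* g)) (cong (+ q *_) (pos-* g g))) (pos-* W W) (ℤ.+≤+ gq≤W²)
     identity : ∀ g N z q y w → g * g * (+ 4 * - N) - (q * (g * g) * (y * y) - w * w) ≡
       - (g * g) * (+ 4 * N - (z * z - q * (y * y))) + -1ℤ * (g * g * (z * z) - w * w)
     identity = ℤ-ring
     factor : ∀ W j y → W * W * (y * y) - j * y * (j * y) ≡ (W * W - j * j) * (y * y)
     factor = ℤ-ring
     commute : ∀ g x → + 4 * (g * g) * x ≡ g * g * (+ 4 * x)
     commute = ℤ-ring

-- The number of ideals of given norm is bounded by a divisor sum of the character

module DivisorSums where

 open import Data.Integer.Base hiding (suc; pred; _^_)
 open import Data.Integer.Properties hiding (_≤?_; _<?_)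
 open import Data.Integer.Divisibility.Signed using (∣⇒∣ᵤ; ∣ᵤ⇒∣) renaming (_∣_ to _∣ℤ_; _∣?_ to _∣ℤ?_; divides to dividesℤ)
 open import Data.List.Base using ([]; _∷_)
 open import Data.List.Relation.Unary.All using ([]; _∷_)
 open import Data.Nat.Base using (_^_)
 open import Data.Nat.Divisibility using (_∣_; divides; _∣?_; ∣-trans; ∣⇒≤; m∣m*n; n∣m*n; *-cancelˡ-∣; *-monoʳ-∣; ∣n⇒∣m*n; ∣m⇒∣m*n; ∣m+n∣m⇒∣n)
 open import Data.Nat.ListAction using (product)
 open import Data.Nat.Primality.Factorisation using (factorise)
 open Congruence using (linear)
 open IntegerCharacters

 module _ (p : ℕ) .{{_ : ℕ.NonZero p}} where

   avoid : (ℕ → ℤ) → ℕ → ℤ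
   avoid f k with p ∣? k
   ... | yes _ = 0ℤ
   ... | no _ = f k

   ∑-multiples : ∀ B f → ∑ℤ (B ℕ.* p) f ≡ ∑ℤ B (λ a → f (a ℕ.* p)) + ∑ℤ (B ℕ.* p) (avoid f)
   ∑-multiples B f = trans (∑ℤ-cong (B ℕ.* p) (λ k _ → split k))
     (trans (∑ℤ-+ (B ℕ.* p) only (avoid f)) (cong (_+ ∑ℤ (B ℕ.* p) (avoid f))
       (trans (∑ℤ-product B p only) (∑ℤ-cong B (λ a _ → block a)))))
     where
     only : ℕ → ℤ
     only k with p ∣? k
     ... | yes _ = f k
     ... | no _ = 0ℤ
     split : ∀ k → f k ≡ only k + avoid f k
     split k with p ∣? k
     ... | yes _ = sym (+-identityʳ (f k))
     ... | no _ = sym (+-identityˡ (f k))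
     only-∣ : ∀ {k} → p ∣ k → only k ≡ f k
     only-∣ {k} d with p ∣? k
     ... | yes _ = refl
     ... | no ∤ = contradiction d ∤
     only-∤ : ∀ {k} → ¬ (p ∣ k) → only k ≡ 0ℤ
     only-∤ {k} ∤ with p ∣? k
     ... | yes d = contradiction d ∤
     ... | no _ = refl
     block : ∀ a → ∑ℤ p (λ b → only (a ℕ.* p ℕ.+ b)) ≡ f (a ℕ.* p)
     block a = trans (∑ℤ-single p 0 (λ b → only (a ℕ.* p ℕ.+ b)) (ℕ.>-nonZero⁻¹ p)
         (λ b b<p b≢0 → only-∤ (λ d → ℕₚ.<⇒≱ b<p (∣⇒≤ {{ℕ.≢-nonZero b≢0}} (∣m+n∣m⇒∣n d (n∣m*n a))))))
       (trans (cong only (ℕₚ.+-identityʳ (a ℕ.* p))) (only-∣ (n∣m*n a)))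

 primeDivisor : ∀ n → 1 ℕ.< n → ∃[ p ] Prime p × p ∣ n
 primeDivisor n 1<n with factorise n {{ℕ.>-nonZero (ℕₚ.<-trans ℕ.z<s 1<n)}}
 ... | record { factors = [] ; isFactorisation = e } = contradiction (sym e) (ℕₚ.<⇒≢ 1<n)
 ... | record { factors = p ∷ ps ; isFactorisation = e ; factorsPrime = pr ∷ _ } = p , pr , subst (p ∣_) (sym e) (m∣m*n (product ps))

 prime-∤⇒coprime : ∀ {p} → Prime p → ∀ {m} → ¬ (p ∣ m) → ∀ {k} → p ∣ m ℕ.* k → p ∣ k
 prime-∤⇒coprime pr {m} ∤ {k} d = [ (λ e → contradiction e ∤) , (λ e → e) ]′ (euclidsLemma m k pr d)

 prime-cancel : ∀ {p} → Prime p → ∀ {k} → ¬ (p ∣ k) → ∀ {n} → k ∣ p ℕ.* n → k ∣ n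
 prime-cancel {p} pr {k} ∤ {n} (divides t e) with prime-∤⇒coprime pr ∤ (divides n (trans (trans (ℕₚ.*-comm k t) (sym e)) (ℕₚ.*-comm p n)))
 ... | divides s t≡ = divides s (ℕₚ.*-cancelˡ-≡ n (s ℕ.* k) p {{prime⇒nonZero pr}} (trans e (trans (cong (ℕ._* k) t≡) (identity s p k))))
   where
   identity : ∀ s p k → s ℕ.* p ℕ.* k ≡ p ℕ.* (s ℕ.* k)
   identity = ℕ-ring

 prime-cancel-^ : ∀ {p} → Prime p → ∀ {k} → ¬ (p ∣ k) → ∀ e {m} → k ∣ p ^ e ℕ.* m → k ∣ m
 prime-cancel-^ pr ∤ zero {m} d = subst (_ ∣_) (ℕₚ.*-identityˡ m) d
 prime-cancel-^ {p} pr {k} ∤ (suc e) {m} d = prime-cancel-^ pr ∤ e (prime-cancel pr ∤ (subst (k ∣_) (ℕₚ.*-assoc p (p ^ e) m) d))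

 module _ (Q : ℕ) (sqf : SquareFree4Q+1 Q) (χ : SplittingCharacter Q) where

   open SplittingCharacter χ

   private
     ρ : ℕ → ℤ
     ρ = rootCount Q

   quotientTerm : ∀ {k n} → Dec (k ∣ n) → ℤ
   quotientTerm (yes (divides t _)) = ρ t
   quotientTerm (no _) = 0ℤ

   squareTerm : ℕ → ℕ → ℤ
   squareTerm k n = quotientTerm (k ℕ.* k ∣? n)

   -- The number of ideals of norm n: the rational factor k, times a primitive ideal of norm n / k².
   idealCount : ℕ → ℤ
   idealCount n = ∑ℤ (suc n) (λ k → squareTerm k n)

   divisorTerm : ℕ → ℕ → ℤ
   divisorTerm n d = ⟦ d ∣? n ⟧ * ψ d

   divisorSum : ℕ → ℤ
   divisorSum n = ∑ℤ (suc n) (divisorTerm n)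

   squareTerm-≡ : ∀ k n t → k ≢ 0 → n ≡ t ℕ.* (k ℕ.* k) → squareTerm k n ≡ ρ t
   squareTerm-≡ k n t k≢0 e with k ℕ.* k ∣? n
   ... | no ∤ = contradiction (divides t e) ∤
   ... | yes (divides s f) = cong ρ (ℕₚ.*-cancelʳ-≡ s t (k ℕ.* k) {{ℕₚ.m*n≢0 k k {{ℕ.≢-nonZero k≢0}} {{ℕ.≢-nonZero k≢0}}}} (trans (sym f) e))

   squareTerm-∤ : ∀ k n → ¬ (k ℕ.* k ∣ n) → squareTerm k n ≡ 0ℤ
   squareTerm-∤ k n ∤ with k ℕ.* k ∣? n
   ... | yes d = contradiction d ∤
   ... | no _ = refl

   squareTerm-nonneg : ∀ k n → 0ℤ ≤ squareTerm k n
   squareTerm-nonneg k n with k ℕ.* k ∣? n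
   ... | yes (divides t _) = rootCount-nonneg Q t
   ... | no _ = ≤-refl

   squareTerm-0 : ∀ {n} → n ≢ 0 → squareTerm 0 n ≡ 0ℤ
   squareTerm-0 {n} n≢0 = squareTerm-∤ 0 n λ { (divides t e) → n≢0 (trans e (ℕₚ.*-zeroʳ t)) }

   idealCount-extend : ∀ {n} → n ≢ 0 → ∀ {B} → n ℕ.< B → ∑ℤ B (λ k → squareTerm k n) ≡ idealCount n
   idealCount-extend {n} n≢0 n<B = ∑ℤ-extend-≡ _ n<B λ k n<k → squareTerm-∤ k n λ d →
     ℕₚ.<⇒≱ n<k (ℕₚ.≤-trans (ℕₚ.m≤m*n k k {{ℕ.>-nonZero (ℕₚ.≤-<-trans z≤n n<k)}}) (∣⇒≤ {{ℕ.≢-nonZero n≢0}} d))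

   divisorSum-extend : ∀ {n} → n ≢ 0 → ∀ {B} → n ℕ.< B → ∑ℤ B (divisorTerm n) ≡ divisorSum n
   divisorSum-extend {n} n≢0 n<B = ∑ℤ-extend-≡ _ n<B λ d n<d → trans (cong (_* ψ d) (⟦⟧-no (d ∣? n) λ e →
     ℕₚ.<⇒≱ n<d (∣⇒≤ {{ℕ.≢-nonZero n≢0}} e))) (*-zeroˡ (ψ d))

   module _ {p : ℕ} (pr : Prime p) where

     private
       instance
         p≢0 : ℕ.NonZero p
         p≢0 = prime⇒nonZero pr
       s : ℤ
       s = ψ p
       pⁿ≢0 : ∀ e {m} → m ≢ 0 → p ^ e ℕ.* m ≢ 0
       pⁿ≢0 e {m} m≢0 = ℕ.≢-nonZero⁻¹ _ {{ℕₚ.m*n≢0 (p ^ e) m {{ℕₚ.m^n≢0 p e}} {{ℕ.≢-nonZero m≢0}}}}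

     -- The factors at p, with s = ψ(p): `localRoots e` bounds the primitive ideals of norm pᵉ,
     -- `localIdeals e` bounds all ideals of that norm by splitting off a rational factor p, and
     -- `localDivisors e` is 1 + s + ... + sᵉ in Horner form.
     localRoots : ℕ → ℤ
     localRoots zero = 1ℤ
     localRoots (suc zero) = 1ℤ + s
     localRoots (suc (suc e)) = (s * s) * localRoots (suc e)

     localIdeals : ℕ → ℤ
     localIdeals zero = 1ℤ
     localIdeals (suc zero) = 1ℤ + s
     localIdeals (suc (suc e)) = localIdeals e + localRoots (suc (suc e))

     localDivisors : ℕ → ℤ
     localDivisors zero = 1ℤ
     localDivisors (suc e) = s * localDivisors e + 1ℤ

     private
       s-cases : s ≡ 0ℤ ⊎ s * s ≡ 1ℤ
       s-cases = [ inj₁ , (λ h → inj₂ ([ (λ e → cong₂ _*_ e e) , (λ e → cong₂ _*_ e e) ]′ h)) ]′ (ψ-values p)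

       1+s≥0 : 0ℤ ≤ 1ℤ + s
       1+s≥0 = ψ≥-1 Q sqf χ p

       s²≥0 : 0ℤ ≤ s * s
       s²≥0 = [ (λ e → ≤-reflexive (sym (cong₂ _*_ e e))) , (λ e → subst (0ℤ ≤_) (sym e) (+≤+ z≤n)) ]′ s-cases

       *-nonneg : ∀ {i j} → 0ℤ ≤ i → 0ℤ ≤ j → 0ℤ ≤ i * j
       *-nonneg {+ m} {+ n} _ _ = subst (0ℤ ≤_) (pos-* m n) (+≤+ z≤n)

     localRoots-nonneg : ∀ e → 0ℤ ≤ localRoots e
     localRoots-nonneg zero = +≤+ z≤n
     localRoots-nonneg (suc zero) = 1+s≥0
     localRoots-nonneg (suc (suc e)) = *-nonneg s²≥0 (localRoots-nonneg (suc e))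

     localIdeals-nonneg : ∀ e → 0ℤ ≤ localIdeals e
     localIdeals-nonneg zero = +≤+ z≤n
     localIdeals-nonneg (suc zero) = 1+s≥0
     localIdeals-nonneg (suc (suc e)) = +-mono-≤ (localIdeals-nonneg e) (localRoots-nonneg (suc (suc e)))

     -- From e to e + 2 both sides grow by 1 + s if s² = 1, and both stay equal to 1 if s = 0.
     localIdeals≡localDivisors : ∀ e → localIdeals e ≡ localDivisors e
     localIdeals≡localDivisors zero = refl
     localIdeals≡localDivisors (suc zero) = identity s
       where
       identity : ∀ s → 1ℤ + s ≡ s * 1ℤ + 1ℤ
       identity = ℤ-ring
     localIdeals≡localDivisors (suc (suc e)) = [ ramified , unramified ]′ s-cases
       where
       unramified : s * s ≡ 1ℤ → localIdeals e + localRoots (suc (suc e)) ≡ s * (s * localDivisors e + 1ℤ) + 1ℤ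
       unramified s² = trans (cong₂ _+_ (localIdeals≡localDivisors e) (roots (suc e)))
         (linear (- localDivisors e) s² (identity s (localDivisors e)))
         where
         roots : ∀ e → localRoots (suc e) ≡ 1ℤ + s
         roots zero = refl
         roots (suc e) = trans (cong₂ _*_ s² (roots e)) (*-identityˡ (1ℤ + s))
         identity : ∀ s g → (g + (1ℤ + s)) - (s * (s * g + 1ℤ) + 1ℤ) ≡ (- g) * (s * s - 1ℤ)
         identity = ℤ-ring
       ramified : s ≡ 0ℤ → localIdeals e + localRoots (suc (suc e)) ≡ s * (s * localDivisors e + 1ℤ) + 1ℤ
       ramified s≡0 = trans (cong₂ _+_ (trans (localIdeals≡localDivisors e) (one e))
           (trans (cong (λ t → t * t * localRoots (suc e)) s≡0) (*-zeroˡ (localRoots (suc e)))))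
         (sym (trans (cong (λ t → t * (s * localDivisors e + 1ℤ) + 1ℤ) s≡0) (cong (_+ 1ℤ) (*-zeroˡ (s * localDivisors e + 1ℤ)))))
         where
         one : ∀ e → localDivisors e ≡ 1ℤ
         one zero = refl
         one (suc e) = trans (cong (λ t → t * localDivisors e + 1ℤ) s≡0) (cong (_+ 1ℤ) (*-zeroˡ (localDivisors e)))

     rootCount-^ : ∀ e m → m ≢ 0 → ¬ (p ∣ m) → ρ (p ^ e ℕ.* m) ≤ localRoots e * ρ m
     rootCount-^ zero m m≢0 p∤m = ≤-reflexive (trans (cong ρ (ℕₚ.*-identityˡ m)) (sym (*-identityˡ (ρ m))))
     rootCount-^ (suc zero) m m≢0 p∤m = subst (λ t → ρ (t ℕ.* m) ≤ (1ℤ + s) * ρ m) (sym (ℕₚ.*-identityʳ p))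
       (rootCount-∤ Q sqf χ pr m m≢0 (λ d → p∤m (∣⇒∣ᵤ d)))
     rootCount-^ (suc (suc e)) m m≢0 p∤m = begin
       ρ (p ^ suc (suc e) ℕ.* m) ≡⟨ cong ρ (ℕₚ.*-assoc p (p ^ suc e) m) ⟩
       ρ (p ℕ.* (p ^ suc e ℕ.* m)) ≤⟨ rootCount-∣ Q sqf χ pr (p ^ suc e ℕ.* m) (pⁿ≢0 (suc e) m≢0)
                                                 (∣ᵤ⇒∣ (∣m⇒∣m*n m (m∣m*n (p ^ e)))) ⟩
       (s * s) * ρ (p ^ suc e ℕ.* m) ≤⟨ *-monoˡ-≤-nonNeg (s * s) {{nonNegative s²≥0}} (rootCount-^ (suc e) m m≢0 p∤m) ⟩
       (s * s) * (localRoots (suc e) * ρ m) ≡⟨ *-assoc (s * s) (localRoots (suc e)) (ρ m) ⟨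
       (s * s) * localRoots (suc e) * ρ m ∎
       where open ≤-Reasoning

     private
       avoiding : ∀ e {m} → m ≢ 0 → ¬ (p ∣ m) → ∀ B → m ℕ.< B →
         ∑ℤ B (avoid p (λ k → squareTerm k (p ^ e ℕ.* m))) ≤ localRoots e * idealCount m
       avoiding e {m} m≢0 p∤m B m<B = ≤-trans (∑ℤ-mono B (λ k _ → pointwise k))
         (≤-reflexive (trans (sym (∑ℤ-*ˡ B (localRoots e) (λ k → squareTerm k m))) (cong (localRoots e *_) (idealCount-extend m≢0 m<B))))
         where
         nonneg : ∀ k → 0ℤ ≤ localRoots e * squareTerm k m
         nonneg k = *-nonneg (localRoots-nonneg e) (squareTerm-nonneg k m)
         coprime-case : ∀ k → ¬ (p ∣ k) → Dec (k ℕ.* k ∣ m) → squareTerm k (p ^ e ℕ.* m) ≤ localRoots e * squareTerm k m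
         coprime-case k p∤k (no ∤) = ≤-trans (≤-reflexive (squareTerm-∤ k (p ^ e ℕ.* m) (λ d → ∤ (prime-cancel-^ pr
           (λ p∣k² → [ p∤k , p∤k ]′ (euclidsLemma k k pr p∣k²)) e d)))) (nonneg k)
         coprime-case zero p∤0 _ = contradiction (divides 0 refl) p∤0
         coprime-case k@(suc _) p∤k (yes (divides t m≡)) = begin
           squareTerm k (p ^ e ℕ.* m) ≡⟨ squareTerm-≡ k (p ^ e ℕ.* m) (p ^ e ℕ.* t) (λ ()) (trans (cong (p ^ e ℕ.*_) m≡) (sym (ℕₚ.*-assoc (p ^ e) t (k ℕ.* k)))) ⟩
           ρ (p ^ e ℕ.* t) ≤⟨ rootCount-^ e t (λ t≡0 → m≢0 (trans m≡ (cong (ℕ._* (k ℕ.* k)) t≡0))) (λ d → p∤m (subst (p ∣_) (sym m≡) (∣m⇒∣m*n (k ℕ.* k) d))) ⟩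
           localRoots e * ρ t ≡⟨ cong (localRoots e *_) (squareTerm-≡ k m t (λ ()) m≡) ⟨
           localRoots e * squareTerm k m ∎
           where open ≤-Reasoning
         pointwise : ∀ k → avoid p (λ k → squareTerm k (p ^ e ℕ.* m)) k ≤ localRoots e * squareTerm k m
         pointwise k with p ∣? k
         ... | yes _ = nonneg k
         ... | no p∤k = coprime-case k p∤k (k ℕ.* k ∣? m)

       split : ∀ n → n ≢ 0 → idealCount n ≡
         ∑ℤ (suc n) (λ a → squareTerm (a ℕ.* p) n) + ∑ℤ (suc n ℕ.* p) (avoid p (λ k → squareTerm k n))
       split n n≢0 = trans (sym (idealCount-extend n≢0 (ℕₚ.m≤m*n (suc n) p))) (∑-multiples p (suc n) (λ k → squareTerm k n))

       bigger : ∀ n {m} → m ℕ.≤ n → m ℕ.< suc n ℕ.* p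
       bigger n m≤n = ℕₚ.<-≤-trans (s≤s m≤n) (ℕₚ.m≤m*n (suc n) p)

       m≤pᵉm : ∀ e m → m ℕ.≤ p ^ e ℕ.* m
       m≤pᵉm e m = ℕₚ.m≤n*m m (p ^ e) {{ℕₚ.m^n≢0 p e}}

       [ap]² : ∀ a → (a ℕ.* p) ℕ.* (a ℕ.* p) ≡ p ℕ.* (p ℕ.* (a ℕ.* a))
       [ap]² a = identity a p
         where
         identity : ∀ a p → (a ℕ.* p) ℕ.* (a ℕ.* p) ≡ p ℕ.* (p ℕ.* (a ℕ.* a))
         identity = ℕ-ring

     -- The rational factors k are split by divisibility by p. Those that p divides correspond to
     -- ideals of norm p^(e - 2) m; for the others k² ∣ pᵉ m is the same as k² ∣ m, and the roots
     -- modulo the quotient are bounded by `rootCount-^`.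
     idealCount-^ : ∀ e m → m ≢ 0 → ¬ (p ∣ m) → idealCount (p ^ e ℕ.* m) ≤ localIdeals e * idealCount m
     idealCount-^ zero m m≢0 p∤m = ≤-reflexive (trans (cong idealCount (ℕₚ.*-identityˡ m)) (sym (*-identityˡ (idealCount m))))
     idealCount-^ (suc zero) m m≢0 p∤m = begin
       idealCount n
         ≡⟨ split n (pⁿ≢0 1 m≢0) ⟩
       ∑ℤ (suc n) (λ a → squareTerm (a ℕ.* p) n) + ∑ℤ (suc n ℕ.* p) (avoid p (λ k → squareTerm k n))
         ≡⟨ cong (_+ ∑ℤ (suc n ℕ.* p) (avoid p (λ k → squareTerm k n))) (∑ℤ-vanish (suc n) (λ a _ → squareTerm-∤ (a ℕ.* p) n (no-square a))) ⟩
       0ℤ + ∑ℤ (suc n ℕ.* p) (avoid p (λ k → squareTerm k n))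
         ≡⟨ +-identityˡ _ ⟩
       ∑ℤ (suc n ℕ.* p) (avoid p (λ k → squareTerm k n))
         ≤⟨ avoiding 1 m≢0 p∤m (suc n ℕ.* p) (bigger n (m≤pᵉm 1 m)) ⟩
       (1ℤ + s) * idealCount m ∎
       where
       open ≤-Reasoning
       n : ℕ
       n = p ^ 1 ℕ.* m
       no-square : ∀ a → ¬ ((a ℕ.* p) ℕ.* (a ℕ.* p) ∣ n)
       no-square a d = p∤m (∣-trans (m∣m*n (a ℕ.* a)) (*-cancelˡ-∣ p (subst₂ _∣_ ([ap]² a) (cong (ℕ._* m) (ℕₚ.*-identityʳ p)) d)))
     idealCount-^ (suc (suc e)) m m≢0 p∤m = begin
       idealCount n
         ≡⟨ split n (pⁿ≢0 (suc (suc e)) m≢0) ⟩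
       ∑ℤ (suc n) (λ a → squareTerm (a ℕ.* p) n) + ∑ℤ (suc n ℕ.* p) (avoid p (λ k → squareTerm k n))
         ≡⟨ cong (_+ ∑ℤ (suc n ℕ.* p) (avoid p (λ k → squareTerm k n))) (trans
              (∑ℤ-cong (suc n) (λ a _ → descend a)) (idealCount-extend n′≢0 (s≤s n′≤n))) ⟩
       idealCount n′ + ∑ℤ (suc n ℕ.* p) (avoid p (λ k → squareTerm k n))
         ≤⟨ +-mono-≤ (idealCount-^ e m m≢0 p∤m) (avoiding (suc (suc e)) m≢0 p∤m (suc n ℕ.* p) (bigger n (m≤pᵉm (suc (suc e)) m))) ⟩
       localIdeals e * idealCount m + localRoots (suc (suc e)) * idealCount m
         ≡⟨ *-distribʳ-+ (idealCount m) (localIdeals e) (localRoots (suc (suc e))) ⟨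
       localIdeals (suc (suc e)) * idealCount m ∎
       where
       open ≤-Reasoning
       n n′ : ℕ
       n = p ^ suc (suc e) ℕ.* m
       n′ = p ^ e ℕ.* m
       n′≢0 : n′ ≢ 0
       n′≢0 = pⁿ≢0 e m≢0
       n≡ : n ≡ p ℕ.* (p ℕ.* n′)
       n≡ = identity p (p ^ e) m
         where
         identity : ∀ p t m → p ℕ.* (p ℕ.* t) ℕ.* m ≡ p ℕ.* (p ℕ.* (t ℕ.* m))
         identity = ℕ-ring
       n′≤n : n′ ℕ.≤ n
       n′≤n = subst (n′ ℕ.≤_) (sym n≡) (ℕₚ.≤-trans (ℕₚ.m≤n*m n′ p) (ℕₚ.m≤n*m (p ℕ.* n′) p))
       descend : ∀ a → squareTerm (a ℕ.* p) n ≡ squareTerm a n′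
       descend zero = trans (squareTerm-0 (pⁿ≢0 (suc (suc e)) m≢0)) (sym (squareTerm-0 n′≢0))
       descend a@(suc _) with a ℕ.* a ∣? n′
       ... | yes (divides t n′≡) = squareTerm-≡ (a ℕ.* p) n t (ℕ.≢-nonZero⁻¹ _ {{ℕₚ.m*n≢0 a p}})
         (trans n≡ (trans (cong (λ t → p ℕ.* (p ℕ.* t)) n′≡) (identity a p t)))
         where
         identity : ∀ a p t → p ℕ.* (p ℕ.* (t ℕ.* (a ℕ.* a))) ≡ t ℕ.* ((a ℕ.* p) ℕ.* (a ℕ.* p))
         identity = ℕ-ring
       ... | no ∤ = squareTerm-∤ (a ℕ.* p) n λ d → ∤ (*-cancelˡ-∣ p (*-cancelˡ-∣ p (subst₂ _∣_ ([ap]² a) n≡ d)))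

     -- A divisor a p of n corresponds to the divisor a of n / p with the additional weight s; the
     -- divisors prime to p are those of m.
     divisorSum-^ : ∀ e m → m ≢ 0 → ¬ (p ∣ m) → divisorSum (p ^ e ℕ.* m) ≡ localDivisors e * divisorSum m
     divisorSum-^ zero m m≢0 p∤m = trans (cong divisorSum (ℕₚ.*-identityˡ m)) (sym (*-identityˡ (divisorSum m)))
     divisorSum-^ (suc e) m m≢0 p∤m = begin
       divisorSum n
         ≡⟨ divisorSum-extend (pⁿ≢0 (suc e) m≢0) (ℕₚ.m≤m*n (suc n) p) ⟨
       ∑ℤ (suc n ℕ.* p) (divisorTerm n)
         ≡⟨ ∑-multiples p (suc n) (divisorTerm n) ⟩
       ∑ℤ (suc n) (λ a → divisorTerm n (a ℕ.* p)) + ∑ℤ (suc n ℕ.* p) (avoid p (divisorTerm n))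
         ≡⟨ cong₂ _+_
              (trans (∑ℤ-cong (suc n) (λ a _ → descend a)) (trans (sym (∑ℤ-*ˡ (suc n) s (divisorTerm n′)))
                (cong (s *_) (trans (divisorSum-extend (pⁿ≢0 e m≢0) (s≤s n′≤n)) (divisorSum-^ e m m≢0 p∤m)))))
              (trans (∑ℤ-cong (suc n ℕ.* p) (λ k _ → keep k)) (divisorSum-extend m≢0 (bigger n (m≤pᵉm (suc e) m)))) ⟩
       s * (localDivisors e * divisorSum m) + divisorSum m
         ≡⟨ identity s (localDivisors e) (divisorSum m) ⟩
       localDivisors (suc e) * divisorSum m ∎
       where
       open ≡-Reasoning
       n n′ : ℕ
       n = p ^ suc e ℕ.* m
       n′ = p ^ e ℕ.* m
       n≡ : n ≡ p ℕ.* n′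
       n≡ = ℕₚ.*-assoc p (p ^ e) m
       n′≤n : n′ ℕ.≤ n
       n′≤n = subst (n′ ℕ.≤_) (sym n≡) (ℕₚ.m≤n*m n′ p)
       identity : ∀ s g d → s * (g * d) + d ≡ (s * g + 1ℤ) * d
       identity = ℤ-ring
       rotate : ∀ s x y → x * (y * s) ≡ s * (x * y)
       rotate = ℤ-ring
       descend : ∀ a → divisorTerm n (a ℕ.* p) ≡ s * divisorTerm n′ a
       descend a = trans (cong₂ _*_ (⟦⟧-⇔ (a ℕ.* p ∣? n) (a ∣? n′)
           (λ d → *-cancelˡ-∣ p (subst₂ _∣_ (ℕₚ.*-comm a p) n≡ d))
           (λ d → subst₂ _∣_ (ℕₚ.*-comm p a) (sym n≡) (*-monoʳ-∣ p d))) (ψ-* a p))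
         (rotate s ⟦ a ∣? n′ ⟧ (ψ a))
       keep : ∀ k → avoid p (divisorTerm n) k ≡ divisorTerm m k
       keep k with p ∣? k
       ... | yes p∣k = sym (trans (cong (_* ψ k) (⟦⟧-no (k ∣? m) (λ d → p∤m (∣-trans p∣k d)))) (*-zeroˡ (ψ k)))
       ... | no p∤k = cong (_* ψ k) (⟦⟧-⇔ (k ∣? n) (k ∣? m) (prime-cancel-^ pr p∤k (suc e)) (∣n⇒∣m*n (p ^ suc e)))

   strip : ∀ {p} → Prime p → ∀ b n → n ℕ.≤ b → n ≢ 0 → ∃₂ λ e m → n ≡ p ^ e ℕ.* m × m ≢ 0 × ¬ (p ∣ m)
   strip pr zero zero z≤n n≢0 = contradiction refl n≢0
   strip {p} pr (suc b) n n≤ n≢0 with p ∣? n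
   ... | no ∤ = 0 , n , sym (ℕₚ.*-identityˡ n) , n≢0 , ∤
   ... | yes (divides n′ n≡) with strip pr b n′ (ℕ.s≤s⁻¹ (ℕₚ.<-≤-trans n′<n n≤)) n′≢0
     where
     n′≢0 : n′ ≢ 0
     n′≢0 e = n≢0 (trans n≡ (cong (ℕ._* p) e))
     n′<n : n′ ℕ.< n
     n′<n = subst (n′ ℕ.<_) (sym n≡) (ℕₚ.m<m*n n′ p {{ℕ.≢-nonZero n′≢0}} (ℕ.nonTrivial⇒n>1 p {{prime⇒nonTrivial pr}}))
   ... | e , m , n′≡ , m≢0 , ∤ = suc e , m , trans n≡ (trans (cong (ℕ._* p) n′≡) (identity (p ^ e) m p)) , m≢0 , ∤
     where
     identity : ∀ t m p → t ℕ.* m ℕ.* p ≡ p ℕ.* t ℕ.* m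
     identity = ℕ-ring

   -- Induction over n with the bound b as fuel: the full power of one prime is stripped off, and
   -- its local factors on the two sides agree.
   idealCount≤divisorSum : ∀ n → n ≢ 0 → idealCount n ≤ divisorSum n
   idealCount≤divisorSum n = go n n ℕₚ.≤-refl
     where
     go : ∀ b n → n ℕ.≤ b → n ≢ 0 → idealCount n ≤ divisorSum n
     go zero zero z≤n n≢0 = contradiction refl n≢0
     go (suc b) zero _ n≢0 = contradiction refl n≢0
     go (suc b) (suc zero) _ _ = ≤-reflexive (trans one (sym (trans (+-identityˡ _)
       (trans (cong (_* ψ 1) (⟦⟧-yes (1 ∣? 1) (divides 1 refl))) (trans (*-identityˡ (ψ 1)) ψ-1)))))
       where
       w : ℤ
       w = normω Q 0ℤ
       one : idealCount 1 ≡ 1ℤ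
       one = trans (cong₂ _+_ (trans (+-identityˡ (squareTerm 0 1)) (squareTerm-0 {1} (λ ()))) (squareTerm-≡ 1 1 1 (λ ()) refl))
         (trans (+-identityˡ (ρ 1)) (trans (+-identityˡ ⟦ 1ℤ ∣ℤ? w ⟧) (⟦⟧-yes (1ℤ ∣ℤ? w) (dividesℤ w (sym (*-identityʳ w))))))
     go (suc b) n@(suc (suc _)) n≤ n≢0 with primeDivisor n (s≤s (s≤s z≤n))
     ... | p , pr , p∣n with strip pr n n ℕₚ.≤-refl n≢0
     ... | zero , m , n≡ , m≢0 , p∤m = contradiction (subst (p ∣_) (trans n≡ (ℕₚ.*-identityˡ m)) p∣n) p∤m
     ... | suc e , m , n≡ , m≢0 , p∤m = begin
       idealCount n ≡⟨ cong idealCount n≡ ⟩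
       idealCount (p ^ suc e ℕ.* m) ≤⟨ idealCount-^ pr (suc e) m m≢0 p∤m ⟩
       localIdeals pr (suc e) * idealCount m ≤⟨ *-monoˡ-≤-nonNeg (localIdeals pr (suc e)) {{nonNegative (localIdeals-nonneg pr (suc e))}}
                                                    (go b m (ℕ.s≤s⁻¹ (ℕₚ.<-≤-trans m<n n≤)) m≢0) ⟩
       localIdeals pr (suc e) * divisorSum m ≡⟨ cong (_* divisorSum m) (localIdeals≡localDivisors pr (suc e)) ⟩
       localDivisors pr (suc e) * divisorSum m ≡⟨ divisorSum-^ pr (suc e) m m≢0 p∤m ⟨
       divisorSum (p ^ suc e ℕ.* m) ≡⟨ cong divisorSum n≡ ⟨
       divisorSum n ∎
       where
       open ≤-Reasoning
       m<n : m ℕ.< n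
       m<n = subst (m ℕ.<_) (sym n≡) (subst (m ℕ.<_) (ℕₚ.*-comm m (p ^ suc e))
         (ℕₚ.m<m*n m (p ^ suc e) {{ℕ.≢-nonZero m≢0}} (ℕₚ.<-≤-trans (ℕ.nonTrivial⇒n>1 p {{prime⇒nonTrivial pr}})
           (ℕₚ.m≤m*n p (p ^ e) {{ℕₚ.m^n≢0 p e {{prime⇒nonZero pr}}}}))))

-- Integer estimates for lattice points in thin wedges

module Wedges where

 import Data.Integer.DivMod as ℤ/
 open import Data.Nat.Base
 open import Data.Nat.DivMod
 open import Data.Nat.Properties
 open import Defs using (isqrt; isqrt-lower; isqrt-upper)
 open Congruence using (linear)

 -- The sum of ⌊y / E⌋ over y ≤ M. In the row y of a wedge g z runs through a progression of step E
 -- = 2 a g inside an interval of length y, so ⌊y / E⌋ points are guaranteed.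
 rows : (E : ℕ) .{{_ : NonZero E}} → ℕ → ℕ
 rows E zero = 0
 rows E (suc M) = suc M / E + rows E M

 n≤[1+n/E]*E : ∀ n E .{{_ : NonZero E}} → n ≤ E * suc (n / E)
 n≤[1+n/E]*E n E = subst₂ _≤_ (sym (m≡m%n+[m/n]*n n E)) (*-comm (suc (n / E)) E) (+-monoˡ-≤ (n / E * E) (<⇒≤ (m%n<n n E)))

 rows-lower : ∀ E .{{_ : NonZero E}} M → M * M ≤ 2 * E * (rows E M + M)
 rows-lower E zero = z≤n
 rows-lower E (suc M) = begin
   suc M * suc M ≤⟨ m≤m+n (suc M * suc M) 1 ⟩
   suc M * suc M + 1 ≡⟨ square M ⟩
   M * M + 2 * suc M ≤⟨ +-mono-≤ (rows-lower E M) (*-monoʳ-≤ 2 (n≤[1+n/E]*E (suc M) E)) ⟩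
   2 * E * (rows E M + M) + 2 * (E * suc (suc M / E)) ≡⟨ regroup E (rows E M) M (suc M / E) ⟩
   2 * E * ((suc M / E + rows E M) + suc M) ∎
   where
   open ≤-Reasoning
   square : ∀ M → suc M * suc M + 1 ≡ M * M + 2 * suc M
   square = ℕ-ring
   regroup : ∀ E r M d → 2 * E * (r + M) + 2 * (E * suc d) ≡ 2 * E * ((d + r) + suc M)
   regroup = ℕ-ring

 -- `D` is going to be W² - j². In the j-th wedge the norm is at least -D y² / (4 g²), so the
 -- condition D M² ≤ X = 4 a g² Z² ensures that the rows up to `M` hold only points of index at most
 -- Z².
 module Count (a g Z D : ℕ) {{_ : NonZero a}} {{_ : NonZero g}} {{_ : NonZero Z}} {{_ : NonZero D}} where

   E X M : ℕ
   E = 2 * a * g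
   X = 2 * E * (g * (Z * Z))
   M = isqrt (X / D)

   instance
     E≢0 : NonZero E
     E≢0 = m*n≢0 (2 * a) g {{m*n≢0 2 a}}

   M-bound : D * (M * M) ≤ X
   M-bound = ≤-trans (*-monoʳ-≤ D (isqrt-lower (X / D))) (subst (_≤ X) (*-comm (X / D) D) (m/n*n≤m X D))

   X-bound : X ≤ D * (suc M * suc M)
   X-bound = ≤-trans (n≤[1+n/E]*E X D) (*-monoʳ-≤ D (isqrt-upper (X / D)))

   M≤EZ : M ≤ E * Z
   M≤EZ with M ≤? E * Z
   ... | yes p = p
   ... | no ¬p = contradiction (≤-trans (≤-trans (m≤n*m (M * M) D) M-bound) X≤) (<⇒≱ (*-mono-< (≰⇒> ¬p) (≰⇒> ¬p)))
     where
     X≤ : X ≤ E * Z * (E * Z)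
     X≤ = subst₂ _≤_ (identity g E Z) (square E Z) (*-monoˡ-≤ (E * (Z * Z)) (*-monoˡ-≤ g (m≤m*n 2 a)))
       where
       identity : ∀ g E Z → 2 * g * (E * (Z * Z)) ≡ 2 * E * (g * (Z * Z))
       identity = ℕ-ring
       square : ∀ E Z → E * (E * (Z * Z)) ≡ E * Z * (E * Z)
       square = ℕ-ring

   -- D M² is nearly X = 2 E g Z², and the rows hold about M² / (2 E) points; this gives the main
   -- term g Z² / D. Rounding `M` and every row costs at most a multiple of E Z.
   count-lower : g * (Z * Z) ≤ D * (rows E M + 4 * (E * Z))
   count-lower = *-cancelˡ-≤ (2 * E) {{m*n≢0 2 E}} (begin
     2 * E * (g * (Z * Z)) ≤⟨ X-bound ⟩
     D * (suc M * suc M) ≡⟨ cong (D *_) (expand M) ⟩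
     D * (M * M + 2 * M + 1) ≤⟨ *-monoʳ-≤ D (+-mono-≤ (+-mono-≤ (rows-lower E M) (*-monoʳ-≤ 2 (m≤n*m M E))) 1≤2EEZ) ⟩
     D * (2 * E * (rows E M + M) + 2 * (E * M) + 2 * E * (E * Z)) ≡⟨ regroup D E (rows E M) M (E * Z) ⟩
     2 * E * (D * (rows E M + (2 * M + E * Z))) ≤⟨ *-monoʳ-≤ (2 * E) (*-monoʳ-≤ D (+-monoʳ-≤ (rows E M) (+-mono-≤ (*-monoʳ-≤ 2 M≤EZ) (m≤n*m (E * Z) 2)))) ⟩
     2 * E * (D * (rows E M + (2 * (E * Z) + 2 * (E * Z)))) ≡⟨ cong (λ t → 2 * E * (D * (rows E M + t))) (four (E * Z)) ⟩
     2 * E * (D * (rows E M + 4 * (E * Z))) ∎)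
     where
     open ≤-Reasoning
     1≤2EEZ : 1 ≤ 2 * E * (E * Z)
     1≤2EEZ = ℕ.>-nonZero⁻¹ (2 * E * (E * Z)) {{m*n≢0 (2 * E) (E * Z) {{m*n≢0 2 E}} {{m*n≢0 E Z}}}}
     expand : ∀ M → suc M * suc M ≡ M * M + 2 * M + 1
     expand = ℕ-ring
     regroup : ∀ D E r M s → D * (2 * E * (r + M) + 2 * (E * M) + 2 * E * s) ≡ 2 * E * (D * (r + (2 * M + s)))
     regroup = ℕ-ring
     four : ∀ x → 2 * x + 2 * x ≡ 4 * x
     four = ℕ-ring

 module Point (a g : ℕ) (c : ℕ) {{_ : NonZero a}} {{_ : NonZero g}} where

   E : ℕ
   E = 2 * a * g

   instance
     E≢0 : NonZero E
     E≢0 = m*n≢0 (2 * a) g {{m*n≢0 2 a}}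

   offset : ℕ → ℕ → ℤ
   offset j y = + (g * (2 * c + 1) * y) ℤ.- + (j * y)

   -- The least x with j y ≤ g z, where z = 2 (x a + y c) + y.
   start : ℕ → ℕ → ℤ
   start j y = ℤ.- (offset j y ℤ./ℕ E)

   trace : ℤ → ℕ → ℤ
   trace x y = + 2 ℤ.* (x ℤ.* + a ℤ.+ + y ℤ.* + c) ℤ.+ + y

   -- `start` comes from division with remainder by E, so g z exceeds j y by that remainder, plus E
   -- for every step in x.
   scaled-trace : ∀ j y i → + g ℤ.* trace (start j y ℤ.+ + i) y ≡ + (j * y + (offset j y ℤ.%ℕ E + E * i))
   scaled-trace j y i = trans (linear {l = n} 1ℤ (trans (ℤ/.a≡a%ℕn+[a/ℕn]*n n E) (cong (λ e → + (n ℤ.%ℕ E) ℤ.+ (n ℤ./ℕ E) ℤ.* e) E≡))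
       (identity (+ g) (+ a) (+ c) (+ y) (+ (j * y)) (n ℤ./ℕ E) (+ (n ℤ.%ℕ E)) (+ i) (+ (g * (2 * c + 1) * y)) gd))
     (sym (trans (ℤₚ.pos-+ (j * y) (n ℤ.%ℕ E + E * i)) (cong (ℤ._+_ (+ (j * y))) (trans (ℤₚ.pos-+ (n ℤ.%ℕ E) (E * i)) (cong (ℤ._+_ (+ (n ℤ.%ℕ E))) (trans (ℤₚ.pos-* E i) (cong (ℤ._* + i) E≡)))))))
     where
     n : ℤ
     n = offset j y
     E≡ : + E ≡ + 2 ℤ.* + a ℤ.* + g
     E≡ = trans (ℤₚ.pos-* (2 * a) g) (cong (ℤ._* + g) (ℤₚ.pos-* 2 a))
     gd : + (g * (2 * c + 1) * y) ≡ + g ℤ.* (+ 2 ℤ.* + c ℤ.+ 1ℤ) ℤ.* + y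
     gd = trans (ℤₚ.pos-* (g * (2 * c + 1)) y) (cong (ℤ._* + y) (trans (ℤₚ.pos-* g (2 * c + 1)) (cong (+ g ℤ.*_) (trans (ℤₚ.pos-+ (2 * c) 1) (cong (ℤ._+ 1ℤ) (ℤₚ.pos-* 2 c))))))
     identity : ∀ g a c y J k r i G → G ≡ g ℤ.* (+ 2 ℤ.* c ℤ.+ 1ℤ) ℤ.* y →
       g ℤ.* (+ 2 ℤ.* ((ℤ.- k ℤ.+ i) ℤ.* a ℤ.+ y ℤ.* c) ℤ.+ y) ℤ.- (J ℤ.+ (r ℤ.+ + 2 ℤ.* a ℤ.* g ℤ.* i)) ≡
       1ℤ ℤ.* ((G ℤ.- J) ℤ.- (r ℤ.+ k ℤ.* (+ 2 ℤ.* a ℤ.* g)))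
     identity g a c y J k r i G refl = ring g a c y J k r i
       where
       ring : ∀ g a c y J k r i → g ℤ.* (+ 2 ℤ.* ((ℤ.- k ℤ.+ i) ℤ.* a ℤ.+ y ℤ.* c) ℤ.+ y) ℤ.- (J ℤ.+ (r ℤ.+ + 2 ℤ.* a ℤ.* g ℤ.* i)) ≡
         1ℤ ℤ.* ((g ℤ.* (+ 2 ℤ.* c ℤ.+ 1ℤ) ℤ.* y ℤ.- J) ℤ.- (r ℤ.+ k ℤ.* (+ 2 ℤ.* a ℤ.* g)))
       ring = ℤ-ring

   in-wedge : ∀ j y i → i < y / E → (j * y ≤ j * y + (offset j y ℤ.%ℕ E + E * i)) × j * y + (offset j y ℤ.%ℕ E + E * i) < suc j * y
   in-wedge j y i i< = m≤m+n (j * y) _ , subst (j * y + (offset j y ℤ.%ℕ E + E * i) <_) (+-comm (j * y) y) (+-monoʳ-< (j * y) (begin-strict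
     offset j y ℤ.%ℕ E + E * i <⟨ +-monoˡ-< (E * i) (ℤ/.n%ℕd<d (offset j y) E) ⟩
     E + E * i ≡⟨ *-suc E i ⟨
     E * suc i ≤⟨ *-monoʳ-≤ E i< ⟩
     E * (y / E) ≡⟨ *-comm E (y / E) ⟩
     y / E * E ≤⟨ m/n*n≤m y E ⟩
     y ∎))
     where open ≤-Reasoning

 square-cancel-≤ : ∀ {m n} → m * m ≤ n * n → m ≤ n
 square-cancel-≤ {m} {n} h = ≮⇒≥ (λ n<m → <⇒≱ (*-mono-< n<m n<m) h)

 square-cancel-< : ∀ {m n} → m * m < n * n → m < n
 square-cancel-< {m} {n} h = ≰⇒> (λ n≤m → <⇒≱ h (*-mono-≤ n≤m n≤m))

 -- With W = V + 1, the product of `A` = W - J and `B` = W + J is close to g², and `B` is close to g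
 -- (√q + √(q - 1)). Hence B / A is about 4q, and the harmonic sum from A to B plays the part of
 -- log(4q).
 module SquareRoots (p g : ℕ) .{{_ : NonZero g}} where

   q V J A B : ℕ
   q = suc p
   V = isqrt (q * (g * g))
   J = isqrt (p * (g * g))
   A = suc V ∸ J
   B = suc V + J

   private
     instance
       gg : NonZero (g * g)
       gg = m*n≢0 g g

   J≤V : J ≤ V
   J≤V = s≤s⁻¹ (square-cancel-< (≤-<-trans (isqrt-lower (p * (g * g))) (≤-<-trans (*-monoˡ-≤ (g * g) (n≤1+n p)) (isqrt-upper (q * (g * g))))))

   q*g²≤[1+V]² : q * (g * g) ≤ suc V * suc V
   q*g²≤[1+V]² = <⇒≤ (isqrt-upper (q * (g * g)))

   J²+g²≤q*g² : J * J + g * g ≤ q * (g * g)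
   J²+g²≤q*g² = subst (J * J + g * g ≤_) (+-comm (p * (g * g)) (g * g)) (+-monoˡ-≤ (g * g) (isqrt-lower (p * (g * g))))

   A+J≡ : A + J ≡ suc V
   A+J≡ = m∸n+n≡m (m≤n⇒m≤1+n J≤V)

   A+2J≡B : A + (J + J) ≡ B
   A+2J≡B = trans (sym (+-assoc A J J)) (cong (_+ J) A+J≡)

   private
     AB+J² : A * B + J * J ≡ suc V * suc V
     AB+J² = trans (cong (λ B → A * B + J * J) (sym A+2J≡B)) (trans (identity A J) (cong₂ _*_ A+J≡ A+J≡))
       where
       identity : ∀ A J → A * (A + (J + J)) + J * J ≡ (A + J) * (A + J)
       identity = ℕ-ring

   g²≤AB : g * g ≤ A * B
   g²≤AB = +-cancelʳ-≤ (J * J) (g * g) (A * B) (begin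
     g * g + J * J ≡⟨ +-comm (g * g) (J * J) ⟩
     J * J + g * g ≤⟨ J²+g²≤q*g² ⟩
     q * (g * g) ≤⟨ q*g²≤[1+V]² ⟩
     suc V * suc V ≡⟨ AB+J² ⟨
     A * B + J * J ∎)
     where open ≤-Reasoning

   AB≤g²+2B : A * B ≤ g * g + 2 * B
   AB≤g²+2B = +-cancelʳ-≤ (J * J) (A * B) (g * g + 2 * B) (begin
     A * B + J * J ≡⟨ AB+J² ⟩
     suc V * suc V ≡⟨ expand V ⟩
     V * V + (2 * V + 1) ≤⟨ +-monoˡ-≤ (2 * V + 1) (isqrt-lower (q * (g * g))) ⟩
     g * g + p * (g * g) + (2 * V + 1) ≤⟨ +-monoˡ-≤ (2 * V + 1) (+-monoʳ-≤ (g * g) (<⇒≤ (isqrt-upper (p * (g * g))))) ⟩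
     g * g + suc J * suc J + (2 * V + 1) ≡⟨ collect (g * g) V J ⟩
     g * g + 2 * B + J * J ∎)
     where
     open ≤-Reasoning
     expand : ∀ V → suc V * suc V ≡ V * V + (2 * V + 1)
     expand = ℕ-ring
     collect : ∀ G V J → G + suc J * suc J + (2 * V + 1) ≡ G + 2 * (suc V + J) + J * J
     collect = ℕ-ring

   B≤3qg : B ≤ 3 * (q * g)
   B≤3qg = begin
     suc V + J ≤⟨ s≤s (+-mono-≤ V≤qg (≤-trans J≤V V≤qg)) ⟩
     1 + (q * g + q * g) ≤⟨ +-monoˡ-≤ (q * g + q * g) (>-nonZero⁻¹ (q * g) {{m*n≢0 q g}}) ⟩
     q * g + (q * g + q * g) ≡⟨ triple (q * g) ⟩
     3 * (q * g) ∎
     where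
     open ≤-Reasoning
     triple : ∀ x → x + (x + x) ≡ 3 * x
     triple = ℕ-ring
     V≤qg : V ≤ q * g
     V≤qg = square-cancel-≤ (≤-trans (isqrt-lower (q * (g * g))) (subst (q * (g * g) ≤_) (regroup q g) (*-monoˡ-≤ (g * g) (m≤m*n q q))))
       where
       regroup : ∀ q g → q * q * (g * g) ≡ q * g * (q * g)
       regroup = ℕ-ring

   A-large : ∀ T → 3 * q * T ≤ g → T ≤ A
   A-large T large = *-cancelˡ-≤ (3 * q) {{m*n≢0 3 q}} (≤-trans large (*-cancelʳ-≤ g (3 * q * A) g (begin
     g * g ≤⟨ g²≤AB ⟩
     A * B ≤⟨ *-monoʳ-≤ A B≤3qg ⟩
     A * (3 * (q * g)) ≡⟨ regroup A q g ⟩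
     3 * q * A * g ∎)))
     where
     open ≤-Reasoning
     regroup : ∀ A q g → A * (3 * (q * g)) ≡ 3 * q * A * g
     regroup = ℕ-ring

   -- Multiplied by B, the claim compares about 7 q g², from A B ≈ g², with about 8 (q - 1) g², from
   -- B² ≈ 4 (q - 1) g². The excess (q - 8) g² absorbs the rounding errors, which are at most g²
   -- once g ≥ 50 q².
   B-large : 17 ≤ q → 50 * (q * q) ≤ g → 7 * (q * A + 3) ≤ 2 * B
   B-large 17≤q large = *-cancelʳ-≤ (7 * (q * A + 3)) (2 * B) B (+-cancelʳ-≤ (4 * B + 2 + 8 * (g * g)) (7 * (q * A + 3) * B) (2 * B * B) (begin
     7 * (q * A + 3) * B + (4 * B + 2 + 8 * (g * g)) ≡⟨ expand q A B (g * g) ⟩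
     7 * q * (A * B) + (25 * B + 2 + 8 * (g * g)) ≤⟨ +-monoˡ-≤ (25 * B + 2 + 8 * (g * g)) (*-monoʳ-≤ (7 * q) AB≤g²+2B) ⟩
     7 * q * (g * g + 2 * B) + (25 * B + 2 + 8 * (g * g)) ≡⟨ collect q B (g * g) ⟩
     7 * q * (g * g) + ((14 * q + 25) * B + 2) + 8 * (g * g) ≤⟨ +-monoˡ-≤ (8 * (g * g)) (+-monoʳ-≤ (7 * q * (g * g)) small) ⟩
     7 * q * (g * g) + g * g + 8 * (g * g) ≡⟨ nine q (g * g) ⟩
     7 * q * (g * g) + 9 * (g * g) ≤⟨ +-monoʳ-≤ (7 * q * (g * g)) (*-monoˡ-≤ (g * g) (≤-trans 9≤17 17≤q)) ⟩
     7 * q * (g * g) + q * (g * g) ≡⟨ last p (g * g) ⟩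
     2 * (4 * (p * (g * g))) + 8 * (g * g) ≤⟨ +-monoˡ-≤ (8 * (g * g)) (*-monoʳ-≤ 2 square) ⟩
     2 * (suc B * suc B) + 8 * (g * g) ≡⟨ finish B (g * g) ⟩
     2 * B * B + (4 * B + 2 + 8 * (g * g)) ∎))
     where
     open ≤-Reasoning
     9≤17 : 9 ≤ 17
     9≤17 = m≤m+n 9 8
     square : 4 * (p * (g * g)) ≤ suc B * suc B
     square = begin
       4 * (p * (g * g)) ≤⟨ *-monoʳ-≤ 4 (<⇒≤ (isqrt-upper (p * (g * g)))) ⟩
       4 * (suc J * suc J) ≡⟨ four (suc J) ⟩
       (suc J + suc J) * (suc J + suc J) ≤⟨ *-mono-≤ half half ⟩
       suc B * suc B ∎
       where
       four : ∀ x → 4 * (x * x) ≡ (x + x) * (x + x)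
       four = ℕ-ring
       half : suc J + suc J ≤ suc B
       half = s≤s (subst (_≤ suc V + J) (sym (+-suc J J)) (+-monoˡ-≤ J (s≤s J≤V)))
     small : (14 * q + 25) * B + 2 ≤ g * g
     small = begin
       (14 * q + 25) * B + 2 ≤⟨ +-mono-≤ (*-mono-≤ (+-monoʳ-≤ (14 * q) (≤-trans (m≤m+n 25 9) (*-monoʳ-≤ 2 17≤q))) B≤3qg) (*-monoʳ-≤ 2 (>-nonZero⁻¹ (q * q * g) {{m*n≢0 (q * q) g {{m*n≢0 q q}}}})) ⟩
       (14 * q + 2 * q) * (3 * (q * g)) + 2 * (q * q * g) ≡⟨ total q g ⟩
       50 * (q * q) * g ≤⟨ *-monoˡ-≤ g large ⟩
       g * g ∎
       where
       total : ∀ q g → (14 * q + 2 * q) * (3 * (q * g)) + 2 * (q * q * g) ≡ 50 * (q * q) * g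
       total = ℕ-ring
     expand : ∀ q A B G → 7 * (q * A + 3) * B + (4 * B + 2 + 8 * G) ≡ 7 * q * (A * B) + (25 * B + 2 + 8 * G)
     expand = ℕ-ring
     collect : ∀ q B G → 7 * q * (G + 2 * B) + (25 * B + 2 + 8 * G) ≡ 7 * q * G + ((14 * q + 25) * B + 2) + 8 * G
     collect = ℕ-ring
     nine : ∀ q G → 7 * q * G + G + 8 * G ≡ 7 * q * G + 9 * G
     nine = ℕ-ring
     last : ∀ p G → 7 * suc p * G + suc p * G ≡ 2 * (4 * (p * G)) + 8 * G
     last = ℕ-ring
     finish : ∀ B G → 2 * (suc B * suc B) + 8 * G ≡ 2 * B * B + (4 * B + 2 + 8 * G)
     finish = ℕ-ring

open import Algebra.Bundles using (CommutativeRing)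
open import Algebra.Solver.Ring.AlmostCommutativeRing using (AlmostCommutativeRing; fromCommutativeRing; _-Raw-AlmostCommutative⟶_)
open import Data.Bool.Base using (Bool; true; false)
open import Data.Empty using (⊥; ⊥-elim)
open import Data.Fin.Base as Fin using (Fin)
import Data.Integer.DivMod as ℤ/
open import Data.List.Base using (List; []; _∷_; _++_; length; map; concatMap; downFrom; allFin; filter)
open import Data.List.Membership.Propositional using (lose; find) renaming (_∈_ to _∈ˡ_)
open import Data.List.Membership.Propositional.Properties using (∈-++⁺ˡ; ∈-++⁺ʳ; ∈-++⁻; ∈-∃++; ∈-concatMap⁺; ∈-concatMap⁻; ∈-downFrom⁺; ∈-downFrom⁻; ∈-filter⁺; ∈-map⁺; ∈-map⁻)
open import Data.List.Properties using (length-++; length-map; length-downFrom; length-tabulate)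
open import Data.List.Relation.Unary.All using (All; []; _∷_; lookup)
open import Data.List.Relation.Unary.AllPairs using ([]; _∷_)
open import Data.List.Relation.Unary.Any using (Any; here; there)
open import Data.List.Relation.Unary.Unique.Propositional using (Unique)
import Data.List.Relation.Unary.Unique.Propositional.Properties as Unique
open import Data.Maybe.Base using (Maybe; just; nothing)
import Data.Nat.Coprimality as Coprime
open import Data.Rational.Base hiding (NonZero)
open import Data.Rational.Properties as ℚₚ
open import Data.Rational.Solver using (module +-*-Solver)
import Data.Rational.Unnormalised.Base as ℚᵘ
import Data.Rational.Unnormalised.Properties as ℚᵘₚ
open import Function.Bundles using (Bijection; mk⇔)
open import Relation.Nullary.Decidable using (decidable-stable; from-yes)
open import Defs hiding (0≤1/1+; bounded; trace)
open +-*-Solver using (solve; _:=_; _:+_; _:*_; :-_; _:-_; con)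
open Congruence
open IntegerCharacters using (odd; jacobi; ε-double; square-nonneg; SquareFree; odd≢double; pólya-vinogradov; -1≤ψ; charSum≤; charSum≤q; -q≤charSum; normω; rootCount; SquareFree4Q+1; ⟦_⟧; ⟦⟧-yes; ⟦⟧-no; SplittingCharacter; splittingCharacter; squareFreeℤ; modulus; inSector; InSector; scale-sector; same-sector; cross-sector; square≡1⇒±1; module WedgePoint) renaming (P to halfModulus; Q to quarterModulus)
open DivisorSums
open Wedges

-- Pigeonhole principle and codes of ideals

module _ {A B : Set} where

  -- Removing the partner of the head preserves the hypotheses.
  pigeonhole : (R : A → B → Set) → (∀ {x x′ y} → R x y → R x′ y → x ≡ x′) →
    ∀ xs ys → Unique xs → (∀ {x} → x ∈ˡ xs → ∃[ y ] y ∈ˡ ys × R x y) → length xs ℕ.≤ length ys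
  pigeonhole R injective [] ys _ _ = z≤n
  pigeonhole R injective (x ∷ xs) ys (x∉ ∷ unique) related with related (here refl)
  ... | y , y∈ , Rxy with ∈-∃++ y∈
  ... | us , vs , refl = begin
    suc (length xs) ≤⟨ s≤s (pigeonhole R injective xs (us ++ vs) unique partner) ⟩
    suc (length (us ++ vs)) ≡⟨ cong suc (length-++ us) ⟩
    suc (length us ℕ.+ length vs) ≡⟨ ℕₚ.+-suc (length us) (length vs) ⟨
    length us ℕ.+ length (y ∷ vs) ≡⟨ length-++ us ⟨
    length (us ++ y ∷ vs) ∎
    where
    open ℕₚ.≤-Reasoning
    remove : ∀ {x′ z} → x′ ∈ˡ xs → z ∈ˡ us ++ y ∷ vs → R x′ z → z ∈ˡ us ++ vs
    remove x′∈ z∈ Rx′z = [ ∈-++⁺ˡ , (λ { (here refl) → contradiction (injective Rxy Rx′z) (lookup x∉ x′∈) ; (there z∈vs) → ∈-++⁺ʳ us z∈vs }) ]′ (∈-++⁻ us z∈)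
    partner : ∀ {x′} → x′ ∈ˡ xs → ∃[ z ] z ∈ˡ us ++ vs × R x′ z
    partner x′∈ with related (there x′∈)
    ... | z , z∈ , Rx′z = z , remove x′∈ z∈ Rx′z , Rx′z

module _ {A B : Set} (f : A → List B) where

  ∈-concatMap-intro : ∀ {a b as} → a ∈ˡ as → b ∈ˡ f a → b ∈ˡ concatMap f as
  ∈-concatMap-intro a∈ b∈ = ∈-concatMap⁺ f (lose a∈ b∈)

  ∈-concatMap-elim : ∀ {b} as → b ∈ˡ concatMap f as → ∃[ a ] a ∈ˡ as × b ∈ˡ f a
  ∈-concatMap-elim as b∈ = find (∈-concatMap⁻ f {xs = as} b∈)

  -- The tag recovers the block of an entry, so that different blocks are disjoint.
  concatMap-unique : (tag : B → A) → (∀ {a b} → b ∈ˡ f a → tag b ≡ a) → (∀ a → Unique (f a)) → ∀ {as} → Unique as → Unique (concatMap f as)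
  concatMap-unique tag tagged unique [] = []
  concatMap-unique tag tagged unique {a ∷ as} (a∉ ∷ u) = Unique.++⁺ (unique a) (concatMap-unique tag tagged unique u)
    λ { (b∈ , b∈′) → let (a′ , a′∈ , b∈a′) = ∈-concatMap-elim as b∈′ in lookup a∉ a′∈ (trans (sym (tagged b∈)) (tagged b∈a′)) }

length-concatMap-downFrom : ∀ {B : Set} (f : ℕ → List B) n → + length (concatMap f (downFrom n)) ≡ ∑ℤ n (λ i → + length (f i))
length-concatMap-downFrom f zero = refl
length-concatMap-downFrom f (suc n) = trans (cong +_ (length-++ (f n))) (trans (cong (ℤ._+_ (+ length (f n))) (length-concatMap-downFrom f n))
  (ℤₚ.+-comm (+ length (f n)) (∑ℤ n (λ i → + length (f i)))))

length-filter-downFrom : ∀ {P : ℕ → Set} (P? : ∀ i → Dec (P i)) n → + length (filter P? (downFrom n)) ≡ ∑ℤ n (λ i → ⟦ P? i ⟧)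
length-filter-downFrom P? zero = refl
length-filter-downFrom P? (suc n) with P? n
... | yes _ = trans (cong (ℤ._+_ 1ℤ) (length-filter-downFrom P? n)) (ℤₚ.+-comm 1ℤ (∑ℤ n (λ i → ⟦ P? i ⟧)))
... | no _ = trans (length-filter-downFrom P? n) (sym (ℤₚ.+-identityʳ (∑ℤ n (λ i → ⟦ P? i ⟧))))

module _ (Q : ℕ) where

  rootCodes : ℕ → ℕ → List (ℕ × ℕ × ℕ)
  rootCodes k t = map (λ c → k , t , c) (filter (λ c → + t ℤ∣.∣? normω Q (+ c)) (downFrom t))

  quotientCodes : ∀ k {n} → Dec (k ℕ.* k ℕ∣.∣ n) → List (ℕ × ℕ × ℕ)
  quotientCodes k (yes (ℕ∣.divides t _)) = rootCodes k t
  quotientCodes k (no _) = []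

  -- The ideals k (ℤ t + ℤ (c + ω)) of norm `n + 1`, written as triples (k , t , c). The shift lets
  -- lists over `downFrom` begin with norm 1.
  codes : ℕ → List (ℕ × ℕ × ℕ)
  codes n = concatMap (λ k → quotientCodes k (k ℕ.* k ℕ∣.∣? suc n)) (downFrom (suc (suc n)))

  length-rootCodes : ∀ k t → + length (rootCodes k t) ≡ rootCount Q t
  length-rootCodes k t = trans (cong +_ (length-map (λ c → k , t , c) (filter (λ c → + t ℤ∣.∣? normω Q (+ c)) (downFrom t))))
    (length-filter-downFrom (λ c → + t ℤ∣.∣? normω Q (+ c)) t)

  code∈ : ∀ {k t c n} → suc n ≡ t ℕ.* (k ℕ.* k) → c ℕ.< t → + t ℤ∣.∣ normω Q (+ c) → (k , t , c) ∈ˡ codes n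
  code∈ {k} {t} {c} {n} n≡ c<t t∣ = ∈-concatMap-intro (λ k → quotientCodes k (k ℕ.* k ℕ∣.∣? suc n)) (∈-downFrom⁺ k<) (go (k ℕ.* k ℕ∣.∣? suc n))
    where
    k≢0 : k ≢ 0
    k≢0 refl = contradiction (trans n≡ (ℕₚ.*-zeroʳ t)) λ ()
    t≢0 : t ≢ 0
    t≢0 refl = contradiction n≡ λ ()
    k< : k ℕ.< suc (suc n)
    k< = s≤s (ℕₚ.≤-trans (ℕₚ.m≤m*n k k {{ℕ.≢-nonZero k≢0}}) (ℕₚ.≤-trans (ℕₚ.m≤n*m (k ℕ.* k) t {{ℕ.≢-nonZero t≢0}}) (ℕₚ.≤-reflexive (sym n≡))))
    go : (d : Dec (k ℕ.* k ℕ∣.∣ suc n)) → (k , t , c) ∈ˡ quotientCodes k d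
    go (yes (ℕ∣.divides t′ e)) = subst (λ s → (k , t , c) ∈ˡ rootCodes k s) t≡
      (∈-map⁺ (λ c → k , t , c) (∈-filter⁺ (λ c → + t ℤ∣.∣? normω Q (+ c)) (∈-downFrom⁺ c<t) t∣))
      where
      t≡ : t ≡ t′
      t≡ = ℕₚ.*-cancelʳ-≡ t t′ (k ℕ.* k) {{ℕₚ.m*n≢0 k k {{ℕ.≢-nonZero k≢0}} {{ℕ.≢-nonZero k≢0}}}} (trans (sym n≡) e)
    go (no ¬d) = contradiction (ℕ∣.divides t n≡) ¬d

-- Sums of rational numbers

private
  toℚᵘ-fromℤ : ∀ i → toℚᵘ (fromℤ i) ℚᵘ.≃ ℚᵘ.mkℚᵘ i 0
  toℚᵘ-fromℤ i = toℚᵘ-fromℚᵘ (ℚᵘ.mkℚᵘ i 0)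

fromℤ-+ : ∀ i j → fromℤ (i ℤ.+ j) ≡ fromℤ i + fromℤ j
fromℤ-+ i j = toℚᵘ-injective (ℚᵘₚ.≃-trans (toℚᵘ-fromℤ (i ℤ.+ j)) (ℚᵘₚ.≃-trans (ℚᵘ.*≡* identity)
  (ℚᵘₚ.≃-trans (ℚᵘₚ.+-cong (ℚᵘₚ.≃-sym (toℚᵘ-fromℤ i)) (ℚᵘₚ.≃-sym (toℚᵘ-fromℤ j)))
    (ℚᵘₚ.≃-sym (toℚᵘ-homo-+ (fromℤ i) (fromℤ j))))))
  where
  identity : (i ℤ.+ j) ℤ.* 1ℤ ≡ (i ℤ.* 1ℤ ℤ.+ j ℤ.* 1ℤ) ℤ.* 1ℤ
  identity = cong (ℤ._* 1ℤ) (sym (cong₂ ℤ._+_ (ℤₚ.*-identityʳ i) (ℤₚ.*-identityʳ j)))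

fromℤ-* : ∀ i j → fromℤ (i ℤ.* j) ≡ fromℤ i * fromℤ j
fromℤ-* i j = toℚᵘ-injective (ℚᵘₚ.≃-trans (toℚᵘ-fromℤ (i ℤ.* j)) (ℚᵘₚ.≃-trans (ℚᵘ.*≡* refl)
  (ℚᵘₚ.≃-trans (ℚᵘₚ.*-cong (ℚᵘₚ.≃-sym (toℚᵘ-fromℤ i)) (ℚᵘₚ.≃-sym (toℚᵘ-fromℤ j)))
    (ℚᵘₚ.≃-sym (toℚᵘ-homo-* (fromℤ i) (fromℤ j))))))

fromℤ-pos-* : ∀ m n → fromℤ (+ (m ℕ.* n)) ≡ fromℤ (+ m) * fromℤ (+ n)
fromℤ-pos-* m n = trans (cong fromℤ (ℤₚ.pos-* m n)) (fromℤ-* (+ m) (+ n))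

two : ℚ
two = fromℤ (+ 2)

fromℤ-neg : ∀ i → fromℤ (ℤ.- i) ≡ - fromℤ i
fromℤ-neg i = toℚᵘ-injective (ℚᵘₚ.≃-trans (toℚᵘ-fromℤ (ℤ.- i)) (ℚᵘₚ.≃-trans
  (ℚᵘₚ.-‿cong (ℚᵘₚ.≃-sym (toℚᵘ-fromℤ i))) (ℚᵘₚ.≃-sym (toℚᵘ-homo‿- (fromℤ i)))))

fromℤ-- : ∀ i j → fromℤ (i ℤ.- j) ≡ fromℤ i - fromℤ j
fromℤ-- i j = trans (fromℤ-+ i (ℤ.- j)) (cong (_+_ (fromℤ i)) (fromℤ-neg j))

fromℤ-mono-≤ : ∀ {i j} → i ℤ.≤ j → fromℤ i ≤ fromℤ j
fromℤ-mono-≤ {i} {j} h = toℚᵘ-cancel-≤ (ℚᵘₚ.≤-respˡ-≃ (ℚᵘₚ.≃-sym (toℚᵘ-fromℤ i))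
  (ℚᵘₚ.≤-respʳ-≃ (ℚᵘₚ.≃-sym (toℚᵘ-fromℤ j)) (ℚᵘ.*≤* (ℤₚ.*-monoʳ-≤-nonNeg 1ℤ h))))

fromℤ-cancel-≤ : ∀ {i j} → fromℤ i ≤ fromℤ j → i ℤ.≤ j
fromℤ-cancel-≤ {i} {j} h with ℚᵘₚ.≤-respˡ-≃ (toℚᵘ-fromℤ i) (ℚᵘₚ.≤-respʳ-≃ (toℚᵘ-fromℤ j) (toℚᵘ-mono-≤ h))
... | ℚᵘ.*≤* g = subst₂ ℤ._≤_ (ℤₚ.*-identityʳ i) (ℤₚ.*-identityʳ j) g

fromℤ-mono-< : ∀ {i j} → i ℤ.< j → fromℤ i < fromℤ j
fromℤ-mono-< {i} {j} h = ≰⇒> (λ g → ℤₚ.<⇒≱ h (fromℤ-cancel-≤ {j} {i} g))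

fromℤ-injective : ∀ {i j} → fromℤ i ≡ fromℤ j → i ≡ j
fromℤ-injective {i} {j} e = ℤₚ.≤-antisym (fromℤ-cancel-≤ {i} {j} (≤-reflexive e)) (fromℤ-cancel-≤ {j} {i} (≤-reflexive (sym e)))

fromℤ-nonneg : ∀ n → 0ℚ ≤ fromℤ (+ n)
fromℤ-nonneg n = fromℤ-mono-≤ {0ℤ} {+ n} (ℤ.+≤+ z≤n)

fromℤ-∑ : ∀ n f → fromℤ (∑ℤ n f) ≡ ∑ n (λ i → fromℤ (f i))
fromℤ-∑ zero f = refl
fromℤ-∑ (suc n) f = trans (fromℤ-+ (∑ℤ n f) (f n)) (cong (_+ fromℤ (f n)) (fromℤ-∑ n f))

*-1/1+ : ∀ n → fromℤ (+ suc n) * 1/1+ n ≡ 1ℚ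
*-1/1+ n = toℚᵘ-injective (ℚᵘₚ.≃-trans (toℚᵘ-homo-* (fromℤ (+ suc n)) (1/1+ n))
  (ℚᵘₚ.≃-trans (ℚᵘₚ.*-cong (toℚᵘ-fromℤ (+ suc n)) (toℚᵘ-fromℚᵘ (ℚᵘ.mkℚᵘ (+ 1) n))) (ℚᵘ.*≡* identity)))
  where
  identity : (+ suc n ℤ.* 1ℤ) ℤ.* 1ℤ ≡ 1ℤ ℤ.* (+ suc (n ℕ.+ 0))
  identity = trans (trans (ℤₚ.*-identityʳ _) (ℤₚ.*-identityʳ _)) (trans (cong (λ t → + suc t) (sym (ℕₚ.+-identityʳ n))) (sym (ℤₚ.*-identityˡ _)))

0≤1/1+ : ∀ n → 0ℚ ≤ 1/1+ n
0≤1/1+ n = <⇒≤ (0<1/1+ n)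

0≤* : ∀ {p q} → 0ℚ ≤ p → 0ℚ ≤ q → 0ℚ ≤ p * q
0≤* {p} {q} hp hq = subst (_≤ p * q) (*-zeroʳ p) (*-monoˡ-≤-nonNeg p {{nonNegative hp}} hq)

*-monoˡ : ∀ {p q} r → 0ℚ ≤ r → p ≤ q → r * p ≤ r * q
*-monoˡ r hr h = *-monoˡ-≤-nonNeg r {{nonNegative hr}} h

*-monoʳ : ∀ {p q} r → 0ℚ ≤ r → p ≤ q → p * r ≤ q * r
*-monoʳ r hr h = *-monoʳ-≤-nonNeg r {{nonNegative hr}} h

*-mono : ∀ {p q r s} → 0ℚ ≤ p → 0ℚ ≤ s → p ≤ q → r ≤ s → p * r ≤ q * s
*-mono {p} {s = s} hp hs h k = ≤-trans (*-monoˡ p hp k) (*-monoʳ s hs h)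

p≤q⇒0≤q-p : ∀ {p q} → p ≤ q → 0ℚ ≤ q - p
p≤q⇒0≤q-p {p} {q} h = subst (_≤ q - p) (+-inverseʳ p) (+-monoˡ-≤ (- p) h)

0≤q-p⇒p≤q : ∀ {p q} → 0ℚ ≤ q - p → p ≤ q
0≤q-p⇒p≤q {p} {q} h = subst₂ _≤_ (+-identityˡ p) (solve 2 (λ p q → q :- p :+ p := q) refl p q) (+-monoˡ-≤ p h)

∑-cong : ∀ n {f g : ℕ → ℚ} → (∀ i → i ℕ.< n → f i ≡ g i) → ∑ n f ≡ ∑ n g
∑-cong zero h = refl
∑-cong (suc n) h = cong₂ _+_ (∑-cong n (λ i i<n → h i (ℕₚ.m<n⇒m<1+n i<n))) (h n ℕₚ.≤-refl)

∑-mono : ∀ n {f g : ℕ → ℚ} → (∀ i → i ℕ.< n → f i ≤ g i) → ∑ n f ≤ ∑ n g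
∑-mono zero h = ≤-refl
∑-mono (suc n) h = +-mono-≤ (∑-mono n (λ i i<n → h i (ℕₚ.m<n⇒m<1+n i<n))) (h n ℕₚ.≤-refl)

∑-+ : ∀ n f g → ∑ n (λ i → f i + g i) ≡ ∑ n f + ∑ n g
∑-+ zero f g = refl
∑-+ (suc n) f g = trans (cong (_+ (f n + g n)) (∑-+ n f g))
  (solve 4 (λ a b c d → (a :+ b) :+ (c :+ d) := (a :+ c) :+ (b :+ d)) refl (∑ n f) (∑ n g) (f n) (g n))

∑-*ˡ : ∀ n c f → c * ∑ n f ≡ ∑ n (λ i → c * f i)
∑-*ˡ zero c f = *-zeroʳ c
∑-*ˡ (suc n) c f = trans (*-distribˡ-+ c (∑ n f) (f n)) (cong (_+ c * f n) (∑-*ˡ n c f))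

∑-const : ∀ n c → ∑ n (λ _ → c) ≡ fromℤ (+ n) * c
∑-const zero c = sym (*-zeroˡ c)
∑-const (suc n) c = trans (cong (_+ c) (∑-const n c)) (trans
  (solve 2 (λ k c → k :* c :+ c := (con 1ℚ :+ k) :* c) refl (fromℤ (+ n)) c)
  (cong (_* c) (sym (fromℤ-+ 1ℤ (+ n)))))

∑-split : ∀ m n f → ∑ (m ℕ.+ n) f ≡ ∑ m f + ∑ n (λ i → f (m ℕ.+ i))
∑-split m zero f = trans (cong (λ k → ∑ k f) (ℕₚ.+-identityʳ m)) (sym (+-identityʳ (∑ m f)))
∑-split m (suc n) f = trans (cong (λ k → ∑ k f) (ℕₚ.+-suc m n))
  (trans (cong (_+ f (m ℕ.+ n)) (∑-split m n f)) (+-assoc (∑ m f) (∑ n (λ i → f (m ℕ.+ i))) (f (m ℕ.+ n))))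

∑-nonneg : ∀ n {f} → (∀ i → i ℕ.< n → 0ℚ ≤ f i) → 0ℚ ≤ ∑ n f
∑-nonneg n {f} h = subst (_≤ ∑ n f) (trans (∑-const n 0ℚ) (*-zeroʳ (fromℤ (+ n)))) (∑-mono n h)

1/1+-difference : ∀ i → 1/1+ i - 1/1+ (suc i) ≡ 1/1+ i * 1/1+ (suc i)
1/1+-difference i = begin
  r - s ≡⟨ cong₂ _-_ (sym (*-identityʳ r)) (sym (*-identityˡ s)) ⟩
  r * 1ℚ - 1ℚ * s ≡⟨ cong₂ (λ a b → r * a - b * s) (sym (*-1/1+ (suc i))) (sym (*-1/1+ i)) ⟩
  r * (fromℤ (+ suc (suc i)) * s) - (k * r) * s ≡⟨ cong (λ t → r * (t * s) - (k * r) * s) (fromℤ-+ 1ℤ (+ suc i)) ⟩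
  r * ((1ℚ + k) * s) - (k * r) * s ≡⟨ solve 3 (λ r s k → r :* ((con 1ℚ :+ k) :* s) :- (k :* r) :* s := r :* s) refl r s k ⟩
  r * s ∎
  where
  open ≡-Reasoning
  r s k : ℚ
  r = 1/1+ i
  s = 1/1+ (suc i)
  k = fromℤ (+ suc i)

Decreasing : (ℕ → ℚ) → Set
Decreasing D = ∀ i → D (suc i) ≤ D i

-- Abel summation as a comparison principle.
abel : ∀ (f b D : ℕ → ℚ) → Decreasing D → (∀ i → 0ℚ ≤ D i) → (∀ n → ∑ n f ≤ ∑ n b) →
  ∀ n → ∑ n (λ i → f i * D i) ≤ ∑ n (λ i → b i * D i)
abel f b D dec D≥0 h zero = ≤-refl
abel f b D dec D≥0 h (suc n) = 0≤q-p⇒p≤q (≤-trans (0≤* (p≤q⇒0≤q-p (h (suc n))) (D≥0 n)) (strong n))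
  where
  -- The invariant that survives the induction: the weighted sums differ by at least the last
  -- difference of the plain sums times the last weight.
  strong : ∀ n → (∑ (suc n) b - ∑ (suc n) f) * D n ≤ ∑ (suc n) (λ i → b i * D i) - ∑ (suc n) (λ i → f i * D i)
  strong zero = ≤-reflexive (solve 3 (λ b f d → ((con 0ℚ :+ b) :- (con 0ℚ :+ f)) :* d := (con 0ℚ :+ b :* d) :- (con 0ℚ :+ f :* d)) refl (b 0) (f 0) (D 0))
  strong (suc n) = begin
    ((B + β) - (F + φ)) * D (suc n) ≡⟨ solve 5 (λ B β F φ d → ((B :+ β) :- (F :+ φ)) :* d := (B :- F) :* d :+ (β :* d :- φ :* d)) refl B β F φ (D (suc n)) ⟩
    (B - F) * D (suc n) + (β * D (suc n) - φ * D (suc n)) ≤⟨ +-monoˡ-≤ _ (*-monoˡ (B - F) (p≤q⇒0≤q-p (h (suc n))) (dec n)) ⟩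
    (B - F) * D n + (β * D (suc n) - φ * D (suc n)) ≤⟨ +-monoˡ-≤ _ (strong n) ⟩
    (X - Y) + (β * D (suc n) - φ * D (suc n)) ≡⟨ solve 4 (λ X Y u v → (X :- Y) :+ (u :- v) := (X :+ u) :- (Y :+ v)) refl X Y (β * D (suc n)) (φ * D (suc n)) ⟩
    (X + β * D (suc n)) - (Y + φ * D (suc n)) ∎
    where
    open ≤-Reasoning
    B F β φ X Y : ℚ
    B = ∑ (suc n) b
    F = ∑ (suc n) f
    β = b (suc n)
    φ = f (suc n)
    X = ∑ (suc n) (λ i → b i * D i)
    Y = ∑ (suc n) (λ i → f i * D i)

-- Upper bound for the number of ideals

-- The bound for L(1, χ) when m = ⌊√q⌋.
Λ : ℕ → ℚ
Λ m = H 1 m + 1ℚ - ½ * (fromℤ (+ m) * 1/1+ m)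

module Character (ψ : ℕ → ℤ) (q m : ℕ)
  (ψ≥-1 : ∀ n → -1ℤ ℤ.≤ ψ n)
  (S≤n : ∀ n → ∑ℤ n (λ i → ψ (suc i)) ℤ.≤ + n)
  (S≤q : ∀ n → ∑ℤ n (λ i → ψ (suc i)) ℤ.≤ + q)
  (-q≤S : ∀ n → ℤ.- + q ℤ.≤ ∑ℤ n (λ i → ψ (suc i)))
  (∑S≤ : ∀ n → + 2 ℤ.* ∑ℤ n (λ k → ∑ℤ k (λ i → ψ (suc i))) ℤ.≤ + (n ℕ.* suc m))
  where

  r : ℕ → ℚ
  r = 1/1+

  S : ℕ → ℚ
  S n = fromℤ (∑ℤ n (λ i → ψ (suc i)))

  ψℚ : ℕ → ℚ
  ψℚ i = fromℤ (ψ (suc i))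

  S-suc : ∀ n → S (suc n) ≡ S n + ψℚ n
  S-suc n = fromℤ-+ (∑ℤ n (λ i → ψ (suc i))) (ψ (suc n))

  summation-by-parts : ∀ n → ∑ n (λ i → ψℚ i * r i) ≡ S n * r n + ∑ n (λ i → S (suc i) * (r i * r (suc i)))
  summation-by-parts zero = sym (trans (+-identityʳ (0ℚ * r 0)) (*-zeroˡ (r 0)))
  summation-by-parts (suc n) = begin
    ∑ n (λ i → ψℚ i * r i) + ψℚ n * r n
      ≡⟨ cong (_+ ψℚ n * r n) (summation-by-parts n) ⟩
    (S n * r n + T) + ψℚ n * r n
      ≡⟨ solve 5 (λ s p a b T → (s :* a :+ T) :+ p :* a := (s :+ p) :* b :+ (T :+ (s :+ p) :* (a :- b))) refl (S n) (ψℚ n) (r n) (r (suc n)) T ⟩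
    (S n + ψℚ n) * r (suc n) + (T + (S n + ψℚ n) * (r n - r (suc n)))
      ≡⟨ cong₂ (λ s d → s * r (suc n) + (T + s * d)) (sym (S-suc n)) (1/1+-difference n) ⟩
    S (suc n) * r (suc n) + (T + S (suc n) * (r n * r (suc n))) ∎
    where
    open ≡-Reasoning
    T : ℚ
    T = ∑ n (λ i → S (suc i) * (r i * r (suc i)))

  -- The differences 1/d - 1/(d+1), made constant for d ≤ m: the derivative of
  -- the largest convex minorant of 1/d that is linear up to m + 1.
  D : ℕ → ℚ
  D zero = r m * r m
  D (suc i) with suc i ℕₚ.≤? m
  ... | yes _ = r m * r m
  ... | no _ = r i * r (suc i)

  D-low : ∀ {d} → d ℕ.≤ m → D d ≡ r m * r m
  D-low {zero} _ = refl
  D-low {suc i} h with suc i ℕₚ.≤? m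
  ... | yes _ = refl
  ... | no ¬h = contradiction h ¬h

  D-high : ∀ {i} → m ℕ.≤ i → D (suc i) ≡ r i * r (suc i)
  D-high {i} h with suc i ℕₚ.≤? m
  ... | yes g = contradiction (ℕₚ.≤-trans g h) (ℕₚ.<-irrefl refl)
  ... | no _ = refl

  r*r≥0 : ∀ i j → 0ℚ ≤ r i * r j
  r*r≥0 i j = 0≤* (0≤1/1+ i) (0≤1/1+ j)

  D≥0 : ∀ d → 0ℚ ≤ D d
  D≥0 zero = r*r≥0 m m
  D≥0 (suc i) with suc i ℕₚ.≤? m
  ... | yes _ = r*r≥0 m m
  ... | no _ = r*r≥0 i (suc i)

  r-mono : ∀ {i j k l} → i ℕ.≤ k → j ℕ.≤ l → r k * r l ≤ r i * r j
  r-mono {i} {j} {k} {l} h g = *-mono (0≤1/1+ k) (0≤1/1+ j) (1/1+-antitone h) (1/1+-antitone g)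

  D-decreasing : Decreasing D
  D-decreasing d with suc d ℕₚ.≤? m
  ... | yes h = ≤-reflexive (sym (D-low (ℕₚ.<⇒≤ h)))
  ... | no ¬h with ℕₚ.m≤n⇒m<n∨m≡n (ℕ.s≤s⁻¹ (ℕₚ.≰⇒> ¬h))
  ... | inj₂ refl = ≤-trans (r-mono {m} {m} {m} {suc m} ℕₚ.≤-refl (ℕₚ.n≤1+n m)) (≤-reflexive (sym (D-low ℕₚ.≤-refl)))
  ... | inj₁ (s≤s {n = d′} h) = ≤-trans (r-mono {d′} {suc d′} {suc d′} {suc (suc d′)} (ℕₚ.n≤1+n d′) (ℕₚ.n≤1+n (suc d′))) (≤-reflexive (sym (D-high h)))

  ∑D-low : ∑ (suc m) D ≡ r m
  ∑D-low = trans (∑-cong (suc m) (λ d d< → D-low (ℕ.s≤s⁻¹ d<))) (trans (∑-const (suc m) (r m * r m))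
    (trans (sym (*-assoc (fromℤ (+ suc m)) (r m) (r m))) (trans (cong (_* r m) (*-1/1+ m)) (*-identityˡ (r m)))))

  ∑D-high : ∀ l → ∑ l (λ i → D (suc m ℕ.+ i)) ≡ r m - r (m ℕ.+ l)
  ∑D-high zero = sym (trans (cong (λ t → r m - r t) (ℕₚ.+-identityʳ m)) (+-inverseʳ (r m)))
  ∑D-high (suc l) = trans (cong₂ _+_ (∑D-high l) (trans (D-high (ℕₚ.m≤m+n m l)) (sym (1/1+-difference (m ℕ.+ l)))))
    (trans (solve 3 (λ a b c → (a :- b) :+ (b :- c) := a :- c) refl (r m) (r (m ℕ.+ l)) (r (suc (m ℕ.+ l))))
      (cong (λ t → r m - r t) (sym (ℕₚ.+-suc m l))))

  ∑D≤ : ∀ l → ∑ (suc m ℕ.+ l) D ≤ r m + r m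
  ∑D≤ l = begin
    ∑ (suc m ℕ.+ l) D ≡⟨ ∑-split (suc m) l D ⟩
    ∑ (suc m) D + ∑ l (λ i → D (suc m ℕ.+ i)) ≡⟨ cong₂ _+_ ∑D-low (∑D-high l) ⟩
    r m + (r m - r (m ℕ.+ l)) ≤⟨ +-monoʳ-≤ (r m) (subst (r m - r (m ℕ.+ l) ≤_) (+-identityʳ (r m)) (+-monoʳ-≤ (r m) (neg-antimono-≤ (0≤1/1+ (m ℕ.+ l))))) ⟩
    r m + r m ∎
    where open ≤-Reasoning

  -- As `D` decreases, `abel` carries the Pólya-Vinogradov bound, by which the S(d) are at most (m +
  -- 1) / 2 on average, over to the weighted sum. The total weight of `D` is at most 2 / (m + 1).
  main-part : ∀ l → ∑ (suc m ℕ.+ l) (λ d → S d * D d) ≤ 1ℚ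
  main-part l = begin
    ∑ (suc m ℕ.+ l) (λ d → S d * D d) ≤⟨ abel S (λ _ → c) D D-decreasing D≥0 partial (suc m ℕ.+ l) ⟩
    ∑ (suc m ℕ.+ l) (λ d → c * D d) ≡⟨ ∑-*ˡ (suc m ℕ.+ l) c D ⟨
    c * ∑ (suc m ℕ.+ l) D ≤⟨ *-monoˡ c c≥0 (∑D≤ l) ⟩
    c * (r m + r m) ≡⟨ solve 2 (λ n r → (con ½ :* n) :* (r :+ r) := n :* r) refl (fromℤ (+ suc m)) (r m) ⟩
    fromℤ (+ suc m) * r m ≡⟨ *-1/1+ m ⟩
    1ℚ ∎
    where
    open ≤-Reasoning
    c : ℚ
    c = ½ * fromℤ (+ suc m)
    c≥0 : 0ℚ ≤ c
    c≥0 = 0≤* (nonNegative⁻¹ ½) (fromℤ-nonneg (suc m))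
    partial : ∀ n → ∑ n S ≤ ∑ n (λ _ → c)
    partial n = begin
      ∑ n S ≡⟨ solve 1 (λ x → x := con ½ :* (con two :* x)) refl (∑ n S) ⟩
      ½ * (two * ∑ n S) ≡⟨ cong (λ t → ½ * (two * t)) (sym (fromℤ-∑ n _)) ⟩
      ½ * (two * fromℤ (∑ℤ n (λ k → ∑ℤ k (λ i → ψ (suc i))))) ≡⟨ cong (½ *_) (sym (fromℤ-* (+ 2) (∑ℤ n (λ k → ∑ℤ k (λ i → ψ (suc i)))))) ⟩
      ½ * fromℤ (+ 2 ℤ.* ∑ℤ n (λ k → ∑ℤ k (λ i → ψ (suc i)))) ≤⟨ *-monoˡ ½ (nonNegative⁻¹ ½) (fromℤ-mono-≤ {+ 2 ℤ.* ∑ℤ n (λ k → ∑ℤ k (λ i → ψ (suc i)))} {+ (n ℕ.* suc m)} (∑S≤ n)) ⟩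
      ½ * fromℤ (+ (n ℕ.* suc m)) ≡⟨ cong (λ t → ½ * t) (fromℤ-pos-* n (suc m)) ⟩
      ½ * (fromℤ (+ n) * fromℤ (+ suc m)) ≡⟨ solve 2 (λ n k → con ½ :* (n :* k) := n :* (con ½ :* k)) refl (fromℤ (+ n)) (fromℤ (+ suc m)) ⟩
      fromℤ (+ n) * c ≡⟨ ∑-const n c ⟨
      ∑ n (λ _ → c) ∎

  -- Term by term, with d = i + 1: S(d) (1/(d(d+1)) - D(d)) is at most 1/(d+1) - d/(m+1)² for d ≤ m, and vanishes beyond.
  correction : ∀ l → ∑ (m ℕ.+ l) (λ i → S (suc i) * (r i * r (suc i) - D (suc i))) ≤ H 1 m - ½ * (fromℤ (+ m) * r m)
  correction l = begin
    ∑ (m ℕ.+ l) E ≡⟨ ∑-split m l E ⟩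
    ∑ m E + ∑ l (λ i → E (m ℕ.+ i)) ≡⟨ cong (_+_ (∑ m E)) (trans (∑-cong l (λ i _ → high (ℕₚ.m≤m+n m i))) (trans (∑-const l 0ℚ) (*-zeroʳ (fromℤ (+ l))))) ⟩
    ∑ m E + 0ℚ ≡⟨ +-identityʳ (∑ m E) ⟩
    ∑ m E ≤⟨ ∑-mono m low ⟩
    ∑ m (λ i → r (suc i) + (- (r m * r m)) * fromℤ (+ suc i)) ≡⟨ trans (∑-+ m _ _) (cong (_+_ (H 1 m)) (sym (∑-*ˡ m (- (r m * r m)) _))) ⟩
    H 1 m + (- (r m * r m)) * ∑ m (λ i → fromℤ (+ suc i)) ≡⟨ cong (λ t → H 1 m + (- (r m * r m)) * t) (triangular m) ⟩
    H 1 m + (- (r m * r m)) * (½ * (fromℤ (+ m) * fromℤ (+ suc m))) ≡⟨ solve 4 (λ h r m k → h :+ (:- (r :* r)) :* (con ½ :* (m :* k)) := h :- con ½ :* (m :* r) :* (k :* r)) refl (H 1 m) (r m) (fromℤ (+ m)) (fromℤ (+ suc m)) ⟩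
    H 1 m - ½ * (fromℤ (+ m) * r m) * (fromℤ (+ suc m) * r m) ≡⟨ cong (λ t → H 1 m - t) (trans (cong (λ t → ½ * (fromℤ (+ m) * r m) * t) (*-1/1+ m)) (*-identityʳ (½ * (fromℤ (+ m) * r m)))) ⟩
    H 1 m - ½ * (fromℤ (+ m) * r m) ∎
    where
    open ≤-Reasoning
    E : ℕ → ℚ
    E i = S (suc i) * (r i * r (suc i) - D (suc i))
    high : ∀ {i} → m ℕ.≤ i → E i ≡ 0ℚ
    high {i} h = trans (cong (λ t → S (suc i) * (r i * r (suc i) - t)) (D-high h))
      (trans (cong (S (suc i) *_) (+-inverseʳ (r i * r (suc i)))) (*-zeroʳ (S (suc i))))
    low : ∀ i → i ℕ.< m → E i ≤ r (suc i) + (- (r m * r m)) * fromℤ (+ suc i)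
    low i i<m = begin
      S (suc i) * (r i * r (suc i) - D (suc i))
        ≤⟨ *-monoʳ _ (p≤q⇒0≤q-p (≤-trans (≤-reflexive (D-low i<m)) (r-mono {i} {suc i} {m} {m} (ℕₚ.<⇒≤ i<m) i<m)))
             (fromℤ-mono-≤ {∑ℤ (suc i) (λ i → ψ (suc i))} {+ suc i} (S≤n (suc i))) ⟩
      fromℤ (+ suc i) * (r i * r (suc i) - D (suc i))
        ≡⟨ cong (λ t → fromℤ (+ suc i) * (r i * r (suc i) - t)) (D-low i<m) ⟩
      fromℤ (+ suc i) * (r i * r (suc i) - r m * r m)
        ≡⟨ solve 4 (λ k a b c → k :* (a :* b :- c) := (k :* a) :* b :+ (:- c) :* k) refl (fromℤ (+ suc i)) (r i) (r (suc i)) (r m * r m) ⟩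
      (fromℤ (+ suc i) * r i) * r (suc i) + (- (r m * r m)) * fromℤ (+ suc i)
        ≡⟨ cong (_+ (- (r m * r m)) * fromℤ (+ suc i)) (trans (cong (_* r (suc i)) (*-1/1+ i)) (*-identityˡ (r (suc i)))) ⟩
      r (suc i) + (- (r m * r m)) * fromℤ (+ suc i) ∎
    triangular : ∀ n → ∑ n (λ i → fromℤ (+ suc i)) ≡ ½ * (fromℤ (+ n) * fromℤ (+ suc n))
    triangular zero = sym (trans (cong (½ *_) (*-zeroˡ (fromℤ (+ 1)))) (*-zeroʳ ½))
    triangular (suc n) = trans (cong (_+ fromℤ (+ suc n)) (triangular n))
      (trans (cong₂ (λ a b → ½ * (a * fromℤ (+ suc n)) + b) pred-n refl) (trans
        (solve 1 (λ k → con ½ :* ((k :- con 1ℚ) :* k) :+ k := con ½ :* (k :* (con 1ℚ :+ k))) refl (fromℤ (+ suc n)))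
        (cong (λ t → ½ * (fromℤ (+ suc n) * t)) (sym (fromℤ-+ 1ℤ (+ suc n))))))
      where
      pred-n : fromℤ (+ n) ≡ fromℤ (+ suc n) - 1ℚ
      pred-n = trans (solve 1 (λ k → k := (con 1ℚ :+ k) :- con 1ℚ) refl (fromℤ (+ n))) (cong (_- 1ℚ) (sym (fromℤ-+ 1ℤ (+ n))))

  -- After summation by parts the boundary term is at most q / (Z + 1) with Z = m + l. The weights 1
  -- / (d (d + 1)) are split into `D d`, where the bound on average is used, and an excess supported
  -- on d ≤ m, where S(d) ≤ d is better.
  L-bound : ∀ l → ∑ (m ℕ.+ l) (λ i → ψℚ i * r i) ≤ Λ m + fromℤ (+ q) * r (m ℕ.+ l)
  L-bound l = begin
    ∑ Z (λ i → ψℚ i * r i)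
      ≡⟨ summation-by-parts Z ⟩
    S Z * r Z + ∑ Z (λ i → S (suc i) * (r i * r (suc i)))
      ≡⟨ cong (_+_ (S Z * r Z)) (trans (∑-cong Z (λ i _ → solve 3 (λ s w d → s :* w := s :* (w :- d) :+ s :* d) refl (S (suc i)) (r i * r (suc i)) (D (suc i)))) (∑-+ Z _ _)) ⟩
    S Z * r Z + (∑ Z (λ i → S (suc i) * (r i * r (suc i) - D (suc i))) + ∑ Z (λ i → S (suc i) * D (suc i)))
      ≤⟨ +-mono-≤ (*-monoʳ (r Z) (0≤1/1+ Z) (fromℤ-mono-≤ {∑ℤ Z (λ i → ψ (suc i))} {+ q} (S≤q Z))) (+-mono-≤ (correction l) (≤-trans (≤-reflexive shift) (main-part l))) ⟩
    fromℤ (+ q) * r Z + (H 1 m - ½ * (fromℤ (+ m) * r m) + 1ℚ)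
      ≡⟨ solve 3 (λ a h t → a :+ (h :- t :+ con 1ℚ) := h :+ con 1ℚ :- t :+ a) refl (fromℤ (+ q) * r Z) (H 1 m) (½ * (fromℤ (+ m) * r m)) ⟩
    Λ m + fromℤ (+ q) * r Z ∎
    where
    open ≤-Reasoning
    Z : ℕ
    Z = m ℕ.+ l
    shift : ∑ Z (λ i → S (suc i) * D (suc i)) ≡ ∑ (suc Z) (λ d → S d * D d)
    shift = sym (trans (∑-split 1 Z (λ d → S d * D d)) (trans (cong (_+ ∑ Z (λ i → S (suc i) * D (suc i)))
      (trans (+-identityˡ (0ℚ * D 0)) (*-zeroˡ (D 0)))) (+-identityˡ _)))

  floor-upper : ∀ Y j → fromℤ (+ (Y ℕ./ suc j)) ≤ fromℤ (+ Y) * r j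
  floor-upper Y j = begin
    x ≡⟨ trans (sym (*-identityʳ x)) (cong (x *_) (sym (*-1/1+ j))) ⟩
    x * (fromℤ (+ suc j) * r j) ≡⟨ *-assoc x (fromℤ (+ suc j)) (r j) ⟨
    x * fromℤ (+ suc j) * r j ≡⟨ cong (_* r j) (sym (fromℤ-pos-* (Y ℕ./ suc j) (suc j))) ⟩
    fromℤ (+ (Y ℕ./ suc j ℕ.* suc j)) * r j ≤⟨ *-monoʳ (r j) (0≤1/1+ j) (fromℤ-mono-≤ {+ (Y ℕ./ suc j ℕ.* suc j)} {+ Y} (ℤ.+≤+ (ℕ/.m/n*n≤m Y (suc j)))) ⟩
    fromℤ (+ Y) * r j ∎
    where
    open ≤-Reasoning
    x : ℚ
    x = fromℤ (+ (Y ℕ./ suc j))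

  floor-lower : ∀ Y j → fromℤ (+ Y) * r j ≤ fromℤ (+ (Y ℕ./ suc j)) + 1ℚ
  floor-lower Y j = begin
    fromℤ (+ Y) * r j ≤⟨ *-monoʳ (r j) (0≤1/1+ j) (fromℤ-mono-≤ {+ Y} {+ (suc (Y ℕ./ suc j) ℕ.* suc j)} (ℤ.+≤+ Y≤)) ⟩
    fromℤ (+ (suc (Y ℕ./ suc j) ℕ.* suc j)) * r j ≡⟨ cong (_* r j) (trans (cong fromℤ (ℤₚ.pos-* (suc (Y ℕ./ suc j)) (suc j))) (fromℤ-* (+ suc (Y ℕ./ suc j)) (+ suc j))) ⟩
    fromℤ (+ suc (Y ℕ./ suc j)) * fromℤ (+ suc j) * r j ≡⟨ trans (*-assoc (fromℤ (+ suc (Y ℕ./ suc j))) (fromℤ (+ suc j)) (r j)) (trans (cong (fromℤ (+ suc (Y ℕ./ suc j)) *_) (*-1/1+ j)) (*-identityʳ (fromℤ (+ suc (Y ℕ./ suc j))))) ⟩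
    fromℤ (+ suc (Y ℕ./ suc j)) ≡⟨ trans (fromℤ-+ 1ℤ (+ (Y ℕ./ suc j))) (+-comm 1ℚ (fromℤ (+ (Y ℕ./ suc j)))) ⟩
    fromℤ (+ (Y ℕ./ suc j)) + 1ℚ ∎
    where
    open ≤-Reasoning
    Y≤ : Y ℕ.≤ suc (Y ℕ./ suc j) ℕ.* suc j
    Y≤ = ℕₚ.≤-trans (ℕₚ.≤-reflexive (ℕ/.m≡m%n+[m/n]*n Y (suc j))) (ℕₚ.+-monoˡ-≤ (Y ℕ./ suc j ℕ.* suc j) (ℕₚ.<⇒≤ (ℕ/.m%n<n Y (suc j))))

  term : ℕ → ℕ → ℚ
  term Y j = ψℚ j * fromℤ (+ (Y ℕ./ suc j))

  -- The floor only loses, by at most 1, and -ψ ≤ 1, so replacing ⌊Y / d⌋ by Y / d costs at most 1.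
  term≤ : ∀ Y j → term Y j ≤ fromℤ (+ Y) * (ψℚ j * r j) + 1ℚ
  term≤ Y j = begin
    p * f ≡⟨ solve 3 (λ p f y → p :* f := y :* p :+ (:- p) :* (y :- f)) refl p f y ⟩
    y * p + (- p) * (y - f) ≤⟨ +-monoʳ-≤ (y * p) (*-monoʳ (y - f) (p≤q⇒0≤q-p (floor-upper Y j)) -p≤1) ⟩
    y * p + 1ℚ * (y - f) ≡⟨ cong (_+_ (y * p)) (*-identityˡ (y - f)) ⟩
    y * p + (y - f) ≤⟨ +-monoʳ-≤ (y * p) (≤-trans (+-monoˡ-≤ (- f) (floor-lower Y j)) (≤-reflexive (solve 1 (λ f → f :+ con 1ℚ :- f := con 1ℚ) refl f))) ⟩
    y * p + 1ℚ ≡⟨ cong (_+ 1ℚ) (solve 3 (λ Y r p → Y :* r :* p := Y :* (p :* r)) refl (fromℤ (+ Y)) (r j) p) ⟩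
    fromℤ (+ Y) * (p * r j) + 1ℚ ∎
    where
    open ≤-Reasoning
    p f y : ℚ
    p = ψℚ j
    f = fromℤ (+ (Y ℕ./ suc j))
    y = fromℤ (+ Y) * r j
    -p≤1 : - p ≤ 1ℚ
    -p≤1 = neg-antimono-≤ (fromℤ-mono-≤ { -1ℤ} {ψ (suc j)} (ψ≥-1 (suc j)))

  -- Beyond d = Z the weights ⌊Z² / d⌋ decrease from a value of at most Z, and sums of ψ over blocks
  -- are at most 2q. `abel` compares ψ with the sequence 2q, 0, 0, ....
  tail≤ : ∀ Z n → ∑ n (λ i → term (Z ℕ.* Z) (Z ℕ.+ i)) ≤ fromℤ (+ (2 ℕ.* q)) * fromℤ (+ Z)
  tail≤ Z n = ≤-trans (abel (λ i → ψℚ (Z ℕ.+ i)) b F decreasing (λ i → fromℤ-nonneg (Y ℕ./ suc (Z ℕ.+ i))) partial n) (weights n)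
    where
    open ≤-Reasoning
    Y : ℕ
    Y = Z ℕ.* Z
    c : ℚ
    c = fromℤ (+ (2 ℕ.* q))
    F b : ℕ → ℚ
    F i = fromℤ (+ (Y ℕ./ suc (Z ℕ.+ i)))
    b zero = c
    b (suc _) = 0ℚ
    decreasing : Decreasing F
    decreasing i = fromℤ-mono-≤ {+ (Y ℕ./ suc (Z ℕ.+ suc i))} {+ (Y ℕ./ suc (Z ℕ.+ i))}
      (ℤ.+≤+ (ℕ/./-monoʳ-≤ Y (s≤s (ℕₚ.+-monoʳ-≤ Z (ℕₚ.n≤1+n i)))))
    ∑b : ∀ n → ∑ (suc n) b ≡ c
    ∑b zero = +-identityˡ c
    ∑b (suc n) = trans (+-identityʳ _) (∑b n)
    partial-S : ∀ n → ∑ n (λ i → ψℚ (Z ℕ.+ i)) ≡ S (Z ℕ.+ n) - S Z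
    partial-S n = trans (solve 2 (λ a b → b := (a :+ b) :- a) refl (S Z) (∑ n (λ i → ψℚ (Z ℕ.+ i))))
      (cong (_- S Z) (sym (trans (fromℤ-∑ (Z ℕ.+ n) (λ i → ψ (suc i))) (trans (∑-split Z n ψℚ) (cong (_+ ∑ n (λ i → ψℚ (Z ℕ.+ i))) (sym (fromℤ-∑ Z (λ i → ψ (suc i)))))))))
    partial : ∀ n → ∑ n (λ i → ψℚ (Z ℕ.+ i)) ≤ ∑ n b
    partial zero = ≤-refl
    partial (suc n) = begin
      ∑ (suc n) (λ i → ψℚ (Z ℕ.+ i)) ≡⟨ partial-S (suc n) ⟩
      S (Z ℕ.+ suc n) - S Z ≤⟨ +-mono-≤ (fromℤ-mono-≤ {∑ℤ (Z ℕ.+ suc n) (λ i → ψ (suc i))} {+ q} (S≤q (Z ℕ.+ suc n)))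
                                     (neg-antimono-≤ (≤-trans (≤-reflexive (sym (fromℤ-neg (+ q)))) (fromℤ-mono-≤ {ℤ.- + q} {∑ℤ Z (λ i → ψ (suc i))} (-q≤S Z)))) ⟩
      fromℤ (+ q) - - fromℤ (+ q) ≡⟨ solve 1 (λ a → a :- (:- a) := a :+ a) refl (fromℤ (+ q)) ⟩
      fromℤ (+ q) + fromℤ (+ q) ≡⟨ trans (sym (fromℤ-+ (+ q) (+ q))) (cong (λ t → fromℤ (+ (q ℕ.+ t))) (sym (ℕₚ.+-identityʳ q))) ⟩
      c ≡⟨ ∑b n ⟨
      ∑ (suc n) b ∎
    weights : ∀ n → ∑ n (λ i → b i * F i) ≤ c * fromℤ (+ Z)
    weights zero = 0≤* (fromℤ-nonneg (2 ℕ.* q)) (fromℤ-nonneg Z)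
    weights (suc zero) = ≤-trans (≤-reflexive (+-identityˡ (c * F 0))) (*-monoˡ c (fromℤ-nonneg (2 ℕ.* q))
      (fromℤ-mono-≤ {+ (Y ℕ./ suc (Z ℕ.+ 0))} {+ Z} (ℤ.+≤+ (ℕₚ.≤-trans (ℕ/./-monoʳ-≤ Y (s≤s (ℕₚ.m≤m+n Z 0))) (Y/[1+Z]≤Z Z)))))
      where
      Y/[1+Z]≤Z : ∀ Z → (Z ℕ.* Z) ℕ./ suc Z ℕ.≤ Z
      Y/[1+Z]≤Z Z = ℕₚ.≤-trans (ℕ/./-monoˡ-≤ (suc Z) (ℕₚ.*-monoʳ-≤ Z (ℕₚ.n≤1+n Z))) (ℕₚ.≤-reflexive (ℕ/.m*n/n≡m Z (suc Z)))
    weights (suc (suc n)) = ≤-trans (≤-reflexive (trans (cong (_+_ (∑ (suc n) (λ i → b i * F i))) (*-zeroˡ (F (suc n)))) (+-identityʳ _))) (weights (suc n))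

  -- The Dirichlet hyperbola argument for Σ ψ(d) ⌊Z²/d⌋, cut at d = Z.
  hyperbola : ∀ l → let Z = m ℕ.+ l in
    ∑ (Z ℕ.* Z) (term (Z ℕ.* Z)) ≤ fromℤ (+ (Z ℕ.* Z)) * Λ m + fromℤ (+ (3 ℕ.* q ℕ.+ 1)) * fromℤ (+ Z)
  hyperbola l = begin
    ∑ Y (term Y) ≡⟨ cong (λ t → ∑ t (term Y)) (sym (ℕₚ.m+[n∸m]≡n (Z≤Y Z))) ⟩
    ∑ (Z ℕ.+ (Y ∸ Z)) (term Y) ≡⟨ ∑-split Z (Y ∸ Z) (term Y) ⟩
    ∑ Z (term Y) + ∑ (Y ∸ Z) (λ i → term Y (Z ℕ.+ i)) ≤⟨ +-mono-≤ head≤ (tail≤ Z (Y ∸ Z)) ⟩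
    (y * (Λ m + fromℤ (+ q) * r Z) + z) + fromℤ (+ (2 ℕ.* q)) * z ≤⟨ +-monoˡ-≤ (fromℤ (+ (2 ℕ.* q)) * z) (+-monoˡ-≤ z remainder) ⟩
    ((y * Λ m + fromℤ (+ q) * z) + z) + fromℤ (+ (2 ℕ.* q)) * z ≡⟨ solve 4 (λ a p z t → ((a :+ p :* z) :+ z) :+ t :* z := a :+ (p :+ t :+ con 1ℚ) :* z) refl (y * Λ m) (fromℤ (+ q)) z (fromℤ (+ (2 ℕ.* q))) ⟩
    y * Λ m + (fromℤ (+ q) + fromℤ (+ (2 ℕ.* q)) + 1ℚ) * z ≡⟨ cong (λ t → y * Λ m + t * z) constants ⟩
    y * Λ m + fromℤ (+ (3 ℕ.* q ℕ.+ 1)) * z ∎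
    where
    open ≤-Reasoning
    Z Y : ℕ
    Z = m ℕ.+ l
    Y = Z ℕ.* Z
    Z≤Y : ∀ Z → Z ℕ.≤ Z ℕ.* Z
    Z≤Y zero = z≤n
    Z≤Y Z@(suc _) = ℕₚ.m≤m*n Z Z
    y z : ℚ
    y = fromℤ (+ Y)
    z = fromℤ (+ Z)
    constants : fromℤ (+ q) + fromℤ (+ (2 ℕ.* q)) + 1ℚ ≡ fromℤ (+ (3 ℕ.* q ℕ.+ 1))
    constants = trans (cong (_+ 1ℚ) (sym (fromℤ-+ (+ q) (+ (2 ℕ.* q))))) (trans (sym (fromℤ-+ (+ (q ℕ.+ 2 ℕ.* q)) 1ℤ)) (cong (λ t → fromℤ (+ t)) (triple q)))
      where
      triple : ∀ q → q ℕ.+ 2 ℕ.* q ℕ.+ 1 ≡ 3 ℕ.* q ℕ.+ 1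
      triple = ℕ-ring
    head≤ : ∑ Z (term Y) ≤ y * (Λ m + fromℤ (+ q) * r Z) + z
    head≤ = begin
      ∑ Z (term Y) ≤⟨ ∑-mono Z (λ j _ → term≤ Y j) ⟩
      ∑ Z (λ j → y * (ψℚ j * r j) + 1ℚ) ≡⟨ trans (∑-+ Z _ _) (cong₂ _+_ (sym (∑-*ˡ Z y _)) (trans (∑-const Z 1ℚ) (*-identityʳ z))) ⟩
      y * ∑ Z (λ j → ψℚ j * r j) + z ≤⟨ +-monoˡ-≤ z (*-monoˡ y (fromℤ-nonneg Y) (L-bound l)) ⟩
      y * (Λ m + fromℤ (+ q) * r Z) + z ∎
    remainder : y * (Λ m + fromℤ (+ q) * r Z) ≤ y * Λ m + fromℤ (+ q) * z
    remainder = ≤-trans (≤-reflexive (solve 4 (λ y a p r → y :* (a :+ p :* r) := y :* a :+ p :* (y :* r)) refl y (Λ m) (fromℤ (+ q)) (r Z)))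
      (+-monoʳ-≤ (y * Λ m) (*-monoˡ (fromℤ (+ q)) (fromℤ-nonneg q) (begin
        y * r Z ≡⟨ cong (_* r Z) (fromℤ-pos-* Z Z) ⟩
        z * z * r Z ≡⟨ *-assoc z z (r Z) ⟩
        z * (z * r Z) ≤⟨ *-monoˡ z (fromℤ-nonneg Z) (≤-trans (*-monoʳ (r Z) (0≤1/1+ Z) (fromℤ-mono-≤ {+ Z} {+ suc Z} (ℤ.+≤+ (ℕₚ.n≤1+n Z)))) (≤-reflexive (*-1/1+ Z))) ⟩
        z * 1ℚ ≡⟨ *-identityʳ z ⟩
        z ∎)))

count-multiples : ∀ d .{{_ : ℕ.NonZero d}} Y → ∑ℤ Y (λ i → ⟦ d ℕ∣.∣? suc i ⟧) ≡ + (Y ℕ./ d)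
count-multiples d@(suc d-1) Y = begin
  ∑ℤ Y f ≡⟨ cong (λ t → ∑ℤ t f) (trans (ℕ/.m≡m%n+[m/n]*n Y d) (ℕₚ.+-comm (Y ℕ.% d) (c ℕ.* d))) ⟩
  ∑ℤ (c ℕ.* d ℕ.+ Y ℕ.% d) f ≡⟨ ∑ℤ-split (c ℕ.* d) (Y ℕ.% d) f ⟩
  ∑ℤ (c ℕ.* d) f ℤ.+ ∑ℤ (Y ℕ.% d) (λ i → f (c ℕ.* d ℕ.+ i))
    ≡⟨ cong₂ ℤ._+_ (trans (∑ℤ-product c d f) (trans (∑ℤ-cong c (λ a _ → block a)) (trans (∑ℤ-const c 1ℤ) (ℤₚ.*-identityʳ (+ c)))))
         (∑ℤ-vanish (Y ℕ.% d) (λ i i< → absent c i (ℕₚ.<-≤-trans (s≤s i<) (ℕ/.m%n<n Y d)))) ⟩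
  + c ℤ.+ 0ℤ ≡⟨ ℤₚ.+-identityʳ (+ c) ⟩
  + c ∎
  where
  open ≡-Reasoning
  c : ℕ
  c = Y ℕ./ d
  f : ℕ → ℤ
  f i = ⟦ d ℕ∣.∣? suc i ⟧
  absent : ∀ a i → suc i ℕ.< d → f (a ℕ.* d ℕ.+ i) ≡ 0ℤ
  absent a i i<d = ⟦⟧-no (d ℕ∣.∣? suc (a ℕ.* d ℕ.+ i)) λ e → ℕₚ.<⇒≱ i<d (ℕ∣.∣⇒≤
    (ℕ∣.∣m+n∣m⇒∣n (subst (d ℕ∣.∣_) (sym (ℕₚ.+-suc (a ℕ.* d) i)) e) (ℕ∣.n∣m*n a)))
  block : ∀ a → ∑ℤ d (λ b → f (a ℕ.* d ℕ.+ b)) ≡ 1ℤ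
  block a = trans (cong₂ ℤ._+_ (∑ℤ-vanish d-1 (λ b b< → absent a b (s≤s b<)))
      (⟦⟧-yes (d ℕ∣.∣? suc (a ℕ.* d ℕ.+ d-1)) (subst (d ℕ∣.∣_) (ℕₚ.+-suc (a ℕ.* d) d-1) (ℕ∣.∣m∣n⇒∣m+n (ℕ∣.n∣m*n a) ℕ∣.∣-refl))))
    refl

-- Arithmetic of ℚ(√d)

square-root-rational : ∀ p n → p * p ≡ fromℤ (+ n) → ∃[ m ] m ℕ.* m ≡ n
square-root-rational p@(mkℚ a d c) n e = go (cross (toℚᵘ-cong-* e))
  where
  toℚᵘ-cong-* : p * p ≡ fromℤ (+ n) → (toℚᵘ p ℚᵘ.* toℚᵘ p) ℚᵘ.≃ ℚᵘ.mkℚᵘ (+ n) 0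
  toℚᵘ-cong-* e = ℚᵘₚ.≃-trans (ℚᵘₚ.≃-sym (toℚᵘ-homo-* p p)) (ℚᵘₚ.≃-trans (ℚᵘₚ.≃-reflexive (cong toℚᵘ e)) (toℚᵘ-fromℚᵘ (ℚᵘ.mkℚᵘ (+ n) 0)))
  cross : (toℚᵘ p ℚᵘ.* toℚᵘ p) ℚᵘ.≃ ℚᵘ.mkℚᵘ (+ n) 0 → ℤ.∣ a ∣ ℕ.* ℤ.∣ a ∣ ≡ n ℕ.* (suc d ℕ.* suc d)
  cross (ℚᵘ.*≡* h) = trans (sym (ℤₚ.abs-* a a)) (trans (cong ℤ.∣_∣ (sym (ℤₚ.*-identityʳ (a ℤ.* a)))) (trans (cong ℤ.∣_∣ h) (ℤₚ.abs-* (+ n) (+ (suc d ℕ.* suc d)))))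
  go : ℤ.∣ a ∣ ℕ.* ℤ.∣ a ∣ ≡ n ℕ.* (suc d ℕ.* suc d) → ∃[ m ] m ℕ.* m ≡ n
  go h = ℤ.∣ a ∣ , trans h (trans (cong (λ t → n ℕ.* (t ℕ.* t)) d≡1) (ℕₚ.*-identityʳ n))
    where
    coprime : Coprime.Coprime (suc d) ℤ.∣ a ∣
    coprime = Coprime.sym (Coprime.recompute c)
    d∣a² : suc d ℕ∣.∣ ℤ.∣ a ∣ ℕ.* ℤ.∣ a ∣
    d∣a² = subst (suc d ℕ∣.∣_) (sym h) (ℕ∣.∣n⇒∣m*n n (ℕ∣.m∣m*n (suc d)))
    d≡1 : suc d ≡ 1
    d≡1 = coprime (ℕ∣.∣-refl , Coprime.coprime-divisor coprime d∣a²)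

p*q≡0⇒p≡0 : ∀ p q → q ≢ 0ℚ → p * q ≡ 0ℚ → p ≡ 0ℚ
p*q≡0⇒p≡0 p q q≢0 e = trans (sym (*-identityʳ p)) (trans (cong (p *_) (sym (*-inverseʳ q {{≢-nonZero q≢0}})))
  (trans (sym (*-assoc p q ((1/ q) {{≢-nonZero q≢0}}))) (trans (cong (_* (1/ q) {{≢-nonZero q≢0}}) e) (*-zeroˡ ((1/ q) {{≢-nonZero q≢0}})))))

*-cancelʳ-≢0 : ∀ {p r} t → t ≢ 0ℚ → p * t ≡ r * t → p ≡ r
*-cancelʳ-≢0 {p} {r} t t≢0 e = trans (solve 2 (λ p r → p := (p :- r) :+ r) refl p r)
  (trans (cong (_+ r) (p*q≡0⇒p≡0 (p - r) t t≢0 (trans (solve 3 (λ p r t → (p :- r) :* t := p :* t :- r :* t) refl p r t)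
    (trans (cong (_- r * t) e) (+-inverseʳ (r * t)))))) (+-identityˡ r))

module _ {d : ℕ} where

  open CommutativeRing (ℚ√-commutativeRing d) public using ()
    renaming ( *-assoc to *ᴷ-assoc; *-comm to *ᴷ-comm; *-identityˡ to *ᴷ-identityˡ; *-identityʳ to *ᴷ-identityʳ
             ; +-assoc to +ᴷ-assoc; +-comm to +ᴷ-comm; +-identityˡ to +ᴷ-identityˡ; +-identityʳ to +ᴷ-identityʳ
             ; distribˡ to *ᴷ-distribˡ; distribʳ to *ᴷ-distribʳ; zeroˡ to *ᴷ-zeroˡ; zeroʳ to *ᴷ-zeroʳ
             ; -‿inverseʳ to +ᴷ-inverseʳ )

  private
    D : ℚ
    D = fromℤ (+ d)

  rational : ℚ → ℚ√ d
  rational p = p + 0ℚ √d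

  rootᴷ : ℚ√ d
  rootᴷ = 0ℚ + 1ℚ √d

  conjugate : ℚ√ d → ℚ√ d
  conjugate (a + b √d) = a + (- b) √d

  norm : ℚ√ d → ℚ
  norm (a + b √d) = a * a - D * (b * b)

  norm-* : ∀ x y → norm (x *ᴷ y) ≡ norm x * norm y
  norm-* (a + b √d) (a′ + b′ √d) = solve 5 (λ D a b c d →
    (a :* c :+ D :* (b :* d)) :* (a :* c :+ D :* (b :* d)) :- D :* ((a :* d :+ b :* c) :* (a :* d :+ b :* c)) :=
    (a :* a :- D :* (b :* b)) :* (c :* c :- D :* (d :* d))) refl D a b a′ b′

  rational-* : ∀ p q → rational (p * q) ≡ rational p *ᴷ rational q
  rational-* p q = cong₂ _+_√d (solve 3 (λ D p q → p :* q := p :* q :+ D :* (con 0ℚ :* con 0ℚ)) refl D p q)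
    (solve 2 (λ p q → con 0ℚ := p :* con 0ℚ :+ con 0ℚ :* q) refl p q)

  rational-+ : ∀ p q → rational (p + q) ≡ rational p +ᴷ rational q
  rational-+ p q = cong₂ _+_√d refl (sym (+-identityʳ 0ℚ))

  scale : ∀ p x → rational p *ᴷ x ≡ (p * rat x) + (p * irr x) √d
  scale p (a + b √d) = cong₂ _+_√d (solve 4 (λ D p a b → p :* a :+ D :* (con 0ℚ :* b) := p :* a) refl D p a b)
    (solve 3 (λ p a b → p :* b :+ con 0ℚ :* a := p :* b) refl p a b)

  ι-+ : ∀ m n → ι {d} (m ℤ.+ n) ≡ ι m +ᴷ ι n
  ι-+ m n = trans (cong rational (fromℤ-+ m n)) (rational-+ (fromℤ m) (fromℤ n))

  ι-* : ∀ m n → ι {d} (m ℤ.* n) ≡ ι m *ᴷ ι n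
  ι-* m n = trans (cong rational (fromℤ-* m n)) (rational-* (fromℤ m) (fromℤ n))

  ι-neg : ∀ n → ι {d} (ℤ.- n) ≡ -ᴷ ι n
  ι-neg n = cong (_+ 0ℚ √d) (fromℤ-neg n)

  x*conjugate : ∀ x → x *ᴷ conjugate x ≡ rational (norm x)
  x*conjugate (a + b √d) = cong₂ _+_√d (solve 3 (λ D a b → a :* a :+ D :* (b :* (:- b)) := a :* a :- D :* (b :* b)) refl D a b)
    (solve 2 (λ a b → a :* (:- b) :+ b :* a := con 0ℚ) refl a b)

  norm≡0⇒≡0 : ¬ (∃[ m ] m ℕ.* m ≡ d) → ∀ x → norm x ≡ 0ℚ → x ≡ 0ᴷ
  norm≡0⇒≡0 nonsquare x@(a + b √d) e with b ℚₚ.≟ 0ℚ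
  ... | yes refl = cong (_+ 0ℚ √d) (a≡0 a (trans (solve 2 (λ D a → a :* a := a :* a :- D :* (con 0ℚ :* con 0ℚ)) refl D a) e))
    where
    a≡0 : ∀ a → a * a ≡ 0ℚ → a ≡ 0ℚ
    a≡0 a h with a ℚₚ.≟ 0ℚ
    ... | yes z = z
    ... | no ¬z = p*q≡0⇒p≡0 a a ¬z h
  ... | no b≢0 = contradiction (square-root-rational (a * b⁻¹) d root) nonsquare
    where
    b⁻¹ : ℚ
    b⁻¹ = (1/ b) {{≢-nonZero b≢0}}
    root : (a * b⁻¹) * (a * b⁻¹) ≡ D
    root = begin
      (a * b⁻¹) * (a * b⁻¹) ≡⟨ solve 4 (λ D a b c → (a :* c) :* (a :* c) := (a :* a :- D :* (b :* b)) :* (c :* c) :+ D :* ((b :* c) :* (b :* c))) refl D a b b⁻¹ ⟩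
      (a * a - D * (b * b)) * (b⁻¹ * b⁻¹) + D * ((b * b⁻¹) * (b * b⁻¹)) ≡⟨ cong₂ (λ s t → s * (b⁻¹ * b⁻¹) + D * (t * t)) e (*-inverseʳ b {{≢-nonZero b≢0}}) ⟩
      0ℚ * (b⁻¹ * b⁻¹) + D * (1ℚ * 1ℚ) ≡⟨ solve 2 (λ D c → con 0ℚ :* (c :* c) :+ D :* (con 1ℚ :* con 1ℚ) := D) refl D b⁻¹ ⟩
      D ∎
      where open ≡-Reasoning

module Inverse {d : ℕ} (nonsquare : ¬ (∃[ m ] m ℕ.* m ≡ d)) where

  norm≢0 : ∀ {x : ℚ√ d} → x ≢ 0ᴷ → norm x ≢ 0ℚ
  norm≢0 {x} x≢0 e = x≢0 (norm≡0⇒≡0 nonsquare x e)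

  inverseᴷ : ∀ x → x ≢ 0ᴷ → ∃[ y ] x *ᴷ y ≡ 1ᴷ
  inverseᴷ x x≢0 = conjugate x *ᴷ rational n⁻¹ , trans (sym (*ᴷ-assoc x (conjugate x) (rational n⁻¹)))
    (trans (cong (_*ᴷ rational n⁻¹) (x*conjugate x)) (trans (sym (rational-* (norm x) n⁻¹))
      (cong rational (*-inverseʳ (norm x) {{≢-nonZero (norm≢0 x≢0)}}))))
    where
    n⁻¹ : ℚ
    n⁻¹ = (1/ norm x) {{≢-nonZero (norm≢0 x≢0)}}

  1ᴷ≢0ᴷ : 1ᴷ ≢ 0ᴷ {d}
  1ᴷ≢0ᴷ ()

  invertible⇒≢0 : ∀ {x y : ℚ√ d} → x *ᴷ y ≡ 1ᴷ → x ≢ 0ᴷ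
  invertible⇒≢0 {x} {y} e refl = 1ᴷ≢0ᴷ (trans (sym e) (*ᴷ-zeroˡ y))

module FieldSolver {d : ℕ} where

  private
    target : AlmostCommutativeRing _ _
    target = fromCommutativeRing (ℚ√-commutativeRing d)

    morphism : ℤ.+-*-rawRing -Raw-AlmostCommutative⟶ target
    morphism = record
      { ⟦_⟧ = ι
      ; +-homo = ι-+
      ; *-homo = ι-*
      ; -‿homo = ι-neg
      ; 0-homo = refl
      ; 1-homo = refl
      }

    coefficients : (m n : ℤ) → Maybe (ι {d} m ≡ ι n)
    coefficients m n with m ℤₚ.≟ n
    ... | yes e = just (cong ι e)
    ... | no _ = nothing

  open import Algebra.Solver.Ring ℤ.+-*-rawRing target morphism coefficients public using ()
    renaming (solve to solveᴷ; _:=_ to _:≡_; _:+_ to _⊕_; _:*_ to _⊗_; :-_ to ⊝_; _:-_ to _⊖_; con to conᴷ)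

χ2⇒mod8 : ∀ q → χ q (+ 2) ≡ 1ℤ → q ℕ.% 8 ≡ 1 ⊎ q ℕ.% 8 ≡ 7
χ2⇒mod8 q e = go (trans (sym (ℤₚ.*-identityʳ (kronecker2 (+ q)))) e)
  where
  go : kronecker2 (+ q) ≡ 1ℤ → q ℕ.% 8 ≡ 1 ⊎ q ℕ.% 8 ≡ 7
  go h with q ℕ.% 8
  ... | 1 = inj₁ refl
  ... | 7 = inj₂ refl
  ... | 0 with () ← h
  ... | 2 with () ← h
  ... | 3 with () ← h
  ... | 4 with () ← h
  ... | 5 with () ← h
  ... | 6 with () ← h
  ... | suc (suc (suc (suc (suc (suc (suc (suc _))))))) with () ← h

numerator-denominator : ∀ a d .(c : Coprime.Coprime ℤ.∣ a ∣ (suc d)) → mkℚ a d c * fromℤ (+ suc d) ≡ fromℤ a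
numerator-denominator a d c = toℚᵘ-injective (ℚᵘₚ.≃-trans (toℚᵘ-homo-* (mkℚ a d c) (fromℤ (+ suc d)))
  (ℚᵘₚ.≃-trans (ℚᵘₚ.*-cong {ℚᵘ.mkℚᵘ a d} ℚᵘₚ.≃-refl (toℚᵘ-fromℚᵘ (ℚᵘ.mkℚᵘ (+ suc d) 0)))
    (ℚᵘₚ.≃-trans (ℚᵘ.*≡* identity) (ℚᵘₚ.≃-sym (toℚᵘ-fromℚᵘ (ℚᵘ.mkℚᵘ a 0))))))
  where
  identity : (a ℤ.* + suc d) ℤ.* 1ℤ ≡ a ℤ.* + suc (d ℕ.* 1)
  identity = trans (ℤₚ.*-identityʳ (a ℤ.* + suc d)) (cong (λ t → a ℤ.* + suc t) (sym (ℕₚ.*-identityʳ d)))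

-- Norms of integral elements are integers

power : ℚ → ℕ → ℚ
power p zero = 1ℚ
power p (suc k) = p * power p k

IsInteger : ℚ → Set
IsInteger p = ∃[ n ] p ≡ fromℤ n

cancel-denominator : ∀ x y w v b → b ≢ 0ℚ → x * b ≡ y → y * w ≡ v * b → x * w ≡ v
cancel-denominator x y w v b b≢0 e f = *-cancelʳ-≢0 b b≢0 (trans (solve 3 (λ x w b → x :* w :* b := x :* b :* w) refl x w b) (trans (cong (_* w) e) f))

module _ (p : ℚ) (a : ℤ) (d : ℕ) (coprime : Coprime.Coprime (suc d) ℤ.∣ a ∣) (p*B≡a : p * fromℤ (+ suc d) ≡ fromℤ a) where

  private
    B : ℕ
    B = suc d

  denominator-divides : ∀ w → IsInteger w → IsInteger (p * w) → ∃[ v ] w ≡ fromℤ v * fromℤ (+ B)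
  denominator-divides w (z , e) (z′ , e′) = quotient B∣z , trans e (trans (cong fromℤ (ℤ∣._∣_.equality B∣z)) (fromℤ-* (quotient B∣z) (+ B)))
    where
    open ℤ∣ using (quotient)
    za≡z′B : z ℤ.* a ≡ z′ ℤ.* + B
    za≡z′B = fromℤ-injective {z ℤ.* a} {z′ ℤ.* + B} (begin
      fromℤ (z ℤ.* a) ≡⟨ fromℤ-* z a ⟩
      fromℤ z * fromℤ a ≡⟨ cong₂ _*_ (sym e) (sym p*B≡a) ⟩
      w * (p * fromℤ (+ B)) ≡⟨ solve 3 (λ w p B → w :* (p :* B) := (p :* w) :* B) refl w p (fromℤ (+ B)) ⟩
      (p * w) * fromℤ (+ B) ≡⟨ cong (_* fromℤ (+ B)) e′ ⟩
      fromℤ z′ * fromℤ (+ B) ≡⟨ fromℤ-* z′ (+ B) ⟨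
      fromℤ (z′ ℤ.* + B) ∎)
      where open ≡-Reasoning
    B∣z : + B ℤ∣.∣ z
    B∣z = ℤ∣.∣ᵤ⇒∣ (Coprime.coprime-divisor coprime
      (subst (B ℕ∣.∣_) (trans (ℤₚ.abs-* z a) (ℕₚ.*-comm ℤ.∣ z ∣ ℤ.∣ a ∣)) (ℤ∣.∣⇒∣ᵤ (ℤ∣.divides z′ za≡z′B))))

  AllIntegers : ℕ → Set
  AllIntegers D = ∀ k → IsInteger (fromℤ (+ D) * power p k)

  -- If all D pᵏ are integers, then the denominator B of p divides all of them,
  -- so that D / B has the same property: an infinite descent unless B = 1.
  descend : ∀ D → D ≢ 0 → d ≢ 0 → AllIntegers D → ∃[ D′ ] D′ ℕ.< D × D′ ≢ 0 × AllIntegers D′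
  descend D D≢0 d≢0 h = from-quotient (B∣ 0)
    where
    shift : ∀ k → fromℤ (+ D) * power p (suc k) ≡ p * (fromℤ (+ D) * power p k)
    shift k = solve 3 (λ D p w → D :* (p :* w) := p :* (D :* w)) refl (fromℤ (+ D)) p (power p k)
    B∣ : ∀ k → ∃[ v ] fromℤ (+ D) * power p k ≡ fromℤ v * fromℤ (+ B)
    B∣ k = denominator-divides (fromℤ (+ D) * power p k) (h k) (subst IsInteger (shift k) (h (suc k)))
    from-quotient : (∃[ w ] fromℤ (+ D) * power p 0 ≡ fromℤ w * fromℤ (+ B)) → ∃[ D′ ] D′ ℕ.< D × D′ ≢ 0 × AllIntegers D′
    from-quotient (w , e) = D′ , D′<D , D′≢0 , λ k → quotient k (B∣ k)
      where
      D′ : ℕ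
      D′ = ℤ.∣ w ∣
      D≡wB : + D ≡ w ℤ.* + B
      D≡wB = fromℤ-injective {+ D} {w ℤ.* + B} (trans (sym (*-identityʳ (fromℤ (+ D)))) (trans e (sym (fromℤ-* w (+ B)))))
      D≡ : D ≡ D′ ℕ.* B
      D≡ = trans (cong ℤ.∣_∣ D≡wB) (ℤₚ.abs-* w (+ B))
      D′≢0 : D′ ≢ 0
      D′≢0 z = D≢0 (trans D≡ (cong (ℕ._* B) z))
      D′<D : D′ ℕ.< D
      D′<D = subst (D′ ℕ.<_) (sym D≡) (ℕₚ.m<m*n D′ B {{ℕ.≢-nonZero D′≢0}} (s≤s (ℕₚ.n≢0⇒n>0 d≢0)))
      quotient : ∀ k → (∃[ v ] fromℤ (+ D) * power p k ≡ fromℤ v * fromℤ (+ B)) → IsInteger (fromℤ (+ D′) * power p k)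
      quotient k (v , e) = v , cancel-denominator (fromℤ (+ D′)) (fromℤ (+ D)) (power p k) (fromℤ v) (fromℤ (+ B))
        (λ z → contradiction (fromℤ-injective {+ B} {0ℤ} z) λ ()) (trans (sym (fromℤ-pos-* D′ B)) (cong (λ t → fromℤ (+ t)) (sym D≡))) e

  bounded-denominators : ∀ b D → D ℕ.≤ b → D ≢ 0 → AllIntegers D → d ≡ 0
  bounded-denominators zero D D≤b D≢0 h = contradiction (ℕₚ.n≤0⇒n≡0 D≤b) D≢0
  bounded-denominators (suc b) D D≤b D≢0 h = decidable-stable (d ℕₚ.≟ 0) λ d≢0 → d≢0 (recurse (descend D D≢0 d≢0 h))
    where
    recurse : (∃[ D′ ] D′ ℕ.< D × D′ ≢ 0 × AllIntegers D′) → d ≡ 0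
    recurse (D′ , D′<D , D′≢0 , h′) = bounded-denominators b D′ (ℕ.s≤s⁻¹ (ℕₚ.<-≤-trans D′<D D≤b)) D′≢0 h′

-- The complete integral closedness of ℤ; in this form it applies to norms, whose powers will have a
-- common denominator.
integer-if-denominators-bounded : ∀ D → D ≢ 0 → ∀ p → (∀ k → IsInteger (fromℤ (+ D) * power p k)) → IsInteger p
integer-if-denominators-bounded D D≢0 p@(mkℚ a d c) h = a , trans (sym (*-identityʳ p))
  (trans (cong (λ t → p * fromℤ (+ suc t)) (sym d≡0)) p*B≡a)
  where
  p*B≡a : p * fromℤ (+ suc d) ≡ fromℤ a
  p*B≡a = numerator-denominator a d c
  d≡0 : d ≡ 0
  d≡0 = bounded-denominators p a d (Coprime.sym (Coprime.recompute c)) p*B≡a D D ℕₚ.≤-refl D≢0 h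

module _ {d : ℕ} where

  open FieldSolver {d}

  -- Membership in the order ℤ[√d].
  InOrder : ℚ√ d → Set
  InOrder x = IsInteger (rat x) × IsInteger (irr x)

  order-ι : ∀ n → InOrder (ι n)
  order-ι n = (n , refl) , (0ℤ , refl)

  order-+ : ∀ {x y} → InOrder x → InOrder y → InOrder (x +ᴷ y)
  order-+ ((a , e) , (b , f)) ((a′ , e′) , (b′ , f′)) =
    (a ℤ.+ a′ , trans (cong₂ _+_ e e′) (sym (fromℤ-+ a a′))) , (b ℤ.+ b′ , trans (cong₂ _+_ f f′) (sym (fromℤ-+ b b′)))

  order-* : ∀ {x y} → InOrder x → InOrder y → InOrder (x *ᴷ y)
  order-* ((a , e) , (b , f)) ((a′ , e′) , (b′ , f′)) =
    (a ℤ.* a′ ℤ.+ + d ℤ.* (b ℤ.* b′) , trans (cong₂ _+_ (prod a a′ e e′) (trans (cong (fromℤ (+ d) *_) (prod b b′ f f′)) (sym (fromℤ-* (+ d) (b ℤ.* b′))))) (sym (fromℤ-+ (a ℤ.* a′) (+ d ℤ.* (b ℤ.* b′))))) ,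
    (a ℤ.* b′ ℤ.+ b ℤ.* a′ , trans (cong₂ _+_ (prod a b′ e f′) (prod b a′ f e′)) (sym (fromℤ-+ (a ℤ.* b′) (b ℤ.* a′))))
    where
    prod : ∀ {p q} m n → p ≡ fromℤ m → q ≡ fromℤ n → p * q ≡ fromℤ (m ℤ.* n)
    prod m n e f = trans (cong₂ _*_ e f) (sym (fromℤ-* m n))

  powerᴷ : ℚ√ d → ℕ → ℚ√ d
  powerᴷ x zero = 1ᴷ
  powerᴷ x (suc k) = x *ᴷ powerᴷ x k

  norm-power : ∀ x k → norm (powerᴷ x k) ≡ power (norm x) k
  norm-power x zero = solve 1 (λ D → con 1ℚ :* con 1ℚ :- D :* (con 0ℚ :* con 0ℚ) := con 1ℚ) refl (fromℤ (+ d))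
  norm-power x (suc k) = trans (norm-* x (powerᴷ x k)) (cong (norm x *_) (norm-power x k))

  data Suffix : List ℤ → List ℤ → Set where
    here : ∀ {cs} → Suffix cs cs
    there : ∀ {c cs ds} → Suffix (c ∷ ds) cs → Suffix ds cs

  suffix-∷ : ∀ {c cs ds} → Suffix ds cs → Suffix ds (c ∷ cs)
  suffix-∷ here = there here
  suffix-∷ (there s) = there (suffix-∷ s)

  suffix-[] : ∀ cs → Suffix [] cs
  suffix-[] [] = here
  suffix-[] (c ∷ cs) = suffix-∷ (suffix-[] cs)

  suffix-length : ∀ {ds cs} → Suffix ds cs → length ds ℕ.≤ length cs
  suffix-length here = ℕₚ.≤-refl
  suffix-length (there s) = ℕₚ.≤-trans (ℕₚ.n≤1+n _) (suffix-length s)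

  module _ (x : ℚ√ d) (2x : InOrder (ι (+ 2) *ᴷ x)) (cs : List ℤ) (root : evalMonic cs x ≡ 0ᴷ) where

    private
      pow2 : ℕ → ℚ√ d
      pow2 n = ι (+ (2 ℕ.^ n))

    evaluations : ∀ n ds → length ds ℕ.≤ n → InOrder (pow2 n *ᴷ evalMonic ds x)
    evaluations n [] _ = subst InOrder (sym (*ᴷ-identityʳ (pow2 n))) (order-ι (+ (2 ℕ.^ n)))
    evaluations (suc n) (c ∷ ds) (s≤s h) = subst InOrder (sym split)
      (order-+ (order-ι (+ (2 ℕ.^ suc n) ℤ.* c)) (order-* 2x (evaluations n ds h)))
      where
      open ≡-Reasoning
      e : ℚ√ d
      e = evalMonic ds x
      split : pow2 (suc n) *ᴷ (ι c +ᴷ x *ᴷ e) ≡ ι (+ (2 ℕ.^ suc n) ℤ.* c) +ᴷ (ι (+ 2) *ᴷ x) *ᴷ (pow2 n *ᴷ e)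
      split = trans (*ᴷ-distribˡ (pow2 (suc n)) (ι c) (x *ᴷ e)) (cong₂ _+ᴷ_ (sym (ι-* (+ (2 ℕ.^ suc n)) c)) (begin
        pow2 (suc n) *ᴷ (x *ᴷ e) ≡⟨ cong (_*ᴷ (x *ᴷ e)) (trans (cong ι (ℤₚ.pos-* 2 (2 ℕ.^ n))) (ι-* (+ 2) (+ (2 ℕ.^ n)))) ⟩
        (ι (+ 2) *ᴷ pow2 n) *ᴷ (x *ᴷ e) ≡⟨ *ᴷ-assoc (ι (+ 2)) (pow2 n) (x *ᴷ e) ⟩
        ι (+ 2) *ᴷ (pow2 n *ᴷ (x *ᴷ e)) ≡⟨ cong (ι (+ 2) *ᴷ_) (trans (sym (*ᴷ-assoc (pow2 n) x e)) (trans (cong (_*ᴷ e) (*ᴷ-comm (pow2 n) x)) (*ᴷ-assoc x (pow2 n) e))) ⟩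
        ι (+ 2) *ᴷ (x *ᴷ (pow2 n *ᴷ e)) ≡⟨ *ᴷ-assoc (ι (+ 2)) x (pow2 n *ᴷ e) ⟨
        (ι (+ 2) *ᴷ x) *ᴷ (pow2 n *ᴷ e) ∎))

    private
      N : ℚ√ d
      N = pow2 (length cs)

    -- The values of the Horner scheme span a lattice that is stable under x.
    powers-bounded : ∀ k ds → Suffix ds cs → InOrder (N *ᴷ (powerᴷ x k *ᴷ evalMonic ds x))
    powers-bounded zero ds s = subst (λ t → InOrder (N *ᴷ t)) (sym (*ᴷ-identityˡ (evalMonic ds x)))
      (evaluations (length cs) ds (suffix-length s))
    powers-bounded (suc k) ds here = subst InOrder (sym (trans (cong (λ t → N *ᴷ (powerᴷ x (suc k) *ᴷ t)) root)
      (trans (cong (N *ᴷ_) (*ᴷ-zeroʳ (powerᴷ x (suc k)))) (*ᴷ-zeroʳ N)))) (order-ι 0ℤ)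
    -- Writing e for the Horner value, x e(ds) = e(c ∷ ds) - c e([]). The exponent of x drops by
    -- one, and both lists are again suffixes of `cs`.
    powers-bounded (suc k) ds (there {c} s) = subst InOrder (sym split)
      (order-+ (powers-bounded k (c ∷ ds) s) (order-* (order-ι (ℤ.- c)) (powers-bounded k [] (suffix-[] cs))))
      where
      e y : ℚ√ d
      e = evalMonic ds x
      y = powerᴷ x k
      identity : ∀ (N y x e c : ℚ√ d) → N *ᴷ ((x *ᴷ y) *ᴷ e) ≡ N *ᴷ (y *ᴷ (c +ᴷ x *ᴷ e)) +ᴷ (-ᴷ c) *ᴷ (N *ᴷ (y *ᴷ 1ᴷ))
      identity = solveᴷ 5 (λ N y x e c → N ⊗ ((x ⊗ y) ⊗ e) :≡ N ⊗ (y ⊗ (c ⊕ x ⊗ e)) ⊕ (⊝ c) ⊗ (N ⊗ (y ⊗ conᴷ 1ℤ))) refl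
      split : N *ᴷ (powerᴷ x (suc k) *ᴷ e) ≡
        N *ᴷ (y *ᴷ evalMonic (c ∷ ds) x) +ᴷ ι (ℤ.- c) *ᴷ (N *ᴷ (y *ᴷ 1ᴷ))
      split = trans (identity N y x e (ι c)) (cong (λ t → N *ᴷ (y *ᴷ evalMonic (c ∷ ds) x) +ᴷ t *ᴷ (N *ᴷ (y *ᴷ 1ᴷ))) (sym (ι-neg c)))

    -- With n the length of `cs`, the element 2ⁿ xᵏ lies in ℤ[√d] for every k, so 4ⁿ is a common
    -- denominator of the powers of `norm x`.
    norm-integer : IsInteger (norm x)
    norm-integer = integer-if-denominators-bounded (2 ℕ.^ length cs ℕ.* 2 ℕ.^ length cs) nonzero (norm x) bounded
      where
      D : ℕ
      D = 2 ℕ.^ length cs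
      nonzero : D ℕ.* D ≢ 0
      nonzero = ℕ.≢-nonZero⁻¹ (D ℕ.* D) {{ℕₚ.m*n≢0 D D {{ℕₚ.m^n≢0 2 (length cs)}} {{ℕₚ.m^n≢0 2 (length cs)}}}}
      order-norm : ∀ y → InOrder y → IsInteger (norm y)
      order-norm y ((a , e) , (b , f)) = a ℤ.* a ℤ.- + d ℤ.* (b ℤ.* b) , trans
        (cong₂ (λ s t → s * s - fromℤ (+ d) * (t * t)) e f)
        (sym (trans (fromℤ-- (a ℤ.* a) (+ d ℤ.* (b ℤ.* b))) (cong₂ _-_ (fromℤ-* a a) (trans (fromℤ-* (+ d) (b ℤ.* b)) (cong (fromℤ (+ d) *_) (fromℤ-* b b))))))
      bounded : ∀ k → IsInteger (fromℤ (+ (D ℕ.* D)) * power (norm x) k)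
      bounded k = subst IsInteger (trans (norm-* N (powerᴷ x k)) (cong₂ _*_ norm-N (norm-power x k)))
        (order-norm (N *ᴷ powerᴷ x k) (subst (λ t → InOrder (N *ᴷ t)) (*ᴷ-identityʳ (powerᴷ x k)) (powers-bounded k [] (suffix-[] cs))))
        where
        norm-N : norm N ≡ fromℤ (+ (D ℕ.* D))
        norm-N = trans (solve 2 (λ D n → n :* n :- D :* (con 0ℚ :* con 0ℚ) := n :* n) refl (fromℤ (+ d)) (fromℤ (+ D)))
          (trans (sym (fromℤ-* (+ D) (+ D))) (cong fromℤ (sym (ℤₚ.pos-* D D))))

-- The ring of integers

parityℤ : ∀ A → (∃[ a ] A ≡ + 2 ℤ.* a) ⊎ (∃[ a ] A ≡ + 2 ℤ.* a ℤ.+ 1ℤ)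
parityℤ A with A ℤ.%ℕ 2 in e | ℤ/.n%ℕd<d A 2 | ℤ/.a≡a%ℕn+[a/ℕn]*n A 2
... | 0 | _ | h = inj₁ (A ℤ./ℕ 2 , trans h (trans (ℤₚ.+-identityˡ _) (ℤₚ.*-comm (A ℤ./ℕ 2) (+ 2))))
... | 1 | _ | h = inj₂ (A ℤ./ℕ 2 , trans h (trans (ℤₚ.+-comm 1ℤ (A ℤ./ℕ 2 ℤ.* + 2)) (cong (ℤ._+ 1ℤ) (ℤₚ.*-comm (A ℤ./ℕ 2) (+ 2)))))
... | suc (suc _) | s≤s (s≤s ()) | _

1≢2* : ∀ x → 1ℤ ≢ + 2 ℤ.* x
1≢2* x e with ℕ∣.∣⇒≤ (ℤ∣.∣⇒∣ᵤ (ℤ∣.divides {+ 2} {1ℤ} x (trans e (ℤₚ.*-comm (+ 2) x))))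
... | s≤s ()

module _ {d : ℕ} where

  det : ℚ√ d → ℚ√ d → ℚ
  det x y = rat x * irr y - rat y * irr x

  ω : ℚ√ d
  ω = ½ + ½ √d

module _ (q : ℕ) (disc : IsRealQuadraticDiscriminant q) where

  open IsRealQuadraticDiscriminant disc
  open IntegralBasis basis

  private
    D : ℚ
    D = fromℤ (+ q)

    q≢0 : q ≢ 0
    q≢0 e = nonsquare (0 , sym e)

  Δ : ℚ
  Δ = det ω₁ ω₂

  -- The discriminant of the basis is 4 q Δ², and it is q by hypothesis.
  2Δ : two * Δ ≡ 1ℚ ⊎ two * Δ ≡ - 1ℚ
  2Δ with two * Δ - 1ℚ ≟ 0ℚ
  ... | yes e = inj₁ (trans (solve 1 (λ x → x := (x :- con 1ℚ) :+ con 1ℚ) refl (two * Δ)) (cong (_+ 1ℚ) e))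
  ... | no ¬e = inj₂ (trans (solve 1 (λ x → x := (x :+ con 1ℚ) :- con 1ℚ) refl (two * Δ))
    (cong (_- 1ℚ) (p*q≡0⇒p≡0 (two * Δ + 1ℚ) (two * Δ - 1ℚ) ¬e factors)))
    where
    D≢0 : D ≢ 0ℚ
    D≢0 e = q≢0 (ℤₚ.+-injective (fromℤ-injective {+ q} {0ℤ} e))
    factors : (two * Δ + 1ℚ) * (two * Δ - 1ℚ) ≡ 0ℚ
    factors = p*q≡0⇒p≡0 _ D D≢0 (trans (identity D (rat ω₁) (irr ω₁) (rat ω₂) (irr ω₂)) (trans (cong (_- D) disc≡q) (+-inverseʳ D)))
      where
      identity : ∀ D a b c e → ((two * (a * e - c * b) + 1ℚ) * (two * (a * e - c * b) - 1ℚ)) * D ≡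
        (((a * a + D * (b * b)) + (a * a + D * (b * b))) * ((c * c + D * (e * e)) + (c * c + D * (e * e)))
         - ((a * c + D * (b * e)) + (a * c + D * (b * e))) * ((c * a + D * (e * b)) + (c * a + D * (e * b)))) - D
      identity = solve 5 (λ D a b c e → ((con two :* (a :* e :- c :* b) :+ con 1ℚ) :* (con two :* (a :* e :- c :* b) :- con 1ℚ)) :* D :=
        (((a :* a :+ D :* (b :* b)) :+ (a :* a :+ D :* (b :* b))) :* ((c :* c :+ D :* (e :* e)) :+ (c :* c :+ D :* (e :* e)))
         :- ((a :* c :+ D :* (b :* e)) :+ (a :* c :+ D :* (b :* e))) :* ((c :* a :+ D :* (e :* b)) :+ (c :* a :+ D :* (e :* b)))) :- D) refl

  2Δ-integer : IsInteger (two * Δ)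
  2Δ-integer = [ (λ e → 1ℤ , e) , (λ e → -1ℤ , e) ]′ 2Δ

  -- The determinant is bilinear, so its double is an integral multiple of 2 Δ = ±1.
  det-integral : ∀ x y → IsIntegral x → IsIntegral y → IsInteger (two * det x y)
  det-integral x y ix iy = combine (spanning x ix) (spanning y iy) 2Δ-integer
    where
    combine : (∃₂ λ a b → x ≡ ι a *ᴷ ω₁ +ᴷ ι b *ᴷ ω₂) → (∃₂ λ a b → y ≡ ι a *ᴷ ω₁ +ᴷ ι b *ᴷ ω₂) →
      IsInteger (two * Δ) → IsInteger (two * det x y)
    combine (a , b , refl) (a′ , b′ , refl) (n , e) = (a ℤ.* b′ ℤ.- a′ ℤ.* b) ℤ.* n , (begin
      two * det (ι a *ᴷ ω₁ +ᴷ ι b *ᴷ ω₂) (ι a′ *ᴷ ω₁ +ᴷ ι b′ *ᴷ ω₂)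
        ≡⟨ cong₂ (λ u v → two * det u v) (cong₂ _+ᴷ_ (scale (fromℤ a) ω₁) (scale (fromℤ b) ω₂)) (cong₂ _+ᴷ_ (scale (fromℤ a′) ω₁) (scale (fromℤ b′) ω₂)) ⟩
      two * ((fromℤ a * rat ω₁ + fromℤ b * rat ω₂) * (fromℤ a′ * irr ω₁ + fromℤ b′ * irr ω₂)
        - (fromℤ a′ * rat ω₁ + fromℤ b′ * rat ω₂) * (fromℤ a * irr ω₁ + fromℤ b * irr ω₂))
        ≡⟨ identity (fromℤ a) (fromℤ b) (fromℤ a′) (fromℤ b′) (rat ω₁) (irr ω₁) (rat ω₂) (irr ω₂) ⟩
      (fromℤ a * fromℤ b′ - fromℤ a′ * fromℤ b) * (two * Δ)
        ≡⟨ cong₂ _*_ (sym (trans (fromℤ-- (a ℤ.* b′) (a′ ℤ.* b)) (cong₂ _-_ (fromℤ-* a b′) (fromℤ-* a′ b)))) e ⟩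
      fromℤ (a ℤ.* b′ ℤ.- a′ ℤ.* b) * fromℤ n
        ≡⟨ fromℤ-* (a ℤ.* b′ ℤ.- a′ ℤ.* b) n ⟨
      fromℤ ((a ℤ.* b′ ℤ.- a′ ℤ.* b) ℤ.* n) ∎)
      where
      open ≡-Reasoning
      identity : ∀ a b a′ b′ r i s j → two * ((a * r + b * s) * (a′ * i + b′ * j) - (a′ * r + b′ * s) * (a * i + b * j)) ≡
        (a * b′ - a′ * b) * (two * (r * j - s * i))
      identity = solve 8 (λ a b a′ b′ r i s j → con two :* ((a :* r :+ b :* s) :* (a′ :* i :+ b′ :* j) :- (a′ :* r :+ b′ :* s) :* (a :* i :+ b :* j)) :=
        (a :* b′ :- a′ :* b) :* (con two :* (r :* j :- s :* i))) refl

  1-integral : IsIntegral (1ᴷ {q})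
  1-integral = (-1ℤ ∷ []) , cong₂ _+_√d
    (solve 1 (λ D → con (- 1ℚ) :+ (con 1ℚ :* con 1ℚ :+ D :* (con 0ℚ :* con 0ℚ)) := con 0ℚ) refl D) refl

  root-integral : ∀ n (p : ℚ) → D * (p * p) ≡ fromℤ n → IsIntegral {q} (0ℚ + p √d)
  root-integral n p e = (ℤ.- n ∷ 0ℤ ∷ []) , cong₂ _+_√d
    (trans (cong (_+ (0ℚ * (0ℚ + (0ℚ * 1ℚ + D * (p * 0ℚ))) + D * (p * (0ℚ + (0ℚ * 0ℚ + p * 1ℚ))))) (trans (fromℤ-neg n) (cong -_ (sym e))))
      (solve 2 (λ D p → :- (D :* (p :* p)) :+ (con 0ℚ :* (con 0ℚ :+ (con 0ℚ :* con 1ℚ :+ D :* (p :* con 0ℚ))) :+ D :* (p :* (con 0ℚ :+ (con 0ℚ :* con 0ℚ :+ p :* con 1ℚ)))) := con 0ℚ) refl D p))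
    (solve 2 (λ D p → con 0ℚ :+ (con 0ℚ :* (con 0ℚ :+ (con 0ℚ :* con 0ℚ :+ p :* con 1ℚ)) :+ p :* (con 0ℚ :+ (con 0ℚ :* con 1ℚ :+ D :* (p :* con 0ℚ)))) := con 0ℚ) refl D p)

  -- The irrational part is the determinant of 1 and x; the determinant with √q gives the rational
  -- part in the same way.
  2irr-integer : ∀ x → IsIntegral x → IsInteger (two * irr x)
  2irr-integer x ix = subst (λ t → IsInteger (two * t))
    (solve 2 (λ a b → con 1ℚ :* b :- a :* con 0ℚ := b) refl (rat x) (irr x)) (det-integral 1ᴷ x 1-integral ix)

  2rat-integer : ∀ x → IsIntegral x → IsInteger (two * rat x)
  2rat-integer x ix = subst (λ t → IsInteger (two * t))
    (solve 2 (λ a b → a :* con 1ℚ :- con 0ℚ :* b := a) refl (rat x) (irr x))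
    (det-integral x rootᴷ ix (root-integral (+ q) 1ℚ (*-identityʳ D)))

  integral-norm : ∀ x → IsIntegral x → IsInteger (norm x)
  integral-norm x ix@(cs , e) = norm-integer x (subst InOrder (sym (scale two x)) (2rat-integer x ix , 2irr-integer x ix)) cs e

  -- For q ≡ 3 modulo 4, divisibility of A² - q B² by 4 forces A and B to be even. All integral
  -- elements would then lie in ℤ[√q], and 2 Δ would be even instead of ±1.
  module Residue7 (k : ℕ) (q≡ : q ≡ 8 ℕ.* k ℕ.+ 7) where

    half-even : ∀ A B n → A ℤ.* A ℤ.- + q ℤ.* (B ℤ.* B) ≡ + 4 ℤ.* n → (∃[ a ] A ≡ + 2 ℤ.* a) × (∃[ b ] B ≡ + 2 ℤ.* b)
    half-even A B n e = cases (parityℤ A) (parityℤ B)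
      where
      qℤ : + q ≡ + 8 ℤ.* + k ℤ.+ + 7
      qℤ = trans (cong +_ q≡) (cong (ℤ._+ + 7) (ℤₚ.pos-* 8 k))
      h : A ℤ.* A ℤ.- (+ 8 ℤ.* + k ℤ.+ + 7) ℤ.* (B ℤ.* B) ≡ + 4 ℤ.* n
      h = trans (cong (λ t → A ℤ.* A ℤ.- t ℤ.* (B ℤ.* B)) (sym qℤ)) e
      cases : _ → _ → (∃[ a ] A ≡ + 2 ℤ.* a) × (∃[ b ] B ≡ + 2 ℤ.* b)
      cases (inj₁ a) (inj₁ b) = a , b
      cases (inj₂ (a , refl)) (inj₁ (b , refl)) = contradiction
        (linear 1ℤ h (identity a b (+ k) n)) (1≢2* (+ 2 ℤ.* n ℤ.- + 2 ℤ.* (a ℤ.* a) ℤ.- + 2 ℤ.* a ℤ.+ + 2 ℤ.* ((+ 8 ℤ.* + k ℤ.+ + 7) ℤ.* (b ℤ.* b))))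
        where
        identity : ∀ a b k n → 1ℤ ℤ.- + 2 ℤ.* (+ 2 ℤ.* n ℤ.- + 2 ℤ.* (a ℤ.* a) ℤ.- + 2 ℤ.* a ℤ.+ + 2 ℤ.* ((+ 8 ℤ.* k ℤ.+ + 7) ℤ.* (b ℤ.* b))) ≡
          1ℤ ℤ.* ((+ 2 ℤ.* a ℤ.+ 1ℤ) ℤ.* (+ 2 ℤ.* a ℤ.+ 1ℤ) ℤ.- (+ 8 ℤ.* k ℤ.+ + 7) ℤ.* ((+ 2 ℤ.* b) ℤ.* (+ 2 ℤ.* b)) ℤ.- + 4 ℤ.* n)
        identity = ℤ-ring
      cases (inj₁ (a , refl)) (inj₂ (b , refl)) = contradiction
        (linear -1ℤ h (identity a b (+ k) n)) (1≢2* (+ 2 ℤ.* (a ℤ.* a) ℤ.- + 2 ℤ.* n ℤ.- (+ 8 ℤ.* + k ℤ.+ + 7) ℤ.* (+ 2 ℤ.* (b ℤ.* b) ℤ.+ + 2 ℤ.* b) ℤ.- + 4 ℤ.* + k ℤ.- + 3))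
        where
        identity : ∀ a b k n → 1ℤ ℤ.- + 2 ℤ.* (+ 2 ℤ.* (a ℤ.* a) ℤ.- + 2 ℤ.* n ℤ.- (+ 8 ℤ.* k ℤ.+ + 7) ℤ.* (+ 2 ℤ.* (b ℤ.* b) ℤ.+ + 2 ℤ.* b) ℤ.- + 4 ℤ.* k ℤ.- + 3) ≡
          -1ℤ ℤ.* ((+ 2 ℤ.* a) ℤ.* (+ 2 ℤ.* a) ℤ.- (+ 8 ℤ.* k ℤ.+ + 7) ℤ.* ((+ 2 ℤ.* b ℤ.+ 1ℤ) ℤ.* (+ 2 ℤ.* b ℤ.+ 1ℤ)) ℤ.- + 4 ℤ.* n)
        identity = ℤ-ring
      cases (inj₂ (a , refl)) (inj₂ (b , refl)) = contradiction half (1≢2* x)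
        where
        x : ℤ
        x = n ℤ.- a ℤ.* a ℤ.- a ℤ.+ + 2 ℤ.* (+ k ℤ.* (+ 4 ℤ.* (b ℤ.* b) ℤ.+ + 4 ℤ.* b ℤ.+ 1ℤ)) ℤ.+ + 7 ℤ.* (b ℤ.* b ℤ.+ b) ℤ.+ + 2
        identity : ∀ a b k n → + 2 ℤ.* 1ℤ ℤ.- + 2 ℤ.* (+ 2 ℤ.* (n ℤ.- a ℤ.* a ℤ.- a ℤ.+ + 2 ℤ.* (k ℤ.* (+ 4 ℤ.* (b ℤ.* b) ℤ.+ + 4 ℤ.* b ℤ.+ 1ℤ)) ℤ.+ + 7 ℤ.* (b ℤ.* b ℤ.+ b) ℤ.+ + 2)) ≡
          1ℤ ℤ.* ((+ 2 ℤ.* a ℤ.+ 1ℤ) ℤ.* (+ 2 ℤ.* a ℤ.+ 1ℤ) ℤ.- (+ 8 ℤ.* k ℤ.+ + 7) ℤ.* ((+ 2 ℤ.* b ℤ.+ 1ℤ) ℤ.* (+ 2 ℤ.* b ℤ.+ 1ℤ)) ℤ.- + 4 ℤ.* n)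
        identity = ℤ-ring
        half : 1ℤ ≡ + 2 ℤ.* x
        half = ℤₚ.*-cancelˡ-≡ (+ 2) 1ℤ (+ 2 ℤ.* x) (linear 1ℤ h (identity a b (+ k) n))

    even-coordinates : ∀ x → IsIntegral x → InOrder x
    even-coordinates x ix = go (2rat-integer x ix) (2irr-integer x ix) (integral-norm x ix)
      where
      halve : ∀ p A a → two * p ≡ fromℤ A → A ≡ + 2 ℤ.* a → p ≡ fromℤ a
      halve p A a e f = trans (solve 1 (λ p → p := con ½ :* (con two :* p)) refl p)
        (trans (cong (½ *_) (trans e (trans (cong fromℤ f) (fromℤ-* (+ 2) a)))) (solve 1 (λ a → con ½ :* (con two :* a) := a) refl (fromℤ a)))
      go : IsInteger (two * rat x) → IsInteger (two * irr x) → IsInteger (norm x) → InOrder x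
      go (A , e) (B , f) (n , g) = finish (half-even A B n (fromℤ-injective {A ℤ.* A ℤ.- + q ℤ.* (B ℤ.* B)} {+ 4 ℤ.* n} (begin
        fromℤ (A ℤ.* A ℤ.- + q ℤ.* (B ℤ.* B)) ≡⟨ trans (fromℤ-- (A ℤ.* A) (+ q ℤ.* (B ℤ.* B))) (cong₂ _-_ (fromℤ-* A A) (trans (fromℤ-* (+ q) (B ℤ.* B)) (cong (D *_) (fromℤ-* B B)))) ⟩
        fromℤ A * fromℤ A - D * (fromℤ B * fromℤ B) ≡⟨ cong₂ (λ s t → s * s - D * (t * t)) (sym e) (sym f) ⟩
        two * rat x * (two * rat x) - D * (two * irr x * (two * irr x))
          ≡⟨ solve 3 (λ D a b → con two :* a :* (con two :* a) :- D :* (con two :* b :* (con two :* b)) := con (fromℤ (+ 4)) :* (a :* a :- D :* (b :* b))) refl D (rat x) (irr x) ⟩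
        fromℤ (+ 4) * norm x ≡⟨ trans (cong (fromℤ (+ 4) *_) g) (sym (fromℤ-* (+ 4) n)) ⟩
        fromℤ (+ 4 ℤ.* n) ∎)))
        where
        open ≡-Reasoning
        finish : (∃[ a ] A ≡ + 2 ℤ.* a) × (∃[ b ] B ≡ + 2 ℤ.* b) → InOrder x
        finish ((a , p) , (b , r)) = (a , halve (rat x) A a e p) , (b , halve (irr x) B b f r)

    impossible : ⊥
    impossible = go (even-coordinates ω₁ ω₁-integral) (even-coordinates ω₂ ω₂-integral)
      where
      go : InOrder ω₁ → InOrder ω₂ → ⊥
      go ((a , e) , (b , f)) ((a′ , e′) , (b′ , f′)) = [ (λ h → 1≢2* m (fromℤ-injective {1ℤ} {+ 2 ℤ.* m} (sym (trans value h)))) ,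
        (λ h → 1≢2* (ℤ.- m) (trans (sym (ℤₚ.neg-involutive 1ℤ)) (trans (cong ℤ.-_ (fromℤ-injective { -1ℤ} {+ 2 ℤ.* m} (sym (trans value h)))) (ℤₚ.neg-distribʳ-* (+ 2) m)))) ]′ 2Δ
        where
        m : ℤ
        m = a ℤ.* b′ ℤ.- a′ ℤ.* b
        value : fromℤ (+ 2 ℤ.* m) ≡ two * Δ
        value = trans (fromℤ-* (+ 2) m) (cong (two *_) (trans (fromℤ-- (a ℤ.* b′) (a′ ℤ.* b))
          (cong₂ _-_ (trans (fromℤ-* a b′) (cong₂ _*_ (sym e) (sym f′))) (trans (fromℤ-* a′ b) (cong₂ _*_ (sym e′) (sym f))))))

  residue1 : χ q (+ 2) ≡ 1ℤ → ∃[ k ] q ≡ 8 ℕ.* k ℕ.+ 1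
  residue1 h = [ (λ e → q ℕ./ 8 , expand 1 e) , (λ e → ⊥-elim (Residue7.impossible (q ℕ./ 8) (expand 7 e))) ]′ (χ2⇒mod8 q h)
    where
    expand : ∀ r → q ℕ.% 8 ≡ r → q ≡ 8 ℕ.* (q ℕ./ 8) ℕ.+ r
    expand r e = trans (ℕ/.m≡m%n+[m/n]*n q 8) (trans (cong (ℕ._+ q ℕ./ 8 ℕ.* 8) e) (trans (ℕₚ.+-comm r (q ℕ./ 8 ℕ.* 8)) (cong (ℕ._+ r) (ℕₚ.*-comm (q ℕ./ 8) 8))))

  -- If p² ∣ q, then √q / p is integral as a root of X² - q / p². Its doubled irrational part 2 / p
  -- must be an integer, so p = 2 and q is even.
  odd-squareFree : (∀ m → q ≢ 2 ℕ.* m) → SquareFree q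
  odd-squareFree q-odd {p} pr (ℕ∣.divides q′ e) = even-p (2irr-integer (0ℚ + r √d) (root-integral (+ q′) r value))
    where
    instance
      p≢0 : ℕ.NonZero p
      p≢0 = prime⇒nonZero pr
    r : ℚ
    r = 1/1+ (ℕ.pred p)
    p*r≡1 : fromℤ (+ p) * r ≡ 1ℚ
    p*r≡1 = trans (cong (λ t → fromℤ (+ t) * r) (sym (ℕₚ.suc-pred p))) (*-1/1+ (ℕ.pred p))
    D≡ : D ≡ fromℤ (+ q′) * (fromℤ (+ p) * fromℤ (+ p))
    D≡ = trans (cong (λ t → fromℤ (+ t)) e) (trans (cong fromℤ (trans (ℤₚ.pos-* q′ (p ℕ.* p)) (cong (+ q′ ℤ.*_) (ℤₚ.pos-* p p))))
      (trans (fromℤ-* (+ q′) (+ p ℤ.* + p)) (cong (fromℤ (+ q′) *_) (fromℤ-* (+ p) (+ p)))))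
    value : D * (r * r) ≡ fromℤ (+ q′)
    value = trans (cong (_* (r * r)) D≡) (trans (solve 3 (λ k p r → k :* (p :* p) :* (r :* r) := k :* ((p :* r) :* (p :* r))) refl (fromℤ (+ q′)) (fromℤ (+ p)) r)
      (trans (cong (λ t → fromℤ (+ q′) * (t * t)) p*r≡1) (*-identityʳ (fromℤ (+ q′)))))
    even-p : ¬ IsInteger (two * r)
    even-p (n , f) = q-odd (q′ ℕ.* p) (trans e (trans (cong (λ t → q′ ℕ.* (p ℕ.* t)) p≡2) (identity q′ p)))
      where
      identity : ∀ k p → k ℕ.* (p ℕ.* 2) ≡ 2 ℕ.* (k ℕ.* p)
      identity = ℕ-ring
      2≡n*p : + 2 ≡ n ℤ.* + p
      2≡n*p = fromℤ-injective {+ 2} {n ℤ.* + p} (sym (trans (fromℤ-* n (+ p)) (trans (cong (_* fromℤ (+ p)) (sym f))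
        (trans (solve 2 (λ r p → con two :* r :* p := con two :* (p :* r)) refl r (fromℤ (+ p))) (trans (cong (two *_) p*r≡1) (*-identityʳ two))))))
      p≡2 : p ≡ 2
      p≡2 = ℕₚ.≤-antisym (ℕ∣.∣⇒≤ (ℤ∣.∣⇒∣ᵤ (ℤ∣.divides n 2≡n*p))) (ℕ.nonTrivial⇒n>1 p {{prime⇒nonTrivial pr}})

-- The maximal order as ℤ + ℤ ω

module Maximal (q Q : ℕ) (q≡ : q ≡ 4 ℕ.* Q ℕ.+ 1) where

  D : ℚ
  D = fromℤ (+ q)

  D≡ : D ≡ fromℤ (+ 4) * fromℤ (+ Q) + 1ℚ
  D≡ = trans (cong (λ t → fromℤ (+ t)) q≡) (trans (fromℤ-+ (+ (4 ℕ.* Q)) 1ℤ) (cong (_+ 1ℚ) (fromℤ-pos-* 4 Q)))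

  element : ℤ → ℤ → ℚ√ q
  element m n = ι m +ᴷ ι n *ᴷ ω

  element≡ : ∀ m n → element m n ≡ (fromℤ m + ½ * fromℤ n) + (½ * fromℤ n) √d
  element≡ m n = trans (cong (ι m +ᴷ_) (scale (fromℤ n) ω)) (cong₂ _+_√d
    (solve 2 (λ m n → m :+ n :* con ½ := m :+ con ½ :* n) refl (fromℤ m) (fromℤ n))
    (solve 1 (λ n → con 0ℚ :+ n :* con ½ := con ½ :* n) refl (fromℤ n)))

  element-integral : ∀ m n → IsIntegral (element m n)
  element-integral m n = (N ∷ ℤ.- t ∷ []) , trans (cong (evalMonic (N ∷ ℤ.- t ∷ [])) (element≡ m n)) (cong₂ _+_√d
    (trans (cong₂ (λ u v → u + (x * (v + (x * 1ℚ + D * (y * 0ℚ))) + D * (y * (0ℚ + (x * 0ℚ + y * 1ℚ))))) N≡ t≡)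
      (trans (cong (λ D → (M * M + M * n′ - Q′ * (n′ * n′)) + (x * (- (two * M + n′) + (x * 1ℚ + D * (y * 0ℚ))) + D * (y * (0ℚ + (x * 0ℚ + y * 1ℚ))))) D≡)
        (solve 3 (λ M n Q → let x = M :+ con ½ :* n ; y = con ½ :* n ; D = con (fromℤ (+ 4)) :* Q :+ con 1ℚ in
          (M :* M :+ M :* n :- Q :* (n :* n)) :+ (x :* (:- (con two :* M :+ n) :+ (x :* con 1ℚ :+ D :* (y :* con 0ℚ))) :+ D :* (y :* (con 0ℚ :+ (x :* con 0ℚ :+ y :* con 1ℚ)))) := con 0ℚ) refl M n′ Q′)))
    (trans (cong (λ v → 0ℚ + (x * (0ℚ + (x * 0ℚ + y * 1ℚ)) + y * (v + (x * 1ℚ + D * (y * 0ℚ))))) t≡)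
      (solve 3 (λ M n D → let x = M :+ con ½ :* n ; y = con ½ :* n in
        con 0ℚ :+ (x :* (con 0ℚ :+ (x :* con 0ℚ :+ y :* con 1ℚ)) :+ y :* (:- (con two :* M :+ n) :+ (x :* con 1ℚ :+ D :* (y :* con 0ℚ)))) := con 0ℚ) refl M n′ D)))
    where
    N t : ℤ
    N = m ℤ.* m ℤ.+ m ℤ.* n ℤ.- + Q ℤ.* (n ℤ.* n)
    t = + 2 ℤ.* m ℤ.+ n
    M n′ Q′ x y : ℚ
    M = fromℤ m
    n′ = fromℤ n
    Q′ = fromℤ (+ Q)
    x = M + ½ * n′
    y = ½ * n′
    N≡ : fromℤ N ≡ M * M + M * n′ - Q′ * (n′ * n′)
    N≡ = trans (fromℤ-- (m ℤ.* m ℤ.+ m ℤ.* n) (+ Q ℤ.* (n ℤ.* n))) (cong₂ _-_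
      (trans (fromℤ-+ (m ℤ.* m) (m ℤ.* n)) (cong₂ _+_ (fromℤ-* m m) (fromℤ-* m n)))
      (trans (fromℤ-* (+ Q) (n ℤ.* n)) (cong (Q′ *_) (fromℤ-* n n))))
    t≡ : fromℤ (ℤ.- t) ≡ - (two * M + n′)
    t≡ = trans (fromℤ-neg t) (cong -_ (trans (fromℤ-+ (+ 2 ℤ.* m) n) (cong (_+ n′) (fromℤ-* (+ 2) m))))

  module _ (disc : IsRealQuadraticDiscriminant q) where

    -- Twice the determinants of x with 1 and with ω are integers; up to sign they are the
    -- coordinates of x with respect to 1 and ω.
    integral⇒element : ∀ x → IsIntegral x → ∃₂ λ m n → x ≡ element m n
    integral⇒element x ix = go (2irr-integer q disc x ix)
      (det-integral q disc (element 0ℤ 1ℤ) x (element-integral 0ℤ 1ℤ) ix)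
      where
      go : IsInteger (two * irr x) → IsInteger (two * det (element 0ℤ 1ℤ) x) → ∃₂ λ m n → x ≡ element m n
      go (B , f) (e , g) = ℤ.- e , B , trans (cong₂ _+_√d rational-part irrational-part) (sym (element≡ (ℤ.- e) B))
        where
        irrational-part : irr x ≡ ½ * fromℤ B
        irrational-part = trans (solve 1 (λ b → b := con ½ :* (con two :* b)) refl (irr x)) (cong (½ *_) f)
        g′ : irr x - rat x ≡ fromℤ e
        g′ = trans (solve 2 (λ a b → b :- a := con two :* ((con 0ℚ :+ con ½ :* con 1ℚ) :* b :- a :* (con ½ :* con 1ℚ))) refl (rat x) (irr x))
          (trans (cong (λ t → two * det t x) (sym (element≡ 0ℤ 1ℤ))) g)
        rational-part : rat x ≡ fromℤ (ℤ.- e) + ½ * fromℤ B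
        rational-part = trans (solve 2 (λ a b → a := (:- (b :- a)) :+ b) refl (rat x) (irr x))
          (cong₂ _+_ (trans (cong -_ g′) (sym (fromℤ-neg e))) irrational-part)

-- Lattices and their normal forms

record RationalGCD (p q : ℚ) : Set where
  field
    g : ℚ
    u v m n : ℤ
    bézout : g ≡ fromℤ u * p + fromℤ v * q
    p≡m*g : p ≡ fromℤ m * g
    q≡n*g : q ≡ fromℤ n * g

rationalGCD : ∀ p q → RationalGCD p q
rationalGCD p@(mkℚ a i c) q@(mkℚ b j c′) = record
  { g = fromℤ (+ G.g) * w ; u = G.u ; v = G.v ; m = G.m ; n = G.n
  ; bézout = begin
      fromℤ (+ G.g) * w ≡⟨ cong (λ t → fromℤ t * w) G.bézout ⟩
      fromℤ (G.u ℤ.* A ℤ.+ G.v ℤ.* B) * w ≡⟨ cong (_* w) (trans (fromℤ-+ (G.u ℤ.* A) (G.v ℤ.* B)) (cong₂ _+_ (fromℤ-* G.u A) (fromℤ-* G.v B))) ⟩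
      (fromℤ G.u * fromℤ A + fromℤ G.v * fromℤ B) * w ≡⟨ solve 5 (λ u A v B w → (u :* A :+ v :* B) :* w := u :* (A :* w) :+ v :* (B :* w)) refl (fromℤ G.u) (fromℤ A) (fromℤ G.v) (fromℤ B) w ⟩
      fromℤ G.u * (fromℤ A * w) + fromℤ G.v * (fromℤ B * w) ≡⟨ cong₂ (λ s t → fromℤ G.u * s + fromℤ G.v * t) (sym p≡) (sym q≡) ⟩
      fromℤ G.u * p + fromℤ G.v * q ∎
  ; p≡m*g = multiple A G.m p≡ G.a≡m*g
  ; q≡n*g = multiple B G.n q≡ G.b≡n*g
  }
  where
  open ≡-Reasoning
  A B : ℤ
  A = a ℤ.* + suc j
  B = b ℤ.* + suc i
  w : ℚ
  w = 1/1+ i * 1/1+ j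
  module G = ExtendedGCD (extendedGCD A B)
  clear : ∀ p a i j → p * fromℤ (+ suc i) ≡ fromℤ a → p ≡ fromℤ (a ℤ.* + suc j) * (1/1+ i * 1/1+ j)
  clear p a i j e = sym (begin
    fromℤ (a ℤ.* + suc j) * (1/1+ i * 1/1+ j) ≡⟨ cong (_* (1/1+ i * 1/1+ j)) (trans (fromℤ-* a (+ suc j)) (cong (_* fromℤ (+ suc j)) (sym e))) ⟩
    p * fromℤ (+ suc i) * fromℤ (+ suc j) * (1/1+ i * 1/1+ j) ≡⟨ solve 5 (λ p I J x y → p :* I :* J :* (x :* y) := p :* (I :* x) :* (J :* y)) refl p (fromℤ (+ suc i)) (fromℤ (+ suc j)) (1/1+ i) (1/1+ j) ⟩
    p * (fromℤ (+ suc i) * 1/1+ i) * (fromℤ (+ suc j) * 1/1+ j) ≡⟨ cong₂ (λ s t → p * s * t) (*-1/1+ i) (*-1/1+ j) ⟩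
    p * 1ℚ * 1ℚ ≡⟨ trans (*-identityʳ (p * 1ℚ)) (*-identityʳ p) ⟩
    p ∎)
  p≡ : p ≡ fromℤ A * w
  p≡ = clear p a i j (numerator-denominator a i c)
  q≡ : q ≡ fromℤ B * w
  q≡ = trans (clear q b j i (numerator-denominator b j c′)) (cong (fromℤ B *_) (*-comm (1/1+ j) (1/1+ i)))
  multiple : ∀ {p} A m → p ≡ fromℤ A * w → A ≡ m ℤ.* + G.g → p ≡ fromℤ m * (fromℤ (+ G.g) * w)
  multiple A m e f = trans e (trans (cong (λ t → fromℤ t * w) f) (trans (cong (_* w) (fromℤ-* m (+ G.g))) (*-assoc (fromℤ m) (fromℤ (+ G.g)) w)))

module _ {d : ℕ} where

  open FieldSolver {d}

  ZSpan : List (ℚ√ d) → ℚ√ d → Set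
  ZSpan [] x = x ≡ 0ᴷ
  ZSpan (v ∷ vs) x = ∃₂ λ n y → ZSpan vs y × x ≡ ι n *ᴷ v +ᴷ y

  record Subgroup (P : ℚ√ d → Set) : Set where
    field
      zero-closed : P 0ᴷ
      +-closed : ∀ {x y} → P x → P y → P (x +ᴷ y)
      ι-closed : ∀ n {x} → P x → P (ι n *ᴷ x)

  open Subgroup public

  span-subgroup : ∀ vs → Subgroup (ZSpan vs)
  span-subgroup [] = record
    { zero-closed = refl
    ; +-closed = λ { refl refl → refl }
    ; ι-closed = λ { n refl → *ᴷ-zeroʳ (ι n) } }
  span-subgroup (v ∷ vs) = record
    { zero-closed = 0ℤ , 0ᴷ , zero-closed (span-subgroup vs) , solveᴷ 1 (λ v → conᴷ 0ℤ :≡ conᴷ 0ℤ ⊗ v ⊕ conᴷ 0ℤ) refl v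
    ; +-closed = λ { (m , y , p , refl) (n , z , r , refl) → m ℤ.+ n , y +ᴷ z , +-closed (span-subgroup vs) p r ,
        trans (solveᴷ 5 (λ m v y n z → (m ⊗ v ⊕ y) ⊕ (n ⊗ v ⊕ z) :≡ (m ⊕ n) ⊗ v ⊕ (y ⊕ z)) refl (ι m) v y (ι n) z)
          (cong (λ t → t *ᴷ v +ᴷ (y +ᴷ z)) (sym (ι-+ m n))) }
    ; ι-closed = λ { n (m , y , p , refl) → n ℤ.* m , ι n *ᴷ y , ι-closed (span-subgroup vs) n p ,
        trans (solveᴷ 4 (λ n m v y → n ⊗ (m ⊗ v ⊕ y) :≡ (n ⊗ m) ⊗ v ⊕ n ⊗ y) refl (ι n) (ι m) v y)
          (cong (λ t → t *ᴷ v +ᴷ ι n *ᴷ y) (sym (ι-* n m))) } }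

  span-head : ∀ v vs → ZSpan (v ∷ vs) v
  span-head v vs = 1ℤ , 0ᴷ , zero-closed (span-subgroup vs) , solveᴷ 1 (λ v → v :≡ conᴷ 1ℤ ⊗ v ⊕ conᴷ 0ℤ) refl v

  span-tail : ∀ v vs {x} → ZSpan vs x → ZSpan (v ∷ vs) x
  span-tail v vs {x} p = 0ℤ , x , p , solveᴷ 2 (λ v x → x :≡ conᴷ 0ℤ ⊗ v ⊕ x) refl v x

  span-⊆ : ∀ {P} → Subgroup P → ∀ {vs} → All P vs → ∀ x → ZSpan vs x → P x
  span-⊆ G [] x refl = zero-closed G
  span-⊆ G (p ∷ ps) x (n , y , s , refl) = +-closed G (ι-closed G n p) (span-⊆ G ps y s)

  infix 4 _≐_
  _≐_ : (ℚ√ d → Set) → (ℚ√ d → Set) → Set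
  P ≐ R = (∀ x → P x → R x) × (∀ x → R x → P x)

  ≐-sym : ∀ {P R} → P ≐ R → R ≐ P
  ≐-sym (f , g) = g , f

  ≐-trans : ∀ {P R S} → P ≐ R → R ≐ S → P ≐ S
  ≐-trans (f , g) (h , k) = (λ x p → h x (f x p)) , (λ x s → g x (k x s))

  -- Hermite normal form: one generator on the rational axis and one more. Zero entries allow for
  -- lattices of smaller rank.
  triangle : ℚ → ℚ → ℚ → List (ℚ√ d)
  triangle r s t = rational r ∷ (s + t √d) ∷ []

  record Triangular (P : ℚ√ d → Set) : Set where
    constructor triangular
    field
      r s t : ℚ
      spans : P ≐ ZSpan (triangle r s t)

  triangle-intro : ∀ r s t M N {x} → rat x ≡ fromℤ M * r + fromℤ N * s → irr x ≡ fromℤ N * t → ZSpan (triangle r s t) x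
  triangle-intro r s t M N {x} e f = M , ι N *ᴷ (s + t √d) +ᴷ 0ᴷ , (N , 0ᴷ , refl , refl) , sym (begin
    ι M *ᴷ rational r +ᴷ (ι N *ᴷ (s + t √d) +ᴷ 0ᴷ)
      ≡⟨ cong₂ (λ a b → a +ᴷ (b +ᴷ 0ᴷ)) (sym (rational-* (fromℤ M) r)) (scale (fromℤ N) (s + t √d)) ⟩
    (fromℤ M * r + (fromℤ N * s + 0ℚ)) + (0ℚ + (fromℤ N * t + 0ℚ)) √d
      ≡⟨ cong₂ _+_√d (trans (cong (_+_ (fromℤ M * r)) (+-identityʳ (fromℤ N * s))) (sym e))
           (trans (trans (+-identityˡ (fromℤ N * t + 0ℚ)) (+-identityʳ (fromℤ N * t))) (sym f)) ⟩
    x ∎)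
    where open ≡-Reasoning

  triangle-elim : ∀ r s t x → ZSpan (triangle r s t) x →
    ∃₂ λ M N → rat x ≡ fromℤ M * r + fromℤ N * s × irr x ≡ fromℤ N * t
  triangle-elim r s t x (M , y , (N , _ , refl , refl) , refl) = M , N ,
    solve 6 (λ D M r N s t → (M :* r :+ D :* (con 0ℚ :* con 0ℚ)) :+ ((N :* s :+ D :* (con 0ℚ :* t)) :+ con 0ℚ) := M :* r :+ N :* s) refl (fromℤ (+ d)) (fromℤ M) r (fromℤ N) s t ,
    solve 5 (λ M r N s t → (M :* con 0ℚ :+ con 0ℚ :* r) :+ ((N :* t :+ con 0ℚ :* s) :+ con 0ℚ) := N :* t) refl (fromℤ M) r (fromℤ N) s t

  -- `G₁` combines the irrational parts of the old and the new generator into the vector w + g √d.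
  -- The remainders e₁ and e₂ are purely rational, and `G₂` and `G₃` merge them with r.
  insert : ∀ v vs → Triangular (ZSpan vs) → Triangular (ZSpan (v ∷ vs))
  insert v@(x + y √d) vs (triangular r s t (to , from)) = triangular r′ w G₁.g (A⊆B , span-⊆ A (ρ′∈A ∷ w∈A ∷ []))
    where
    module G₁ = RationalGCD (rationalGCD t y)
    w e₁ e₂ : ℚ
    w = fromℤ G₁.u * s + fromℤ G₁.v * x
    e₁ = s - fromℤ G₁.m * w
    e₂ = x - fromℤ G₁.n * w
    module G₂ = RationalGCD (rationalGCD r e₁)
    module G₃ = RationalGCD (rationalGCD G₂.g e₂)
    r′ : ℚ
    r′ = G₃.g
    B : Subgroup (ZSpan (triangle r′ w G₁.g))
    B = span-subgroup (triangle r′ w G₁.g)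
    A : Subgroup (ZSpan (v ∷ vs))
    A = span-subgroup (v ∷ vs)
    restore : ∀ a b → a ≡ (a - b) + b
    restore = solve 2 (λ a b → a := (a :- b) :+ b) refl
    chain : ∀ m k {a} → a ≡ fromℤ m * G₂.g → G₂.g ≡ fromℤ k * r′ → a ≡ fromℤ (m ℤ.* k) * r′
    chain m k e f = trans e (trans (cong (fromℤ m *_) f) (trans (sym (*-assoc (fromℤ m) (fromℤ k) r′)) (cong (_* r′) (sym (fromℤ-* m k)))))
    ρ∈B : ZSpan (triangle r′ w G₁.g) (rational r)
    ρ∈B = triangle-intro r′ w G₁.g (G₂.m ℤ.* G₃.m) 0ℤ
      (trans (chain G₂.m G₃.m G₂.p≡m*g G₃.p≡m*g) (sym (trans (cong (_+_ (fromℤ (G₂.m ℤ.* G₃.m) * r′)) (*-zeroˡ w)) (+-identityʳ _))))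
      (sym (*-zeroˡ G₁.g))
    σ∈B : ZSpan (triangle r′ w G₁.g) (s + t √d)
    σ∈B = triangle-intro r′ w G₁.g (G₂.n ℤ.* G₃.m) G₁.m
      (trans (restore s (fromℤ G₁.m * w)) (cong (_+ fromℤ G₁.m * w) (chain G₂.n G₃.m G₂.q≡n*g G₃.p≡m*g))) G₁.p≡m*g
    v∈B : ZSpan (triangle r′ w G₁.g) v
    v∈B = triangle-intro r′ w G₁.g G₃.n G₁.n (trans (restore x (fromℤ G₁.n * w)) (cong (_+ fromℤ G₁.n * w) G₃.q≡n*g)) G₁.q≡n*g
    A⊆B : ∀ z → ZSpan (v ∷ vs) z → ZSpan (triangle r′ w G₁.g) z
    A⊆B z (n , z′ , p , refl) = +-closed B (ι-closed B n v∈B) (span-⊆ B (ρ∈B ∷ σ∈B ∷ []) z′ (to z′ p))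
    member : ∀ {z} → ZSpan (triangle r s t) z → ZSpan (v ∷ vs) z
    member {z} p = span-tail v vs (from z p)
    ρ∈A : ZSpan (v ∷ vs) (rational r)
    ρ∈A = member (span-head (rational r) _)
    σ∈A : ZSpan (v ∷ vs) (s + t √d)
    σ∈A = member (span-tail (rational r) _ (span-head (s + t √d) []))
    v∈A : ZSpan (v ∷ vs) v
    v∈A = span-head v vs
    combination : ∀ m n {p q z} → ZSpan (v ∷ vs) p → ZSpan (v ∷ vs) q →
      rat z ≡ fromℤ m * rat p + fromℤ n * rat q → irr z ≡ fromℤ m * irr p + fromℤ n * irr q → ZSpan (v ∷ vs) z
    combination m n {p} {q} {z} hp hq e f = subst (ZSpan (v ∷ vs))
      (trans (cong₂ _+ᴷ_ (scale (fromℤ m) p) (scale (fromℤ n) q)) (cong₂ _+_√d (sym e) (sym f)))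
      (+-closed A (ι-closed A m hp) (ι-closed A n hq))
    w∈A : ZSpan (v ∷ vs) (w + G₁.g √d)
    w∈A = combination G₁.u G₁.v σ∈A v∈A refl G₁.bézout
    minus : ∀ a m b → a - fromℤ m * b ≡ fromℤ 1ℤ * a + fromℤ (ℤ.- m) * b
    minus a m b = trans (solve 3 (λ a m b → a :- m :* b := con 1ℚ :* a :+ (:- m) :* b) refl a (fromℤ m) b) (cong (λ t → 1ℚ * a + t * b) (sym (fromℤ-neg m)))
    vanish : ∀ a m b → a ≡ fromℤ m * b → 0ℚ ≡ fromℤ 1ℤ * a + fromℤ (ℤ.- m) * b
    vanish a m b e = trans (sym (trans (cong (_- fromℤ m * b) e) (+-inverseʳ (fromℤ m * b)))) (minus a m b)
    ε₁∈A : ZSpan (v ∷ vs) (rational e₁)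
    ε₁∈A = combination 1ℤ (ℤ.- G₁.m) σ∈A w∈A (minus s G₁.m w) (vanish t G₁.m G₁.g G₁.p≡m*g)
    ε₂∈A : ZSpan (v ∷ vs) (rational e₂)
    ε₂∈A = combination 1ℤ (ℤ.- G₁.n) v∈A w∈A (minus x G₁.n w) (vanish y G₁.n G₁.g G₁.q≡n*g)
    zeros : ∀ m n → 0ℚ ≡ fromℤ m * 0ℚ + fromℤ n * 0ℚ
    zeros m n = sym (cong₂ _+_ (*-zeroʳ (fromℤ m)) (*-zeroʳ (fromℤ n)))
    γ∈A : ZSpan (v ∷ vs) (rational G₂.g)
    γ∈A = combination G₂.u G₂.v ρ∈A ε₁∈A G₂.bézout (zeros G₂.u G₂.v)
    ρ′∈A : ZSpan (v ∷ vs) (rational r′)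
    ρ′∈A = combination G₃.u G₃.v γ∈A ε₂∈A G₃.bézout (zeros G₃.u G₃.v)

  triangulate : ∀ vs → Triangular (ZSpan vs)
  triangulate [] = triangular 0ℚ 0ℚ 0ℚ ((λ { x refl → zero-closed (span-subgroup (triangle 0ℚ 0ℚ 0ℚ)) }) ,
    span-⊆ (span-subgroup []) (refl ∷ refl ∷ []))
  triangulate (v ∷ vs) = insert v vs (triangulate vs)

module Forms (q Q : ℕ) (q≡ : q ≡ 4 ℕ.* Q ℕ.+ 1) (nonsquare : ¬ (∃[ m ] m ℕ.* m ≡ q)) where

  open Maximal q Q q≡
  open FieldSolver {q}

  -- The lattice ℤ a + ℤ (c + ω), an ideal when a divides the norm of c + ω.
  formBasis : ℕ → ℤ → List (ℚ√ q)
  formBasis a c = ι (+ a) ∷ element c 1ℤ ∷ []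

  Scaled : ℚ√ q → (ℚ√ q → Set) → ℚ√ q → Set
  Scaled τ P x = ∃[ y ] P y × x ≡ τ *ᴷ y

  record NormalForm (P : ℚ√ q → Set) : Set where
    field
      τ : ℚ
      τ≢0 : τ ≢ 0ℚ
      a c : ℕ
      a≢0 : a ≢ 0
      c<a : c ℕ.< a
      a∣norm : + a ℤ∣.∣ normω Q (+ c)
      spans : P ≐ Scaled (rational {q} τ) (ZSpan (formBasis a (+ c)))

  ωClosed : (ℚ√ q → Set) → Set
  ωClosed P = ∀ x → P x → P (ω *ᴷ x)

  private
    sign : ∀ n → ∃[ e ] n ≡ e ℤ.* + ℤ.∣ n ∣ × + ℤ.∣ n ∣ ≡ e ℤ.* n
    sign (+ n) = 1ℤ , sym (ℤₚ.*-identityˡ (+ n)) , sym (ℤₚ.*-identityˡ (+ n))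
    sign -[1+ n ] = -1ℤ , sym (ℤₚ.-1*i≡-i (+ suc n)) , sym (ℤₚ.-1*i≡-i -[1+ n ])

  scaled-subgroup : ∀ τ {P} → Subgroup P → Subgroup (Scaled τ P)
  scaled-subgroup τ G = record
    { zero-closed = 0ᴷ , zero-closed G , sym (*ᴷ-zeroʳ τ)
    ; +-closed = λ { (y , p , refl) (z , r , refl) → y +ᴷ z , +-closed G p r , sym (*ᴷ-distribˡ τ y z) }
    ; ι-closed = λ { n (y , p , refl) → ι n *ᴷ y , ι-closed G n p ,
        solveᴷ 3 (λ n t y → n ⊗ (t ⊗ y) :≡ t ⊗ (n ⊗ y)) refl (ι n) τ y } }

  preimage-subgroup : ∀ τ {P} → Subgroup P → Subgroup (λ y → P (τ *ᴷ y))
  preimage-subgroup τ {P} G = record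
    { zero-closed = subst P (sym (*ᴷ-zeroʳ τ)) (zero-closed G)
    ; +-closed = λ {x} {y} p r → subst P (sym (*ᴷ-distribˡ τ x y)) (+-closed G p r)
    ; ι-closed = λ n {x} p → subst P (solveᴷ 3 (λ n t y → n ⊗ (t ⊗ y) :≡ t ⊗ (n ⊗ y)) refl (ι n) τ x) (ι-closed G n p) }

  scaled-⊆ : ∀ τ vs {P} → Subgroup P → All (λ v → P (τ *ᴷ v)) vs → ∀ x → Scaled τ (ZSpan vs) x → P x
  scaled-⊆ τ vs G gens x (y , s , refl) = span-⊆ (preimage-subgroup τ G) gens y s

  -- The four equations say that ω r and ω (s + t √q) lie in the lattice. Their irrational parts
  -- give r = 2 n₀ t and s = (2 n₁ - 1) t, so the lattice is 2 t (ℤ n₀ + ℤ (n₁ - 1 + ω)).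
  module _ (r s t : ℚ) (m₀ n₀ m₁ n₁ : ℤ)
    (r-rat : ½ * r ≡ fromℤ m₀ * r + fromℤ n₀ * s) (r-irr : ½ * r ≡ fromℤ n₀ * t)
    (s-rat : ½ * s + D * (½ * t) ≡ fromℤ m₁ * r + fromℤ n₁ * s) (s-irr : ½ * t + ½ * s ≡ fromℤ n₁ * t)
    (nonzero : ¬ (r ≡ 0ℚ × s ≡ 0ℚ × t ≡ 0ℚ))
    where

    private
      τ : ℚ
      τ = two * t

      r≡ : r ≡ two * (fromℤ n₀ * t)
      r≡ = trans (solve 1 (λ r → r := con two :* (con ½ :* r)) refl r) (cong (two *_) r-irr)

      s≡ : s ≡ two * (fromℤ n₁ * t) - t
      s≡ = trans (solve 2 (λ s t → s := con two :* (con ½ :* t :+ con ½ :* s) :- t) refl s t) (cong (λ u → two * u - t) s-irr)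

      t≢0 : t ≢ 0ℚ
      t≢0 e = nonzero
        ( trans r≡ (trans (cong (λ u → two * (fromℤ n₀ * u)) e) (trans (cong (two *_) (*-zeroʳ (fromℤ n₀))) (*-zeroʳ two)))
        , trans s≡ (trans (cong (λ u → two * (fromℤ n₁ * u) - u) e) (trans (cong (λ u → two * u - 0ℚ) (*-zeroʳ (fromℤ n₁))) refl))
        , e)

      τ≢0 : τ ≢ 0ℚ
      τ≢0 e = t≢0 (p*q≡0⇒p≡0 t two (λ ()) (trans (*-comm t two) e))

      -- The rational part of ω (s + t √q), after elimination of r and s. It says that the norm of
      -- n₁ - 1 + ω is -m₁ n₀, hence divisible by n₀.
      norm-equation : fromℤ (+ Q) ≡ fromℤ m₁ * fromℤ n₀ + fromℤ n₁ * fromℤ n₁ - fromℤ n₁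
      norm-equation = *-cancelʳ-≢0 t t≢0 (begin
        fromℤ (+ Q) * t
          ≡⟨ solve 3 (λ Q n t → Q :* t := con ½ :* (con ½ :* (con two :* (n :* t) :- t) :+ (con (fromℤ (+ 4)) :* Q :+ con 1ℚ) :* (con ½ :* t)) :- con ½ :* (n :* t)) refl (fromℤ (+ Q)) (fromℤ n₁) t ⟩
        ½ * (½ * (two * (fromℤ n₁ * t) - t) + (fromℤ (+ 4) * fromℤ (+ Q) + 1ℚ) * (½ * t)) - ½ * (fromℤ n₁ * t)
          ≡⟨ cong (λ u → ½ * u - ½ * (fromℤ n₁ * t)) (trans (cong₂ (λ u v → ½ * u + v * (½ * t)) (sym s≡) (sym D≡)) s-rat) ⟩
        ½ * (fromℤ m₁ * r + fromℤ n₁ * s) - ½ * (fromℤ n₁ * t)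
          ≡⟨ cong₂ (λ u v → ½ * (fromℤ m₁ * u + fromℤ n₁ * v) - ½ * (fromℤ n₁ * t)) r≡ s≡ ⟩
        ½ * (fromℤ m₁ * (two * (fromℤ n₀ * t)) + fromℤ n₁ * (two * (fromℤ n₁ * t) - t)) - ½ * (fromℤ n₁ * t)
          ≡⟨ solve 4 (λ m n₀ n t → con ½ :* (m :* (con two :* (n₀ :* t)) :+ n :* (con two :* (n :* t) :- t)) :- con ½ :* (n :* t) := (m :* n₀ :+ n :* n :- n) :* t) refl (fromℤ m₁) (fromℤ n₀) (fromℤ n₁) t ⟩
        (fromℤ m₁ * fromℤ n₀ + fromℤ n₁ * fromℤ n₁ - fromℤ n₁) * t ∎)
        where open ≡-Reasoning

      c₀ : ℤ
      c₀ = n₁ ℤ.- 1ℤ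

      norm≡ : normω Q c₀ ≡ (ℤ.- m₁) ℤ.* n₀
      norm≡ = linear -1ℤ integer (identity (+ Q) m₁ n₀ n₁)
        where
        integer : + Q ≡ m₁ ℤ.* n₀ ℤ.+ n₁ ℤ.* n₁ ℤ.- n₁
        integer = fromℤ-injective {+ Q} {m₁ ℤ.* n₀ ℤ.+ n₁ ℤ.* n₁ ℤ.- n₁} (trans norm-equation (sym (trans (fromℤ-- (m₁ ℤ.* n₀ ℤ.+ n₁ ℤ.* n₁) n₁)
          (cong (_- fromℤ n₁) (trans (fromℤ-+ (m₁ ℤ.* n₀) (n₁ ℤ.* n₁)) (cong₂ _+_ (fromℤ-* m₁ n₀) (fromℤ-* n₁ n₁)))))))
        identity : ∀ Q m n₀ n → ((n ℤ.- 1ℤ) ℤ.* (n ℤ.- 1ℤ) ℤ.+ (n ℤ.- 1ℤ) ℤ.- Q) ℤ.- (ℤ.- m) ℤ.* n₀ ≡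
          -1ℤ ℤ.* (Q ℤ.- (m ℤ.* n₀ ℤ.+ n ℤ.* n ℤ.- n))
        identity = ℤ-ring

      -- Otherwise n₁ - 1 + ω would have norm zero, and q would be the square of 2 n₁ - 1.
      n₀≢0 : n₀ ≢ 0ℤ
      n₀≢0 e = nonsquare (ℤ.∣ k ∣ , trans (sym (ℤₚ.abs-* k k)) (cong ℤ.∣_∣ square))
        where
        k : ℤ
        k = + 2 ℤ.* n₁ ℤ.- 1ℤ
        identity : ∀ Q n m → (+ 2 ℤ.* n ℤ.- 1ℤ) ℤ.* (+ 2 ℤ.* n ℤ.- 1ℤ) ℤ.- (+ 4 ℤ.* Q ℤ.+ 1ℤ) ≡
          + 4 ℤ.* (((n ℤ.- 1ℤ) ℤ.* (n ℤ.- 1ℤ) ℤ.+ (n ℤ.- 1ℤ) ℤ.- Q) ℤ.- m ℤ.* 0ℤ)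
        identity = ℤ-ring
        square : k ℤ.* k ≡ + q
        square = trans (linear (+ 4) (trans norm≡ (cong ((ℤ.- m₁) ℤ.*_) e)) (identity (+ Q) n₁ (ℤ.- m₁)))
          (sym (trans (cong +_ q≡) (cong (ℤ._+ 1ℤ) (ℤₚ.pos-* 4 Q))))

      a : ℕ
      a = ℤ.∣ n₀ ∣

      a≢0 : a ≢ 0
      a≢0 e = n₀≢0 (ℤₚ.∣i∣≡0⇒i≡0 e)

      instance
        a-nonZero : ℕ.NonZero a
        a-nonZero = ℕ.≢-nonZero a≢0

      c : ℕ
      c = c₀ ℤ.%ℕ a

      k : ℤ
      k = c₀ ℤ./ℕ a

      c₀≡ : c₀ ≡ + c ℤ.+ k ℤ.* + a
      c₀≡ = ℤ/.a≡a%ℕn+[a/ℕn]*n c₀ a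

      a∣norm : + a ℤ∣.∣ normω Q (+ c)
      a∣norm = ≈-∣ (normω Q (+ c)) (normω Q c₀)
        (≈-+ (+ c ℤ.* + c ℤ.+ + c) (c₀ ℤ.* c₀ ℤ.+ c₀) (ℤ.- + Q) (ℤ.- + Q)
          (≈-+ (+ c ℤ.* + c) (c₀ ℤ.* c₀) (+ c) c₀ (≈-* (+ c) c₀ (+ c) c₀ c≈ c≈) c≈) (≈-refl (ℤ.- + Q)))
        (ℤ∣.divides (ℤ.- m₁ ℤ.* proj₁ (sign n₀)) (trans norm≡ (trans (cong ((ℤ.- m₁) ℤ.*_) (proj₁ (proj₂ (sign n₀)))) (sym (ℤₚ.*-assoc (ℤ.- m₁) (proj₁ (sign n₀)) (+ a))))))
        where
        c≈ : + c ≈ c₀ [ a ]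
        c≈ = ≈-sym c₀ (+ c) (%-≈ a c₀)

      ρ-τ : rational {q} r ≡ rational {q} τ *ᴷ ι n₀
      ρ-τ = trans (cong (rational {q}) (trans r≡ (solve 2 (λ n t → con two :* (n :* t) := (con two :* t) :* n) refl (fromℤ n₀) t))) (rational-* τ (fromℤ n₀))

      σ-τ : s + t √d ≡ rational {q} τ *ᴷ element c₀ 1ℤ
      σ-τ = trans (cong₂ _+_√d
          (trans s≡ (trans (solve 2 (λ n t → con two :* (n :* t) :- t := (con two :* t) :* ((n :- con 1ℚ) :+ con ½ :* con 1ℚ)) refl (fromℤ n₁) t)
            (cong (λ u → τ * (u + ½ * 1ℚ)) (sym (fromℤ-- n₁ 1ℤ)))))
          (solve 1 (λ t → t := (con two :* t) :* (con ½ :* con 1ℚ)) refl t))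
        (trans (sym (scale τ ((fromℤ c₀ + ½ * 1ℚ) + (½ * 1ℚ) √d))) (cong (rational {q} τ *ᴷ_) (sym (element≡ c₀ 1ℤ))))

      element-shift : element c₀ 1ℤ ≡ ι k *ᴷ ι (+ a) +ᴷ element (+ c) 1ℤ
      element-shift = trans (cong (λ u → ι u +ᴷ ι 1ℤ *ᴷ ω) c₀≡) (trans (cong (_+ᴷ ι 1ℤ *ᴷ ω) (trans (ι-+ (+ c) (k ℤ.* + a)) (cong (ι (+ c) +ᴷ_) (ι-* k (+ a)))))
        (solveᴷ 4 (λ c k a w → (c ⊕ k ⊗ a) ⊕ w :≡ k ⊗ a ⊕ (c ⊕ w)) refl (ι (+ c)) (ι k) (ι (+ a)) (ι 1ℤ *ᴷ ω)))

      T : Subgroup (ZSpan (triangle {q} r s t))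
      T = span-subgroup (triangle {q} r s t)

      F : Subgroup (ZSpan (formBasis a (+ c)))
      F = span-subgroup (formBasis a (+ c))

      α∈F : ZSpan (formBasis a (+ c)) (ι (+ a))
      α∈F = span-head (ι (+ a)) _

      β∈F : ZSpan (formBasis a (+ c)) (element (+ c) 1ℤ)
      β∈F = span-tail (ι (+ a)) _ (span-head (element (+ c) 1ℤ) [])

      τα∈T : ZSpan (triangle {q} r s t) (rational {q} τ *ᴷ ι (+ a))
      τα∈T = subst (ZSpan (triangle {q} r s t)) (trans (cong (ι e *ᴷ_) ρ-τ) (trans
          (solveᴷ 3 (λ e t n → e ⊗ (t ⊗ n) :≡ t ⊗ (e ⊗ n)) refl (ι e) (rational {q} τ) (ι n₀))
          (cong (rational {q} τ *ᴷ_) (trans (sym (ι-* e n₀)) (cong ι (sym (proj₂ (proj₂ (sign n₀)))))))))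
        (ι-closed T e (span-head (rational {q} r) _))
        where
        e : ℤ
        e = proj₁ (sign n₀)

      τβ∈T : ZSpan (triangle {q} r s t) (rational {q} τ *ᴷ element (+ c) 1ℤ)
      τβ∈T = subst (ZSpan (triangle {q} r s t)) (trans (cong₂ (λ u v → u +ᴷ v *ᴷ (rational {q} τ *ᴷ ι (+ a))) (trans σ-τ (cong (rational {q} τ *ᴷ_) element-shift)) (ι-neg k))
          (solveᴷ 4 (λ t k a b → t ⊗ (k ⊗ a ⊕ b) ⊕ (⊝ k) ⊗ (t ⊗ a) :≡ t ⊗ b) refl (rational {q} τ) (ι k) (ι (+ a)) (element (+ c) 1ℤ)))
        (+-closed T (span-tail (rational {q} r) _ (span-head (s + t √d) [])) (ι-closed T (ℤ.- k) τα∈T))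

    normalForm-triangle : NormalForm (ZSpan (triangle {q} r s t))
    normalForm-triangle = record
      { τ = τ ; τ≢0 = τ≢0 ; a = a ; c = c ; a≢0 = a≢0 ; c<a = ℤ/.n%ℕd<d c₀ a ; a∣norm = a∣norm
      ; spans = span-⊆ (scaled-subgroup (rational {q} τ) F)
          ( (ι n₀ , subst (ZSpan (formBasis a (+ c))) (trans (sym (ι-* (proj₁ (sign n₀)) (+ a))) (cong ι (sym (proj₁ (proj₂ (sign n₀)))))) (ι-closed F (proj₁ (sign n₀)) α∈F) , ρ-τ)
          ∷ (element c₀ 1ℤ , subst (ZSpan (formBasis a (+ c))) (sym element-shift) (+-closed F (ι-closed F k α∈F) β∈F) , σ-τ) ∷ [])
        , scaled-⊆ (rational {q} τ) (formBasis a (+ c)) T (τα∈T ∷ τβ∈T ∷ []) }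

  normalForm-resp : ∀ {P R} → P ≐ R → NormalForm R → NormalForm P
  normalForm-resp e f = record { NormalForm f ; spans = ≐-trans e (NormalForm.spans f) }

  normalForm : ∀ vs → ωClosed (ZSpan vs) → (∃[ x ] ZSpan vs x × x ≢ 0ᴷ) → NormalForm (ZSpan vs)
  normalForm vs closed (x , x∈ , x≢0) = go (triangulate vs)
    where
    go : Triangular (ZSpan vs) → NormalForm (ZSpan vs)
    go (triangular r s t (to , from)) = normalForm-resp (to , from)
      (build (triangle-elim {q} r s t (ω {q} *ᴷ rational {q} r) (to (ω {q} *ᴷ rational {q} r) (closed (rational {q} r) (from (rational {q} r) (span-head (rational {q} r) _)))))
             (triangle-elim {q} r s t (ω {q} *ᴷ (s + t √d)) (to (ω {q} *ᴷ (s + t √d)) (closed (s + t √d) (from (s + t √d) (span-tail (rational {q} r) _ (span-head (s + t √d) [])))))))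
      where
      build : (∃₂ λ M N → rat (ω {q} *ᴷ rational {q} r) ≡ fromℤ M * r + fromℤ N * s × irr (ω {q} *ᴷ rational {q} r) ≡ fromℤ N * t) →
        (∃₂ λ M N → rat (ω {q} *ᴷ (s + t √d)) ≡ fromℤ M * r + fromℤ N * s × irr (ω {q} *ᴷ (s + t √d)) ≡ fromℤ N * t) →
        NormalForm (ZSpan (triangle {q} r s t))
      build (m₀ , n₀ , e₀ , f₀) (m₁ , n₁ , e₁ , f₁) = normalForm-triangle r s t m₀ n₀ m₁ n₁
        (trans (solve 2 (λ D r → con ½ :* r := con ½ :* r :+ D :* (con ½ :* con 0ℚ)) refl D r) e₀)
        (trans (solve 1 (λ r → con ½ :* r := con ½ :* con 0ℚ :+ con ½ :* r) refl r) f₀) e₁ f₁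
        (λ { (r≡0 , s≡0 , t≡0) → x≢0 (vanish r≡0 s≡0 t≡0 (triangle-elim {q} r s t x (to x x∈))) })
        where
        vanish : r ≡ 0ℚ → s ≡ 0ℚ → t ≡ 0ℚ → (∃₂ λ M N → rat x ≡ fromℤ M * r + fromℤ N * s × irr x ≡ fromℤ N * t) → x ≡ 0ᴷ
        vanish refl refl refl (M , N , e , f) = cong₂ _+_√d
          (trans e (cong₂ _+_ (*-zeroʳ (fromℤ M)) (*-zeroʳ (fromℤ N)))) (trans f (*-zeroʳ (fromℤ N)))

-- Ideals as lattices stable under ω

module Ideal (q Q : ℕ) (q≡ : q ≡ 4 ℕ.* Q ℕ.+ 1) (nonsquare : ¬ (∃[ m ] m ℕ.* m ≡ q)) where

  open Maximal q Q q≡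
  open FieldSolver {q}
  open Inverse nonsquare
  open Forms q Q q≡ nonsquare

  K : Set
  K = ℚ√ q

  ω² : ω {q} *ᴷ ω ≡ ω +ᴷ ι (+ Q)
  ω² = cong₂ _+_√d (trans (cong (λ D → ½ * ½ + D * (½ * ½)) D≡)
    (solve 1 (λ Q → con ½ :* con ½ :+ (con (fromℤ (+ 4)) :* Q :+ con 1ℚ) :* (con ½ :* con ½) := con ½ :+ Q) refl (fromℤ (+ Q)))) refl

  -- Since the ring of integers is ℤ + ℤ ω, the submodule generated by the g is the ℤ-span of all g
  -- and ω g.
  expand : List K → List K
  expand [] = []
  expand (g ∷ gs) = g ∷ ω *ᴷ g ∷ expand gs

  ω-closed-gens : ∀ vs → All (λ v → ZSpan vs (ω *ᴷ v)) vs → ωClosed (ZSpan vs)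
  ω-closed-gens vs gens = span-⊆ (preimage-subgroup ω (span-subgroup vs)) gens

  expand-ω : ∀ gs → All (λ v → ZSpan (expand gs) (ω *ᴷ v)) (expand gs)
  expand-ω [] = []
  expand-ω (g ∷ gs) = span-tail g _ (span-head (ω *ᴷ g) (expand gs))
    ∷ subst (ZSpan (expand (g ∷ gs))) ω²g
        (+-closed G (span-tail g _ (span-head (ω *ᴷ g) (expand gs))) (ι-closed G (+ Q) (span-head g _)))
    ∷ weaken (expand-ω gs)
    where
    G : Subgroup (ZSpan (expand (g ∷ gs)))
    G = span-subgroup (expand (g ∷ gs))
    ω²g : ω *ᴷ g +ᴷ ι (+ Q) *ᴷ g ≡ ω *ᴷ (ω *ᴷ g)
    ω²g = trans (solveᴷ 3 (λ w Q g → w ⊗ g ⊕ Q ⊗ g :≡ (w ⊕ Q) ⊗ g) refl ω (ι (+ Q)) g)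
      (trans (cong (_*ᴷ g) (sym ω²)) (*ᴷ-assoc ω ω g))
    weaken : ∀ {vs} → All (λ v → ZSpan (expand gs) (ω *ᴷ v)) vs → All (λ v → ZSpan (expand (g ∷ gs)) (ω *ᴷ v)) vs
    weaken [] = []
    weaken (p ∷ ps) = span-tail g _ (span-tail (ω *ᴷ g) _ p) ∷ weaken ps

  module _ (disc : IsRealQuadraticDiscriminant q) where

    ideal⊆span : ∀ gs x → x ∈⟨ gs ⟩ → ZSpan (expand gs) x
    ideal⊆span [] x e = e
    ideal⊆span (g ∷ gs) x (a , y , ia , y∈ , refl) = go (integral⇒element disc a ia)
      where
      go : (∃₂ λ m n → a ≡ element m n) → ZSpan (expand (g ∷ gs)) (a *ᴷ g +ᴷ y)
      go (m , n , refl) = m , ι n *ᴷ (ω *ᴷ g) +ᴷ y , (n , y , ideal⊆span gs y y∈ , refl) ,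
        solveᴷ 5 (λ m n w g y → (m ⊕ n ⊗ w) ⊗ g ⊕ y :≡ m ⊗ g ⊕ (n ⊗ (w ⊗ g) ⊕ y)) refl (ι m) (ι n) ω g y

    span⊆ideal : ∀ gs x → ZSpan (expand gs) x → x ∈⟨ gs ⟩
    span⊆ideal [] x e = e
    span⊆ideal (g ∷ gs) x (m , _ , (n , y , y∈ , refl) , refl) = element m n , y , element-integral m n , span⊆ideal gs y y∈ ,
      solveᴷ 5 (λ m n w g y → m ⊗ g ⊕ (n ⊗ (w ⊗ g) ⊕ y) :≡ (m ⊕ n ⊗ w) ⊗ g ⊕ y) refl (ι m) (ι n) ω g y

  nonzero-member : ∀ gs → Any (_≢ 0ᴷ) gs → ∃[ x ] ZSpan (expand gs) x × x ≢ 0ᴷ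
  nonzero-member (g ∷ gs) (here g≢0) = g , span-head g _ , g≢0
  nonzero-member (g ∷ gs) (there h) = extend (nonzero-member gs h)
    where
    extend : (∃[ x ] ZSpan (expand gs) x × x ≢ 0ᴷ) → ∃[ x ] ZSpan (expand (g ∷ gs)) x × x ≢ 0ᴷ
    extend (x , x∈ , x≢0) = x , span-tail g _ (span-tail (ω *ᴷ g) _ x∈) , x≢0

  idealForm : ∀ gs → Any (_≢ 0ᴷ) gs → NormalForm (ZSpan (expand gs))
  idealForm gs h = normalForm (expand gs) (ω-closed-gens (expand gs) (expand-ω gs)) (nonzero-member gs h)

  Form : ℕ → ℤ → K → Set
  Form a c = ZSpan (formBasis a c)

  scale-by : K → (K → Set) → K → Set
  scale-by = Scaled

  scaled-cong : ∀ τ {P R : K → Set} → P ≐ R → scale-by τ P ≐ scale-by τ R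
  scaled-cong τ (f , g) = (λ { x (y , p , e) → y , f y p , e }) , (λ { x (y , r , e) → y , g y r , e })

  scaled-scaled : ∀ σ τ {P : K → Set} → scale-by σ (scale-by τ P) ≐ scale-by (σ *ᴷ τ) P
  scaled-scaled σ τ = (λ { x (_ , (y , p , refl) , e) → y , p , trans e (sym (*ᴷ-assoc σ τ y)) })
    , (λ { x (y , p , e) → τ *ᴷ y , (y , p , refl) , trans e (*ᴷ-assoc σ τ y) })

  scaled-1 : ∀ {τ} {P : K → Set} → τ ≡ 1ᴷ → P ≐ scale-by τ P
  scaled-1 {P = P} refl = (λ x p → x , p , sym (*ᴷ-identityˡ x)) , (λ { x (y , p , refl) → subst P (sym (*ᴷ-identityˡ y)) p })

  scaled-invert : ∀ {σ τ} {P R : K → Set} → σ *ᴷ τ ≡ 1ᴷ → P ≐ scale-by τ R → R ≐ scale-by σ P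
  scaled-invert {σ} {τ} e h = ≐-trans (scaled-1 e) (≐-trans (≐-sym (scaled-scaled σ τ)) (scaled-cong σ (≐-sym h)))

  scaled-trans : ∀ {σ τ} {P R S : K → Set} → P ≐ scale-by σ R → R ≐ scale-by τ S → P ≐ scale-by (σ *ᴷ τ) S
  scaled-trans {σ} {τ} h k = ≐-trans h (≐-trans (scaled-cong σ k) (scaled-scaled σ τ))

  scaled-span : ∀ τ vs → ZSpan (map (τ *ᴷ_) vs) ≐ scale-by τ (ZSpan vs)
  scaled-span τ [] = (λ { x refl → 0ᴷ , refl , sym (*ᴷ-zeroʳ τ) }) , (λ { x (y , refl , e) → trans e (*ᴷ-zeroʳ τ) })
  scaled-span τ (v ∷ vs) = (λ { x (n , y , p , refl) → go x n y (proj₁ (scaled-span τ vs) y p) })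
    , (λ { x (_ , (n , y , p , refl) , refl) → n , τ *ᴷ y , proj₂ (scaled-span τ vs) (τ *ᴷ y) (y , p , refl) ,
        solveᴷ 4 (λ t n v y → t ⊗ (n ⊗ v ⊕ y) :≡ n ⊗ (t ⊗ v) ⊕ t ⊗ y) refl τ (ι n) v y })
    where
    go : ∀ x n y → scale-by τ (ZSpan vs) y → scale-by τ (ZSpan (v ∷ vs)) (ι n *ᴷ (τ *ᴷ v) +ᴷ y)
    go x n y (z , s , refl) = ι n *ᴷ v +ᴷ z , (n , z , s , refl) ,
      solveᴷ 4 (λ t n v y → n ⊗ (t ⊗ v) ⊕ t ⊗ y :≡ t ⊗ (n ⊗ v ⊕ y)) refl τ (ι n) v z

  element-unfold : ∀ c → element c 1ℤ ≡ ι c +ᴷ ω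
  element-unfold c = cong (ι c +ᴷ_) (*ᴷ-identityˡ ω)

  β² : ∀ c → element c 1ℤ *ᴷ element c 1ℤ ≡ ι (+ 2 ℤ.* c ℤ.+ 1ℤ) *ᴷ element c 1ℤ +ᴷ -ᴷ ι (normω Q c)
  β² c = begin
    element c 1ℤ *ᴷ element c 1ℤ ≡⟨ cong₂ _*ᴷ_ (element-unfold c) (element-unfold c) ⟩
    (ι c +ᴷ ω) *ᴷ (ι c +ᴷ ω) ≡⟨ solveᴷ 2 (λ c w → (c ⊕ w) ⊗ (c ⊕ w) :≡ (c ⊗ c ⊕ (c ⊕ c) ⊗ w) ⊕ w ⊗ w) refl (ι c) ω ⟩
    (ι c *ᴷ ι c +ᴷ (ι c +ᴷ ι c) *ᴷ ω) +ᴷ ω *ᴷ ω ≡⟨ cong ((ι c *ᴷ ι c +ᴷ (ι c +ᴷ ι c) *ᴷ ω) +ᴷ_) ω² ⟩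
    (ι c *ᴷ ι c +ᴷ (ι c +ᴷ ι c) *ᴷ ω) +ᴷ (ω +ᴷ ι (+ Q)) ≡⟨ solveᴷ 3 (λ c w Q → (c ⊗ c ⊕ (c ⊕ c) ⊗ w) ⊕ (w ⊕ Q) :≡ (conᴷ (+ 2) ⊗ c ⊕ conᴷ 1ℤ) ⊗ (c ⊕ w) ⊕ ⊝ (c ⊗ c ⊕ c ⊕ ⊝ Q)) refl (ι c) ω (ι (+ Q)) ⟩
    (ι (+ 2) *ᴷ ι c +ᴷ ι 1ℤ) *ᴷ (ι c +ᴷ ω) +ᴷ -ᴷ (ι c *ᴷ ι c +ᴷ ι c +ᴷ -ᴷ ι (+ Q))
      ≡⟨ cong₂ (λ s t → s *ᴷ (ι c +ᴷ ω) +ᴷ -ᴷ t) (sym (trans (ι-+ (+ 2 ℤ.* c) 1ℤ) (cong (_+ᴷ ι 1ℤ) (ι-* (+ 2) c))))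
           (sym (trans (ι-+ (c ℤ.* c ℤ.+ c) (ℤ.- + Q)) (cong₂ _+ᴷ_ (trans (ι-+ (c ℤ.* c) c) (cong (_+ᴷ ι c) (ι-* c c))) (ι-neg (+ Q))))) ⟩
    ι (+ 2 ℤ.* c ℤ.+ 1ℤ) *ᴷ (ι c +ᴷ ω) +ᴷ -ᴷ ι (normω Q c) ≡⟨ cong (λ t → ι (+ 2 ℤ.* c ℤ.+ 1ℤ) *ᴷ t +ᴷ -ᴷ ι (normω Q c)) (sym (element-unfold c)) ⟩
    ι (+ 2 ℤ.* c ℤ.+ 1ℤ) *ᴷ element c 1ℤ +ᴷ -ᴷ ι (normω Q c) ∎
    where open ≡-Reasoning

  module _ (a : ℕ) (c : ℤ) (a∣norm : + a ℤ∣.∣ normω Q c) where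

    private
      α β : K
      α = ι (+ a)
      β = element c 1ℤ
      G : Subgroup (Form a c)
      G = span-subgroup (α ∷ β ∷ [])
      α∈ : Form a c α
      α∈ = span-head α _
      β∈ : Form a c β
      β∈ = span-tail α _ (span-head β [])

    -- The divisibility of the norm enters in the second relation: ω α = -c α + a β and ω β = (c +
    -- 1) β - f α, where f is the norm of β divided by a.
    ω-form : All (λ v → Form a c (ω *ᴷ v)) (α ∷ β ∷ [])
    ω-form = subst (Form a c) ωα (+-closed G (ι-closed G (ℤ.- c) α∈) (ι-closed G (+ a) β∈))
      ∷ subst (Form a c) ωβ (+-closed G (ι-closed G (c ℤ.+ 1ℤ) β∈) (ι-closed G (ℤ.- f) α∈)) ∷ []
      where
      f : ℤ
      f = ℤ∣.quotient a∣norm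
      ωα : ι (ℤ.- c) *ᴷ α +ᴷ ι (+ a) *ᴷ β ≡ ω *ᴷ α
      ωα = trans (cong₂ (λ s t → s *ᴷ α +ᴷ α *ᴷ t) (ι-neg c) (element-unfold c))
        (solveᴷ 3 (λ c a w → (⊝ c) ⊗ a ⊕ a ⊗ (c ⊕ w) :≡ w ⊗ a) refl (ι c) α ω)
      ωβ : ι (c ℤ.+ 1ℤ) *ᴷ β +ᴷ ι (ℤ.- f) *ᴷ α ≡ ω *ᴷ β
      ωβ = begin
        ι (c ℤ.+ 1ℤ) *ᴷ β +ᴷ ι (ℤ.- f) *ᴷ α
          ≡⟨ cong₂ (λ s t → s *ᴷ β +ᴷ t) (ι-+ c 1ℤ) (trans (sym (ι-* (ℤ.- f) (+ a))) (trans (cong ι (trans (sym (ℤₚ.neg-distribˡ-* f (+ a))) (cong ℤ.-_ (sym (ℤ∣._∣_.equality a∣norm))))) (ι-neg (normω Q c)))) ⟩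
        (ι c +ᴷ ι 1ℤ) *ᴷ β +ᴷ -ᴷ ι (normω Q c)
          ≡⟨ solveᴷ 3 (λ c b n → (c ⊕ conᴷ 1ℤ) ⊗ b ⊕ ⊝ n :≡ ((conᴷ (+ 2) ⊗ c ⊕ conᴷ 1ℤ) ⊗ b ⊕ ⊝ n) ⊕ (⊝ c) ⊗ b) refl (ι c) β (ι (normω Q c)) ⟩
        ((ι (+ 2) *ᴷ ι c +ᴷ ι 1ℤ) *ᴷ β +ᴷ -ᴷ ι (normω Q c)) +ᴷ (-ᴷ ι c) *ᴷ β
          ≡⟨ cong (λ s → (s *ᴷ β +ᴷ -ᴷ ι (normω Q c)) +ᴷ (-ᴷ ι c) *ᴷ β) (sym (trans (ι-+ (+ 2 ℤ.* c) 1ℤ) (cong (_+ᴷ ι 1ℤ) (ι-* (+ 2) c)))) ⟩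
        (ι (+ 2 ℤ.* c ℤ.+ 1ℤ) *ᴷ β +ᴷ -ᴷ ι (normω Q c)) +ᴷ (-ᴷ ι c) *ᴷ β
          ≡⟨ cong (_+ᴷ (-ᴷ ι c) *ᴷ β) (sym (β² c)) ⟩
        β *ᴷ β +ᴷ (-ᴷ ι c) *ᴷ β
          ≡⟨ cong (λ t → t *ᴷ β +ᴷ (-ᴷ ι c) *ᴷ β) (element-unfold c) ⟩
        (ι c +ᴷ ω) *ᴷ β +ᴷ (-ᴷ ι c) *ᴷ β
          ≡⟨ solveᴷ 3 (λ c w b → (c ⊕ w) ⊗ b ⊕ (⊝ c) ⊗ b :≡ w ⊗ b) refl (ι c) ω β ⟩
        ω *ᴷ β ∎
        where open ≡-Reasoning

    -- A multiple of a lattice stable under ω is again stable and so has a normal form. With τ the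
    -- inverse of a point this produces its code, with τ = √q the second family of lattices.
    scaledForm : ∀ τ → τ ≢ 0ᴷ → NormalForm (scale-by τ (Form a c))
    scaledForm τ τ≢0 = normalForm-resp (≐-sym (scaled-span τ basis))
      (normalForm (map (τ *ᴷ_) basis) (ω-closed-gens (map (τ *ᴷ_) basis) (gens ω-form))
        (τ *ᴷ β , span-tail (τ *ᴷ α) _ (span-head (τ *ᴷ β) []) , nonzero))
      where
      basis : List K
      basis = α ∷ β ∷ []
      gens : All (λ v → Form a c (ω *ᴷ v)) basis → All (λ v → ZSpan (map (τ *ᴷ_) basis) (ω *ᴷ v)) (map (τ *ᴷ_) basis)
      gens (p ∷ r ∷ []) = move α p ∷ move β r ∷ []
        where
        move : ∀ v → Form a c (ω *ᴷ v) → ZSpan (map (τ *ᴷ_) basis) (ω *ᴷ (τ *ᴷ v))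
        move v p = proj₂ (scaled-span τ basis) (ω *ᴷ (τ *ᴷ v)) (ω *ᴷ v , p , solveᴷ 3 (λ w t v → w ⊗ (t ⊗ v) :≡ t ⊗ (w ⊗ v)) refl ω τ v)
      nonzero : τ *ᴷ β ≢ 0ᴷ
      nonzero e = norm≢0 τ≢0 (p*q≡0⇒p≡0 (norm τ) (norm β) (norm≢0 β≢0) (trans (sym (norm-* τ β)) (trans (cong norm e)
        (solve 1 (λ D → con 0ℚ :* con 0ℚ :- D :* (con 0ℚ :* con 0ℚ) := con 0ℚ) refl D))))
        where
        ½≢0 : ½ * 1ℚ ≢ 0ℚ
        ½≢0 ()
        β≢0 : β ≢ 0ᴷ
        β≢0 e = ½≢0 (trans (sym (cong irr (element≡ c 1ℤ))) (cong irr e))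

-- Inverse ideals of lattice points

*≡1⇒square≡1 : ∀ m n → m ℤ.* n ≡ 1ℤ → m ℤ.* m ≡ 1ℤ
*≡1⇒square≡1 m n e = trans (square m) (cong (λ t → + (t ℕ.* t)) (ℕₚ.m*n≡1⇒m≡1 ℤ.∣ m ∣ ℤ.∣ n ∣ (trans (sym (ℤₚ.abs-* m n)) (cong ℤ.∣_∣ e))))
  where
  square : ∀ m → m ℤ.* m ≡ + (ℤ.∣ m ∣ ℕ.* ℤ.∣ m ∣)
  square (+ n) = sym (ℤₚ.pos-* n n)
  square -[1+ n ] = refl

square≡1⇒abs≡1 : ∀ e → e ℤ.* e ≡ 1ℤ → ℤ.∣ e ∣ ≡ 1
square≡1⇒abs≡1 e h = ℕₚ.m*n≡1⇒m≡1 ℤ.∣ e ∣ ℤ.∣ e ∣ (trans (sym (ℤₚ.abs-* e e)) (cong ℤ.∣_∣ h))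

module _ {d : ℕ} where

  det-scale : ∀ (τ x y : ℚ√ d) → det (τ *ᴷ x) (τ *ᴷ y) ≡ norm τ * det x y
  det-scale (t + u √d) (a + b √d) (a′ + b′ √d) = solve 7 (λ D t u a b c e →
    (t :* a :+ D :* (u :* b)) :* (t :* e :+ u :* c) :- (t :* c :+ D :* (u :* e)) :* (t :* b :+ u :* a) :=
    (t :* t :- D :* (u :* u)) :* (a :* e :- c :* b)) refl (fromℤ (+ d)) t u a b a′ b′

  unfold : ∀ m n (w₁ w₂ : ℚ√ d) → ι m *ᴷ w₁ +ᴷ (ι n *ᴷ w₂ +ᴷ 0ᴷ) ≡ (fromℤ m * rat w₁ + fromℤ n * rat w₂) + (fromℤ m * irr w₁ + fromℤ n * irr w₂) √d
  unfold m n w₁ w₂ = cong₂ _+ᴷ_ (scale (fromℤ m) w₁) (trans (+ᴷ-identityʳ (ι n *ᴷ w₂)) (scale (fromℤ n) w₂))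

  det-⊆ : ∀ {v₁ v₂ w₁ w₂ : ℚ√ d} → ZSpan (w₁ ∷ w₂ ∷ []) v₁ → ZSpan (w₁ ∷ w₂ ∷ []) v₂ → ∃[ e ] det v₁ v₂ ≡ fromℤ e * det w₁ w₂
  det-⊆ {w₁ = w₁} {w₂} (m , _ , (n , _ , refl , refl) , refl) (m′ , _ , (n′ , _ , refl , refl) , refl) =
    m ℤ.* n′ ℤ.- m′ ℤ.* n , trans (cong₂ det (unfold m n w₁ w₂) (unfold m′ n′ w₁ w₂)) (trans
      (solve 8 (λ m n m′ n′ a b c e → (m :* a :+ n :* c) :* (m′ :* b :+ n′ :* e) :- (m′ :* a :+ n′ :* c) :* (m :* b :+ n :* e) :=
        (m :* n′ :- m′ :* n) :* (a :* e :- c :* b)) refl (fromℤ m) (fromℤ n) (fromℤ m′) (fromℤ n′) (rat w₁) (irr w₁) (rat w₂) (irr w₂))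
      (cong (_* det w₁ w₂) (sym (trans (fromℤ-- (m ℤ.* n′) (m′ ℤ.* n)) (cong₂ _-_ (fromℤ-* m n′) (fromℤ-* m′ n))))))

  -- Inclusion in both directions gives two integral ratios of determinants with product 1.
  det-≐ : ∀ {v₁ v₂ w₁ w₂ : ℚ√ d} → ZSpan (v₁ ∷ v₂ ∷ []) ≐ ZSpan (w₁ ∷ w₂ ∷ []) → det w₁ w₂ ≢ 0ℚ →
    ∃[ e ] e ℤ.* e ≡ 1ℤ × det v₁ v₂ ≡ fromℤ e * det w₁ w₂
  det-≐ {v₁} {v₂} {w₁} {w₂} (f , g) w≢0 = go (det-⊆ (f v₁ (span-head v₁ _)) (f v₂ (span-tail v₁ _ (span-head v₂ []))))
      (det-⊆ (g w₁ (span-head w₁ _)) (g w₂ (span-tail w₁ _ (span-head w₂ []))))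
    where
    go : (∃[ e ] det v₁ v₂ ≡ fromℤ e * det w₁ w₂) → (∃[ e ] det w₁ w₂ ≡ fromℤ e * det v₁ v₂) →
      ∃[ e ] e ℤ.* e ≡ 1ℤ × det v₁ v₂ ≡ fromℤ e * det w₁ w₂
    go (e , p) (e′ , p′) = e , *≡1⇒square≡1 e e′ (fromℤ-injective {e ℤ.* e′} {1ℤ} (trans (fromℤ-* e e′) unit)) , p
      where
      W : ℚ
      W = det w₁ w₂
      unit : fromℤ e * fromℤ e′ ≡ 1ℚ
      unit = trans (solve 1 (λ x → x := (x :- con 1ℚ) :+ con 1ℚ) refl (fromℤ e * fromℤ e′)) (cong (_+ 1ℚ)
        (p*q≡0⇒p≡0 (fromℤ e * fromℤ e′ - 1ℚ) W w≢0 (trans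
          (solve 3 (λ e e′ w → (e :* e′ :- con 1ℚ) :* w := e′ :* (e :* w) :- w) refl (fromℤ e) (fromℤ e′) W)
          (trans (cong (λ t → fromℤ e′ * t - W) (sym p)) (trans (cong (_- W) (sym p′)) (+-inverseʳ W))))))

module CodeOf (q Q : ℕ) (q≡ : q ≡ 4 ℕ.* Q ℕ.+ 1) (nonsquare : ¬ (∃[ m ] m ℕ.* m ≡ q)) where

  open Maximal q Q q≡
  open FieldSolver {q}
  open Inverse nonsquare
  open Forms q Q q≡ nonsquare
  open Ideal q Q q≡ nonsquare

  elementNorm : ℤ → ℤ → ℤ
  elementNorm m n = m ℤ.* m ℤ.+ m ℤ.* n ℤ.- + Q ℤ.* (n ℤ.* n)

  norm-element : ∀ m n → norm (element m n) ≡ fromℤ (elementNorm m n)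
  norm-element m n = trans (cong norm (element≡ m n)) (trans (cong (λ D → (fromℤ m + ½ * fromℤ n) * (fromℤ m + ½ * fromℤ n) - D * ((½ * fromℤ n) * (½ * fromℤ n))) D≡)
    (trans (solve 3 (λ m n Q → (m :+ con ½ :* n) :* (m :+ con ½ :* n) :- (con (fromℤ (+ 4)) :* Q :+ con 1ℚ) :* ((con ½ :* n) :* (con ½ :* n)) := m :* m :+ m :* n :- Q :* (n :* n)) refl (fromℤ m) (fromℤ n) (fromℤ (+ Q)))
      (sym (trans (fromℤ-- (m ℤ.* m ℤ.+ m ℤ.* n) (+ Q ℤ.* (n ℤ.* n))) (cong₂ _-_ (trans (fromℤ-+ (m ℤ.* m) (m ℤ.* n)) (cong₂ _+_ (fromℤ-* m m) (fromℤ-* m n)))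
        (trans (fromℤ-* (+ Q) (n ℤ.* n)) (cong (fromℤ (+ Q) *_) (fromℤ-* n n))))))))

  det-form : ∀ a c → det (ι (+ a)) (element c 1ℤ) ≡ fromℤ (+ a) * ½
  det-form a c = trans (cong (det (ι (+ a))) (element≡ c 1ℤ))
    (solve 2 (λ a c → a :* (con ½ :* con 1ℚ) :- (c :+ con ½ :* con 1ℚ) :* con 0ℚ := a :* con ½) refl (fromℤ (+ a)) (fromℤ c))

  point : ℕ → ℤ → ℤ → ℤ → K
  point a c x y = element (x ℤ.* + a ℤ.+ y ℤ.* c) y

  point∈ : ∀ a c x y → Form a c (point a c x y)
  point∈ a c x y = x , ι y *ᴷ element c 1ℤ +ᴷ 0ᴷ , (y , 0ᴷ , refl , refl) , (begin
    ι (x ℤ.* + a ℤ.+ y ℤ.* c) +ᴷ ι y *ᴷ ω ≡⟨ cong (_+ᴷ ι y *ᴷ ω) (trans (ι-+ (x ℤ.* + a) (y ℤ.* c)) (cong₂ _+ᴷ_ (ι-* x (+ a)) (ι-* y c))) ⟩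
    (ι x *ᴷ ι (+ a) +ᴷ ι y *ᴷ ι c) +ᴷ ι y *ᴷ ω ≡⟨ solveᴷ 5 (λ x a y c w → (x ⊗ a ⊕ y ⊗ c) ⊕ y ⊗ w :≡ x ⊗ a ⊕ (y ⊗ (c ⊕ w) ⊕ conᴷ 0ℤ)) refl (ι x) (ι (+ a)) (ι y) (ι c) ω ⟩
    ι x *ᴷ ι (+ a) +ᴷ (ι y *ᴷ (ι c +ᴷ ω) +ᴷ 0ᴷ) ≡⟨ cong (λ t → ι x *ᴷ ι (+ a) +ᴷ (ι y *ᴷ t +ᴷ 0ᴷ)) (sym (element-unfold c)) ⟩
    ι x *ᴷ ι (+ a) +ᴷ (ι y *ᴷ element c 1ℤ +ᴷ 0ᴷ) ∎)
    where open ≡-Reasoning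

  -- The inverse ideal (1/k)(ℤ + ℤ (c′ + ω)/a′) of the integral ideal α Form⁻¹, of norm k² a′.
  record Code (a : ℕ) (c : ℤ) (m n : ℤ) : Set where
    field
      k a′ c′ : ℕ
      a′≢0 : a′ ≢ 0
      c′<a′ : c′ ℕ.< a′
      a′∣norm : + a′ ℤ∣.∣ normω Q (+ c′)
      index : ℤ.∣ elementNorm m n ∣ ≡ a ℕ.* (a′ ℕ.* (k ℕ.* k))
      α⁻¹ : K
      α⁻¹-inverse : α⁻¹ *ᴷ element m n ≡ 1ᴷ
      τ : ℚ
      μ : ℤ
      ∣μ∣≡k : ℤ.∣ μ ∣ ≡ k
      τ* : τ * (fromℤ μ * fromℤ (+ a′)) ≡ 1ℚ
      spans : scale-by α⁻¹ (Form a c) ≐ scale-by (rational τ) (Form a′ (+ c′))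

  norm-rational : ∀ τ → norm (rational {q} τ) ≡ τ * τ
  norm-rational τ = solve 2 (λ D t → t :* t :- D :* (con 0ℚ :* con 0ℚ) := t :* t) refl D τ

  norm-1 : norm (1ᴷ {q}) ≡ 1ℚ
  norm-1 = norm-rational 1ℚ

  form-member : ∀ μ ν a c → ι μ *ᴷ ι (+ a) +ᴷ (ι ν *ᴷ element c 1ℤ +ᴷ 0ᴷ) ≡
    (fromℤ μ * fromℤ (+ a) + fromℤ ν * (fromℤ c + ½)) + (½ * fromℤ ν) √d
  form-member μ ν a c = trans (cong₂ _+ᴷ_ (sym (rational-* (fromℤ μ) (fromℤ (+ a)))) (trans (+ᴷ-identityʳ (ι ν *ᴷ element c 1ℤ)) (trans (cong (ι ν *ᴷ_) (element≡ c 1ℤ))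
      (scale (fromℤ ν) ((fromℤ c + ½ * 1ℚ) + (½ * 1ℚ) √d)))))
    (cong₂ _+_√d (cong (λ t → fromℤ μ * fromℤ (+ a) + fromℤ ν * (fromℤ c + t)) (*-identityʳ ½))
      (trans (+-identityˡ (fromℤ ν * (½ * 1ℚ))) (trans (cong (fromℤ ν *_) (*-identityʳ ½)) (*-comm (fromℤ ν) ½))))

  -- The irrational part of 1 is zero, so ν vanishes and 1 = τ μ a. Up to sign this μ is the
  -- rational factor k of the code.
  unit-member : ∀ τ → τ ≢ 0ℚ → ∀ μ ν a c → 1ᴷ ≡ rational τ *ᴷ (ι μ *ᴷ ι (+ a) +ᴷ (ι ν *ᴷ element c 1ℤ +ᴷ 0ᴷ)) → τ * (fromℤ μ * fromℤ (+ a)) ≡ 1ℚ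
  unit-member τ τ≢0 μ ν a c e = trans (sym (trans (cong (λ t → τ * (fromℤ μ * fromℤ (+ a) + t * (fromℤ c + ½))) ν≡0)
      (cong (τ *_) (trans (cong (_+_ (fromℤ μ * fromℤ (+ a))) (*-zeroˡ (fromℤ c + ½))) (+-identityʳ (fromℤ μ * fromℤ (+ a)))))))
    (sym (cong rat e′))
    where
    e′ : 1ᴷ {q} ≡ (τ * (fromℤ μ * fromℤ (+ a) + fromℤ ν * (fromℤ c + ½))) + (τ * (½ * fromℤ ν)) √d
    e′ = trans e (trans (cong (rational τ *ᴷ_) (form-member μ ν a c)) (scale τ ((fromℤ μ * fromℤ (+ a) + fromℤ ν * (fromℤ c + ½)) + (½ * fromℤ ν) √d)))
    ν≡0 : fromℤ ν ≡ 0ℚ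
    ν≡0 = p*q≡0⇒p≡0 (fromℤ ν) τ τ≢0 (trans (solve 2 (λ n t → n :* t := con two :* (t :* (con ½ :* n))) refl (fromℤ ν) τ)
      (cong (two *_) (sym (cong irr e′))))

  -- The covolumes of the two bases agree up to sign. With λ₁ = α⁻¹ and τ = 1 / (μ a′) this becomes
  -- |N α| = a a′ μ² in `index-of`.
  determinants : ∀ λ₁ τ a c a′ c′ → τ ≢ 0ℚ → a′ ≢ 0 → scale-by λ₁ (Form a c) ≐ scale-by (rational τ) (Form a′ c′) →
    ∃[ e ] e ℤ.* e ≡ 1ℤ × norm λ₁ * (fromℤ (+ a) * ½) ≡ fromℤ e * (τ * τ * (fromℤ (+ a′) * ½))
  determinants λ₁ τ a c a′ c′ τ≢0 a′≢0 h = convert (det-≐ {q} {λ₁ *ᴷ ι (+ a)} {λ₁ *ᴷ element c 1ℤ} {rational τ *ᴷ ι (+ a′)} {rational τ *ᴷ element c′ 1ℤ}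
      (≐-trans (scaled-span λ₁ (formBasis a c)) (≐-trans h (≐-sym (scaled-span (rational τ) (formBasis a′ c′)))))
      (λ z → nonzero (trans (sym value′) z)))
    where
    value : det (λ₁ *ᴷ ι (+ a)) (λ₁ *ᴷ element c 1ℤ) ≡ norm λ₁ * (fromℤ (+ a) * ½)
    value = trans (det-scale λ₁ (ι (+ a)) (element c 1ℤ)) (cong (norm λ₁ *_) (det-form a c))
    value′ : det (rational {q} τ *ᴷ ι (+ a′)) (rational τ *ᴷ element c′ 1ℤ) ≡ τ * τ * (fromℤ (+ a′) * ½)
    value′ = trans (det-scale (rational τ) (ι (+ a′)) (element c′ 1ℤ)) (cong₂ _*_ (norm-rational τ) (det-form a′ c′))
    ½≢0 : ½ ≢ 0ℚ
    ½≢0 ()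
    nonzero : τ * τ * (fromℤ (+ a′) * ½) ≢ 0ℚ
    nonzero z = τ≢0 (p*q≡0⇒p≡0 τ τ τ≢0 (p*q≡0⇒p≡0 (τ * τ) (fromℤ (+ a′) * ½)
      (λ h → a′≢0 (ℤₚ.+-injective (fromℤ-injective {+ a′} {0ℤ} (p*q≡0⇒p≡0 (fromℤ (+ a′)) ½ ½≢0 h)))) z))
    convert : (∃[ e ] e ℤ.* e ≡ 1ℤ × det (λ₁ *ᴷ ι (+ a)) (λ₁ *ᴷ element c 1ℤ) ≡ fromℤ e * det (rational {q} τ *ᴷ ι (+ a′)) (rational τ *ᴷ element c′ 1ℤ)) →
      ∃[ e ] e ℤ.* e ≡ 1ℤ × norm λ₁ * (fromℤ (+ a) * ½) ≡ fromℤ e * (τ * τ * (fromℤ (+ a′) * ½))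
    convert (e , e² , h) = e , e² , trans (sym value) (trans h (cong (fromℤ e *_) value′))

  private
    index-identity : ∀ l N A A′ M E T → l * N ≡ 1ℚ → T * (M * A′) ≡ 1ℚ → l * (A * ½) ≡ E * (T * T * (A′ * ½)) → A * (A′ * (M * M)) ≡ E * N
    index-identity l N A A′ M E T lN TMA h = begin
      A * (A′ * (M * M)) ≡⟨ trans (sym (*-identityˡ _)) (cong (_* (A * (A′ * (M * M)))) (sym lN)) ⟩
      l * N * (A * (A′ * (M * M))) ≡⟨ solve 5 (λ l N a b m → l :* N :* (a :* (b :* (m :* m))) := (l :* (a :* con ½)) :* (con two :* N :* (b :* (m :* m)))) refl l N A A′ M ⟩
      l * (A * ½) * (two * N * (A′ * (M * M))) ≡⟨ cong (_* (two * N * (A′ * (M * M)))) h ⟩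
      E * (T * T * (A′ * ½)) * (two * N * (A′ * (M * M))) ≡⟨ solve 5 (λ E t a N m → E :* (t :* t :* (a :* con ½)) :* (con two :* N :* (a :* (m :* m))) := E :* N :* ((t :* (m :* a)) :* (t :* (m :* a)))) refl E T A′ N M ⟩
      E * N * ((T * (M * A′)) * (T * (M * A′))) ≡⟨ cong (λ t → E * N * (t * t)) TMA ⟩
      E * N * (1ℚ * 1ℚ) ≡⟨ *-identityʳ (E * N) ⟩
      E * N ∎
      where open ≡-Reasoning

  index-of : ∀ (λ₁ : K) τ μ a a′ m n → norm λ₁ * fromℤ (elementNorm m n) ≡ 1ℚ → τ * (fromℤ μ * fromℤ (+ a′)) ≡ 1ℚ →
    (∃[ e ] e ℤ.* e ≡ 1ℤ × norm λ₁ * (fromℤ (+ a) * ½) ≡ fromℤ e * (τ * τ * (fromℤ (+ a′) * ½))) →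
    ℤ.∣ elementNorm m n ∣ ≡ a ℕ.* (a′ ℕ.* (ℤ.∣ μ ∣ ℕ.* ℤ.∣ μ ∣))
  index-of λ₁ τ μ a a′ m n inv τ* (e , e² , h) = begin
    ℤ.∣ elementNorm m n ∣ ≡⟨ ℕₚ.*-identityˡ ℤ.∣ elementNorm m n ∣ ⟨
    1 ℕ.* ℤ.∣ elementNorm m n ∣ ≡⟨ cong (ℕ._* ℤ.∣ elementNorm m n ∣) (sym (square≡1⇒abs≡1 e e²)) ⟩
    ℤ.∣ e ∣ ℕ.* ℤ.∣ elementNorm m n ∣ ≡⟨ trans (sym (ℤₚ.abs-* e (elementNorm m n))) (cong ℤ.∣_∣ (sym integral)) ⟩
    ℤ.∣ + a ℤ.* (+ a′ ℤ.* (μ ℤ.* μ)) ∣ ≡⟨ trans (ℤₚ.abs-* (+ a) (+ a′ ℤ.* (μ ℤ.* μ))) (cong (a ℕ.*_) (trans (ℤₚ.abs-* (+ a′) (μ ℤ.* μ)) (cong (a′ ℕ.*_) (ℤₚ.abs-* μ μ)))) ⟩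
    a ℕ.* (a′ ℕ.* (ℤ.∣ μ ∣ ℕ.* ℤ.∣ μ ∣)) ∎
    where
    open ≡-Reasoning
    integral : + a ℤ.* (+ a′ ℤ.* (μ ℤ.* μ)) ≡ e ℤ.* elementNorm m n
    integral = fromℤ-injective {+ a ℤ.* (+ a′ ℤ.* (μ ℤ.* μ))} {e ℤ.* elementNorm m n}
      (trans (trans (fromℤ-* (+ a) (+ a′ ℤ.* (μ ℤ.* μ))) (cong (fromℤ (+ a) *_) (trans (fromℤ-* (+ a′) (μ ℤ.* μ)) (cong (fromℤ (+ a′) *_) (fromℤ-* μ μ)))))
        (trans (index-identity (norm λ₁) (fromℤ (elementNorm m n)) (fromℤ (+ a)) (fromℤ (+ a′)) (fromℤ μ) (fromℤ e) τ inv τ* h) (sym (fromℤ-* e (elementNorm m n)))))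

  private
    code-from : ∀ a c m n λ₁ → λ₁ *ᴷ element m n ≡ 1ᴷ → NormalForm (scale-by λ₁ (Form a c)) → scale-by λ₁ (Form a c) 1ᴷ → Code a c m n
    code-from a c m n λ₁ λα≡1 F 1∈ = build (proj₁ F.spans 1ᴷ 1∈)
      where
      module F = NormalForm F
      inv : norm λ₁ * fromℤ (elementNorm m n) ≡ 1ℚ
      inv = trans (cong (norm λ₁ *_) (sym (norm-element m n))) (trans (sym (norm-* λ₁ (element m n))) (trans (cong norm λα≡1) norm-1))
      assemble : ∀ μ → F.τ * (fromℤ μ * fromℤ (+ F.a)) ≡ 1ℚ → Code a c m n
      assemble μ τ* = record
        { k = ℤ.∣ μ ∣ ; a′ = F.a ; c′ = F.c ; a′≢0 = F.a≢0 ; c′<a′ = F.c<a ; a′∣norm = F.a∣norm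
        ; index = index-of λ₁ F.τ μ a F.a m n inv τ* (determinants λ₁ F.τ a c F.a (+ F.c) F.τ≢0 F.a≢0 F.spans)
        ; α⁻¹ = λ₁ ; α⁻¹-inverse = λα≡1 ; τ = F.τ ; μ = μ ; ∣μ∣≡k = refl ; τ* = τ* ; spans = F.spans }
      build : scale-by (rational F.τ) (Form F.a (+ F.c)) 1ᴷ → Code a c m n
      build (_ , (μ , _ , (ν , _ , z≡ , y≡) , x≡) , one) = assemble μ (unit-member F.τ F.τ≢0 μ ν F.a (+ F.c)
        (trans one (cong (rational F.τ *ᴷ_) (trans x≡ (cong (ι μ *ᴷ ι (+ F.a) +ᴷ_) (trans y≡ (cong (ι ν *ᴷ element (+ F.c) 1ℤ +ᴷ_) z≡)))))))

  code : ∀ a c → + a ℤ∣.∣ normω Q c → ∀ m n → element m n ≢ 0ᴷ → Form a c (element m n) → Code a c m n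
  code a c a∣norm m n α≢0 α∈ = go (inverseᴷ (element m n) α≢0)
    where
    go : (∃[ y ] element m n *ᴷ y ≡ 1ᴷ) → Code a c m n
    go (y , e) = code-from a c m n y e′ (scaledForm a c a∣norm y (invertible⇒≢0 e′)) (element m n , α∈ , sym e′)
      where
      e′ : y *ᴷ element m n ≡ 1ᴷ
      e′ = trans (*ᴷ-comm y (element m n)) e

  SameCode : ∀ {a c m n a₁ c₁ m₁ n₁} → Code a c m n → Code a₁ c₁ m₁ n₁ → Set
  SameCode C C₁ = Code.k C ≡ Code.k C₁ × Code.a′ C ≡ Code.a′ C₁ × Code.c′ C ≡ Code.c′ C₁

  ±-abs : ∀ m n → ℤ.∣ m ∣ ≡ ℤ.∣ n ∣ → ∃[ s ] m ≡ s ℤ.* n × s ℤ.* s ≡ 1ℤ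
  ±-abs (+ m) (+ n) e = 1ℤ , trans (cong +_ e) (sym (ℤₚ.*-identityˡ (+ n))) , refl
  ±-abs (+ m) -[1+ n ] refl = -1ℤ , sym (ℤₚ.-1*i≡-i -[1+ n ]) , refl
  ±-abs -[1+ m ] (+ n) refl = -1ℤ , sym (ℤₚ.-1*i≡-i (+ n)) , refl
  ±-abs -[1+ m ] -[1+ n ] refl = 1ℤ , sym (ℤₚ.*-identityˡ -[1+ n ]) , refl

  -- The code determines τ = ±1 / (k a′) up to its sign, and a lattice absorbs the sign.
  sameCode⇒≐ : ∀ {a c m n a₁ c₁ m₁ n₁} (C : Code a c m n) (C₁ : Code a₁ c₁ m₁ n₁) → SameCode C C₁ →
    scale-by (Code.α⁻¹ C) (Form a c) ≐ scale-by (Code.α⁻¹ C₁) (Form a₁ c₁)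
  sameCode⇒≐ {a} {c} {m} {n} {a₁} {c₁} {m₁} {n₁} C C₁ (k≡ , refl , refl) = ≐-trans C.spans (≐-trans (go (±-abs C.μ C₁.μ (trans C.∣μ∣≡k (trans k≡ (sym C₁.∣μ∣≡k))))) (≐-sym C₁.spans))
    where
    module C = Code C
    module C₁ = Code C₁
    P : K → Set
    P = Form C.a′ (+ C.c′)
    G : Subgroup P
    G = span-subgroup (formBasis C.a′ (+ C.c′))
    absorb : ∀ s τ τ₁ → rational {q} τ ≡ rational τ₁ *ᴷ ι s → ∀ x → scale-by (rational τ) P x → scale-by (rational τ₁) P x
    absorb s τ τ₁ e x (y , p , refl) = ι s *ᴷ y , ι-closed G s p , trans (cong (_*ᴷ y) e) (*ᴷ-assoc (rational τ₁) (ι s) y)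
    go : (∃[ s ] C.μ ≡ s ℤ.* C₁.μ × s ℤ.* s ≡ 1ℤ) → scale-by (rational C.τ) P ≐ scale-by (rational C₁.τ) P
    go (s , μ≡ , s²) = absorb s C.τ C₁.τ (trans (cong rational τ≡) (rational-* C₁.τ S)) , absorb s C₁.τ C.τ (trans (cong rational τ₁≡) (rational-* C.τ S))
      where
      S A M : ℚ
      S = fromℤ s
      A = fromℤ (+ C.a′)
      M = fromℤ C₁.μ
      S² : S * S ≡ 1ℚ
      S² = trans (sym (fromℤ-* s s)) (cong fromℤ s²)
      rel : C.τ * S * (M * A) ≡ 1ℚ
      rel = trans (solve 4 (λ t s m a → t :* s :* (m :* a) := t :* ((s :* m) :* a)) refl C.τ S M A) (trans (cong (λ t → C.τ * (t * A)) (sym (trans (cong fromℤ μ≡) (fromℤ-* s C₁.μ)))) C.τ*)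
      τ₁≡ : C₁.τ ≡ C.τ * S
      τ₁≡ = begin
        C₁.τ ≡⟨ sym (*-identityʳ C₁.τ) ⟩
        C₁.τ * 1ℚ ≡⟨ cong (C₁.τ *_) (sym rel) ⟩
        C₁.τ * (C.τ * S * (M * A)) ≡⟨ solve 3 (λ t u w → t :* (u :* w) := (t :* w) :* u) refl C₁.τ (C.τ * S) (M * A) ⟩
        C₁.τ * (M * A) * (C.τ * S) ≡⟨ trans (cong (_* (C.τ * S)) C₁.τ*) (*-identityˡ (C.τ * S)) ⟩
        C.τ * S ∎
        where open ≡-Reasoning
      τ≡ : C.τ ≡ C₁.τ * S
      τ≡ = sym (trans (cong (_* S) τ₁≡) (trans (*-assoc C.τ S S) (trans (cong (C.τ *_) S²) (*-identityʳ C.τ))))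

-- Units stabilising a lattice

module UnitGroup (q Q : ℕ) (q≡ : q ≡ 4 ℕ.* Q ℕ.+ 1) (nonsquare : ¬ (∃[ m ] m ℕ.* m ≡ q))
  (sqf : SquareFree4Q+1 Q) where

  open Maximal q Q q≡
  open Forms q Q q≡ nonsquare
  open Ideal q Q q≡ nonsquare
  open CodeOf q Q q≡ nonsquare

  -- A quadratic form of discriminant q is primitive, because q is square free.
  primitive-∣ : ∀ a c f → a ≢ 0 → normω Q c ≡ f ℤ.* + a → ∀ y →
    + a ℤ∣.∣ y ℤ.* f → + a ℤ∣.∣ y ℤ.* (+ 2 ℤ.* c ℤ.+ 1ℤ) → + a ℤ∣.∣ y
  primitive-∣ a c f a≢0 norm≡ y (ℤ∣.divides k e) (ℤ∣.divides l e′) = go (extendedGCD (+ a) d)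
    where
    d : ℤ
    d = + 2 ℤ.* c ℤ.+ 1ℤ
    go : ExtendedGCD (+ a) d → + a ℤ∣.∣ y
    go record { g = g₁ ; u = u ; v = v ; m = m ; n = n ; bézout = b ; a≡m*g = a≡ ; b≡n*g = d≡ } = go₂ (extendedGCD (+ g₁) f)
      where
      go₂ : ExtendedGCD (+ g₁) f → + a ℤ∣.∣ y
      go₂ record { g = zero ; m = m′ ; a≡m*g = g₁≡ } = contradiction
        (ℤₚ.+-injective (trans a≡ (trans (cong (m ℤ.*_) (trans g₁≡ (ℤₚ.*-zeroʳ m′))) (ℤₚ.*-zeroʳ m)))) a≢0
      go₂ record { g = suc zero ; u = u′ ; v = v′ ; bézout = b′ } = ℤ∣.divides (u′ ℤ.* (u ℤ.* y ℤ.+ v ℤ.* l) ℤ.+ v′ ℤ.* k)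
        (trans (linear₂ y (y ℤ.* u′) b′ b (identity y u′ (+ g₁) v′ f u (+ a) v d)) (linear₂ (u′ ℤ.* v) v′ e′ e (identity′ y u′ v′ f u (+ a) v d k l)))
        where
        identity : ∀ y u′ g v′ f u a v d → y ℤ.- (u′ ℤ.* (u ℤ.* (y ℤ.* a) ℤ.+ v ℤ.* (y ℤ.* d)) ℤ.+ v′ ℤ.* (y ℤ.* f)) ≡
          y ℤ.* (1ℤ ℤ.- (u′ ℤ.* g ℤ.+ v′ ℤ.* f)) ℤ.+ (y ℤ.* u′) ℤ.* (g ℤ.- (u ℤ.* a ℤ.+ v ℤ.* d))
        identity = ℤ-ring
        identity′ : ∀ y u′ v′ f u a v d k l → (u′ ℤ.* (u ℤ.* (y ℤ.* a) ℤ.+ v ℤ.* (y ℤ.* d)) ℤ.+ v′ ℤ.* (y ℤ.* f)) ℤ.- (u′ ℤ.* (u ℤ.* y ℤ.+ v ℤ.* l) ℤ.+ v′ ℤ.* k) ℤ.* a ≡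
          (u′ ℤ.* v) ℤ.* (y ℤ.* d ℤ.- l ℤ.* a) ℤ.+ v′ ℤ.* (y ℤ.* f ℤ.- k ℤ.* a)
        identity′ = ℤ-ring
      go₂ record { g = g@(suc (suc _)) ; m = m′ ; n = n′ ; a≡m*g = g₁≡ ; b≡n*g = f≡ } = common (primeDivisor g (s≤s (s≤s z≤n)))
        where
        common : (∃[ p ] Prime p × p ℕ∣.∣ g) → + a ℤ∣.∣ y
        common (p , pr , p∣g) = contradiction (subst (+ p ℤ.* + p ℤ∣.∣_) discriminant
            (ℤ∣.∣m∣n⇒∣m-n (square p∣d p∣d) (ℤ∣.∣n⇒∣m*n (+ 4) (square p∣a p∣f)))) (sqf pr)
          where
          p∣gℤ : + p ℤ∣.∣ + g
          p∣gℤ = ℤ∣.∣ᵤ⇒∣ p∣g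
          p∣g₁ : + p ℤ∣.∣ + g₁
          p∣g₁ = subst (+ p ℤ∣.∣_) (sym g₁≡) (ℤ∣.∣n⇒∣m*n m′ p∣gℤ)
          p∣a : + p ℤ∣.∣ + a
          p∣a = subst (+ p ℤ∣.∣_) (sym a≡) (ℤ∣.∣n⇒∣m*n m p∣g₁)
          p∣d : + p ℤ∣.∣ d
          p∣d = subst (+ p ℤ∣.∣_) (sym d≡) (ℤ∣.∣n⇒∣m*n n p∣g₁)
          p∣f : + p ℤ∣.∣ f
          p∣f = subst (+ p ℤ∣.∣_) (sym f≡) (ℤ∣.∣n⇒∣m*n n′ p∣gℤ)
          square : ∀ {m n} → + p ℤ∣.∣ m → + p ℤ∣.∣ n → + p ℤ.* + p ℤ∣.∣ m ℤ.* n
          square {m} {n} (ℤ∣.divides k e) (ℤ∣.divides l g) = ℤ∣.divides (k ℤ.* l) (trans (cong₂ ℤ._*_ e g) (identity k l (+ p)))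
            where
            identity : ∀ k l p → (k ℤ.* p) ℤ.* (l ℤ.* p) ≡ k ℤ.* l ℤ.* (p ℤ.* p)
            identity = ℤ-ring
          discriminant : d ℤ.* d ℤ.- + 4 ℤ.* (+ a ℤ.* f) ≡ + 4 ℤ.* + Q ℤ.+ 1ℤ
          discriminant = linear (+ 4) norm≡ (identity c (+ Q) f (+ a))
            where
            identity : ∀ c Q f a → ((+ 2 ℤ.* c ℤ.+ 1ℤ) ℤ.* (+ 2 ℤ.* c ℤ.+ 1ℤ) ℤ.- + 4 ℤ.* (a ℤ.* f)) ℤ.- (+ 4 ℤ.* Q ℤ.+ 1ℤ) ≡
              + 4 ℤ.* ((c ℤ.* c ℤ.+ c ℤ.- Q) ℤ.- f ℤ.* a)
            identity = ℤ-ring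

  private
    β≡ : ∀ c → element c 1ℤ ≡ (fromℤ c + ½) + ½ √d
    β≡ c = trans (element≡ c 1ℤ) (cong₂ _+_√d (cong (_+_ (fromℤ c)) (*-identityʳ ½)) (*-identityʳ ½))

    -- The hypotheses are the coordinates of η a = x a + y β and η β = x′ a + y′ β with β = c + ω.
    -- Eliminating η by means of β² = (2c + 1) β - f a gives both equations.
    multiplier-equations : ∀ h₁ h₂ A C F x y x′ y′ → A ≢ 0ℚ → (C + ½) * (C + ½) - D * (½ * ½) ≡ F * A →
      h₁ * A ≡ x * A + y * (C + ½) → h₂ * A ≡ ½ * y →
      h₁ * (C + ½) + D * (h₂ * ½) ≡ x′ * A + y′ * (C + ½) → h₁ * ½ + h₂ * (C + ½) ≡ ½ * y′ →
      (y * F ≡ (- x′) * A) × (y * (two * C + 1ℚ) ≡ (y′ - x) * A)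
    multiplier-equations h₁ h₂ A C F x y x′ y′ A≢0 norm e₁ e₂ e₃ e₄ = first , second
      where
      second : y * (two * C + 1ℚ) ≡ (y′ - x) * A
      second = begin
        y * (two * C + 1ℚ) ≡⟨ solve 4 (λ x y A C → y :* (con two :* C :+ con 1ℚ) := con two :* ((x :* A :+ y :* (C :+ con ½)) :* con ½ :+ (con ½ :* y) :* (C :+ con ½)) :- x :* A) refl x y A C ⟩
        two * ((x * A + y * (C + ½)) * ½ + (½ * y) * (C + ½)) - x * A ≡⟨ cong₂ (λ s t → two * (s * ½ + t * (C + ½)) - x * A) (sym e₁) (sym e₂) ⟩
        two * ((h₁ * A) * ½ + (h₂ * A) * (C + ½)) - x * A ≡⟨ solve 5 (λ h₁ h₂ x A C → con two :* ((h₁ :* A) :* con ½ :+ (h₂ :* A) :* (C :+ con ½)) :- x :* A := con two :* A :* (h₁ :* con ½ :+ h₂ :* (C :+ con ½)) :- x :* A) refl h₁ h₂ x A C ⟩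
        two * A * (h₁ * ½ + h₂ * (C + ½)) - x * A ≡⟨ cong (λ s → two * A * s - x * A) e₄ ⟩
        two * A * (½ * y′) - x * A ≡⟨ solve 3 (λ y′ x A → con two :* A :* (con ½ :* y′) :- x :* A := (y′ :- x) :* A) refl y′ x A ⟩
        (y′ - x) * A ∎
        where open ≡-Reasoning
      first : y * F ≡ (- x′) * A
      first = *-cancelʳ-≢0 A A≢0 (begin
        y * F * A ≡⟨ trans (*-assoc y F A) (cong (y *_) (sym norm)) ⟩
        y * ((C + ½) * (C + ½) - D * (½ * ½))
          ≡⟨ solve 5 (λ D x y A C → y :* ((C :+ con ½) :* (C :+ con ½) :- D :* (con ½ :* con ½)) :=
               (x :* A :+ y :* (con two :* C :+ con 1ℚ)) :* (C :+ con ½) :- ((x :* A :+ y :* (C :+ con ½)) :* (C :+ con ½) :+ D :* ((con ½ :* y) :* con ½))) refl D x y A C ⟩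
        (x * A + y * (two * C + 1ℚ)) * (C + ½) - ((x * A + y * (C + ½)) * (C + ½) + D * ((½ * y) * ½))
          ≡⟨ cong₂ (λ s t → (x * A + s) * (C + ½) - t) second (cong₂ (λ s t → s * (C + ½) + D * (t * ½)) (sym e₁) (sym e₂)) ⟩
        (x * A + (y′ - x) * A) * (C + ½) - ((h₁ * A) * (C + ½) + D * ((h₂ * A) * ½))
          ≡⟨ solve 7 (λ D h₁ h₂ x y′ A C → (x :* A :+ (y′ :- x) :* A) :* (C :+ con ½) :- ((h₁ :* A) :* (C :+ con ½) :+ D :* ((h₂ :* A) :* con ½)) :=
               A :* (y′ :* (C :+ con ½) :- (h₁ :* (C :+ con ½) :+ D :* (h₂ :* con ½)))) refl D h₁ h₂ x y′ A C ⟩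
        A * (y′ * (C + ½) - (h₁ * (C + ½) + D * (h₂ * ½)))
          ≡⟨ cong (λ s → A * (y′ * (C + ½) - s)) e₃ ⟩
        A * (y′ * (C + ½) - (x′ * A + y′ * (C + ½)))
          ≡⟨ solve 4 (λ A y C x → A :* (y :* C :- (x :* A :+ y :* C)) := (:- x) :* A :* A) refl A y′ (C + ½) x′ ⟩
        (- x′) * A * A ∎)
        where open ≡-Reasoning

  -- A multiplier satisfies η a = x a + y β, and primitivity of the form makes a divide y; so η = x
  -- + (y / a)(c + ω) is integral.
  multiplier : ∀ a c → a ≢ 0 → + a ℤ∣.∣ normω Q c → ∀ η →
    Form a c (η *ᴷ ι (+ a)) → Form a c (η *ᴷ element c 1ℤ) → ∃₂ λ m n → η ≡ element m n
  multiplier a c a≢0 (ℤ∣.divides f norm≡) η@(h₁ + h₂ √d) (x , _ , (y , _ , z≡ , y≡) , x≡) (x′ , _ , (y′ , _ , z′≡ , y′≡) , x′≡) =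
    go (primitive-∣ a c f a≢0 norm≡ y
      (ℤ∣.divides (ℤ.- x′) (fromℤ-injective {y ℤ.* f} {(ℤ.- x′) ℤ.* + a} (trans (fromℤ-* y f) (trans (proj₁ equations)
        (trans (cong (_* A) (sym (fromℤ-neg x′))) (sym (fromℤ-* (ℤ.- x′) (+ a))))))))
      (ℤ∣.divides (y′ ℤ.- x) (fromℤ-injective {y ℤ.* (+ 2 ℤ.* c ℤ.+ 1ℤ)} {(y′ ℤ.- x) ℤ.* + a}
        (trans (trans (fromℤ-* y (+ 2 ℤ.* c ℤ.+ 1ℤ)) (cong (fromℤ y *_) (trans (fromℤ-+ (+ 2 ℤ.* c) 1ℤ) (cong (_+ 1ℚ) (fromℤ-* (+ 2) c)))))
          (trans (proj₂ equations) (trans (cong (_* A) (sym (fromℤ-- y′ x))) (sym (fromℤ-* (y′ ℤ.- x) (+ a)))))))))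
    where
    A C : ℚ
    A = fromℤ (+ a)
    C = fromℤ c
    A≢0 : A ≢ 0ℚ
    A≢0 e = a≢0 (ℤₚ.+-injective (fromℤ-injective {+ a} {0ℤ} e))
    eq₁ : η *ᴷ ι (+ a) ≡ (fromℤ x * A + fromℤ y * (C + ½)) + (½ * fromℤ y) √d
    eq₁ = trans (trans x≡ (cong (ι x *ᴷ ι (+ a) +ᴷ_) (trans y≡ (cong (ι y *ᴷ element c 1ℤ +ᴷ_) z≡)))) (form-member x y a c)
    eq₂ : η *ᴷ element c 1ℤ ≡ (fromℤ x′ * A + fromℤ y′ * (C + ½)) + (½ * fromℤ y′) √d
    eq₂ = trans (trans x′≡ (cong (ι x′ *ᴷ ι (+ a) +ᴷ_) (trans y′≡ (cong (ι y′ *ᴷ element c 1ℤ +ᴷ_) z′≡)))) (form-member x′ y′ a c)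
    eq₁′ : h₁ * A ≡ fromℤ x * A + fromℤ y * (C + ½)
    eq₁′ = trans (solve 4 (λ D h k A → h :* A := h :* A :+ D :* (k :* con 0ℚ)) refl D h₁ h₂ A) (cong rat eq₁)
    eq₂′ : h₂ * A ≡ ½ * fromℤ y
    eq₂′ = trans (solve 3 (λ h k A → k :* A := h :* con 0ℚ :+ k :* A) refl h₁ h₂ A) (cong irr eq₁)
    eq₃ : η *ᴷ ((C + ½) + ½ √d) ≡ (fromℤ x′ * A + fromℤ y′ * (C + ½)) + (½ * fromℤ y′) √d
    eq₃ = trans (cong (η *ᴷ_) (sym (β≡ c))) eq₂
    normℚ : (C + ½) * (C + ½) - D * (½ * ½) ≡ fromℤ f * A
    normℚ = trans (cong (λ D → (C + ½) * (C + ½) - D * (½ * ½)) D≡) (trans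
      (solve 2 (λ C Q → (C :+ con ½) :* (C :+ con ½) :- (con (fromℤ (+ 4)) :* Q :+ con 1ℚ) :* (con ½ :* con ½) := C :* C :+ C :- Q) refl C (fromℤ (+ Q)))
      (trans (sym (trans (fromℤ-- (c ℤ.* c ℤ.+ c) (+ Q)) (cong (_- fromℤ (+ Q)) (trans (fromℤ-+ (c ℤ.* c) c) (cong (_+ C) (fromℤ-* c c))))))
        (trans (cong fromℤ norm≡) (fromℤ-* f (+ a)))))
    equations : (fromℤ y * fromℤ f ≡ (- fromℤ x′) * A) × (fromℤ y * (two * C + 1ℚ) ≡ (fromℤ y′ - fromℤ x) * A)
    equations = multiplier-equations h₁ h₂ A C (fromℤ f) (fromℤ x) (fromℤ y) (fromℤ x′) (fromℤ y′) A≢0 normℚ eq₁′ eq₂′ (cong rat eq₃) (cong irr eq₃)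
    go : + a ℤ∣.∣ y → ∃₂ λ m n → η ≡ element m n
    go (ℤ∣.divides n e) = x ℤ.+ n ℤ.* c , n , trans (cong₂ _+_√d h₁≡ h₂≡) (sym (element≡ (x ℤ.+ n ℤ.* c) n))
      where
      yA : fromℤ y ≡ fromℤ n * A
      yA = trans (cong fromℤ e) (fromℤ-* n (+ a))
      h₂≡ : h₂ ≡ ½ * fromℤ n
      h₂≡ = *-cancelʳ-≢0 A A≢0 (trans eq₂′ (trans (cong (½ *_) yA) (sym (*-assoc ½ (fromℤ n) A))))
      h₁≡ : h₁ ≡ fromℤ (x ℤ.+ n ℤ.* c) + ½ * fromℤ n
      h₁≡ = *-cancelʳ-≢0 A A≢0 (trans eq₁′ (trans (cong (λ t → fromℤ x * A + t * (C + ½)) yA) (trans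
        (solve 4 (λ x n A C → x :* A :+ n :* A :* (C :+ con ½) := ((x :+ n :* C) :+ con ½ :* n) :* A) refl (fromℤ x) (fromℤ n) A C)
        (cong (λ t → (t + ½ * fromℤ n) * A) (sym (trans (fromℤ-+ x (n ℤ.* c)) (cong (_+_ (fromℤ x)) (fromℤ-* n c))))))))

  record PellUnit (η : K) : Set where
    field
      T U s : ℤ
      η≡ : η ≡ fromℤ T + fromℤ U √d
      s²≡1 : s ℤ.* s ≡ 1ℤ
      pell : T ℤ.* T ℤ.- + q ℤ.* (U ℤ.* U) ≡ s

  -- Both η and its inverse are multipliers, so η = m + n ω has norm ±1. An odd n would make m² + m
  -- n - Q n² even, because Q = 2 R.
  stabiliser : ∀ R → Q ≡ R ℕ.+ R → ∀ a c → a ≢ 0 → + a ℤ∣.∣ normω Q c → ∀ η η′ → η *ᴷ η′ ≡ 1ᴷ →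
    Form a c ≐ scale-by η (Form a c) → PellUnit η
  stabiliser R Q≡ a c a≢0 a∣norm η η′ ηη′≡1 h = go (member η h) (member η′ (scaled-invert {η′} {η} {Form a c} {Form a c} (trans (*ᴷ-comm η′ η) ηη′≡1) h))
    where
    α∈ : Form a c (ι (+ a))
    α∈ = span-head (ι (+ a)) _
    β∈ : Form a c (element c 1ℤ)
    β∈ = span-tail (ι (+ a)) _ (span-head (element c 1ℤ) [])
    member : ∀ η → Form a c ≐ scale-by η (Form a c) → ∃₂ λ m n → η ≡ element m n
    member η (_ , g) = multiplier a c a≢0 a∣norm η (g _ (ι (+ a) , α∈ , refl)) (g _ (element c 1ℤ , β∈ , refl))
    go : (∃₂ λ m n → η ≡ element m n) → (∃₂ λ m n → η′ ≡ element m n) → PellUnit η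
    go (m , n , e) (m′ , n′ , e′) = [ n-even , n-odd ]′ (parityℤ n)
      where
      N : ℤ
      N = elementNorm m n
      unit-norm : N ℤ.* elementNorm m′ n′ ≡ 1ℤ
      unit-norm = fromℤ-injective {N ℤ.* elementNorm m′ n′} {1ℤ} (trans (fromℤ-* N (elementNorm m′ n′))
        (trans (cong₂ _*_ (sym (norm-element m n)) (sym (norm-element m′ n′))) (trans (sym (norm-* (element m n) (element m′ n′)))
          (trans (cong norm (trans (sym (cong₂ _*ᴷ_ e e′)) ηη′≡1)) norm-1))))
      N² : N ℤ.* N ≡ 1ℤ
      N² = *≡1⇒square≡1 N (elementNorm m′ n′) unit-norm
      Qℤ : + Q ≡ + R ℤ.+ + R
      Qℤ = cong +_ Q≡
      n-even : (∃[ U ] n ≡ + 2 ℤ.* U) → PellUnit η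
      n-even (U , n≡) = record { T = m ℤ.+ U ; U = U ; s = N ; s²≡1 = N²
        ; η≡ = trans e (trans (element≡ m n) (cong₂ _+_√d
            (trans (cong (λ t → fromℤ m + ½ * t) n≡ℚ) (trans (cong (_+_ (fromℤ m)) (half (fromℤ U))) (sym (fromℤ-+ m U))))
            (trans (cong (½ *_) n≡ℚ) (half (fromℤ U)))))
        ; pell = trans (cong (λ t → (m ℤ.+ U) ℤ.* (m ℤ.+ U) ℤ.- t ℤ.* (U ℤ.* U)) (trans (cong +_ q≡) (cong (ℤ._+ 1ℤ) (ℤₚ.pos-* 4 Q))))
            (trans (identity m U (+ Q)) (cong (elementNorm m) (sym n≡))) }
        where
        n≡ℚ : fromℤ n ≡ two * fromℤ U
        n≡ℚ = trans (cong fromℤ n≡) (fromℤ-* (+ 2) U)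
        half : ∀ u → ½ * (two * u) ≡ u
        half = solve 1 (λ u → con ½ :* (con two :* u) := u) refl
        identity : ∀ m U Q → (m ℤ.+ U) ℤ.* (m ℤ.+ U) ℤ.- (+ 4 ℤ.* Q ℤ.+ 1ℤ) ℤ.* (U ℤ.* U) ≡
          m ℤ.* m ℤ.+ m ℤ.* (+ 2 ℤ.* U) ℤ.- Q ℤ.* ((+ 2 ℤ.* U) ℤ.* (+ 2 ℤ.* U))
        identity = ℤ-ring
      n-odd : (∃[ b ] n ≡ + 2 ℤ.* b ℤ.+ 1ℤ) → PellUnit η
      n-odd (b , n≡) = contradiction N² (λ h → 1≢2* (x ℤ.* N) (trans (sym h) (trans (cong (ℤ._* N) N-n-even) (ℤₚ.*-assoc (+ 2) x N))))
        where
        half-product : ∃[ k ] m ℤ.* m ℤ.+ m ≡ + 2 ℤ.* k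
        half-product = [ (λ { (j , e) → j ℤ.* m ℤ.+ j , trans (cong (λ t → t ℤ.* m ℤ.+ t) e) (identity₁ j m) }) ,
          (λ { (j , e) → m ℤ.* (j ℤ.+ 1ℤ) , linear m e (identity₂ j m) }) ]′ (parityℤ m)
          where
          identity₁ : ∀ j m → (+ 2 ℤ.* j) ℤ.* m ℤ.+ + 2 ℤ.* j ≡ + 2 ℤ.* (j ℤ.* m ℤ.+ j)
          identity₁ = ℤ-ring
          identity₂ : ∀ j m → (m ℤ.* m ℤ.+ m) ℤ.- + 2 ℤ.* (m ℤ.* (j ℤ.+ 1ℤ)) ≡ m ℤ.* (m ℤ.- (+ 2 ℤ.* j ℤ.+ 1ℤ))
          identity₂ = ℤ-ring
        k x : ℤ
        k = proj₁ half-product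
        x = k ℤ.+ m ℤ.* b ℤ.- + R ℤ.* (n ℤ.* n)
        N-n-even : N ≡ + 2 ℤ.* x
        N-n-even = linear₃ m (ℤ.- (n ℤ.* n)) 1ℤ n≡ Qℤ (proj₂ half-product) (identity m n b (+ Q) (+ R) k)
          where
          identity : ∀ m n b Q R k → (m ℤ.* m ℤ.+ m ℤ.* n ℤ.- Q ℤ.* (n ℤ.* n)) ℤ.- + 2 ℤ.* (k ℤ.+ m ℤ.* b ℤ.- R ℤ.* (n ℤ.* n)) ≡
            m ℤ.* (n ℤ.- (+ 2 ℤ.* b ℤ.+ 1ℤ)) ℤ.+ (ℤ.- (n ℤ.* n)) ℤ.* (Q ℤ.- (R ℤ.+ R)) ℤ.+ 1ℤ ℤ.* ((m ℤ.* m ℤ.+ m) ℤ.- + 2 ℤ.* k)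
          identity = ℤ-ring

-- Different points have different codes

module Separate (q Q R : ℕ) (q≡ : q ≡ 4 ℕ.* Q ℕ.+ 1) (Q≡ : Q ≡ R ℕ.+ R) (disc : IsRealQuadraticDiscriminant q)
  (sqf : SquareFree4Q+1 Q) where

  open IsRealQuadraticDiscriminant disc using (nonsquare)
  open Maximal q Q q≡
  open FieldSolver {q}
  open Inverse nonsquare
  open Forms q Q q≡ nonsquare
  open Ideal q Q q≡ nonsquare
  open CodeOf q Q q≡ nonsquare
  open UnitGroup q Q q≡ nonsquare sqf

  record Similar (P S : K → Set) : Set where
    field
      ratio inv : K
      inverseʳ : ratio *ᴷ inv ≡ 1ᴷ
      scaled : P ≐ scale-by ratio S

  similar-sym : ∀ {P S} → Similar P S → Similar S P
  similar-sym {P} {S} p = record { ratio = inv ; inv = ratio ; inverseʳ = inverseˡ ; scaled = scaled-invert {inv} {ratio} {P} {S} inverseˡ scaled }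
    where
    open Similar p
    inverseˡ : inv *ᴷ ratio ≡ 1ᴷ
    inverseˡ = trans (*ᴷ-comm inv ratio) inverseʳ

  inverse-* : ∀ a a′ b b′ → a *ᴷ a′ ≡ 1ᴷ → b *ᴷ b′ ≡ 1ᴷ → (a *ᴷ b) *ᴷ (a′ *ᴷ b′) ≡ 1ᴷ
  inverse-* a a′ b b′ e f = trans (solveᴷ 4 (λ a a′ b b′ → (a ⊗ b) ⊗ (a′ ⊗ b′) :≡ (a ⊗ a′) ⊗ (b ⊗ b′)) refl a a′ b b′)
    (trans (cong₂ _*ᴷ_ e f) (*ᴷ-identityˡ 1ᴷ))

  similar-trans : ∀ {P S W} → Similar P S → Similar S W → Similar P W
  similar-trans {P} {S} {W} p s = record
    { ratio = p.ratio *ᴷ s.ratio ; inv = p.inv *ᴷ s.inv ; inverseʳ = inverse-* p.ratio p.inv s.ratio s.inv p.inverseʳ s.inverseʳ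
    ; scaled = scaled-trans {p.ratio} {s.ratio} {P} {S} {W} p.scaled s.scaled }
    where
    module p = Similar p
    module s = Similar s

  scale-similar : ∀ σ σ′ {P} → σ *ᴷ σ′ ≡ 1ᴷ → Similar (scale-by σ P) P
  scale-similar σ σ′ e = record { ratio = σ ; inv = σ′ ; inverseʳ = e ; scaled = (λ x p → p) , (λ x p → p) }

  normalForm-similar : ∀ {P} (F : NormalForm P) → Similar P (Form (NormalForm.a F) (+ NormalForm.c F))
  normalForm-similar F = record
    { ratio = rational τ ; inv = rational ((1/ τ) {{≢-nonZero τ≢0}})
    ; inverseʳ = trans (sym (rational-* τ ((1/ τ) {{≢-nonZero τ≢0}}))) (cong rational (*-inverseʳ τ {{≢-nonZero τ≢0}})) ; scaled = spans }
    where open NormalForm F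

  root≢0 : rootᴷ ≢ 0ᴷ {q}
  root≢0 ()

  root-inverse : ∃[ x ] rootᴷ {q} *ᴷ x ≡ 1ᴷ
  root-inverse = inverseᴷ rootᴷ root≢0

  code-similar : ∀ {a c m n} (C : Code a c m n) → Similar (Form a c) (scale-by (Code.α⁻¹ C) (Form a c))
  code-similar {a} {c} {m} {n} C = similar-sym (scale-similar α⁻¹ (element m n) α⁻¹-inverse)
    where open Code C

  -- Equal codes mean α⁻¹ L = α₁⁻¹ L₁, so the lattices are proportional with ratio α / α₁ and belong
  -- to the same ideal class.
  sameCode⇒similar : ∀ {a c m n a₁ c₁ m₁ n₁} (C : Code a c m n) (C₁ : Code a₁ c₁ m₁ n₁) → SameCode C C₁ → Similar (Form a c) (Form a₁ c₁)
  sameCode⇒similar {a} {c} {m} {n} {a₁} {c₁} {m₁} {n₁} C C₁ same = record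
    { ratio = element m n *ᴷ C₁.α⁻¹ ; inv = C.α⁻¹ *ᴷ element m₁ n₁
    ; inverseʳ = inverse-* (element m n) C.α⁻¹ C₁.α⁻¹ (element m₁ n₁) (trans (*ᴷ-comm (element m n) C.α⁻¹) C.α⁻¹-inverse) C₁.α⁻¹-inverse
    ; scaled = scaled-trans {element m n} {C₁.α⁻¹} {Form a c} {scale-by C.α⁻¹ (Form a c)} {Form a₁ c₁} (Similar.scaled (code-similar C)) (sameCode⇒≐ C C₁ same) }
    where
    module C = Code C
    module C₁ = Code C₁

  ratio-* : ∀ {a c m n a₁ c₁ m₁ n₁} (C : Code a c m n) (C₁ : Code a₁ c₁ m₁ n₁) (same : SameCode C C₁) →
    Similar.ratio (sameCode⇒similar C C₁ same) *ᴷ element m₁ n₁ ≡ element m n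
  ratio-* {m = m} {n} {m₁ = m₁} {n₁} C C₁ same = trans (*ᴷ-assoc (element m n) (Code.α⁻¹ C₁) (element m₁ n₁))
    (trans (cong (element m n *ᴷ_) (Code.α⁻¹-inverse C₁)) (*ᴷ-identityʳ (element m n)))

  similar⇒∼ : ∀ (I J : FractionalIdeal q) → Similar (ZSpan (expand (FractionalIdeal.generators J))) (ZSpan (expand (FractionalIdeal.generators I))) → I ∼ J
  similar⇒∼ I J s = record { elt = ratio ; inv = inv ; inverseʳ = inverseʳ } , λ y → mk⇔
    (λ y∈J → forward y (proj₁ scaled y (ideal⊆span disc (gens J) y y∈J)))
    (λ { (x , x∈I , e) → span⊆ideal disc (gens J) y (proj₂ scaled y (x , ideal⊆span disc (gens I) x x∈I , e)) })
    where
    open Similar s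
    gens : FractionalIdeal q → _
    gens = FractionalIdeal.generators
    forward : ∀ y → scale-by ratio (ZSpan (expand (gens I))) y → ∃[ x ] x ∈ I × y ≡ ratio *ᴷ x
    forward y (x , x∈ , e) = x , span⊆ideal disc (gens I) x x∈ , e

  module Labelled {h : ℕ} (classNumber : IsClassNumber q h) where

    ideal : Fin h → FractionalIdeal q
    ideal = Bijection.to classNumber

    span : Fin h → K → Set
    span i = ZSpan (expand (FractionalIdeal.generators (ideal i)))

    abstract
      first : ∀ i → NormalForm (span i)
      first i = idealForm (FractionalIdeal.generators (ideal i)) (FractionalIdeal.nonzero (ideal i))

    module First i = NormalForm (first i)

    abstract
      second : ∀ i → NormalForm (scale-by rootᴷ (Form (First.a i) (+ First.c i)))
      second i = scaledForm (First.a i) (+ First.c i) (First.a∣norm i) rootᴷ root≢0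

    module Second i = NormalForm (second i)

    -- `false` selects the lattice of the class itself, `true` the normal form of its multiple by
    -- √q, which lies in the same class.
    latticeA latticeC : Fin h → Bool → ℕ
    latticeA i false = First.a i
    latticeA i true = Second.a i
    latticeC i false = First.c i
    latticeC i true = Second.c i

    latticeA≢0 : ∀ i σ → latticeA i σ ≢ 0
    latticeA≢0 i false = First.a≢0 i
    latticeA≢0 i true = Second.a≢0 i

    latticeA∣norm : ∀ i σ → + latticeA i σ ℤ∣.∣ normω Q (+ latticeC i σ)
    latticeA∣norm i false = First.a∣norm i
    latticeA∣norm i true = Second.a∣norm i

    Lattice : Fin h → Bool → K → Set
    Lattice i σ = Form (latticeA i σ) (+ latticeC i σ)

    lattice-similar : ∀ i σ → Similar (span i) (Lattice i σ)
    lattice-similar i false = normalForm-similar (first i)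
    lattice-similar i true = similar-trans (normalForm-similar (first i)) (similar-trans
      (similar-sym (scale-similar rootᴷ (proj₁ root-inverse) {Lattice i false} (proj₂ root-inverse)))
      (normalForm-similar (second i)))

    similar⇒≡ : ∀ {i j σ σ′} → Similar (Lattice i σ) (Lattice j σ′) → j ≡ i
    similar⇒≡ {i} {j} {σ} {σ′} s = Bijection.injective classNumber (similar⇒∼ (ideal j) (ideal i)
      (similar-trans (lattice-similar i σ) (similar-trans s (similar-sym (lattice-similar j σ′)))))

  -- 2α = z + y√q for α = m + yω
  trace-of : ℤ → ℤ → ℤ
  trace-of m y = + 2 ℤ.* m ℤ.+ y

  private
    double : ∀ m y → ½ * fromℤ (trace-of m y) ≡ fromℤ m + ½ * fromℤ y
    double m y = trans (cong (½ *_) (trans (fromℤ-+ (+ 2 ℤ.* m) y) (cong (_+ fromℤ y) (fromℤ-* (+ 2) m))))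
      (solve 2 (λ m y → con ½ :* (con two :* m :+ y) := m :+ con ½ :* y) refl (fromℤ m) (fromℤ y))

    from-half : ∀ {x y} → ½ * fromℤ x ≡ ½ * fromℤ y → x ≡ y
    from-half {x} {y} e = fromℤ-injective {x} {y} (trans (unhalve (fromℤ x)) (trans (cong (λ t → two * t) e) (sym (unhalve (fromℤ y)))))
      where
      unhalve : ∀ x → x ≡ two * (½ * x)
      unhalve = solve 1 (λ x → x := con two :* (con ½ :* x)) refl

    rationals : ∀ a b c → fromℤ (a ℤ.* b ℤ.+ c) ≡ fromℤ a * fromℤ b + fromℤ c
    rationals a b c = trans (fromℤ-+ (a ℤ.* b) c) (cong (_+ fromℤ c) (fromℤ-* a b))

    rat-part : ∀ T U z y → fromℤ (T ℤ.* z ℤ.+ + q ℤ.* (U ℤ.* y)) ≡ fromℤ T * fromℤ z + D * (fromℤ U * fromℤ y)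
    rat-part T U z y = trans (rationals T z (+ q ℤ.* (U ℤ.* y))) (cong (_+_ (fromℤ T * fromℤ z)) (trans (fromℤ-* (+ q) (U ℤ.* y)) (cong (D *_) (fromℤ-* U y))))

    irr-part : ∀ T U z y → fromℤ (T ℤ.* y ℤ.+ U ℤ.* z) ≡ fromℤ T * fromℤ y + fromℤ U * fromℤ z
    irr-part T U z y = trans (rationals T y (U ℤ.* z)) (cong (_+_ (fromℤ T * fromℤ y)) (fromℤ-* U z))

    halved : ∀ m y → element m y ≡ rational ½ *ᴷ (fromℤ (trace-of m y) + fromℤ y √d)
    halved m y = trans (element≡ m y) (trans (cong (_+ (½ * fromℤ y) √d) (sym (double m y))) (sym (scale ½ (fromℤ (trace-of m y) + fromℤ y √d))))

  -- The integral form of (T + U√q)(z + y√q) = z′ + y′√q, all scaled by ½.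
  coordinates : ∀ T U z y z′ y′ → _*ᴷ_ {q} (fromℤ T + fromℤ U √d) (rational ½ *ᴷ (fromℤ z + fromℤ y √d)) ≡ rational ½ *ᴷ (fromℤ z′ + fromℤ y′ √d) →
    T ℤ.* z ℤ.+ + q ℤ.* (U ℤ.* y) ≡ z′ × T ℤ.* y ℤ.+ U ℤ.* z ≡ y′
  coordinates T U z y z′ y′ e =
    from-half (trans (cong (½ *_) (rat-part T U z y)) (trans (solve 5 (λ D T U z y → con ½ :* (T :* z :+ D :* (U :* y)) := T :* (con ½ :* z) :+ D :* (U :* (con ½ :* y))) refl D (fromℤ T) (fromℤ U) (fromℤ z) (fromℤ y)) (cong rat e′))) ,
    from-half (trans (cong (½ *_) (irr-part T U z y)) (trans (solve 4 (λ T U z y → con ½ :* (T :* y :+ U :* z) := T :* (con ½ :* y) :+ U :* (con ½ :* z)) refl (fromℤ T) (fromℤ U) (fromℤ z) (fromℤ y)) (cong irr e′)))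
    where
    e′ : _*ᴷ_ {q} (fromℤ T + fromℤ U √d) ((½ * fromℤ z) + (½ * fromℤ y) √d) ≡ (½ * fromℤ z′) + (½ * fromℤ y′) √d
    e′ = trans (cong ((fromℤ T + fromℤ U √d) *ᴷ_) (sym (scale ½ (fromℤ z + fromℤ y √d)))) (trans e (scale ½ (fromℤ z′ + fromℤ y′ √d)))

  private
    halve : ∀ {m m′} y → trace-of m y ≡ trace-of m′ y → m ≡ m′
    halve {m} {m′} y e = ℤₚ.*-cancelˡ-≡ (+ 2) m m′ (trans (sym (remove (+ 2 ℤ.* m) y)) (trans (cong (ℤ._- y) e) (remove (+ 2 ℤ.* m′) y)))
      where
      remove : ∀ x y → x ℤ.+ y ℤ.- y ≡ x
      remove = ℤ-ring

    0<q : 0ℤ ℤ.< + q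
    0<q = subst (λ q → 0ℤ ℤ.< + q) (sym (trans q≡ (ℕₚ.+-comm (4 ℕ.* Q) 1))) (ℤ.+<+ (ℕ.s≤s ℕ.z≤n))

  -- The quotient of the points is a unit stabilising the lattice, and it carries one point of the
  -- sector to another. By `same-sector` it is ±1, and the positive second coordinates fix the sign.
  same-lattice : ∀ {a c m₁ n₁ m₂ n₂} → a ≢ 0 → + a ℤ∣.∣ normω Q c → (C₁ : Code a c m₁ n₁) (C₂ : Code a c m₂ n₂) → SameCode C₁ C₂ →
    InSector q (trace-of m₁ n₁) n₁ → InSector q (trace-of m₂ n₂) n₂ → 0ℤ ℤ.< n₁ → 0ℤ ℤ.< n₂ → m₁ ≡ m₂ × n₁ ≡ n₂
  same-lattice {a} {c} {m₁} {n₁} {m₂} {n₂} a≢0 a∣norm C₁ C₂ same sector₁ sector₂ 0<n₁ 0<n₂ =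
    go (stabiliser R Q≡ a c a≢0 a∣norm (Similar.ratio s) (Similar.inv s) (Similar.inverseʳ s) (Similar.scaled s))
    where
    s : Similar (Form a c) (Form a c)
    s = sameCode⇒similar C₁ C₂ same
    go : PellUnit (Similar.ratio s) → m₁ ≡ m₂ × n₁ ≡ n₂
    go u = conclude (same-sector q {T} {U} {v} s²≡1 pell sector₂ sector₁ (proj₁ equations) (proj₂ equations))
      where
      open PellUnit u renaming (s to v)
      equations : T ℤ.* trace-of m₂ n₂ ℤ.+ + q ℤ.* (U ℤ.* n₂) ≡ trace-of m₁ n₁ × T ℤ.* n₂ ℤ.+ U ℤ.* trace-of m₂ n₂ ≡ n₁
      equations = coordinates T U (trace-of m₂ n₂) n₂ (trace-of m₁ n₁) n₁
        (trans (sym (cong₂ _*ᴷ_ η≡ (halved m₂ n₂))) (trans (ratio-* C₁ C₂ same) (halved m₁ n₁)))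
      vanish : ∀ z → z ℤ.+ + q ℤ.* 0ℤ ≡ z
      vanish z = trans (cong (ℤ._+_ z) (ℤₚ.*-zeroʳ (+ q))) (ℤₚ.+-identityʳ z)
      conclude : U ≡ 0ℤ × T ℤ.* T ≡ 1ℤ → m₁ ≡ m₂ × n₁ ≡ n₂
      conclude (U≡0 , T²) = [ T=1 , T=-1 ]′ (square≡1⇒±1 T T²)
        where
        n₁≡ : n₁ ≡ T ℤ.* n₂
        n₁≡ = trans (sym (proj₂ equations)) (trans (cong (λ U → T ℤ.* n₂ ℤ.+ U ℤ.* trace-of m₂ n₂) U≡0) (ℤₚ.+-identityʳ (T ℤ.* n₂)))
        z₁≡ : trace-of m₁ n₁ ≡ T ℤ.* trace-of m₂ n₂
        z₁≡ = trans (sym (proj₁ equations)) (trans (cong (λ U → T ℤ.* trace-of m₂ n₂ ℤ.+ + q ℤ.* (U ℤ.* n₂)) U≡0) (vanish (T ℤ.* trace-of m₂ n₂)))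
        T=1 : T ≡ 1ℤ → m₁ ≡ m₂ × n₁ ≡ n₂
        T=1 T≡1 = halve {m₁} {m₂} n₁ (trans z₁≡ (trans (cong (ℤ._* trace-of m₂ n₂) T≡1) (trans (ℤₚ.*-identityˡ (trace-of m₂ n₂)) (cong (trace-of m₂) (sym n≡))))) , n≡
          where
          n≡ : n₁ ≡ n₂
          n≡ = trans n₁≡ (trans (cong (ℤ._* n₂) T≡1) (ℤₚ.*-identityˡ n₂))
        T=-1 : T ≡ ℤ.-1ℤ → m₁ ≡ m₂ × n₁ ≡ n₂
        T=-1 T≡-1 = contradiction (ℤₚ.<-trans 0<n₁ (subst (ℤ._< 0ℤ) (sym (trans n₁≡ (trans (cong (ℤ._* n₂) T≡-1) (ℤₚ.-1*i≡-i n₂)))) (ℤₚ.neg-mono-< 0<n₂))) (ℤₚ.<-irrefl refl)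

  -- The second lattice is √q L / τ. The quotient of the points times √q / τ stabilises L, so it is
  -- a Pell unit η with η τ x₂ = √q x₁. With τ = P / S and the invariance of the sector under
  -- scaling, `cross-sector` refutes this for P x₂ and S x₁.
  cross-lattice : ∀ {a c m₁ n₁ m₂ n₂} → a ≢ 0 → + a ℤ∣.∣ normω Q c → (F : NormalForm (scale-by rootᴷ (Form a c))) →
    (C₁ : Code a c m₁ n₁) (C₂ : Code (NormalForm.a F) (+ NormalForm.c F) m₂ n₂) → SameCode C₁ C₂ →
    InSector q (trace-of m₁ n₁) n₁ → InSector q (trace-of m₂ n₂) n₂ → ∀ {X : Set} → X
  cross-lattice {a} {c} {m₁} {n₁} {m₂} {n₂} a≢0 a∣norm F C₁ C₂ same sector₁ sector₂ {X} =
    go (stabiliser R Q≡ a c a≢0 a∣norm (Similar.ratio s) (Similar.inv s) (Similar.inverseʳ s) (Similar.scaled s)) (fraction F.τ)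
    where
    module F = NormalForm F
    t : Similar (Form a c) (Form F.a (+ F.c))
    t = sameCode⇒similar C₁ C₂ same
    τ⁻¹ : ℚ
    τ⁻¹ = (1/ F.τ) {{≢-nonZero F.τ≢0}}
    s : Similar (Form a c) (Form a c)
    s = similar-trans t (similar-trans (similar-sym (normalForm-similar F)) (scale-similar rootᴷ (proj₁ root-inverse) (proj₂ root-inverse)))
    fraction : ∀ τ → ∃₂ λ P S → S ≢ 0ℤ × fromℤ P ≡ τ * fromℤ S
    fraction (mkℚ p d c) = p , + suc d , (λ ()) , sym (numerator-denominator p d c)
    go : PellUnit (Similar.ratio s) → (∃₂ λ P S → S ≢ 0ℤ × fromℤ P ≡ F.τ * fromℤ S) → X
    go u (P , S , S≢0 , P≡) = cross-sector q {T} {U} {v} 0<q s²≡1 pell (scale-sector q P P≢0 sector₂) (scale-sector q S S≢0 sector₁) (proj₁ equations) (proj₂ equations)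
      where
      open PellUnit u renaming (s to v)
      P≢0 : P ≢ 0ℤ
      P≢0 refl = F.τ≢0 (p*q≡0⇒p≡0 F.τ (fromℤ S) (λ e → S≢0 (fromℤ-injective {S} {0ℤ} e)) (sym P≡))
      multiple : ∀ k m n → rational (fromℤ k) *ᴷ element m n ≡ rational ½ *ᴷ (fromℤ (k ℤ.* trace-of m n) + fromℤ (k ℤ.* n) √d)
      multiple k m n = trans (cong (rational (fromℤ k) *ᴷ_) (halved m n)) (trans
        (solveᴷ 3 (λ k h x → k ⊗ (h ⊗ x) :≡ h ⊗ (k ⊗ x)) refl (rational (fromℤ k)) (rational ½) (fromℤ (trace-of m n) + fromℤ n √d))
        (cong (rational ½ *ᴷ_) (trans (scale (fromℤ k) (fromℤ (trace-of m n) + fromℤ n √d)) (cong₂ _+_√d (sym (fromℤ-* k (trace-of m n))) (sym (fromℤ-* k n))))))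
      root-* : ∀ x y → rootᴷ {q} *ᴷ (fromℤ x + fromℤ y √d) ≡ fromℤ (+ q ℤ.* y) + fromℤ x √d
      root-* x y = cong₂ _+_√d (trans (solve 3 (λ D x y → con 0ℚ :* x :+ D :* (con 1ℚ :* y) := D :* y) refl D (fromℤ x) (fromℤ y)) (sym (fromℤ-* (+ q) y)))
        (solve 2 (λ x y → con 0ℚ :* y :+ con 1ℚ :* x := x) refl (fromℤ x) (fromℤ y))
      rational-multiple : rational (fromℤ P) ≡ rational F.τ *ᴷ rational (fromℤ S)
      rational-multiple = trans (cong rational P≡) (rational-* F.τ (fromℤ S))
      product : Similar.ratio s *ᴷ (rational (fromℤ P) *ᴷ element m₂ n₂) ≡ rootᴷ *ᴷ (rational (fromℤ S) *ᴷ element m₁ n₁)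
      product = trans (cong (λ p → Similar.ratio s *ᴷ (p *ᴷ element m₂ n₂)) rational-multiple) (trans
        (solveᴷ 6 (λ η i r τ S α → (η ⊗ (i ⊗ r)) ⊗ ((τ ⊗ S) ⊗ α) :≡ (τ ⊗ i) ⊗ (r ⊗ (S ⊗ (η ⊗ α)))) refl
          (Similar.ratio t) (rational τ⁻¹) rootᴷ (rational F.τ) (rational (fromℤ S)) (element m₂ n₂))
        (trans (cong₂ (λ o α → o *ᴷ (rootᴷ *ᴷ (rational (fromℤ S) *ᴷ α))) (Similar.inverseʳ (normalForm-similar F)) (ratio-* C₁ C₂ same))
          (*ᴷ-identityˡ (rootᴷ *ᴷ (rational (fromℤ S) *ᴷ element m₁ n₁)))))
      equations : T ℤ.* (P ℤ.* trace-of m₂ n₂) ℤ.+ + q ℤ.* (U ℤ.* (P ℤ.* n₂)) ≡ + q ℤ.* (S ℤ.* n₁) × T ℤ.* (P ℤ.* n₂) ℤ.+ U ℤ.* (P ℤ.* trace-of m₂ n₂) ≡ S ℤ.* trace-of m₁ n₁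
      equations = coordinates T U (P ℤ.* trace-of m₂ n₂) (P ℤ.* n₂) (+ q ℤ.* (S ℤ.* n₁)) (S ℤ.* trace-of m₁ n₁)
        (trans (sym (cong₂ _*ᴷ_ η≡ (multiple P m₂ n₂))) (trans product (trans (cong (rootᴷ *ᴷ_) (multiple S m₁ n₁))
          (trans (solveᴷ 3 (λ r h x → r ⊗ (h ⊗ x) :≡ h ⊗ (r ⊗ x)) refl rootᴷ (rational ½) (fromℤ (S ℤ.* trace-of m₁ n₁) + fromℤ (S ℤ.* n₁) √d))
            (cong (rational ½ *ᴷ_) (root-* (S ℤ.* trace-of m₁ n₁) (S ℤ.* n₁)))))))

  module _ {h : ℕ} (classNumber : IsClassNumber q h) where

    open Labelled classNumber

    separated : ∀ i σ j σ′ {m₁ n₁ m₂ n₂} (C₁ : Code (latticeA i σ) (+ latticeC i σ) m₁ n₁) (C₂ : Code (latticeA j σ′) (+ latticeC j σ′) m₂ n₂) →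
      SameCode C₁ C₂ → InSector q (trace-of m₁ n₁) n₁ → InSector q (trace-of m₂ n₂) n₂ → 0ℤ ℤ.< n₁ → 0ℤ ℤ.< n₂ →
      (i ≡ j × σ ≡ σ′) × m₁ ≡ m₂ × n₁ ≡ n₂
    separated i σ j σ′ {m₁} {n₁} {m₂} {n₂} C₁ C₂ same s₁ s₂ p₁ p₂ = go σ σ′ (similar⇒≡ {i} {j} {σ} {σ′} (sameCode⇒similar C₁ C₂ same)) C₁ C₂ same
      where
      flip : ∀ {a c a′ c′} (C₁ : Code a c m₁ n₁) (C₂ : Code a′ c′ m₂ n₂) → SameCode C₁ C₂ → SameCode C₂ C₁
      flip C₁ C₂ (p , r , t) = sym p , sym r , sym t
      go : ∀ σ σ′ {j} → j ≡ i → (C₁ : Code (latticeA i σ) (+ latticeC i σ) m₁ n₁) (C₂ : Code (latticeA j σ′) (+ latticeC j σ′) m₂ n₂) →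
        SameCode C₁ C₂ → (i ≡ j × σ ≡ σ′) × m₁ ≡ m₂ × n₁ ≡ n₂
      go false false refl C₁ C₂ same = (refl , refl) , same-lattice (First.a≢0 i) (First.a∣norm i) C₁ C₂ same s₁ s₂ p₁ p₂
      go true true refl C₁ C₂ same = (refl , refl) , same-lattice (Second.a≢0 i) (Second.a∣norm i) C₁ C₂ same s₁ s₂ p₁ p₂
      go false true refl C₁ C₂ same = cross-lattice (First.a≢0 i) (First.a∣norm i) (second i) C₁ C₂ same s₁ s₂
      go true false refl C₁ C₂ same = cross-lattice (First.a≢0 i) (First.a∣norm i) (second i) C₂ C₁ (flip C₁ C₂ same) s₂ s₁

-- Lattice points in wedges

-- `W` is at least g √q and `J` at most g √(q - 1): both are rounded to the side on which the wedges
-- below `J` stay in the sector and their norms stay bounded.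
module Pack (q Q R : ℕ) (q≡ : q ≡ 4 ℕ.* Q ℕ.+ 1) (Q≡ : Q ≡ R ℕ.+ R) (disc : IsRealQuadraticDiscriminant q)
  (sqf : SquareFree4Q+1 Q) {h : ℕ} (classNumber : IsClassNumber q h)
  (g W J : ℕ) {{g≢0 : NonZero g}} (q*g²≤W² : q ℕ.* (g ℕ.* g) ℕ.≤ W ℕ.* W) (J²+g²≤q*g² : J ℕ.* J ℕ.+ g ℕ.* g ℕ.≤ q ℕ.* (g ℕ.* g)) (J<W : J ℕ.< W) where

  open IsRealQuadraticDiscriminant disc using (nonsquare)
  open Maximal q Q q≡ using (element; element≡)
  open Ideal q Q q≡ nonsquare using (K; Form)
  open CodeOf q Q q≡ nonsquare
  open Separate q Q R q≡ Q≡ disc sqf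
  open Labelled classNumber

  Index : Set
  Index = Fin h × Bool × ℕ × ℕ × ℕ

  element≢0 : ∀ m y → element m (+ suc y) ≢ 0ᴷ
  element≢0 m y e = contradiction (fromℤ-injective {+ suc y} {0ℤ} (p*q≡0⇒p≡0 (fromℤ (+ suc y)) ½ (λ ()) (trans (ℚₚ.*-comm (fromℤ (+ suc y)) ½) (trans (sym (cong irr (element≡ m (+ suc y)))) (cong irr e))))) λ ()

  quadruple-norm : ∀ m y → + 4 ℤ.* elementNorm m y ≡ trace-of m y ℤ.* trace-of m y ℤ.- + q ℤ.* (y ℤ.* y)
  quadruple-norm m y = trans (identity m y (+ Q)) (cong (λ t → trace-of m y ℤ.* trace-of m y ℤ.- t ℤ.* (y ℤ.* y)) (sym q≡ℤ))
    where
    q≡ℤ : + q ≡ + 4 ℤ.* + Q ℤ.+ 1ℤ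
    q≡ℤ = trans (cong +_ q≡) (trans (ℤₚ.pos-+ (4 ℕ.* Q) 1) (cong (ℤ._+ 1ℤ) (ℤₚ.pos-* 4 Q)))
    identity : ∀ m y Q → + 4 ℤ.* (m ℤ.* m ℤ.+ m ℤ.* y ℤ.- Q ℤ.* (y ℤ.* y)) ≡ (+ 2 ℤ.* m ℤ.+ y) ℤ.* (+ 2 ℤ.* m ℤ.+ y) ℤ.- (+ 4 ℤ.* Q ℤ.+ 1ℤ) ℤ.* (y ℤ.* y)
    identity = ℤ-ring

  sector⇒norm<0 : ∀ m y → InSector q (trace-of m y) y → elementNorm m y ℤ.< 0ℤ
  sector⇒norm<0 m y (inSector _ z²<) = ℤₚ.*-cancelˡ-<-nonNeg {elementNorm m y} {0ℤ} (+ 4) (begin-strict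
    + 4 ℤ.* elementNorm m y ≡⟨ quadruple-norm m y ⟩
    trace-of m y ℤ.* trace-of m y ℤ.- + q ℤ.* (y ℤ.* y) <⟨ ℤₚ.+-monoˡ-< (ℤ.- (+ q ℤ.* (y ℤ.* y))) z²< ⟩
    (+ q ℤ.- 1ℤ) ℤ.* (y ℤ.* y) ℤ.- + q ℤ.* (y ℤ.* y) ≡⟨ ring (+ q) (y ℤ.* y) ⟩
    ℤ.- (y ℤ.* y) ≤⟨ ℤₚ.neg-mono-≤ (square-nonneg y) ⟩
    + 4 ℤ.* 0ℤ ∎)
    where
    open ℤₚ.≤-Reasoning
    ring : ∀ q s → (q ℤ.- 1ℤ) ℤ.* s ℤ.- q ℤ.* s ≡ ℤ.- s
    ring = ℤ-ring

  abs-bound : ∀ {N x} → N ℤ.≤ 0ℤ → ℤ.- N ℤ.≤ + x → ℤ.∣ N ∣ ℕ.≤ x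
  abs-bound {+ zero} _ _ = z≤n
  abs-bound {+ suc n} (ℤ.+≤+ ()) _
  abs-bound { -[1+ n ]} _ (ℤ.+≤+ h) = h

  module OfLattice (i : Fin h) (σ : Bool) where

    a c : ℕ
    a = latticeA i σ
    c = latticeC i σ

    instance
      a≢0 : NonZero a
      a≢0 = ℕ.≢-nonZero (latticeA≢0 i σ)

    open Point a g c public

    -- Rows are numbered from 0, so the row `y` has second coordinate `suc y`, which is positive.
    m-coordinate : ℕ → ℕ → ℕ → ℤ
    m-coordinate j y k = (start j (suc y) ℤ.+ + k) ℤ.* + a ℤ.+ + suc y ℤ.* + c

    abstract
      codeOf : ∀ j y k → Code a (+ c) (m-coordinate j y k) (+ suc y)
      codeOf j y k = code a (+ c) (latticeA∣norm i σ) (m-coordinate j y k) (+ suc y) (element≢0 (m-coordinate j y k) y)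
        (point∈ a (+ c) (start j (suc y) ℤ.+ + k) (+ suc y))

    sector : ∀ {j y k} → j ℕ.< J → k ℕ.< suc y ℕ/./ E → InSector q (trace-of (m-coordinate j y k) (+ suc y)) (+ suc y)
    sector {j} {y} {k} j<J k< = WedgePoint.wedge-sector q g W J j (suc y) _ _ (scaled-trace j (suc y) k) (proj₁ (in-wedge j (suc y) k k<)) (proj₂ (in-wedge j (suc y) k k<)) j<J J²+g²≤q*g²

    norm-bound : ∀ {j y k M Z} → j ℕ.< J → k ℕ.< suc y ℕ/./ E → y ℕ.< M → (W ∸ j) ℕ.* (W ℕ.+ j) ℕ.* (M ℕ.* M) ℕ.≤ 2 ℕ.* E ℕ.* (g ℕ.* (Z ℕ.* Z)) →
      ℤ.∣ elementNorm (m-coordinate j y k) (+ suc y) ∣ ℕ.≤ a ℕ.* (Z ℕ.* Z)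
    norm-bound {j} {y} {k} {M} {Z} j<J k< y<M DM² = abs-bound (ℤₚ.<⇒≤ (sector⇒norm<0 (m-coordinate j y k) (+ suc y) (sector j<J k<)))
      (WedgePoint.wedge-norm q g W J j (suc y) _ _ (scaled-trace j (suc y) k) (proj₁ (in-wedge j (suc y) k k<)) (proj₂ (in-wedge j (suc y) k k<)) {M} {a ℕ.* (Z ℕ.* Z)} {elementNorm (m-coordinate j y k) (+ suc y)}
        q*g²≤W² (ℕₚ.<⇒≤ (ℕₚ.<-trans j<J J<W)) y<M (subst ((W ∸ j) ℕ.* (W ℕ.+ j) ℕ.* (M ℕ.* M) ℕ.≤_) (ring a g (Z ℕ.* Z)) DM²) (quadruple-norm (m-coordinate j y k) (+ suc y)))
      where
      ring : ∀ a g z → 2 ℕ.* (2 ℕ.* a ℕ.* g) ℕ.* (g ℕ.* z) ≡ 4 ℕ.* (g ℕ.* g) ℕ.* (a ℕ.* z)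
      ring = ℕ-ring

    norm≢0 : ∀ {j y k} → j ℕ.< J → k ℕ.< suc y ℕ/./ E → ℤ.∣ elementNorm (m-coordinate j y k) (+ suc y) ∣ ≢ 0
    norm≢0 {j} {y} {k} j<J k< e = ℤₚ.<⇒≢ (sector⇒norm<0 (m-coordinate j y k) (+ suc y) (sector j<J k<)) (ℤₚ.∣i∣≡0⇒i≡0 e)

    -- The trace determines the wedge, hence the least x in it.
    m-coordinate-injective : ∀ {j k j′ k′ y} → k ℕ.< suc y ℕ/./ E → k′ ℕ.< suc y ℕ/./ E → m-coordinate j y k ≡ m-coordinate j′ y k′ → j ≡ j′ × k ≡ k′
    m-coordinate-injective {j} {k} {j′} {k′} {y} k< k′< e = j≡j′ , k≡k′ j≡j′
      where
      Y : ℕ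
      Y = suc y
      w w′ : ℕ
      w = j ℕ.* Y ℕ.+ (offset j Y ℤ.%ℕ E ℕ.+ E ℕ.* k)
      w′ = j′ ℕ.* Y ℕ.+ (offset j′ Y ℤ.%ℕ E ℕ.+ E ℕ.* k′)
      w≡w′ : w ≡ w′
      w≡w′ = ℤₚ.+-injective (trans (sym (scaled-trace j Y k)) (trans (cong (λ m → + g ℤ.* (+ 2 ℤ.* m ℤ.+ + Y)) e) (scaled-trace j′ Y k′)))
      wedge-≤ : ∀ {i i′ w} → i ℕ.* Y ℕ.≤ w → w ℕ.< suc i′ ℕ.* Y → i ℕ.≤ i′
      wedge-≤ {i} {i′} p r = ℕ.s≤s⁻¹ (ℕₚ.*-cancelʳ-< Y i (suc i′) (ℕₚ.≤-<-trans p r))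
      j≡j′ : j ≡ j′
      j≡j′ = ℕₚ.≤-antisym (wedge-≤ {j} {j′} (proj₁ (in-wedge j Y k k<)) (subst (ℕ._< suc j′ ℕ.* Y) (sym w≡w′) (proj₂ (in-wedge j′ Y k′ k′<))))
        (wedge-≤ {j′} {j} (proj₁ (in-wedge j′ Y k′ k′<)) (subst (ℕ._< suc j ℕ.* Y) w≡w′ (proj₂ (in-wedge j Y k k<))))
      k≡k′ : j ≡ j′ → k ≡ k′
      k≡k′ refl = ℕₚ.*-cancelˡ-≡ k k′ E (ℕₚ.+-cancelˡ-≡ (offset j Y ℤ.%ℕ E) (E ℕ.* k) (E ℕ.* k′) (ℕₚ.+-cancelˡ-≡ (j ℕ.* Y) _ _ w≡w′))

  -- The bounds on j and k belong to the relation because they place the point in the sector, on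
  -- which injectivity rests.
  Encodes : Index → ℕ × ℕ × ℕ → Set
  Encodes (i , σ , j , y , k) code = j ℕ.< J × k ℕ.< suc y ℕ/./ E × (Code.k C , Code.a′ C , Code.c′ C) ≡ code
    where
    open OfLattice i σ
    C : Code a (+ c) (m-coordinate j y k) (+ suc y)
    C = codeOf j y k

  encodes-injective : ∀ {x x′ code} → Encodes x code → Encodes x′ code → x ≡ x′
  encodes-injective {i , σ , j , y , k} {i′ , σ′ , j′ , y′ , k′} (j< , k< , e) (j′< , k′< , e′) =
    go (separated classNumber i σ i′ σ′ (L.codeOf j y k) (L′.codeOf j′ y′ k′)
        (cong proj₁ ee , cong (λ t → proj₁ (proj₂ t)) ee , cong (λ t → proj₂ (proj₂ t)) ee) (L.sector j< k<) (L′.sector j′< k′<) (ℤ.+<+ (s≤s z≤n)) (ℤ.+<+ (s≤s z≤n)))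
    where
    module L = OfLattice i σ
    module L′ = OfLattice i′ σ′
    ee = trans e (sym e′)
    go : (i ≡ i′ × σ ≡ σ′) × L.m-coordinate j y k ≡ L′.m-coordinate j′ y′ k′ × + suc y ≡ + suc y′ → (i , σ , j , y , k) ≡ (i′ , σ′ , j′ , y′ , k′)
    go ((refl , refl) , m≡ , refl) with L.m-coordinate-injective {j} {k} {j′} {k′} {y} k< k′< m≡
    ... | refl , refl = refl

finite-bound : ∀ n (f : Fin n → ℕ) → ∃[ B ] ∀ i → f i ℕ.≤ B
finite-bound zero f = 0 , λ ()
finite-bound (suc n) f with finite-bound n (λ i → f (Fin.suc i))
... | B , h = f Fin.zero ℕ.⊔ B , λ { Fin.zero → ℕₚ.m≤m⊔n (f Fin.zero) B ; (Fin.suc i) → ℕₚ.≤-trans (h i) (ℕₚ.m≤n⊔m (f Fin.zero) B) }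

length-concatMap-≥ : ∀ {A B : Set} (f : A → List B) x → (∀ a → x ≤ fromℤ (+ length (f a))) → ∀ as → fromℤ (+ length as) * x ≤ fromℤ (+ length (concatMap f as))
length-concatMap-≥ f x h [] = ≤-reflexive (*-zeroˡ x)
length-concatMap-≥ f x h (a ∷ as) = begin
  fromℤ (+ suc (length as)) * x ≡⟨ cong (_* x) (fromℤ-+ 1ℤ (+ length as)) ⟩
  (1ℚ + fromℤ (+ length as)) * x ≡⟨ solve 2 (λ n x → (con 1ℚ :+ n) :* x := x :+ n :* x) refl (fromℤ (+ length as)) x ⟩
  x + fromℤ (+ length as) * x ≤⟨ +-mono-≤ (h a) (length-concatMap-≥ f x h as) ⟩
  fromℤ (+ length (f a)) + fromℤ (+ length (concatMap f as)) ≡⟨ fromℤ-+ (+ length (f a)) (+ length (concatMap f as)) ⟨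
  fromℤ (+ (length (f a) ℕ.+ length (concatMap f as))) ≡⟨ cong (λ n → fromℤ (+ n)) (length-++ (f a)) ⟨
  fromℤ (+ length (concatMap f (a ∷ as))) ∎
  where open ≤-Reasoning

-- All wedge points against the list of ideals of norm at most Z²

module Counts (q Q R : ℕ) (q≡ : q ≡ 4 ℕ.* Q ℕ.+ 1) (Q≡ : Q ≡ R ℕ.+ R) (disc : IsRealQuadraticDiscriminant q)
  (sqf : SquareFree4Q+1 Q) {h : ℕ} (classNumber : IsClassNumber q h)
  (g V J : ℕ) {{g≢0 : NonZero g}} (q*g²≤W² : q ℕ.* (g ℕ.* g) ℕ.≤ suc V ℕ.* suc V) (J²+g²≤q*g² : J ℕ.* J ℕ.+ g ℕ.* g ℕ.≤ q ℕ.* (g ℕ.* g)) (J≤V : J ℕ.≤ V) where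

  open Pack q Q R q≡ Q≡ disc sqf classNumber g (suc V) J q*g²≤W² J²+g²≤q*g² (s≤s J≤V)
  open IsRealQuadraticDiscriminant disc using (nonsquare)
  open CodeOf q Q q≡ nonsquare
  open Maximal q Q q≡ using (element)

  determinant : ℕ → ℕ
  determinant j = suc (V ∸ j) ℕ.* suc (V ℕ.+ j)

  determinant≡ : ∀ {j} → j ℕ.≤ V → determinant j ≡ (suc V ∸ j) ℕ.* (suc V ℕ.+ j)
  determinant≡ {j} j≤V = cong (ℕ._* suc (V ℕ.+ j)) (sym (ℕₚ.+-∸-assoc 1 j≤V))

  side : Fin h → Bool → ℕ
  side i σ = E
    where open OfLattice i σ

  module _ (Z : ℕ) {{Z≢0 : NonZero Z}} where

    module At (i : Fin h) (σ : Bool) (j : ℕ) = Count (OfLattice.a i σ) g Z (determinant j) {{OfLattice.a≢0 i σ}} {{g≢0}} {{Z≢0}} {{ℕₚ.m*n≢0 (suc (V ∸ j)) (suc (V ℕ.+ j))}}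

    abstract
      height : Fin h → Bool → ℕ → ℕ
      height = At.M

      height-bound : ∀ i σ j → determinant j ℕ.* (height i σ j ℕ.* height i σ j) ℕ.≤ At.X i σ j
      height-bound = At.M-bound

    cells : Fin h → Bool → ℕ → ℕ
    cells i σ y = suc y ℕ/./ E
      where open OfLattice i σ

    cellList : Fin h → Bool → ℕ → ℕ → List Index
    cellList i σ j y = map (λ k → i , σ , j , y , k) (downFrom (cells i σ y))

    rowList : Fin h → Bool → ℕ → List Index
    rowList i σ j = concatMap (cellList i σ j) (downFrom (height i σ j))

    wedgeList : Fin h → Bool → List Index
    wedgeList i σ = concatMap (rowList i σ) (downFrom J)

    latticeList : Fin h → List Index
    latticeList i = concatMap (wedgeList i) (false ∷ true ∷ [])

    indexList : List Index
    indexList = concatMap latticeList (allFin h)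

    private
      cell∈ : ∀ i σ j y {x} → x ∈ˡ cellList i σ j y → ∃[ k ] k ℕ.< cells i σ y × x ≡ (i , σ , j , y , k)
      cell∈ i σ j y x∈ with ∈-map⁻ (λ k → i , σ , j , y , k) x∈
      ... | k , k∈ , e = k , ∈-downFrom⁻ k∈ , e

      row∈ : ∀ i σ j {x} → x ∈ˡ rowList i σ j → ∃₂ λ y k → y ℕ.< height i σ j × k ℕ.< cells i σ y × x ≡ (i , σ , j , y , k)
      row∈ i σ j x∈ with ∈-concatMap-elim (cellList i σ j) (downFrom (height i σ j)) x∈
      ... | y , y∈ , x∈y with cell∈ i σ j y x∈y
      ... | k , k< , e = y , k , ∈-downFrom⁻ y∈ , k< , e

      InWedge : Fin h → Bool → Index → Set
      InWedge i σ x = ∃[ j ] ∃₂ λ y k → j ℕ.< J × y ℕ.< height i σ j × k ℕ.< cells i σ y × x ≡ (i , σ , j , y , k)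

      wedge∈ : ∀ i σ {x} → x ∈ˡ wedgeList i σ → InWedge i σ x
      wedge∈ i σ x∈ with ∈-concatMap-elim (rowList i σ) (downFrom J) x∈
      ... | j , j∈ , x∈j with row∈ i σ j x∈j
      ... | y , k , y< , k< , e = j , y , k , ∈-downFrom⁻ j∈ , y< , k< , e

      lattice∈ : ∀ i {x} → x ∈ˡ latticeList i → ∃[ σ ] x ∈ˡ wedgeList i σ
      lattice∈ i x∈ with ∈-concatMap-elim (wedgeList i) (false ∷ true ∷ []) x∈
      ... | σ , _ , x∈σ = σ , x∈σ

      fin-tag : Index → Fin h
      fin-tag (i , _) = i
      bool-tag : Index → Bool
      bool-tag (_ , σ , _) = σ
      wedge-tag row-tag : Index → ℕ
      wedge-tag (_ , _ , j , _) = j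
      row-tag (_ , _ , _ , y , _) = y

    private
      tag₁ : ∀ i {x} → (∃[ σ ] x ∈ˡ wedgeList i σ) → fin-tag x ≡ i
      tag₁ i (σ , x∈) = from-equation (wedge∈ i σ x∈)
        where
        from-equation : ∀ {x} → InWedge i σ x → fin-tag x ≡ i
        from-equation (_ , _ , _ , _ , _ , _ , e) = cong fin-tag e
      tag₂ : ∀ i σ {x} → InWedge i σ x → bool-tag x ≡ σ
      tag₂ i σ (_ , _ , _ , _ , _ , _ , e) = cong bool-tag e
      tag₃ : ∀ i σ j {x} → (∃₂ λ y k → y ℕ.< height i σ j × k ℕ.< cells i σ y × x ≡ (i , σ , j , y , k)) → wedge-tag x ≡ j
      tag₃ i σ j (_ , _ , _ , _ , e) = cong wedge-tag e
      tag₄ : ∀ i σ j y {x} → (∃[ k ] k ℕ.< cells i σ y × x ≡ (i , σ , j , y , k)) → row-tag x ≡ y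
      tag₄ i σ j y (_ , _ , e) = cong row-tag e

      cellList-unique : ∀ i σ j y → Unique (cellList i σ j y)
      cellList-unique i σ j y = Unique.map⁺ {f = λ k → i , σ , j , y , k} (λ e → cong (λ x → proj₂ (proj₂ (proj₂ (proj₂ x)))) e) (Unique.downFrom⁺ (cells i σ y))

      rowList-unique : ∀ i σ j → Unique (rowList i σ j)
      rowList-unique i σ j = concatMap-unique (cellList i σ j) row-tag (λ {y} x∈ → tag₄ i σ j y (cell∈ i σ j y x∈))
        (cellList-unique i σ j) {downFrom (height i σ j)} (Unique.downFrom⁺ (height i σ j))

      wedgeList-unique : ∀ i σ → Unique (wedgeList i σ)
      wedgeList-unique i σ = concatMap-unique (rowList i σ) wedge-tag (λ {j} x∈ → tag₃ i σ j (row∈ i σ j x∈))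
        (rowList-unique i σ) {downFrom J} (Unique.downFrom⁺ J)

      latticeList-unique : ∀ i → Unique (latticeList i)
      latticeList-unique i = concatMap-unique (wedgeList i) bool-tag (λ {σ} x∈ → tag₂ i σ (wedge∈ i σ x∈))
        (wedgeList-unique i) {false ∷ true ∷ []} (((λ ()) ∷ []) ∷ [] ∷ [])

    indexList-unique : Unique indexList
    indexList-unique = concatMap-unique latticeList fin-tag (λ {i} x∈ → tag₁ i (lattice∈ i x∈)) latticeList-unique {allFin h} (Unique.allFin⁺ h)

    codeList : List (ℕ × ℕ × ℕ)
    codeList = concatMap (codes Q) (downFrom (Z ℕ.* Z))

    -- The height of the wedge gives |N α| ≤ a Z², and |N α| = a a′ k², so the ideal of the code has
    -- norm a′ k² ≤ Z².
    encodes : ∀ i σ j y k → j ℕ.< J → y ℕ.< height i σ j → k ℕ.< cells i σ y → ∃[ code ] code ∈ˡ codeList × Encodes (i , σ , j , y , k) code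
    encodes i σ j y k j< y< k< = (C.k , C.a′ , C.c′) , listed (C.a′ ℕ.* (C.k ℕ.* C.k)) refl index≢0 index≤ , j< , k< , refl
      where
      open OfLattice i σ
      module C = Code (codeOf j y k)
      index≢0 : C.a′ ℕ.* (C.k ℕ.* C.k) ≢ 0
      index≢0 e = norm≢0 {j} {y} {k} j< k< (trans C.index (trans (cong (a ℕ.*_) e) (ℕₚ.*-zeroʳ a)))
      index≤ : C.a′ ℕ.* (C.k ℕ.* C.k) ℕ.≤ Z ℕ.* Z
      index≤ = ℕₚ.*-cancelˡ-≤ a (subst (ℕ._≤ a ℕ.* (Z ℕ.* Z)) C.index (norm-bound {j} {y} {k} {height i σ j} {Z} j< k< y<
        (subst (λ D → D ℕ.* (height i σ j ℕ.* height i σ j) ℕ.≤ At.X i σ j) (determinant≡ (ℕₚ.≤-trans (ℕₚ.<⇒≤ j<) J≤V)) (height-bound i σ j))))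
      listed : ∀ n → C.a′ ℕ.* (C.k ℕ.* C.k) ≡ n → n ≢ 0 → n ℕ.≤ Z ℕ.* Z → (C.k , C.a′ , C.c′) ∈ˡ codeList
      listed zero _ n≢0 _ = contradiction refl n≢0
      listed (suc n) e _ n< = ∈-concatMap-intro (codes Q) (∈-downFrom⁺ n<) (code∈ Q (sym e) C.c′<a′ C.a′∣norm)

    encoded : ∀ {x} → x ∈ˡ indexList → ∃[ code ] code ∈ˡ codeList × Encodes x code
    encoded {x} x∈ = of-lattice (∈-concatMap-elim latticeList (allFin h) x∈)
      where
      of-wedge : ∀ i σ → InWedge i σ x → ∃[ code ] code ∈ˡ codeList × Encodes x code
      of-wedge i σ (j , y , k , j< , y< , k< , e) = subst (λ x → ∃[ code ] code ∈ˡ codeList × Encodes x code) (sym e) (encodes i σ j y k j< y< k<)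
      of-label : ∀ i → (∃[ σ ] x ∈ˡ wedgeList i σ) → ∃[ code ] code ∈ˡ codeList × Encodes x code
      of-label i (σ , x∈σ) = of-wedge i σ (wedge∈ i σ x∈σ)
      of-lattice : (∃[ i ] i ∈ˡ allFin h × x ∈ˡ latticeList i) → ∃[ code ] code ∈ˡ codeList × Encodes x code
      of-lattice (i , _ , x∈i) = of-label i (lattice∈ i x∈i)

    index≤code : length indexList ℕ.≤ length codeList
    index≤code = pigeonhole Encodes (λ {x} {x′} {y} → encodes-injective {x} {x′} {y}) indexList codeList indexList-unique encoded

    rowsOf : Fin h → Bool → ℕ → ℕ
    rowsOf i σ n = rows E n
      where open OfLattice i σ

    length-rows : ∀ i σ j n → length (concatMap (cellList i σ j) (downFrom n)) ≡ rowsOf i σ n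
    length-rows i σ j zero = refl
    length-rows i σ j (suc n) = trans (length-++ (cellList i σ j n)) (cong₂ ℕ._+_
      (trans (length-map (λ k → i , σ , j , n , k) (downFrom (cells i σ n))) (length-downFrom (cells i σ n))) (length-rows i σ j n))

    abstract
      rowList-count : ∀ i σ j → g ℕ.* (Z ℕ.* Z) ℕ.≤ determinant j ℕ.* (length (rowList i σ j) ℕ.+ 4 ℕ.* (side i σ ℕ.* Z))
      rowList-count i σ j = subst (λ r → g ℕ.* (Z ℕ.* Z) ℕ.≤ determinant j ℕ.* (r ℕ.+ 4 ℕ.* (side i σ ℕ.* Z))) (sym (length-rows i σ j (height i σ j))) (At.count-lower i σ j)

    private
      r : ℕ → ℚ
      r = 1/1+

    -- This is g / (W² - j²) with W = V + 1, the coefficient of Z² in the lower bound for one wedge.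
    -- It is the same for all lattices; a enters only the error.
    wedgeDensity : ℕ → ℚ
    wedgeDensity j = fromℤ (+ g) * (r (V ∸ j) * r (V ℕ.+ j))

    private
      Z²-scale : ∀ j n m → g ℕ.* (Z ℕ.* Z) ℕ.≤ determinant j ℕ.* (n ℕ.+ m) → fromℤ (+ (Z ℕ.* Z)) * wedgeDensity j ≤ fromℤ (+ n) + fromℤ (+ m)
      Z²-scale j n m le = begin
        z * (G * (a * b)) ≡⟨ solve 4 (λ z G a b → z :* (G :* (a :* b)) := (G :* z) :* (a :* b)) refl z G a b ⟩
        G * z * (a * b) ≡⟨ cong (_* (a * b)) (trans (sym (fromℤ-* (+ g) (+ (Z ℕ.* Z)))) (cong fromℤ (sym (ℤₚ.pos-* g (Z ℕ.* Z))))) ⟩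
        fromℤ (+ (g ℕ.* (Z ℕ.* Z))) * (a * b) ≤⟨ *-monoʳ (a * b) (0≤* (0≤1/1+ (V ∸ j)) (0≤1/1+ (V ℕ.+ j))) (fromℤ-mono-≤ (ℤ.+≤+ le)) ⟩
        fromℤ (+ (determinant j ℕ.* (n ℕ.+ m))) * (a * b) ≡⟨ cong (_* (a * b)) (trans (cong fromℤ (ℤₚ.pos-* (determinant j) (n ℕ.+ m))) (trans (fromℤ-* (+ determinant j) (+ (n ℕ.+ m)))
            (cong₂ _*_ (trans (cong fromℤ (ℤₚ.pos-* (suc (V ∸ j)) (suc (V ℕ.+ j)))) (fromℤ-* (+ suc (V ∸ j)) (+ suc (V ℕ.+ j)))) (fromℤ-+ (+ n) (+ m))))) ⟩
        A * B * (N + M) * (a * b) ≡⟨ solve 6 (λ A B N M a b → A :* B :* (N :+ M) :* (a :* b) := (A :* a) :* (B :* b) :* (N :+ M)) refl A B N M a b ⟩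
        (A * a) * (B * b) * (N + M) ≡⟨ cong₂ (λ s t → s * t * (N + M)) (*-1/1+ (V ∸ j)) (*-1/1+ (V ℕ.+ j)) ⟩
        1ℚ * 1ℚ * (N + M) ≡⟨ *-identityˡ (N + M) ⟩
        N + M ∎
        where
        open ≤-Reasoning
        z G a b A B N M : ℚ
        z = fromℤ (+ (Z ℕ.* Z))
        G = fromℤ (+ g)
        a = r (V ∸ j)
        b = r (V ℕ.+ j)
        A = fromℤ (+ suc (V ∸ j))
        B = fromℤ (+ suc (V ℕ.+ j))
        N = fromℤ (+ n)
        M = fromℤ (+ m)

    module _ (B : ℕ) (side≤B : ∀ i σ → side i σ ℕ.≤ B) where

      error : ℚ
      error = fromℤ (+ (4 ℕ.* (B ℕ.* Z)))

      wedgeList-length : ∀ i σ → fromℤ (+ (Z ℕ.* Z)) * ∑ J wedgeDensity - fromℤ (+ J) * error ≤ fromℤ (+ length (wedgeList i σ))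
      wedgeList-length i σ = subst₂ _≤_ refl
        (trans (solve 2 (λ x e → (x :+ e) :- e := x) refl (fromℤ (+ length (wedgeList i σ))) (fromℤ (+ J) * error)) refl)
        (+-monoˡ-≤ (- (fromℤ (+ J) * error)) (begin
          fromℤ (+ (Z ℕ.* Z)) * ∑ J wedgeDensity ≡⟨ ∑-*ˡ J (fromℤ (+ (Z ℕ.* Z))) wedgeDensity ⟩
          ∑ J (λ j → fromℤ (+ (Z ℕ.* Z)) * wedgeDensity j) ≤⟨ ∑-mono J (λ j _ → row j) ⟩
          ∑ J (λ j → fromℤ (+ length (rowList i σ j)) + error) ≡⟨ ∑-+ J (λ j → fromℤ (+ length (rowList i σ j))) (λ _ → error) ⟩
          ∑ J (λ j → fromℤ (+ length (rowList i σ j))) + ∑ J (λ _ → error) ≡⟨ cong₂ _+_ (trans (sym (fromℤ-∑ J (λ j → + length (rowList i σ j)))) (cong fromℤ (sym (length-concatMap-downFrom (rowList i σ) J)))) (∑-const J error) ⟩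
          fromℤ (+ length (wedgeList i σ)) + fromℤ (+ J) * error ∎))
        where
        open ≤-Reasoning
        row : ∀ j → fromℤ (+ (Z ℕ.* Z)) * wedgeDensity j ≤ fromℤ (+ length (rowList i σ j)) + error
        row j = ≤-trans (Z²-scale j (length (rowList i σ j)) (4 ℕ.* (side i σ ℕ.* Z)) (rowList-count i σ j))
          (+-monoʳ-≤ (fromℤ (+ length (rowList i σ j))) (fromℤ-mono-≤ (ℤ.+≤+ (ℕₚ.*-monoʳ-≤ 4 (ℕₚ.*-monoˡ-≤ Z (side≤B i σ))))))

      codeList-length : fromℤ (+ h) * (two * (fromℤ (+ (Z ℕ.* Z)) * ∑ J wedgeDensity - fromℤ (+ J) * error)) ≤ fromℤ (+ length codeList)
      codeList-length = ≤-trans (subst (λ n → fromℤ (+ n) * (two * x) ≤ fromℤ (+ length indexList)) (length-tabulate {n = h} (λ i → i))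
        (length-concatMap-≥ latticeList (two * x) (λ i → length-concatMap-≥ (wedgeList i) x (wedgeList-length i) (false ∷ true ∷ [])) (allFin h)))
        (fromℤ-mono-≤ (ℤ.+≤+ index≤code))
        where
        x : ℚ
        x = fromℤ (+ (Z ℕ.* Z)) * ∑ J wedgeDensity - fromℤ (+ J) * error

  -- There are only 2h lattices, so one constant B makes all row errors linear in Z.
  side-bound : ∃[ B ] ∀ i σ → side i σ ℕ.≤ B
  side-bound = combine (finite-bound h (λ i → side i false)) (finite-bound h (λ i → side i true))
    where
    combine : (∃[ B ] ∀ i → side i false ℕ.≤ B) → (∃[ B ] ∀ i → side i true ℕ.≤ B) → ∃[ B ] ∀ i σ → side i σ ℕ.≤ B
    combine (B , f) (B′ , f′) = B ℕ.⊔ B′ , λ { i false → ℕₚ.≤-trans (f i) (ℕₚ.m≤m⊔n B B′) ; i true → ℕₚ.≤-trans (f′ i) (ℕₚ.m≤n⊔m B B′) }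

-- Comparison of the two counts

-- This is the passage Z → ∞: a positive x would exceed some 1 / (M + 1), and its multiples would
-- outgrow K.
multiples-bounded⇒≤0 : ∀ x K N → (∀ n → N ℕ.≤ n → fromℤ (+ n) * x ≤ fromℤ (+ K)) → x ≤ 0ℚ
multiples-bounded⇒≤0 x K N bounded = ≮⇒≥ (λ 0<x → impossible 0<x (archimedean x 0<x))
  where
  impossible : 0ℚ < x → ¬ (∃[ M ] 1/1+ M ≤ x)
  impossible 0<x (M , 1/M≤x) = <-irrefl refl (<-≤-trans (fromℤ-mono-< {+ K} {+ k} (ℤ.+<+ (ℕₚ.m≤m+n (suc K) N))) (begin
    fromℤ (+ k) ≡⟨ trans (sym (*-identityʳ (fromℤ (+ k)))) (cong (fromℤ (+ k) *_) (sym (*-1/1+ M))) ⟩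
    fromℤ (+ k) * (fromℤ (+ suc M) * 1/1+ M) ≡⟨ solve 3 (λ k m r → k :* (m :* r) := (m :* k) :* r) refl (fromℤ (+ k)) (fromℤ (+ suc M)) (1/1+ M) ⟩
    fromℤ (+ suc M) * fromℤ (+ k) * 1/1+ M ≡⟨ cong (_* 1/1+ M) (trans (sym (fromℤ-* (+ suc M) (+ k))) (cong fromℤ (sym (ℤₚ.pos-* (suc M) k)))) ⟩
    fromℤ (+ n) * 1/1+ M ≤⟨ *-monoˡ (fromℤ (+ n)) (fromℤ-nonneg n) 1/M≤x ⟩
    fromℤ (+ n) * x ≤⟨ bounded n (ℕₚ.≤-trans (ℕₚ.m≤n+m N (suc K)) (ℕₚ.m≤n*m k (suc M))) ⟩
    fromℤ (+ K) ∎))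
    where
    open ≤-Reasoning
    k n : ℕ
    k = suc K ℕ.+ N
    n = suc M ℕ.* k

module _ (R : ℕ) (R≢0 : R ≢ 0) (sqf : SquareFree (odd (halfModulus R R≢0))) where

  private
    P′ Q′ q : ℕ
    P′ = halfModulus R R≢0
    Q′ = quarterModulus R R≢0
    q = odd P′

    character : SplittingCharacter Q′
    character = splittingCharacter R R≢0 sqf

    ψ : ℕ → ℤ
    ψ n = jacobi P′ (+ n)

    sqf′ = squareFreeℤ R R≢0 sqf

    length-quotientCodes : ∀ k {n} (d : Dec (k ℕ.* k ℕ∣.∣ n)) → + length (quotientCodes Q′ k d) ≡ quotientTerm Q′ sqf′ character d
    length-quotientCodes k (yes (ℕ∣.divides t _)) = length-rootCodes Q′ k t
    length-quotientCodes k (no _) = refl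

    length-codes : ∀ n → + length (codes Q′ n) ≡ idealCount Q′ sqf′ character (suc n)
    length-codes n = trans (length-concatMap-downFrom (λ k → quotientCodes Q′ k (k ℕ.* k ℕ∣.∣? suc n)) (suc (suc n)))
      (∑ℤ-cong (suc (suc n)) (λ k _ → length-quotientCodes k (k ℕ.* k ℕ∣.∣? suc n)))

    divisorSums : ∀ Y → ∑ℤ Y (λ n → divisorSum Q′ sqf′ character (suc n)) ≡ ∑ℤ Y (λ j → ψ (suc j) ℤ.* + (Y ℕ./ suc j))
    divisorSums Y = begin
      ∑ℤ Y (λ n → divisorSum Q′ sqf′ character (suc n)) ≡⟨ ∑ℤ-cong Y (λ n n<Y → extended n n<Y) ⟩
      ∑ℤ Y (λ n → ∑ℤ Y (λ j → ⟦ suc j ℕ∣.∣? suc n ⟧ ℤ.* ψ (suc j))) ≡⟨ ∑ℤ-swap Y Y _ ⟩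
      ∑ℤ Y (λ j → ∑ℤ Y (λ n → ⟦ suc j ℕ∣.∣? suc n ⟧ ℤ.* ψ (suc j))) ≡⟨ ∑ℤ-cong Y (λ j _ → trans (sym (∑ℤ-*ʳ Y (ψ (suc j)) (λ n → ⟦ suc j ℕ∣.∣? suc n ⟧)))
          (trans (cong (ℤ._* ψ (suc j)) (count-multiples (suc j) Y)) (ℤₚ.*-comm (+ (Y ℕ./ suc j)) (ψ (suc j))))) ⟩
      ∑ℤ Y (λ j → ψ (suc j) ℤ.* + (Y ℕ./ suc j)) ∎
      where
      open ≡-Reasoning
      extended : ∀ n → n ℕ.< Y → divisorSum Q′ sqf′ character (suc n) ≡ ∑ℤ Y (λ j → ⟦ suc j ℕ∣.∣? suc n ⟧ ℤ.* ψ (suc j))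
      extended n n<Y = trans (sym (divisorSum-extend Q′ sqf′ character {suc n} (λ ()) {suc Y} (s≤s n<Y)))
        (trans (∑ℤ-first Y (λ d → ⟦ d ℕ∣.∣? suc n ⟧ ℤ.* ψ d))
          (trans (cong (λ t → t ℤ.* ψ 0 ℤ.+ ∑ℤ Y (λ j → ⟦ suc j ℕ∣.∣? suc n ⟧ ℤ.* ψ (suc j))) (⟦⟧-no (0 ℕ∣.∣? suc n) (λ d → contradiction (ℕ∣.0∣⇒≡0 d) λ ())))
            (ℤₚ.+-identityˡ (∑ℤ Y (λ j → ⟦ suc j ℕ∣.∣? suc n ⟧ ℤ.* ψ (suc j))))))

    length-codes≤ : ∀ Y → + length (concatMap (codes Q′) (downFrom Y)) ℤ.≤ ∑ℤ Y (λ j → ψ (suc j) ℤ.* + (Y ℕ./ suc j))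
    length-codes≤ Y = begin
      + length (concatMap (codes Q′) (downFrom Y)) ≡⟨ length-concatMap-downFrom (codes Q′) Y ⟩
      ∑ℤ Y (λ n → + length (codes Q′ n)) ≤⟨ ∑ℤ-mono Y (λ n _ → ℤₚ.≤-trans (ℤₚ.≤-reflexive (length-codes n)) (idealCount≤divisorSum Q′ sqf′ character (suc n) λ ())) ⟩
      ∑ℤ Y (λ n → divisorSum Q′ sqf′ character (suc n)) ≡⟨ divisorSums Y ⟩
      ∑ℤ Y (λ j → ψ (suc j) ℤ.* + (Y ℕ./ suc j)) ∎
      where open ℤₚ.≤-Reasoning

    q≡ : q ≡ 4 ℕ.* Q′ ℕ.+ 1
    q≡ = identity R
      where
      identity : ∀ R → suc (((R ℕ.+ R) ℕ.+ (R ℕ.+ R)) ℕ.+ ((R ℕ.+ R) ℕ.+ (R ℕ.+ R))) ≡ 4 ℕ.* (R ℕ.+ R) ℕ.+ 1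
      identity = ℕ-ring

    P≢0 : P′ ≢ 0
    P≢0 e = R≢0 (ℕₚ.m+n≡0⇒m≡0 R (ℕₚ.m+n≡0⇒m≡0 Q′ e))

  density : ℕ → ℕ → ℕ → ℚ
  density g V j = fromℤ (+ g) * (1/1+ (V ∸ j) * 1/1+ (V ℕ.+ j))

  module _ (m : ℕ) (q≤N² : q ℕ.≤ suc m ℕ.* suc m) where

    private
      even = ε-double Q′
      modulus′ = modulus R R≢0 sqf
      open Character ψ q m (λ n → -1≤ψ P′ P≢0 even modulus′ (+ n)) (charSum≤ P′ P≢0 even modulus′)
        (charSum≤q P′ P≢0 even modulus′) (-q≤charSum P′ P≢0 even modulus′) (pólya-vinogradov P′ P≢0 even modulus′ (suc m) q≤N²)

      upper : ∀ l → let Z = m ℕ.+ l in fromℤ (+ length (concatMap (codes Q′) (downFrom (Z ℕ.* Z)))) ≤ fromℤ (+ (Z ℕ.* Z)) * Λ m + fromℤ (+ (3 ℕ.* q ℕ.+ 1)) * fromℤ (+ Z)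
      upper l = ≤-trans (fromℤ-mono-≤ (length-codes≤ (Z ℕ.* Z))) (≤-trans (≤-reflexive
        (trans (fromℤ-∑ (Z ℕ.* Z) (λ j → ψ (suc j) ℤ.* + ((Z ℕ.* Z) ℕ./ suc j))) (∑-cong (Z ℕ.* Z) (λ j _ → fromℤ-* (ψ (suc j)) (+ ((Z ℕ.* Z) ℕ./ suc j)))))) (hyperbola l))
        where
        Z : ℕ
        Z = m ℕ.+ l

    -- With Z = n the two counts give Z² (2 h σ - Λ) ≤ K Z for every n > m; after division by Z,
    -- `multiples-bounded⇒≤0` applies.
    class-number-bound : ∀ {d h} → d ≡ q → IsRealQuadraticDiscriminant d → IsClassNumber d h → ∀ g V J {{_ : NonZero g}} →
      d ℕ.* (g ℕ.* g) ℕ.≤ suc V ℕ.* suc V → J ℕ.* J ℕ.+ g ℕ.* g ℕ.≤ d ℕ.* (g ℕ.* g) → J ℕ.≤ V →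
      fromℤ (+ h) * (two * ∑ J (density g V)) ≤ Λ m
    class-number-bound {_} {h} refl disc classNumber g V J q*g²≤W² J²+g²≤q*g² J≤V = conclude side-bound
      where
      open Counts q Q′ R q≡ refl disc sqf′ classNumber g V J q*g²≤W² J²+g²≤q*g² J≤V
      η σ : ℚ
      η = fromℤ (+ h)
      σ = ∑ J (density g V)
      conclude : (∃[ B ] ∀ i τ → side i τ ℕ.≤ B) → η * (two * σ) ≤ Λ m
      conclude (B , side≤B) = subst₂ _≤_ (solve 2 (λ x l → (x :- l) :+ l := x) refl (η * (two * σ)) (Λ m)) (+-identityˡ (Λ m))
        (+-monoˡ-≤ (Λ m) (multiples-bounded⇒≤0 (η * (two * σ) - Λ m) K (suc m) bounded))
        where
        -- All terms linear in Z: 3q + 1 from the hyperbola argument, and the errors 4 B Z over the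
        -- J wedges of 2h lattices.
        c K : ℕ
        c = 4 ℕ.* B
        K = 3 ℕ.* q ℕ.+ 1 ℕ.+ h ℕ.* (2 ℕ.* (J ℕ.* c))
        bounded : ∀ n → suc m ℕ.≤ n → fromℤ (+ n) * (η * (two * σ) - Λ m) ≤ fromℤ (+ K)
        bounded n@(suc n-1) (s≤s m≤n) = *-cancelˡ-≤-pos (fromℤ (+ n)) {{positive (fromℤ-mono-< {0ℤ} {+ n} (ℤ.+<+ (s≤s z≤n)))}} (begin
          z * (z * (η * (two * σ) - Λ m))
            ≡⟨ solve 6 (λ z η σ L e t → z :* (z :* (η :* (t :* σ) :- L)) := (η :* (t :* (z :* z :* σ :- e)) :- z :* z :* L) :+ η :* (t :* e)) refl z η σ (Λ m) (fromℤ (+ J) * E) two ⟩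
          (η * (two * (z * z * σ - fromℤ (+ J) * E)) - z * z * Λ m) + η * (two * (fromℤ (+ J) * E))
            ≤⟨ +-monoˡ-≤ (η * (two * (fromℤ (+ J) * E))) (+-monoˡ-≤ (- (z * z * Λ m)) lower≤upper) ⟩
          ((z * z * Λ m + Cq * z) - z * z * Λ m) + η * (two * (fromℤ (+ J) * E))
            ≡⟨ solve 6 (λ a b η t J e → ((a :+ b) :- a) :+ η :* (t :* (J :* e)) := b :+ η :* (t :* (J :* e))) refl (z * z * Λ m) (Cq * z) η two (fromℤ (+ J)) E ⟩
          Cq * z + η * (two * (fromℤ (+ J) * E))
            ≡⟨ cong (λ e → Cq * z + η * (two * (fromℤ (+ J) * e))) E≡ ⟩
          Cq * z + η * (two * (fromℤ (+ J) * (fromℤ (+ c) * z)))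
            ≡⟨ solve 6 (λ p z η t J c → p :* z :+ η :* (t :* (J :* (c :* z))) := z :* (p :+ η :* (t :* (J :* c)))) refl Cq z η two (fromℤ (+ J)) (fromℤ (+ c)) ⟩
          z * (Cq + η * (two * (fromℤ (+ J) * fromℤ (+ c))))
            ≡⟨ cong (z *_) K≡ ⟨
          z * fromℤ (+ K) ∎)
          where
          open ≤-Reasoning
          z E Cq : ℚ
          z = fromℤ (+ n)
          E = fromℤ (+ (4 ℕ.* (B ℕ.* n)))
          Cq = fromℤ (+ (3 ℕ.* q ℕ.+ 1))
          z² : fromℤ (+ (n ℕ.* n)) ≡ z * z
          z² = fromℤ-pos-* n n
          E≡ : E ≡ fromℤ (+ c) * z
          E≡ = trans (cong (λ t → fromℤ (+ t)) (sym (ℕₚ.*-assoc 4 B n))) (fromℤ-pos-* c n)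
          K≡ : fromℤ (+ K) ≡ Cq + η * (two * (fromℤ (+ J) * fromℤ (+ c)))
          K≡ = trans (fromℤ-+ (+ (3 ℕ.* q ℕ.+ 1)) (+ (h ℕ.* (2 ℕ.* (J ℕ.* c))))) (cong (_+_ Cq) (trans (cong fromℤ (ℤₚ.pos-* h (2 ℕ.* (J ℕ.* c)))) (trans (fromℤ-* (+ h) (+ (2 ℕ.* (J ℕ.* c))))
            (cong (η *_) (trans (cong fromℤ (ℤₚ.pos-* 2 (J ℕ.* c))) (trans (fromℤ-* (+ 2) (+ (J ℕ.* c))) (cong (two *_) (fromℤ-pos-* J c))))))))
          lower≤upper : η * (two * (z * z * σ - fromℤ (+ J) * E)) ≤ z * z * Λ m + Cq * z
          lower≤upper = subst (λ y → η * (two * (y * σ - fromℤ (+ J) * E)) ≤ y * Λ m + Cq * z) z²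
            (≤-trans (codeList-length n B side≤B) (subst (λ t → fromℤ (+ length (concatMap (codes Q′) (downFrom (t ℕ.* t)))) ≤ fromℤ (+ (t ℕ.* t)) * Λ m + Cq * fromℤ (+ t))
              (ℕₚ.m+[n∸m]≡n (ℕₚ.m≤n⇒m≤1+n m≤n)) (upper (n ∸ m))))

-- Numerical estimates

H-nonneg : ∀ a l → 0ℚ ≤ H a l
H-nonneg a l = ∑-nonneg l (λ i _ → 0≤1/1+ (a ℕ.+ i))

H-⊆ : ∀ {a b l l′} → a ℕ.≤ b → b ℕ.+ l′ ℕ.≤ a ℕ.+ l → H b l′ ≤ H a l
H-⊆ {a} {b} {l} {l′} a≤b b+l′≤a+l = subst₂ (λ b l → H b l′ ≤ H a l) (ℕₚ.m+[n∸m]≡n a≤b) l≡ (begin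
  H (a ℕ.+ d) l′ ≤⟨ p≤p+q (H (a ℕ.+ d) l′) (H-nonneg (a ℕ.+ d ℕ.+ l′) e) ⟩
  H (a ℕ.+ d) l′ + H (a ℕ.+ d ℕ.+ l′) e ≡⟨ H-split (a ℕ.+ d) l′ e ⟨
  H (a ℕ.+ d) (l′ ℕ.+ e) ≤⟨ p≤p+q (H (a ℕ.+ d) (l′ ℕ.+ e)) (H-nonneg a d) ⟩
  H (a ℕ.+ d) (l′ ℕ.+ e) + H a d ≡⟨ +-comm (H (a ℕ.+ d) (l′ ℕ.+ e)) (H a d) ⟩
  H a d + H (a ℕ.+ d) (l′ ℕ.+ e) ≡⟨ H-split a d (l′ ℕ.+ e) ⟨
  H a (d ℕ.+ (l′ ℕ.+ e)) ∎)
  where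
  open ≤-Reasoning
  d e : ℕ
  d = b ∸ a
  e = (a ℕ.+ l) ∸ (b ℕ.+ l′)
  l≡ : d ℕ.+ (l′ ℕ.+ e) ≡ l
  l≡ = ℕₚ.+-cancelˡ-≡ a (d ℕ.+ (l′ ℕ.+ e)) l (trans (sym (ℕₚ.+-assoc a d (l′ ℕ.+ e))) (trans (cong (ℕ._+ (l′ ℕ.+ e)) (ℕₚ.m+[n∸m]≡n a≤b))
    (trans (sym (ℕₚ.+-assoc b l′ e)) (ℕₚ.m+[n∸m]≡n b+l′≤a+l))))

-- `c₁` is a lower bound for 1/5 + ... + 1/14, which approximates log(7/2) from below. `κ₂` is 2
-- (1/2 + 1/3 + 1/4) + 1 + 3/5 - 2 · 1.3405, rounded up, where 1.3405 bounds log 4 from below.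
c₁ κ₂ : ℚ
c₁ = + 1168 / 1000
κ₂ = + 1086 / 1000

c₁≤ : c₁ ≤ H 4 10
c₁≤ = from-yes (c₁ ≤? H 4 10)

private
  log4 : + 13405 / 10000 ≤ H 8 24
  log4 = from-yes ((+ 13405 / 10000) ≤? H 8 24)

-- Refining the step increases these Riemann sums, and 1/2 + ... + 1/17 already exceeds 2.
log-seq≥2 : ∀ q k → 17 ℕ.≤ q → two ≤ log-seq q k
log-seq≥2 (suc q) k (s≤s 16≤q) = ≤-trans (from-yes (two ≤? H 1 16)) (≤-trans (H-⊆ {1} {1} {q} {16} ℕₚ.≤-refl (s≤s 16≤q))
  (subst (λ t → H 1 q ≤ H t (q ℕ.* suc k)) (ℕₚ.+-identityʳ (suc k)) (refine-≥ 1 q k)))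

-- The interval from A to B is cut at q A; the part beyond has ratio at least 7/2.
H-lower : ∀ q-1 A-1 l → let q = suc q-1 ; A = suc A-1 in 7 ℕ.* (q ℕ.* A ℕ.+ 3) ℕ.≤ 2 ℕ.* (A ℕ.+ l) → log-seq q A-1 + c₁ ≤ H A l
H-lower q-1 A-1 l large = begin
  log-seq q A-1 + c₁ ≤⟨ +-monoʳ-≤ (log-seq q A-1) (≤-trans c₁≤ (refine-≥ 4 10 c)) ⟩
  H A (q-1 ℕ.* A) + H (4 ℕ.* suc c) (10 ℕ.* suc c) ≤⟨ +-monoʳ-≤ (H A (q-1 ℕ.* A)) (H-⊆ {A ℕ.+ q-1 ℕ.* A} {4 ℕ.* suc c} {l ∸ q-1 ℕ.* A} start-≤ end-≤) ⟩
  H A (q-1 ℕ.* A) + H (A ℕ.+ q-1 ℕ.* A) (l ∸ q-1 ℕ.* A) ≡⟨ H-split A (q-1 ℕ.* A) (l ∸ q-1 ℕ.* A) ⟨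
  H A (q-1 ℕ.* A ℕ.+ (l ∸ q-1 ℕ.* A)) ≡⟨ cong (H A) (ℕₚ.m+[n∸m]≡n fits) ⟩
  H A l ∎
  where
  open ≤-Reasoning
  q A x c : ℕ
  q = suc q-1
  A = suc A-1
  x = q ℕ.* A
  -- `suc c` is x / 4 rounded up, so the sum over 1/5, ..., 1/14 can be refined to run from 4
  -- `suc c` ≥ x to 14 `suc c`; from 4 `suc c` ≤ x + 3 and `large` the latter is at most A + l.
  c = pred ((x ℕ.+ 3) ℕ./ 4)
  suc-c : suc c ≡ (x ℕ.+ 3) ℕ./ 4
  suc-c = ℕₚ.suc-pred ((x ℕ.+ 3) ℕ./ 4) {{ℕ.>-nonZero (ℕ/.m≥n⇒m/n>0 {x ℕ.+ 3} {4} (ℕₚ.+-monoˡ-≤ 3 {1} {x} (s≤s z≤n)))}}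
  upper : 4 ℕ.* suc c ℕ.≤ x ℕ.+ 3
  upper = subst (λ t → 4 ℕ.* t ℕ.≤ x ℕ.+ 3) (sym suc-c) (subst (ℕ._≤ x ℕ.+ 3) (ℕₚ.*-comm ((x ℕ.+ 3) ℕ./ 4) 4) (ℕ/.m/n*n≤m (x ℕ.+ 3) 4))
  start-≤ : x ℕ.≤ 4 ℕ.* suc c
  start-≤ = subst (λ t → x ℕ.≤ 4 ℕ.* t) (sym suc-c) (ℕₚ.+-cancelˡ-≤ 3 x (4 ℕ.* ((x ℕ.+ 3) ℕ./ 4)) (subst₂ ℕ._≤_
    (trans (sym (ℕ/.m≡m%n+[m/n]*n (x ℕ.+ 3) 4)) (ℕₚ.+-comm x 3)) (cong (3 ℕ.+_) (ℕₚ.*-comm ((x ℕ.+ 3) ℕ./ 4) 4))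
    (ℕₚ.+-monoˡ-≤ ((x ℕ.+ 3) ℕ./ 4 ℕ.* 4) (ℕ.s≤s⁻¹ (ℕ/.m%n<n (x ℕ.+ 3) 4)))))
  end : 4 ℕ.* suc c ℕ.+ 10 ℕ.* suc c ℕ.≤ A ℕ.+ l
  end = ℕₚ.*-cancelˡ-≤ 2 (ℕₚ.≤-trans (ℕₚ.≤-reflexive (identity (suc c))) (ℕₚ.≤-trans (ℕₚ.*-monoʳ-≤ 7 upper) large))
    where
    identity : ∀ s → 2 ℕ.* (4 ℕ.* s ℕ.+ 10 ℕ.* s) ≡ 7 ℕ.* (4 ℕ.* s)
    identity = ℕ-ring
  fits : q-1 ℕ.* A ℕ.≤ l
  fits = ℕₚ.+-cancelˡ-≤ A (q-1 ℕ.* A) l (ℕₚ.≤-trans start-≤ (ℕₚ.≤-trans (ℕₚ.m≤m+n (4 ℕ.* suc c) (10 ℕ.* suc c)) end))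
  end-≤ : 4 ℕ.* suc c ℕ.+ 10 ℕ.* suc c ℕ.≤ (A ℕ.+ q-1 ℕ.* A) ℕ.+ (l ∸ q-1 ℕ.* A)
  end-≤ = ℕₚ.≤-trans end (ℕₚ.≤-reflexive (sym (trans (ℕₚ.+-assoc A (q-1 ℕ.* A) (l ∸ q-1 ℕ.* A)) (cong (A ℕ.+_) (ℕₚ.m+[n∸m]≡n fits)))))

-- H 1 m is split into 1/2 + 1/3 + 1/4, the terms 1/5, ..., 1/m, and 1/(m + 1). The middle terms and
-- log 4 together are at most log m, and 2 log m ≤ log q because m² ≤ q.
Λ-upper : ∀ q-1 d k → let q = suc q-1 ; m = 4 ℕ.+ d in m ℕ.* m ℕ.≤ q → two * Λ m ≤ log-seq q k + κ₂ + two * 1/1+ k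
Λ-upper q-1 d k m²≤q = begin
  two * Λ m ≡⟨ trans (solve 3 (λ x t r → con two :* (x :+ con 1ℚ :- con ½ :* (t :* r)) := con two :* x :+ con two :- t :* r) refl (H 1 m) (fromℤ (+ m)) (1/1+ m)) (cong₂ (λ x y → two * x + two - y) H≡ m*r) ⟩
  two * (H 1 3 + H 4 d + 1/1+ m) + two - (1ℚ - 1/1+ m) ≡⟨ solve 3 (λ a x r → con two :* (a :+ x :+ r) :+ con two :- (con 1ℚ :- r) := (con two :* a :+ con 1ℚ) :+ con (fromℤ (+ 3)) :* r :+ con two :* x) refl (H 1 3) (H 4 d) (1/1+ m) ⟩
  (two * H 1 3 + 1ℚ) + fromℤ (+ 3) * 1/1+ m + two * H 4 d ≤⟨ +-monoˡ-≤ (two * H 4 d) (+-monoʳ-≤ (two * H 1 3 + 1ℚ) (*-monoˡ (fromℤ (+ 3)) (fromℤ-nonneg 3) (1/1+-antitone {4} {m} (s≤s (s≤s (s≤s (s≤s z≤n))))))) ⟩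
  (two * H 1 3 + 1ℚ) + fromℤ (+ 3) * 1/1+ 4 + two * H 4 d ≤⟨ +-monoˡ-≤ (two * H 4 d) (from-yes (((two * H 1 3 + 1ℚ) + fromℤ (+ 3) * 1/1+ 4) ≤? (κ₂ + two * (+ 13405 / 10000)))) ⟩
  κ₂ + two * (+ 13405 / 10000) + two * H 4 d ≡⟨ solve 3 (λ κ y x → κ :+ con two :* y :+ con two :* x := κ :+ con two :* (y :+ x)) refl κ₂ (+ 13405 / 10000) (H 4 d) ⟩
  κ₂ + two * (+ 13405 / 10000 + H 4 d) ≤⟨ +-monoʳ-≤ κ₂ (*-monoˡ two (fromℤ-nonneg 2) log-m) ⟩
  κ₂ + two * (H K (m-1 ℕ.* K) + 1/1+ k) ≡⟨ solve 3 (λ κ y r → κ :+ con two :* (y :+ r) := con two :* y :+ κ :+ con two :* r) refl κ₂ (H K (m-1 ℕ.* K)) (1/1+ k) ⟩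
  two * H K (m-1 ℕ.* K) + κ₂ + two * 1/1+ k ≤⟨ +-monoˡ-≤ (two * 1/1+ k) (+-monoˡ-≤ κ₂ double) ⟩
  log-seq (suc q-1) k + κ₂ + two * 1/1+ k ∎
  where
  open ≤-Reasoning
  m-1 m K : ℕ
  m-1 = suc (suc (suc d))
  m = suc m-1
  K = suc k
  H≡ : H 1 m ≡ H 1 3 + H 4 d + 1/1+ m
  H≡ = cong (_+ 1/1+ m) (H-split 1 3 d)
  m*r : fromℤ (+ m) * 1/1+ m ≡ 1ℚ - 1/1+ m
  m*r = trans (solve 2 (λ t r → t :* r := (con 1ℚ :+ t) :* r :- r) refl (fromℤ (+ m)) (1/1+ m)) (cong (_- 1/1+ m) (trans (cong (_* 1/1+ m) (sym (fromℤ-+ 1ℤ (+ m)))) (*-1/1+ m)))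
  log-m : + 13405 / 10000 + H 4 d ≤ H K (m-1 ℕ.* K) + 1/1+ k
  log-m = begin
    + 13405 / 10000 + H 4 d ≤⟨ +-mono-≤ (≤-trans log4 (log-close 4 7 k)) (refine-≥ 4 d k) ⟩
    (H K (3 ℕ.* K) + 1/1+ k) + H (4 ℕ.* K) (d ℕ.* K) ≡⟨ solve 3 (λ a r b → (a :+ r) :+ b := (a :+ b) :+ r) refl (H K (3 ℕ.* K)) (1/1+ k) (H (4 ℕ.* K) (d ℕ.* K)) ⟩
    (H K (3 ℕ.* K) + H (4 ℕ.* K) (d ℕ.* K)) + 1/1+ k ≡⟨ cong (_+ 1/1+ k) (trans (sym (H-split K (3 ℕ.* K) (d ℕ.* K))) (cong (H K) (sym (ℕₚ.*-distribʳ-+ K 3 d)))) ⟩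
    H K (m-1 ℕ.* K) + 1/1+ k ∎
  -- The second copy of the sum is refined by the factor m, so that it starts at m K, where the
  -- first copy ends: log m + log m ≤ log(m²).
  double : two * H K (m-1 ℕ.* K) ≤ H K (q-1 ℕ.* K)
  double = begin
    two * H K (m-1 ℕ.* K) ≡⟨ solve 1 (λ x → con two :* x := x :+ x) refl (H K (m-1 ℕ.* K)) ⟩
    H K (m-1 ℕ.* K) + H K (m-1 ℕ.* K) ≤⟨ +-monoʳ-≤ (H K (m-1 ℕ.* K)) (refine-≥ K (m-1 ℕ.* K) m-1) ⟩
    H K (m-1 ℕ.* K) + H (K ℕ.* m) (m-1 ℕ.* K ℕ.* m) ≡⟨ cong (λ t → H K (m-1 ℕ.* K) + H t (m-1 ℕ.* K ℕ.* m)) (ℕₚ.*-comm K m) ⟩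
    H K (m-1 ℕ.* K) + H (K ℕ.+ m-1 ℕ.* K) (m-1 ℕ.* K ℕ.* m) ≡⟨ H-split K (m-1 ℕ.* K) (m-1 ℕ.* K ℕ.* m) ⟨
    H K (m-1 ℕ.* K ℕ.+ m-1 ℕ.* K ℕ.* m) ≤⟨ H-⊆ {K} {K} {q-1 ℕ.* K} {m-1 ℕ.* K ℕ.+ m-1 ℕ.* K ℕ.* m} ℕₚ.≤-refl (ℕₚ.+-monoʳ-≤ K (subst (ℕ._≤ q-1 ℕ.* K) (identity m-1 K) (ℕₚ.*-monoˡ-≤ K squares))) ⟩
    H K (q-1 ℕ.* K) ∎
    where
    squares : m-1 ℕ.+ m-1 ℕ.* m ℕ.≤ q-1
    squares = ℕ.s≤s⁻¹ m²≤q
    identity : ∀ m-1 K → (m-1 ℕ.+ m-1 ℕ.* suc m-1) ℕ.* K ≡ m-1 ℕ.* K ℕ.+ m-1 ℕ.* K ℕ.* suc m-1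
    identity = ℕ-ring

-- Partial fractions: 1/((W − j)(W + j)) = (1/(W − j) + 1/(W + j))/(2W) with W = V + 1.
density-sum : ∀ g V J → J ℕ.≤ V → fromℤ (+ g) * 1/1+ V * H (suc V ∸ J) (J ℕ.+ J) ≤ two * ∑ J (λ j → fromℤ (+ g) * (1/1+ (V ∸ j) * 1/1+ (V ℕ.+ j)))
density-sum g V J J≤V = begin
  G * r * H (suc V ∸ J) (J ℕ.+ J) ≤⟨ *-monoˡ (G * r) (0≤* (fromℤ-nonneg g) (0≤1/1+ V)) (≤-trans (≤-reflexive halves) (+-monoʳ-≤ (H (suc V ∸ J) J) (H-shift-≤ J))) ⟩
  G * r * (H (suc V ∸ J) J + H V J) ≡⟨ cong (λ t → G * r * (t + H V J)) (reverse J J≤V) ⟩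
  G * r * (∑ J (λ j → 1/1+ (V ∸ j)) + H V J) ≡⟨ cong (G * r *_) (sym (∑-+ J (λ j → 1/1+ (V ∸ j)) (λ j → 1/1+ (V ℕ.+ j)))) ⟩
  G * r * ∑ J (λ j → 1/1+ (V ∸ j) + 1/1+ (V ℕ.+ j)) ≡⟨ ∑-*ˡ J (G * r) (λ j → 1/1+ (V ∸ j) + 1/1+ (V ℕ.+ j)) ⟩
  ∑ J (λ j → G * r * (1/1+ (V ∸ j) + 1/1+ (V ℕ.+ j))) ≡⟨ ∑-cong J (λ j j<J → term j (ℕₚ.≤-trans (ℕₚ.<⇒≤ j<J) J≤V)) ⟩
  ∑ J (λ j → two * (G * (1/1+ (V ∸ j) * 1/1+ (V ℕ.+ j)))) ≡⟨ ∑-*ˡ J two (λ j → G * (1/1+ (V ∸ j) * 1/1+ (V ℕ.+ j))) ⟨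
  two * ∑ J (λ j → G * (1/1+ (V ∸ j) * 1/1+ (V ℕ.+ j))) ∎
  where
  open ≤-Reasoning
  G r : ℚ
  G = fromℤ (+ g)
  r = 1/1+ V
  halves : H (suc V ∸ J) (J ℕ.+ J) ≡ H (suc V ∸ J) J + H (suc V) J
  halves = trans (H-split (suc V ∸ J) J J) (cong (λ t → H (suc V ∸ J) J + H t J) (ℕₚ.m∸n+n≡m (ℕₚ.m≤n⇒m≤1+n J≤V)))
  H-shift-≤ : ∀ J → H (suc V) J ≤ H V J
  H-shift-≤ J = ∑-mono J (λ i _ → 1/1+-antitone (ℕₚ.n≤1+n (V ℕ.+ i)))
  reverse : ∀ J → J ℕ.≤ V → H (suc V ∸ J) J ≡ ∑ J (λ j → 1/1+ (V ∸ j))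
  reverse zero _ = refl
  reverse (suc J) J<V = trans (H-shift (V ∸ J) J) (trans (+-comm (1/1+ (V ∸ J)) (H (suc (V ∸ J)) J))
    (cong (_+ 1/1+ (V ∸ J)) (trans (cong (λ t → H t J) (sym (ℕₚ.+-∸-assoc 1 (ℕₚ.<⇒≤ J<V)))) (reverse J (ℕₚ.<⇒≤ J<V)))))
  term : ∀ j → j ℕ.≤ V → G * r * (1/1+ (V ∸ j) + 1/1+ (V ℕ.+ j)) ≡ two * (G * (1/1+ (V ∸ j) * 1/1+ (V ℕ.+ j)))
  term j j≤V = trans (cong (G * r *_) fractions) (trans (solve 4 (λ G r w p → G :* r :* (con two :* w :* p) := (w :* r) :* (con two :* (G :* p))) refl G r W (a * b))
    (trans (cong (_* (two * (G * (a * b)))) (*-1/1+ V)) (*-identityˡ (two * (G * (a * b))))))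
    where
    a b A B W : ℚ
    a = 1/1+ (V ∸ j)
    b = 1/1+ (V ℕ.+ j)
    A = fromℤ (+ suc (V ∸ j))
    B = fromℤ (+ suc (V ℕ.+ j))
    W = fromℤ (+ suc V)
    A+B : A + B ≡ two * W
    A+B = trans (sym (fromℤ-+ (+ suc (V ∸ j)) (+ suc (V ℕ.+ j)))) (trans (cong (λ t → fromℤ (+ t)) total) (fromℤ-pos-* 2 (suc V)))
      where
      total : suc (V ∸ j) ℕ.+ suc (V ℕ.+ j) ≡ 2 ℕ.* suc V
      total = trans (shuffle (V ∸ j) V j) (trans (cong (λ t → suc t ℕ.+ suc V) (ℕₚ.m∸n+n≡m j≤V)) (double V))
        where
        shuffle : ∀ d V j → suc d ℕ.+ suc (V ℕ.+ j) ≡ suc (d ℕ.+ j) ℕ.+ suc V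
        shuffle = ℕ-ring
        double : ∀ V → suc V ℕ.+ suc V ≡ 2 ℕ.* suc V
        double = ℕ-ring
    fractions : a + b ≡ two * W * (a * b)
    fractions = sym (trans (cong (_* (a * b)) (sym A+B)) (trans (solve 4 (λ A B a b → (A :+ B) :* (a :* b) := (A :* a) :* b :+ (B :* b) :* a) refl A B a b)
      (trans (cong₂ (λ s t → s * b + t * a) (*-1/1+ (V ∸ j)) (*-1/1+ (V ℕ.+ j))) (solve 2 (λ a b → con 1ℚ :* b :+ con 1ℚ :* a := a :+ b) refl a b))))

inverse-eventually : ∀ x (x>0 : Positiveᴿ x) → ∃[ N ] ∀ n → N ℕ.≤ n → seq x n * seq (inverse x x>0) n ≡ 1ℚ × 0ℚ ≤ seq (inverse x x>0) n
inverse-eventually x (c , 0<c , N , c≤x) = N , λ n N≤n → inv⊔-inverse c 0<c (c≤x n N≤n) , <⇒≤ (positive⁻¹ (inv⊔ c 0<c (seq x n)) {{inv⊔-positive c 0<c (seq x n)}})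

-- The point is (l + κ₂ + 2e) / (l + c₁ - e) ≤ 1 - w for w = 1 / (25 l). Here c₁ - κ₂ = 0.082, of
-- which l w + c₁ w takes at most 0.04 + 0.02336, since l ≥ 2 gives w ≤ 1/50; the rest covers 3 e ≤
-- 0.015.
final-inequality : ∀ {h s l e w} → 0ℚ ≤ e → e ≤ + 1 / 200 → two ≤ l → 0ℚ ≤ w → 0ℚ ≤ s → fromℤ (+ 25) * l * w ≡ 1ℚ →
  two * (h * (l + c₁ - e)) ≤ (s + e) * (l + κ₂ + two * e) → h ≤ s * ½ * (1ℚ - w) + e
final-inequality {h} {s} {l} {e} {w} 0≤e e≤ 2≤l 0≤w 0≤s 25lw≡1 bound = begin
  h ≡⟨ solve 1 (λ h → h := con ½ :* (con two :* h)) refl h ⟩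
  ½ * (two * h) ≤⟨ *-monoˡ ½ (from-yes (0ℚ ≤? ½)) 2h≤ ⟩
  ½ * ((s + e) * (1ℚ - w)) ≡⟨ solve 3 (λ s e w → con ½ :* ((s :+ e) :* (con 1ℚ :- w)) := (s :* con ½ :* (con 1ℚ :- w) :+ e) :- con ½ :* (e :+ e :* w)) refl s e w ⟩
  x - ½ * (e + e * w) ≤⟨ +-monoʳ-≤ x (neg-antimono-≤ (0≤* {½} (from-yes (0ℚ ≤? ½)) (+-mono-≤ 0≤e (0≤* 0≤e 0≤w)))) ⟩
  x + 0ℚ ≡⟨ +-identityʳ x ⟩
  x ∎
  where
  open ≤-Reasoning
  x D : ℚ
  x = s * ½ * (1ℚ - w) + e
  D = l + c₁ - e
  0<D : 0ℚ < D
  0<D = <-≤-trans (from-yes (0ℚ <? (two + c₁ - + 1 / 200))) (+-mono-≤ (+-monoˡ-≤ c₁ 2≤l) (neg-antimono-≤ e≤))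
  lw : l * w ≡ + 1 / 25
  lw = trans (solve 2 (λ l w → l :* w := con (+ 1 / 25) :* (con (fromℤ (+ 25)) :* l :* w)) refl l w) (trans (cong (+ 1 / 25 *_) 25lw≡1) (*-identityʳ (+ 1 / 25)))
  w≤ : w ≤ + 1 / 50
  w≤ = begin
    w ≡⟨ solve 1 (λ w → w := con ½ :* (con two :* w)) refl w ⟩
    ½ * (two * w) ≤⟨ *-monoˡ ½ (from-yes (0ℚ ≤? ½)) (*-monoʳ w 0≤w 2≤l) ⟩
    ½ * (l * w) ≡⟨ cong (½ *_) lw ⟩
    + 1 / 50 ∎
  saving : l + κ₂ + two * e ≤ D * (1ℚ - w)
  saving = 0≤q-p⇒p≤q (begin
    0ℚ ≤⟨ from-yes (0ℚ ≤? (c₁ - κ₂ - fromℤ (+ 3) * (+ 1 / 200) - + 1 / 25 - c₁ * (+ 1 / 50) + 0ℚ)) ⟩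
    c₁ - κ₂ - fromℤ (+ 3) * (+ 1 / 200) - + 1 / 25 - c₁ * (+ 1 / 50) + 0ℚ ≤⟨ +-mono-≤ (+-mono-≤ (+-monoˡ-≤ (- (+ 1 / 25)) (+-monoʳ-≤ (c₁ - κ₂) (neg-antimono-≤ (*-monoˡ (fromℤ (+ 3)) (fromℤ-nonneg 3) e≤))))
        (neg-antimono-≤ (*-monoˡ c₁ (from-yes (0ℚ ≤? c₁)) w≤))) (0≤* 0≤e 0≤w) ⟩
    c₁ - κ₂ - fromℤ (+ 3) * e - + 1 / 25 - c₁ * w + e * w ≡⟨ cong (λ t → c₁ - κ₂ - fromℤ (+ 3) * e - t - c₁ * w + e * w) lw ⟨
    c₁ - κ₂ - fromℤ (+ 3) * e - l * w - c₁ * w + e * w ≡⟨ solve 5 (λ l e w c k → c :- k :- con (fromℤ (+ 3)) :* e :- l :* w :- c :* w :+ e :* w :=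
        (l :+ c :- e) :* (con 1ℚ :- w) :- (l :+ k :+ con two :* e)) refl l e w c₁ κ₂ ⟩
    D * (1ℚ - w) - (l + κ₂ + two * e) ∎)
  2h≤ : two * h ≤ (s + e) * (1ℚ - w)
  2h≤ = *-cancelʳ-≤-pos D {{positive 0<D}} (begin
    two * h * D ≡⟨ *-assoc two h D ⟩
    two * (h * D) ≤⟨ bound ⟩
    (s + e) * (l + κ₂ + two * e) ≤⟨ *-monoˡ (s + e) (+-mono-≤ 0≤s 0≤e) saving ⟩
    (s + e) * (D * (1ℚ - w)) ≡⟨ solve 3 (λ a d w → a :* (d :* w) := a :* w :* d) refl (s + e) D (1ℚ - w) ⟩
    (s + e) * (1ℚ - w) * D ∎)

-- `H-lower` uses the approximation of log q with step 1/A; `log-close` passes to the step 1/(n + 1)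
-- at a cost of 1/A ≤ 1/(T + 1).
log-wedges : ∀ p n T A l → suc T ℕ.≤ A → 7 ℕ.* (suc p ℕ.* A ℕ.+ 3) ℕ.≤ 2 ℕ.* (A ℕ.+ l) → log-seq (suc p) n + c₁ - 1/1+ T ≤ H A l
log-wedges p n T (suc A-1) l (s≤s T≤A) large = ≤-trans (begin
  log-seq q n + c₁ - 1/1+ T ≤⟨ +-monoˡ-≤ (- 1/1+ T) (+-monoˡ-≤ c₁ (≤-trans (log-close q n A-1) (+-monoʳ-≤ (log-seq q A-1) (1/1+-antitone T≤A)))) ⟩
  log-seq q A-1 + 1/1+ T + c₁ - 1/1+ T ≡⟨ solve 3 (λ l e c → l :+ e :+ c :- e := l :+ c) refl (log-seq q A-1) (1/1+ T) c₁ ⟩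
  log-seq q A-1 + c₁ ∎) (H-lower p A-1 l large)
  where
  open ≤-Reasoning
  q : ℕ
  q = suc p

fraction-* : ∀ a b → + a / suc b ≡ fromℤ (+ a) * 1/1+ b
fraction-* zero b = trans (0/n≡0 (suc b)) (sym (*-zeroˡ (1/1+ b)))
fraction-* (suc a) b = trans (frac-+1 a b) (trans (cong (_+ 1/1+ b) (fraction-* a b)) (trans
  (solve 2 (λ a r → a :* r :+ r := (con 1ℚ :+ a) :* r) refl (fromℤ (+ a)) (1/1+ b)) (cong (_* 1/1+ b) (sym (fromℤ-+ 1ℤ (+ a))))))

module _ (p h : ℕ) (17≤q : 17 ℕ.≤ suc p)
  (bound : ∀ m → suc p ℕ.≤ suc m ℕ.* suc m → ∀ g V J {{_ : NonZero g}} → suc p ℕ.* (g ℕ.* g) ℕ.≤ suc V ℕ.* suc V → J ℕ.* J ℕ.+ g ℕ.* g ℕ.≤ suc p ℕ.* (g ℕ.* g) → J ℕ.≤ V →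
    fromℤ (+ h) * (two * ∑ J (λ j → fromℤ (+ g) * (1/1+ (V ∸ j) * 1/1+ (V ℕ.+ j)))) ≤ Λ m) where

  private
    q : ℕ
    q = suc p
    η : ℚ
    η = fromℤ (+ h)

  2Λ-bound : ∀ n m → m ≡ isqrt q → two * Λ m ≤ log-seq q n + κ₂ + two * 1/1+ n
  2Λ-bound n m m≡ = subst (λ m → two * Λ m ≤ log-seq q n + κ₂ + two * 1/1+ n) (ℕₚ.m+[n∸m]≡n 4≤m)
    (Λ-upper p (m ∸ 4) n (subst (λ m → m ℕ.* m ℕ.≤ q) (sym (ℕₚ.m+[n∸m]≡n 4≤m)) (subst (λ m → m ℕ.* m ℕ.≤ q) (sym m≡) (isqrt-lower q))))
    where
    4≤m : 4 ℕ.≤ m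
    4≤m = subst (4 ℕ.≤_) (sym m≡) (ℕ.s≤s⁻¹ (square-cancel-< {4} (ℕₚ.<-trans 17≤q (isqrt-upper q))))

  -- With g = n + 1 the number V / g is exactly the n-th approximation of √q, and x = (V + 1) / g
  -- exceeds it by 1/(n + 1). Multiplying by x removes the factor g / (V + 1) of `density-sum`.
  approximate : ∀ n T → T ℕ.≤ n → 50 ℕ.* (q ℕ.* q) ℕ.≤ suc n → 3 ℕ.* q ℕ.* suc T ℕ.≤ suc n →
    two * (η * (log-seq q n + c₁ - 1/1+ T)) ≤ (√-seq q n + 1/1+ T) * (log-seq q n + κ₂ + two * 1/1+ T)
  approximate n T T≤n n-large n-large′ = begin
    two * (η * (l + c₁ - 1/1+ T)) ≤⟨ *-monoˡ two (fromℤ-nonneg 2) (*-monoˡ η (fromℤ-nonneg h) (log-wedges p n T A (J ℕ.+ J) (A-large (suc T) n-large′) (subst (λ b → 7 ℕ.* (q ℕ.* A ℕ.+ 3) ℕ.≤ 2 ℕ.* b) (sym A+2J≡B) (B-large 17≤q n-large)))) ⟩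
    two * (η * L) ≡⟨ cong (λ t → two * (η * t)) (sym (trans (cong (_* L) unit) (*-identityˡ L))) ⟩
    two * (η * (x * (G * 1/1+ V) * L)) ≡⟨ solve 5 (λ t η x y L → t :* (η :* (x :* y :* L)) := x :* (t :* (η :* (y :* L)))) refl two η x (G * 1/1+ V) L ⟩
    x * (two * (η * (G * 1/1+ V * L))) ≤⟨ *-monoˡ x 0≤x (*-monoˡ two (fromℤ-nonneg 2) (≤-trans (*-monoˡ η (fromℤ-nonneg h) (density-sum g V J J≤V)) (bound (isqrt q) (ℕₚ.<⇒≤ (isqrt-upper q)) g V J q*g²≤[1+V]² J²+g²≤q*g² J≤V))) ⟩
    x * (two * Λ (isqrt q)) ≤⟨ *-monoˡ x 0≤x (2Λ-bound n (isqrt q) refl) ⟩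
    x * (l + κ₂ + two * 1/1+ n) ≤⟨ *-monoˡ x 0≤x (+-monoʳ-≤ (l + κ₂) (*-monoˡ two (fromℤ-nonneg 2) (1/1+-antitone T≤n))) ⟩
    x * (l + κ₂ + two * 1/1+ T) ≤⟨ *-monoʳ (l + κ₂ + two * 1/1+ T) 0≤rhs (≤-trans (≤-reflexive (frac-+1 V n)) (+-monoʳ-≤ (√-seq q n) (1/1+-antitone T≤n))) ⟩
    (√-seq q n + 1/1+ T) * (l + κ₂ + two * 1/1+ T) ∎
    where
    open ≤-Reasoning
    g : ℕ
    g = suc n
    open SquareRoots p g hiding (q)
    l L x G : ℚ
    l = log-seq q n
    L = H A (J ℕ.+ J)
    x = + suc V / suc n
    G = fromℤ (+ g)
    x≡ : x ≡ fromℤ (+ suc V) * 1/1+ n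
    x≡ = fraction-* (suc V) n
    0≤x : 0ℚ ≤ x
    0≤x = subst (0ℚ ≤_) (sym x≡) (0≤* (fromℤ-nonneg (suc V)) (0≤1/1+ n))
    unit : x * (G * 1/1+ V) ≡ 1ℚ
    unit = trans (cong (_* (G * 1/1+ V)) x≡) (trans (solve 4 (λ v r g s → v :* r :* (g :* s) := (v :* s) :* (g :* r)) refl (fromℤ (+ suc V)) (1/1+ n) G (1/1+ V))
      (trans (cong₂ _*_ (*-1/1+ V) (*-1/1+ n)) (*-identityˡ 1ℚ)))
    0≤rhs : 0ℚ ≤ l + κ₂ + two * 1/1+ T
    0≤rhs = +-mono-≤ (+-mono-≤ (≤-trans (fromℤ-nonneg 2) (log-seq≥2 q n 17≤q)) (from-yes (0ℚ ≤? κ₂))) (0≤* (fromℤ-nonneg 2) (0≤1/1+ T))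

  real-bound : ∀ {d} → d ≡ q → ∀ positive → fromℕ h ≤ᴿ (√ d *ᴿ fromℚ ½) *ᴿ (fromℕ 1 -ᴿ inverse (fromℕ 25 *ᴿ log d) positive)
  real-bound refl 25l>0 ε 0<ε = go (archimedean ε 0<ε) (inverse-eventually (fromℕ 25 *ᴿ log q) 25l>0)
    where
    w : ℕ → ℚ
    w = seq (inverse (fromℕ 25 *ᴿ log q) 25l>0)
    go : (∃[ M ] 1/1+ M ≤ ε) → (∃[ N ] ∀ n → N ℕ.≤ n → fromℤ (+ 25) * log-seq q n * w n ≡ 1ℚ × 0ℚ ≤ w n) →
      ∃[ N ] ∀ n → N ℕ.≤ n → η ≤ √-seq q n * ½ * (1ℚ - w n) + ε
    go (M , 1/M≤ε) (N , inv) = N₁ ℕ.+ N₂ , λ n large →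
      let T≤n = ℕₚ.≤-trans (ℕₚ.≤-trans (ℕₚ.m≤n+m T N) (ℕₚ.m≤m+n (N ℕ.+ T) N₂)) large
          N≤n = ℕₚ.≤-trans (ℕₚ.≤-trans (ℕₚ.m≤m+n N T) (ℕₚ.m≤m+n (N ℕ.+ T) N₂)) large
          N₂≤n = ℕₚ.m≤n⇒m≤1+n (ℕₚ.≤-trans (ℕₚ.m≤n+m N₂ N₁) large)
      in ≤-trans (final-inequality {η} {√-seq q n} {log-seq q n} {1/1+ T} (0≤1/1+ T) (1/1+-antitone {199} {T} (ℕₚ.m≤n⊔m M 199)) (log-seq≥2 q n 17≤q)
          (proj₂ (inv n N≤n)) (0≤√ n) (proj₁ (inv n N≤n))
          (approximate n T T≤n (ℕₚ.≤-trans (ℕₚ.m≤m+n (50 ℕ.* (q ℕ.* q)) (3 ℕ.* q ℕ.* suc T)) N₂≤n) (ℕₚ.≤-trans (ℕₚ.m≤n+m (3 ℕ.* q ℕ.* suc T) (50 ℕ.* (q ℕ.* q))) N₂≤n)))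
        (+-monoʳ-≤ (√-seq q n * ½ * (1ℚ - w n)) (≤-trans (1/1+-antitone (ℕₚ.m≤m⊔n M 199)) 1/M≤ε))
      where
      T N₁ N₂ : ℕ
      -- Then 1/(T + 1) is at most ε and at most 1/200, the size that `final-inequality` admits.
      T = M ℕ.⊔ 199
      N₁ = N ℕ.+ T
      -- The lower bounds on g = n + 1 required by `B-large` and `A-large`.
      N₂ = 50 ℕ.* (q ℕ.* q) ℕ.+ 3 ℕ.* q ℕ.* suc T
      0≤√ : ∀ n → 0ℚ ≤ √-seq q n
      0≤√ n = subst (0ℚ ≤_) (sym (fraction-* (isqrt (q ℕ.* (suc n ℕ.* suc n))) n)) (0≤* (fromℤ-nonneg (isqrt (q ℕ.* (suc n ℕ.* suc n)))) (0≤1/1+ n))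

odd-form : ∀ k → 8 ℕ.* k ℕ.+ 1 ≡ odd ((k ℕ.+ k) ℕ.+ (k ℕ.+ k))
odd-form = identity
  where
  identity : ∀ k → 8 ℕ.* k ℕ.+ 1 ≡ suc (((k ℕ.+ k) ℕ.+ (k ℕ.+ k)) ℕ.+ ((k ℕ.+ k) ℕ.+ (k ℕ.+ k)))
  identity = ℕ-ring

-- 1 and 9 are squares.
large-discriminant : ∀ k → ¬ (∃[ m ] m ℕ.* m ≡ 8 ℕ.* k ℕ.+ 1) → k ≢ 0 × 17 ℕ.≤ 8 ℕ.* k ℕ.+ 1
large-discriminant 0 nonsquare = contradiction (1 , refl) nonsquare
large-discriminant 1 nonsquare = contradiction (3 , refl) nonsquare
large-discriminant k@(suc (suc _)) _ = (λ ()) , ℕₚ.+-monoˡ-≤ 1 (ℕₚ.*-monoʳ-≤ 8 {2} {k} (s≤s (s≤s z≤n)))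

theorem2 : (q h : ℕ) (1<q : 1 ℕ.< q) →
  IsRealQuadraticDiscriminant q →
  χ q (+ 2) ≡ 1ℤ →
  IsClassNumber q h →
  fromℕ h ≤ᴿ (√ q *ᴿ fromℚ ½) *ᴿ
    (fromℕ 1 -ᴿ inverse (fromℕ 25 *ᴿ log q)
      (*-positive (fromℕ 25) (log q) (fromℕ-positive 24) (log-positive q 1<q)))
theorem2 q h 1<q disc χ2≡1 classNumber = from-residue (residue1 q disc χ2≡1)
  where
  from-residue : (∃[ k ] q ≡ 8 ℕ.* k ℕ.+ 1) → fromℕ h ≤ᴿ (√ q *ᴿ fromℚ ½) *ᴿ (fromℕ 1 -ᴿ inverse (fromℕ 25 *ᴿ log q) (*-positive (fromℕ 25) (log q) (fromℕ-positive 24) (log-positive q 1<q)))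
  from-residue (k , e) = real-bound (P′ ℕ.+ P′) h (subst (17 ℕ.≤_) (odd-form k) (proj₂ large))
    (λ m q≤ g V J → class-number-bound k (proj₁ large) sqf m q≤ {odd P′} refl discriminant (subst (λ q → IsClassNumber q h) q≡ classNumber) g V J)
    q≡ (*-positive (fromℕ 25) (log q) (fromℕ-positive 24) (log-positive q 1<q))
    where
    P′ : ℕ
    P′ = (k ℕ.+ k) ℕ.+ (k ℕ.+ k)
    q≡ : q ≡ odd P′
    q≡ = trans e (odd-form k)
    large : k ≢ 0 × 17 ℕ.≤ 8 ℕ.* k ℕ.+ 1
    large = large-discriminant k (subst (λ q → ¬ (∃[ m ] m ℕ.* m ≡ q)) e (IsRealQuadraticDiscriminant.nonsquare disc))
    discriminant : IsRealQuadraticDiscriminant (odd P′)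
    discriminant = subst IsRealQuadraticDiscriminant q≡ disc
    sqf : SquareFree (odd P′)
    sqf = odd-squareFree (odd P′) discriminant (λ m e → odd≢double P′ m (trans e (cong (m ℕ.+_) (ℕₚ.+-identityʳ m))))
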